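{- Let $g \geq 0$ be a constant integer, and let $m=m(n)$ be any integer-valued function with $0\le m\le 3n-6+6g$. Then there is a constant $C$ such that, with probability tending to $1$ as $n\to\infty$, $\Delta (S_{g}(n,m)) \le C\ln n$.
   Context: A graph has genus at most $g$ if it can be embedded without crossing edges on an orientable surface of genus $g$. $\mathcal{S}^{g}(n,m)$ is the set of labelled simple graphs on $[n]$ with exactly $m$ edges and genus at most $g$; $S_{g}(n,m)$ is chosen uniformly at random from it. $\Delta$ denotes maximum degree. -}

module Defs where

open import Data.Bool using (Bool; true; false; _∧_; _∨_; not; if_then_else_)
open import Data.Nat using (ℕ; zero; suc; _+_; _*_; _⊔_; _≤ᵇ_; _<ᵇ_; _≡ᵇ_)
open import Data.Nat.Logarithm using (⌊log₂_⌋)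
open import Data.Fin using (Fin; toℕ)
open import Data.List using (List; []; _∷_; map; concatMap; foldr; allFin)
open import Data.Vec using (Vec; []; _∷_; lookup)
open import Data.Product using (_×_; _,_)

allVecsOf : {A : Set} → List A → (k : ℕ) → List (Vec A k)
allVecsOf xs zero = [] ∷ []
allVecsOf xs (suc k) = concatMap (λ x → map (x ∷_) (allVecsOf xs k)) xs

bools : List Bool
bools = false ∷ true ∷ []

countL : {A : Set} → (A → Bool) → List A → ℕ
countL p = foldr (λ x s → (if p x then 1 else 0) + s) 0

anyL : {A : Set} → (A → Bool) → List A → Bool
anyL p = foldr (λ x b → p x ∨ b) false

allF : (n : ℕ) → (Fin n → Bool) → Bool
allF n p = foldr (λ i b → p i ∧ b) true (allFin n)

anyF : (n : ℕ) → (Fin n → Bool) → Bool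
anyF n p = foldr (λ i b → p i ∨ b) false (allFin n)

sumF : (n : ℕ) → (Fin n → ℕ) → ℕ
sumF n f = foldr (λ i s → f i + s) 0 (allFin n)

countF : (n : ℕ) → (Fin n → Bool) → ℕ
countF n p = sumF n (λ i → if p i then 1 else 0)

maxF : (n : ℕ) → (Fin n → ℕ) → ℕ
maxF n f = foldr (λ i s → f i ⊔ s) 0 (allFin n)

allN : ℕ → (ℕ → Bool) → Bool
allN zero p = true
allN (suc d) p = allN d p ∧ p d

iter : {X : Set} → ℕ → (X → X) → X → X
iter zero f x = x
iter (suc k) f x = f (iter k f x)

eqB : Bool → Bool → Bool
eqB true b = b
eqB false b = not b

eqF : {n : ℕ} → Fin n → Fin n → Bool
eqF i j = toℕ i ≡ᵇ toℕ j

-- Labelled graphs on vertex set Fin n, given by adjacency matrices.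
-- A labelled simple graph on [n] is exactly a symmetric irreflexive
-- Boolean adjacency matrix (one matrix per graph).

Adj : ℕ → Set
Adj n = Vec (Vec Bool n) n

adj : {n : ℕ} → Adj n → Fin n → Fin n → Bool
adj A i j = lookup (lookup A i) j

allAdj : (n : ℕ) → List (Adj n)
allAdj n = allVecsOf (allVecsOf bools n) n

isSimple : {n : ℕ} → Adj n → Bool
isSimple {n} A = allF n (λ i → not (adj A i i) ∧ allF n (λ j → eqB (adj A i j) (adj A j i)))

deg : {n : ℕ} → Adj n → Fin n → ℕ
deg {n} A v = countF n (adj A v)

edges : {n : ℕ} → Adj n → ℕ
edges {n} A = sumF n (λ i → countF n (λ j → (toℕ i <ᵇ toℕ j) ∧ adj A i j))

maxDeg : {n : ℕ} → Adj n → ℕ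
maxDeg {n} A = maxF n (deg A)

reachIn : {n : ℕ} → Adj n → ℕ → Fin n → Fin n → Bool
reachIn A zero s t = eqF s t
reachIn {n} A (suc k) s t = reachIn A k s t ∨ anyF n (λ w → reachIn A k s w ∧ adj A w t)

connected : {n : ℕ} → Adj n → Fin n → Fin n → Bool
connected {n} A = reachIn A n

components : {n : ℕ} → Adj n → ℕ
components {n} A = countF n (λ v → allF n (λ u → not ((toℕ u <ᵇ toℕ v) ∧ connected A u v)))

-- Rotation systems (combinatorial description of orientable embeddings,
-- Heffter–Edmonds).  R v u is the successor of neighbour u in the cyclic
-- order around v; values at non-neighbours are irrelevant.

Rot : ℕ → Set
Rot n = Vec (Vec (Fin n) n) n

rot : {n : ℕ} → Rot n → Fin n → Fin n → Fin n
rot R v u = lookup (lookup R v) u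

allRot : (n : ℕ) → List (Rot n)
allRot n = allVecsOf (allVecsOf (allFin n) n) n

-- R v restricted to N(v) is a single cyclic permutation of N(v):
-- from every neighbour u, the first deg(v) iterates are distinct
-- neighbours and the deg(v)-th iterate returns to u.
validRot : {n : ℕ} → Adj n → Rot n → Bool
validRot {n} A R = allF n (λ v → allF n (λ u → not (adj A v u) ∨ cyc v u))
  where
  cyc : Fin n → Fin n → Bool
  cyc v u =
    allN (deg A v) (λ k → adj A v (iter k (rot R v) u)
                   ∧ allN k (λ k' → not (eqF (iter k (rot R v) u) (iter k' (rot R v) u))))
    ∧ eqF (iter (deg A v) (rot R v) u) u

facePerm : {n : ℕ} → Rot n → Fin n × Fin n → Fin n × Fin n
facePerm R (u , v) = (v , rot R v u)

dartCode : {n : ℕ} → Fin n × Fin n → ℕ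
dartCode {n} (u , v) = toℕ u * n + toℕ v

-- number of faces: face-orbits of darts (counted via their least dart)
-- plus one face for each isolated vertex
faces : {n : ℕ} → Adj n → Rot n → ℕ
faces {n} A R =
  sumF n (λ u → countF n (λ v → adj A u v
     ∧ allN (2 * edges A) (λ k → dartCode (u , v) ≤ᵇ dartCode (iter k (facePerm R) (u , v)))))
  + countF n (λ v → deg A v ≡ᵇ 0)

-- Euler's formula (componentwise): n - E + F = 2 c - 2 γ.  The embedding
-- given by R has genus ≤ g  iff  2 c + E ≤ n + F + 2 g.
rotGenusAtMost : {n : ℕ} → ℕ → Adj n → Rot n → Bool
rotGenusAtMost {n} g A R = (2 * components A + edges A) ≤ᵇ (n + faces A R + 2 * g)

genusAtMost : {n : ℕ} → ℕ → Adj n → Bool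
genusAtMost {n} g A = anyL (λ R → validRot A R ∧ rotGenusAtMost g A R) (allRot n)

inS : (g n m : ℕ) → Adj n → Bool
inS g n m A = isSimple A ∧ (edges A ≡ᵇ m) ∧ genusAtMost g A

countS : (g n m : ℕ) → ℕ
countS g n m = countL (inS g n m) (allAdj n)

countBad : (g n m C : ℕ) → ℕ
countBad g n m C = countL (λ A → inS g n m A ∧ (C * ⌊log₂ n ⌋ <ᵇ maxDeg A)) (allAdj n)

{-# OPTIONS --safe #-}

-- A graph G with a vertex v of degree above C log₂ n, together with a choice of k + 1 vertices out of a
-- linear number and of k = 2 log₂ n letters out of s, is encoded by a graph G′ of the same class and a code
-- of at most n K^(k + 1) n^(k + 1) values with K constant; taking s large makes G rare.
--
-- The chosen vertices are removable and contracted away one after the other: w is removable if it has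
-- degree at most two, or degree at most six and a neighbour x of bounded degree with at most two
-- common neighbours.  Contracting wx loses at most three edges, and O(n) possible data undo it.  The
-- freed vertices then take over consecutive intervals of the rotation at v, whose lengths encode the
-- letters, and each keeps as many edges towards v as its contraction lost, which restores the number
-- of edges.  The genus does not grow: each edge operation multiplies the face permutation by
-- transpositions, and a transposition merges two cycles or splits one.
--
-- Linearly many vertices are removable.  By Euler's inequality linearly many vertices have degree at
-- most six; suppose most of them are irremovable.  Choose a degree band such that many of these have no
-- neighbour with degree inside it, and call the vertices above the band hubs.  At an irremovable
-- vertex either all neighbours are hubs or two paths through it cross, each closing up to a triangle
-- unless both its ends are hubs.  Keeping only such edges at a family of irremovable vertices that is
-- disjoint outside the hubs, every face has two darts leaving a hub, so Euler's inequality bounds the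
-- family by O(hubs + g), whereas a greedy packing is larger because hubs are few.
module Submission where

open import Defs
open import Data.Bool using (Bool; true; false; _∧_; _∨_; not; if_then_else_; T)
open import Data.Bool.Properties using () renaming (_≟_ to _≟ᵇ_)
open import Data.Nat hiding (_≟_)
open import Data.Nat.Properties hiding (_≟_)
open import Data.Nat.DivMod using (_/_; _%_; m≡m%n+[m/n]*n; m%n<n)
open import Data.Nat.Logarithm using (⌊log₂_⌋; ⌊log₂⌋-mono-≤; ⌊log₂[2^n]⌋≡n)
open import Data.Nat.Tactic.RingSolver using (solve-∀)
open import Data.Fin using (Fin; zero; suc; toℕ; fromℕ<; inject≤; combine; remQuot; join; splitAt; _≟_)
open import Data.Fin.Properties using (toℕ-injective; toℕ<n; injective⇒≤; toℕ-fromℕ<; inject≤-injective; toℕ-inject≤; fromℕ<-toℕ; fromℕ<-cong; toℕ-combine; combine-injective; combine-remQuot; splitAt-join)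
open import Data.List using (List; []; _∷_; _++_; map; concatMap; foldr; allFin; length; take; drop)
open import Data.List.Properties using (++-identityʳ; length-take; length-drop; take++drop≡id; ∷-injective)
open import Data.List.Membership.Propositional using (_∈_; _∉_)
open import Data.List.Membership.Propositional.Properties using (∈-allFin; ∈-map⁺; ∈-map⁻; ∈-++⁺ˡ; ∈-++⁺ʳ; ∈-++⁻)
open import Data.List.Relation.Unary.Any using (Any; here; there)
open import Data.List.Relation.Unary.Any.Properties using (lookup-index)
open import Data.List.Relation.Unary.All using (All; []; _∷_)
open import Data.List.Relation.Unary.AllPairs using ([]; _∷_)
open import Data.List.Relation.Unary.Unique.Propositional using (Unique)
open import Data.List.Relation.Unary.Unique.Propositional.Properties using (allFin⁺; map⁺; ++⁺)
open import Data.Vec using (Vec; []; _∷_; lookup; tabulate)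
open import Data.Vec.Properties using (lookup∘tabulate; tabulate∘lookup; tabulate-cong)
open import Data.Product using (Σ-syntax; ∃-syntax; _×_; _,_; proj₁; proj₂)
open import Data.Product.Properties using (,-injectiveˡ; ,-injectiveʳ; ≡-dec)
open import Data.Sum using (_⊎_; inj₁; inj₂; [_,_]′)
open import Data.Empty using (⊥; ⊥-elim)
open import Data.Unit using (⊤; tt)
open import Function using (_∘_; id; case_of_)
open import Relation.Nullary using (¬_; Dec; yes; no; does; contradiction)
open import Relation.Binary using (tri<; tri≈; tri>)
open import Relation.Binary.PropositionalEquality using (_≡_; _≢_; refl; sym; trans; cong; cong₂; subst; subst₂)

-- Finite counting

-- The number of edges is prescribed, and at its extreme value the graph is a triangulation into
-- which no further edge fits; so `v` cannot be relieved by merely adding edges elsewhere, and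
-- vertices have to be freed first. A contraction loses one edge plus one for each common neighbour.
-- The bound of two common neighbours is set by the inverse operation: a vertex put in front of an
-- interval of the rotation at `v` gains at most three edges, the one to `v` and the two extreme
-- edges of the interval that `v` may retain. The `n^(k + 1)` undo values are balanced by the
-- `(n / 28)^(k + 1)` choices of vertices up to a constant per vertex, so the letters are the whole
-- profit, and `s` is twice that constant. This leaves `2^k` against one factor `n` for the name of
-- `v`, whence `k = 2 log₂ n`. Most names of freed vertices are not stored: they are marked
-- neighbours of `v`, whose degree has fallen to `3 (k + 1)`. Their order and the letters are read
-- off the rotation at `v` before the splitting, which must therefore be a function of the
-- contracted graph alone.

ind : Bool → ℕ
ind b = if b then 1 else 0

∧-true : ∀ {x y} → x ∧ y ≡ true → x ≡ true × y ≡ true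
∧-true {true} {true} _ = refl , refl

∧-intro : ∀ {x y} → x ≡ true → y ≡ true → x ∧ y ≡ true
∧-intro refl refl = refl

∨-true : ∀ {x y} → x ∨ y ≡ true → x ≡ true ⊎ y ≡ true
∨-true {true}  _ = inj₁ refl
∨-true {false} e = inj₂ e

∨-introˡ : ∀ {x y} → x ≡ true → x ∨ y ≡ true
∨-introˡ refl = refl

∨-introʳ : ∀ {x y} → y ≡ true → x ∨ y ≡ true
∨-introʳ {true}  refl = refl
∨-introʳ {false} refl = refl

not-true : ∀ {x} → not x ≡ true → x ≡ false
not-true {false} _ = refl

not-intro : ∀ {x} → ¬ (x ≡ true) → not x ≡ true
not-intro {true}  h = ⊥-elim (h refl)
not-intro {false} _ = refl

≢true : ∀ {x} → ¬ (x ≡ true) → x ≡ false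
≢true h = not-true (not-intro h)

true≢false : ∀ {x} → x ≡ true → x ≡ false → ⊥
true≢false refl ()

bool-ext : ∀ {x y} → (x ≡ true → y ≡ true) → (y ≡ true → x ≡ true) → x ≡ y
bool-ext {true}  f g = sym (f refl)
bool-ext {false} {true}  f g = g refl
bool-ext {false} {false} f g = refl

ind-mono : ∀ {x y} → (x ≡ true → y ≡ true) → ind x ≤ ind y
ind-mono {false} h = z≤n
ind-mono {true} h rewrite h refl = ≤-refl

T→≡ : ∀ {x} → T x → x ≡ true
T→≡ {true} _ = refl

≡→T : ∀ {x} → x ≡ true → T x
≡→T refl = tt

does-true : ∀ {P : Set} (d : Dec P) → does d ≡ true → P
does-true (yes p) _ = p

does-intro : ∀ {P : Set} (d : Dec P) → P → does d ≡ true
does-intro (yes _) _ = refl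
does-intro (no ¬p) p = ⊥-elim (¬p p)

does-false : ∀ {P : Set} (d : Dec P) → ¬ P → does d ≡ false
does-false (yes p) ¬p = ⊥-elim (¬p p)
does-false (no _) _ = refl

bool-cases : ∀ b → b ≡ true ⊎ b ≡ false
bool-cases true = inj₁ refl
bool-cases false = inj₂ refl

decide : ∀ {P : Set} → Dec P → P ⊎ ¬ P
decide (yes p) = inj₁ p
decide (no ¬p) = inj₂ ¬p

<ᵇ-true : ∀ {m n} → (m <ᵇ n) ≡ true → m < n
<ᵇ-true {m} {n} e = <ᵇ⇒< m n (≡→T e)

<ᵇ-intro : ∀ {m n} → m < n → (m <ᵇ n) ≡ true
<ᵇ-intro lt = T→≡ (<⇒<ᵇ lt)

≤ᵇ-true : ∀ {m n} → (m ≤ᵇ n) ≡ true → m ≤ n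
≤ᵇ-true {m} {n} e = ≤ᵇ⇒≤ m n (≡→T e)

≤ᵇ-intro : ∀ {m n} → m ≤ n → (m ≤ᵇ n) ≡ true
≤ᵇ-intro le = T→≡ (≤⇒≤ᵇ le)

≡ᵇ-true : ∀ {m n} → (m ≡ᵇ n) ≡ true → m ≡ n
≡ᵇ-true {m} {n} e = ≡ᵇ⇒≡ m n (≡→T e)

≡ᵇ-intro : ∀ {m n} → m ≡ n → (m ≡ᵇ n) ≡ true
≡ᵇ-intro {m} {n} e = T→≡ (≡⇒≡ᵇ m n e)

eqF-true : ∀ {n} {i j : Fin n} → eqF i j ≡ true → i ≡ j
eqF-true e = toℕ-injective (≡ᵇ-true e)

eqF-intro : ∀ {n} {i j : Fin n} → i ≡ j → eqF i j ≡ true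
eqF-intro e = ≡ᵇ-intro (cong toℕ e)

allF-true : ∀ n {p : Fin n → Bool} → allF n p ≡ true → ∀ i → p i ≡ true
allF-true n {p} e i = go (allFin n) e (∈-allFin i)
  where
  go : ∀ xs → foldr (λ i b → p i ∧ b) true xs ≡ true → i ∈ xs → p i ≡ true
  go (x ∷ xs) e (here refl) = proj₁ (∧-true e)
  go (x ∷ xs) e (there m) = go xs (proj₂ (∧-true e)) m

allF-intro : ∀ n {p : Fin n → Bool} → (∀ i → p i ≡ true) → allF n p ≡ true
allF-intro n {p} h = go (allFin n)
  where
  go : ∀ xs → foldr (λ i b → p i ∧ b) true xs ≡ true
  go [] = refl
  go (x ∷ xs) = ∧-intro (h x) (go xs)

anyL-true : ∀ {A : Set} {p : A → Bool} xs → anyL p xs ≡ true → ∃[ x ] p x ≡ true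
anyL-true {p = p} (x ∷ xs) e with p x in eq
... | true  = x , eq
... | false = anyL-true xs e

anyL-intro : ∀ {A : Set} {p : A → Bool} {x} xs → x ∈ xs → p x ≡ true → anyL p xs ≡ true
anyL-intro (x ∷ xs) (here refl) e = ∨-introˡ e
anyL-intro {p = p} (x ∷ xs) (there m) e = ∨-introʳ {p x} (anyL-intro xs m e)

anyF-true : ∀ n {p : Fin n → Bool} → anyF n p ≡ true → ∃[ i ] p i ≡ true
anyF-true n e = anyL-true (allFin n) e

anyF-intro : ∀ n {p : Fin n → Bool} i → p i ≡ true → anyF n p ≡ true
anyF-intro n i e = anyL-intro (allFin n) (∈-allFin i) e

allN-true : ∀ d {p : ℕ → Bool} → allN d p ≡ true → ∀ k → k < d → p k ≡ true
allN-true (suc d) e k lt with m≤n⇒m<n∨m≡n (≤-pred lt)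
... | inj₁ k<d = allN-true d (proj₁ (∧-true e)) k k<d
... | inj₂ refl = proj₂ (∧-true e)

allN-intro : ∀ d {p : ℕ → Bool} → (∀ k → k < d → p k ≡ true) → allN d p ≡ true
allN-intro zero h = refl
allN-intro (suc d) h = ∧-intro (allN-intro d (λ k lt → h k (m<n⇒m<1+n lt))) (h d ≤-refl)

firstBelow : ∀ {P : ℕ → Set} → (∀ k → Dec (P k)) → ∀ d →
  (∃[ k ] (k < d × P k × (∀ j → j < k → ¬ P j))) ⊎ (∀ k → k < d → ¬ P k)
firstBelow P? zero = inj₂ λ _ ()
firstBelow P? (suc d) with firstBelow P? d
... | inj₁ (k , lt , p , h) = inj₁ (k , m<n⇒m<1+n lt , p , h)
... | inj₂ h with P? d
... | yes p = inj₁ (d , ≤-refl , p , h)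
... | no ¬p = inj₂ λ k lt → case m≤n⇒m<n∨m≡n (≤-pred lt) of λ where
        (inj₁ k<d) → h k k<d
        (inj₂ refl) → ¬p

anyN? : ∀ {P : ℕ → Set} → (∀ k → Dec (P k)) → ∀ d → Dec (∃[ k ] (k < d × P k))
anyN? P? d with firstBelow P? d
... | inj₁ (k , lt , p , _) = yes (k , lt , p)
... | inj₂ h = no λ (k , lt , p) → h k lt p

minimal : ∀ {P : ℕ → Set} → (∀ k → Dec (P k)) → ∀ d → P d →
  ∃[ k ] (k ≤ d × P k × (∀ j → j < k → ¬ P j))
minimal P? d p with firstBelow P? (suc d)
... | inj₁ (k , lt , q , h) = k , ≤-pred lt , q , h
... | inj₂ h = ⊥-elim (h d ≤-refl p)

sumL : ∀ {A : Set} → (A → ℕ) → List A → ℕ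
sumL f = foldr (λ x s → f x + s) 0

module _ {A : Set} where

  sumL-mono : ∀ {f g : A → ℕ} xs → (∀ x → f x ≤ g x) → sumL f xs ≤ sumL g xs
  sumL-mono [] h = z≤n
  sumL-mono (x ∷ xs) h = +-mono-≤ (h x) (sumL-mono xs h)

  sumL-cong : ∀ {f g : A → ℕ} xs → (∀ x → f x ≡ g x) → sumL f xs ≡ sumL g xs
  sumL-cong [] h = refl
  sumL-cong (x ∷ xs) h = cong₂ _+_ (h x) (sumL-cong xs h)

  sumL-+ : ∀ (f g : A → ℕ) xs → sumL (λ x → f x + g x) xs ≡ sumL f xs + sumL g xs
  sumL-+ f g [] = refl
  sumL-+ f g (x ∷ xs) rewrite sumL-+ f g xs = lem (f x) (g x) (sumL f xs) (sumL g xs)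
    where
    lem : ∀ a b c d → a + b + (c + d) ≡ a + c + (b + d)
    lem = solve-∀

  sumL-0 : ∀ (xs : List A) → sumL (λ _ → 0) xs ≡ 0
  sumL-0 [] = refl
  sumL-0 (x ∷ xs) = sumL-0 xs

  sumL-const : ∀ c (xs : List A) → sumL (λ _ → c) xs ≡ length xs * c
  sumL-const c [] = refl
  sumL-const c (x ∷ xs) = cong (c +_) (sumL-const c xs)

  sumL-*ˡ : ∀ c (f : A → ℕ) xs → sumL (λ x → c * f x) xs ≡ c * sumL f xs
  sumL-*ˡ c f [] = sym (*-zeroʳ c)
  sumL-*ˡ c f (x ∷ xs) rewrite sumL-*ˡ c f xs = sym (*-distribˡ-+ c (f x) _)

  sumL-++ : ∀ (f : A → ℕ) xs ys → sumL f (xs ++ ys) ≡ sumL f xs + sumL f ys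
  sumL-++ f [] ys = refl
  sumL-++ f (x ∷ xs) ys rewrite sumL-++ f xs ys = sym (+-assoc (f x) _ _)

  sumL-∈ : ∀ {f : A → ℕ} {x} xs → x ∈ xs → f x ≤ sumL f xs
  sumL-∈ {f} (x ∷ xs) (here refl) = m≤m+n _ _
  sumL-∈ {f} (x ∷ xs) (there m) = ≤-trans (sumL-∈ xs m) (m≤n+m _ (f x))

sumL-swap : ∀ {A B : Set} (f : A → B → ℕ) xs ys →
  sumL (λ x → sumL (f x) ys) xs ≡ sumL (λ y → sumL (λ x → f x y) xs) ys
sumL-swap f [] ys = sym (sumL-0 ys)
sumL-swap f (x ∷ xs) ys rewrite sumL-swap f xs ys = sym (sumL-+ (f x) _ ys)

module _ {A : Set} (p : A → Bool) where

  -- Counts are folds over lists; enumerating the elements that satisfy `p` by `Fin (countL p xs)`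
  -- turns comparisons of counts into injections between finite ordinals.
  nth : ∀ xs → Fin (countL p xs) → A
  nth (x ∷ xs) i with p x
  nth (x ∷ xs) zero    | true = x
  nth (x ∷ xs) (suc i) | true = nth xs i
  ... | false = nth xs i

  nth-true : ∀ xs i → p (nth xs i) ≡ true
  nth-true (x ∷ xs) i with p x in eq
  nth-true (x ∷ xs) zero    | true = eq
  nth-true (x ∷ xs) (suc i) | true = nth-true xs i
  ... | false = nth-true xs i

  nth-∈ : ∀ xs i → nth xs i ∈ xs
  nth-∈ (x ∷ xs) i with p x in eq
  nth-∈ (x ∷ xs) zero    | true = here refl
  nth-∈ (x ∷ xs) (suc i) | true = there (nth-∈ xs i)
  ... | false = there (nth-∈ xs i)

  private
    notHere : ∀ {x y : A} {xs} → All (λ z → x ≢ z) xs → y ∈ xs → x ≢ y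
    notHere (px ∷ _) (here refl) = px
    notHere (_ ∷ a) (there m) = notHere a m

  nth-inj : ∀ xs → Unique xs → ∀ i j → nth xs i ≡ nth xs j → i ≡ j
  nth-inj (x ∷ xs) (a ∷ u) i j e with p x
  nth-inj (x ∷ xs) (a ∷ u) zero zero e | true = refl
  nth-inj (x ∷ xs) (a ∷ u) zero (suc j) e | true = ⊥-elim (notHere a (nth-∈ xs j) e)
  nth-inj (x ∷ xs) (a ∷ u) (suc i) zero e | true = ⊥-elim (notHere a (nth-∈ xs i) (sym e))
  nth-inj (x ∷ xs) (a ∷ u) (suc i) (suc j) e | true = cong suc (nth-inj xs u i j e)
  ... | false = nth-inj xs u i j e

  index : ∀ xs {x} → x ∈ xs → p x ≡ true → ∃[ i ] nth xs i ≡ x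
  index (y ∷ xs) m e with p y in eq
  index (y ∷ xs) (here refl) e | true = zero , refl
  index (y ∷ xs) (there m) e | true = suc (proj₁ (index xs m e)) , proj₂ (index xs m e)
  index (y ∷ xs) (here refl) e | false = ⊥-elim (true≢false e eq)
  index (y ∷ xs) (there m) e | false = index xs m e

  ix : ∀ xs {x} → x ∈ xs → p x ≡ true → Fin (countL p xs)
  ix xs m e = proj₁ (index xs m e)

  nth-ix : ∀ xs {x} (m : x ∈ xs) e → nth xs (ix xs m e) ≡ x
  nth-ix xs m e = proj₂ (index xs m e)

record Finite (X : Set) : Set where
  field
    elems    : List X
    complete : ∀ x → x ∈ elems
    unique   : Unique elems
    _≟X_     : (x y : X) → Dec (x ≡ y)

open Finite public

finFinite : ∀ n → Finite (Fin n)
finFinite n = record { elems = allFin n ; complete = ∈-allFin ; unique = allFin⁺ n ; _≟X_ = _≟_ }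

module _ {X : Set} (F : Finite X) where

  count : (X → Bool) → ℕ
  count p = countL p (elems F)

  count-inj : ∀ {a} (p : X → Bool) (f : Fin a → X) → (∀ i → p (f i) ≡ true) →
    (∀ i j → f i ≡ f j → i ≡ j) → a ≤ count p
  count-inj p f h inj = injective⇒≤ {f = λ i → ix p _ (complete F (f i)) (h i)}
    λ {i} {j} e → inj i j (trans (sym (nth-ix p (elems F) (complete F (f i)) (h i)))
      (trans (cong (nth p (elems F)) e) (nth-ix p (elems F) (complete F (f j)) (h j))))

  count-cover : ∀ {a} (p : X → Bool) (f : Fin a → X) →
    (∀ x → p x ≡ true → ∃[ i ] f i ≡ x) → count p ≤ a
  count-cover p f h = injective⇒≤ {f = λ i → proj₁ (h _ (nth-true p (elems F) i))}
    λ {i} {j} e → nth-inj p _ (unique F) i j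
      (trans (sym (proj₂ (h _ (nth-true p (elems F) i))))
        (trans (cong f e) (proj₂ (h _ (nth-true p (elems F) j)))))

  count-mono : ∀ {p q : X → Bool} → (∀ x → p x ≡ true → q x ≡ true) → count p ≤ count q
  count-mono {p} {q} h = sumL-mono (elems F) λ x → ind-mono {p x} (h x)

  count-cong : ∀ {p q : X → Bool} → (∀ x → p x ≡ q x) → count p ≡ count q
  count-cong h = sumL-cong (elems F) λ x → cong ind (h x)

  count-single : ∀ r → count (λ x → does (_≟X_ F x r)) ≡ 1
  count-single r = ≤-antisym
    (count-cover _ (λ (_ : Fin 1) → r) (λ x e → zero , sym (does-true (_≟X_ F x r) e)))
    (count-inj _ (λ (_ : Fin 1) → r) (λ _ → does-intro (_≟X_ F r r) refl) λ { zero zero _ → refl })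

  sum-single : ∀ (f : X → ℕ) r → (∀ x → x ≢ r → f x ≡ 0) → sumL f (elems F) ≡ f r
  sum-single f r h = trans (sumL-cong (elems F) eq)
    (trans (sumL-*ˡ (f r) _ (elems F)) (trans (cong (f r *_) (count-single r)) (*-identityʳ (f r))))
    where
    eq : ∀ x → f x ≡ f r * ind (does (_≟X_ F x r))
    eq x with _≟X_ F x r
    ... | yes refl = sym (*-identityʳ (f r))
    ... | no ne = trans (h x ne) (sym (*-zeroʳ (f r)))

  -- Every `x` with `rep x` owns two distinct tokens and no token has two owners, so pairs of a
  -- representative and a side inject into the tokens. This will count two hub darts on every face.
  count-twice : ∀ {Y : Set} (FY : Finite Y) (rep : X → Bool) (token : Y → Bool)
    (t : ∀ x → rep x ≡ true → Fin 2 → Y) → (∀ x e b → token (t x e b) ≡ true) →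
    (∀ x x' e e' b b' → t x e b ≡ t x' e' b' → x ≡ x') → (∀ x e → t x e zero ≢ t x e (suc zero)) →
    count rep * 2 ≤ countL token (elems FY)
  count-twice {Y} FY rep token t t-true owner sides = injective⇒≤ {f = λ i → ix token (elems FY) (complete FY (f i)) (f-true i)}
      λ {i} {j} e → f-inj i j (trans (sym (nth-ix token (elems FY) (complete FY (f i)) (f-true i)))
        (trans (cong (nth token (elems FY)) e) (nth-ix token (elems FY) (complete FY (f j)) (f-true j))))
    where
    at : Fin (count rep) → Fin 2 → Y
    at q = t (nth rep (elems F) q) (nth-true rep (elems F) q)
    f : Fin (count rep * 2) → Y
    f i = at (proj₁ (remQuot {count rep} 2 i)) (proj₂ (remQuot {count rep} 2 i))
    f-true : ∀ i → token (f i) ≡ true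
    f-true i = t-true _ _ _
    same-side : ∀ q b b' → at q b ≡ at q b' → b ≡ b'
    same-side q zero zero e = refl
    same-side q (suc zero) (suc zero) e = refl
    same-side q zero (suc zero) e = ⊥-elim (sides _ _ e)
    same-side q (suc zero) zero e = ⊥-elim (sides _ _ (sym e))
    pairs : ∀ q b q' b' → at q b ≡ at q' b' → combine q b ≡ combine q' b'
    pairs q b q' b' e with nth-inj rep (elems F) (unique F) q q' (owner _ _ _ _ b b' e)
    ... | refl = cong (combine q) (same-side q b b' e)
    f-inj : ∀ i j → f i ≡ f j → i ≡ j
    f-inj i j e = trans (sym (combine-remQuot {count rep} 2 i)) (trans (pairs _ _ _ _ e) (combine-remQuot {count rep} 2 j))

  count-all : count (λ _ → true) ≡ length (elems F)
  count-all = trans (sumL-const 1 (elems F)) (*-identityʳ _)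

length-allFin : ∀ n → length (allFin n) ≡ n
length-allFin n = ≤-antisym
  (subst (_≤ n) (count-all (finFinite n)) (count-cover (finFinite n) (λ _ → true) id λ x _ → x , refl))
  (subst (n ≤_) (count-all (finFinite n)) (count-inj (finFinite n) (λ _ → true) id (λ _ → refl) λ _ _ e → e))

-- Cycles of permutations and transpositions

record Equiv {X : Set} (R : X → X → Set) : Set where
  field
    reflᴱ  : ∀ {x} → R x x
    symᴱ   : ∀ {x y} → R x y → R y x
    transᴱ : ∀ {x y z} → R x y → R y z → R x z

open Equiv public

module Classes {X : Set} (F : Finite X) (code : X → ℕ)
               (code-inj : ∀ {x y} → code x ≡ code y → x ≡ y) where

  -- A class is counted by its member of least code, the convention of `components` and `faces`.
  -- `Reps` only asks a Boolean test to agree with this, so that counts made with different tests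
  -- can be compared.
  IsRep : (X → X → Set) → X → Set
  IsRep R x = ∀ y → code y < code x → ¬ R y x

  Reps : (X → X → Set) → (X → Bool) → Set
  Reps R p = (∀ x → p x ≡ true → IsRep R x) × (∀ x → IsRep R x → p x ≡ true)

  private
    argmin : ∀ {P : X → Set} → (∀ x → Dec (P x)) → ∀ xs x → P x →
      ∃[ r ] (P r × code r ≤ code x × (∀ y → y ∈ xs → P y → code r ≤ code y))
    argmin P? [] x px = x , px , ≤-refl , λ _ ()
    argmin P? (z ∷ xs) x px with argmin P? xs x px | P? z
    ... | r , pr , le , h | no ¬pz = r , pr , le , λ where
          _ (here refl) pz → ⊥-elim (¬pz pz)
          y (there m) py → h y m py
    ... | r , pr , le , h | yes pz with ≤-total (code r) (code z)
    ...   | inj₁ r≤z = r , pr , le , λ where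
            _ (here refl) _ → r≤z
            y (there m) py → h y m py
    ...   | inj₂ z≤r = z , pz , ≤-trans z≤r le , λ where
            _ (here refl) _ → ≤-refl
            y (there m) py → ≤-trans z≤r (h y m py)

  module _ {R : X → X → Set} (E : Equiv R) (R? : ∀ x y → Dec (R x y)) where

    rep : ∀ a → ∃[ r ] (R r a × IsRep R r)
    rep a with argmin (λ x → R? x a) (elems F) a (reflᴱ E)
    ... | r , ra , _ , h = r , ra , λ y lt ry →
            <⇒≱ lt (h y (complete F y) (transᴱ E ry ra))

    rep-unique : ∀ {x y} → IsRep R x → IsRep R y → R x y → x ≡ y
    rep-unique {x} {y} hx hy xy with <-cmp (code x) (code y)
    ... | tri< lt _ _ = ⊥-elim (hy x lt xy)
    ... | tri≈ _ e _ = code-inj e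
    ... | tri> _ _ gt = ⊥-elim (hx y gt (symᴱ E xy))

    repᵇ : X → Bool
    repᵇ x = not (anyL (λ y → (code y <ᵇ code x) ∧ does (R? y x)) (elems F))

    repᵇ-reps : Reps R repᵇ
    repᵇ-reps = (λ x e y lt r → true≢false
                  (anyL-intro (elems F) (complete F y) (∧-intro (<ᵇ-intro lt) (does-intro (R? y x) r)))
                  (not-true e))
              , λ x h → not-intro λ e → let (y , q) = anyL-true (elems F) e ; (l , r) = ∧-true q
                                        in h y (<ᵇ-true l) (does-true (R? y x) r)

  classes-anti : ∀ {R R' p p'} → (∀ {x y} → R x y → R' x y) → Reps R p → Reps R' p' →
    count F p' ≤ count F p
  classes-anti sub (_ , c) (s' , _) =
    count-mono F λ x e → c x λ y lt r → s' x e y lt (sub r)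

  classes-cong : ∀ {R R' p p'} → (∀ {x y} → R x y → R' x y) → (∀ {x y} → R' x y → R x y) →
    Reps R p → Reps R' p' → count F p ≡ count F p'
  classes-cong f g h h' = ≤-antisym (classes-anti g h' h) (classes-anti f h h')

  private
    -- Of the least members of the two merging classes the larger one, `rb`, ceases to be least in
    -- its class; every other element keeps its status.
    merge′ : ∀ {R R' p p'} (E : Equiv R) (E' : Equiv R') (R? : ∀ x y → Dec (R x y)) →
      (∀ {x y} → R x y → R' x y) → ∀ {a b} → R' a b →
      (∀ {x y} → R' x y → R x y ⊎ (R x a × R b y) ⊎ (R x b × R a y)) →
      ∀ ra rb → R ra a → IsRep R ra → R rb b → IsRep R rb → code ra < code rb →
      Reps R p → Reps R' p' → count F p ≡ suc (count F p')
    merge′ {R} {R'} {p} {p'} E E' R? sub {a} {b} ab split ra rb rra ira rrb irb lt (s , c) (s' , c') =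
      trans (sumL-cong (elems F) pointwise)
        (trans (sumL-+ _ _ (elems F))
          (trans (+-comm _ (count F (λ x → does (_≟X_ F x rb)))) (cong (_+ count F p') (count-single F rb))))
      where
      rab : R' ra rb
      rab = transᴱ E' (sub rra) (transᴱ E' ab (symᴱ E' (sub rrb)))
      iff : ∀ x → x ≢ rb → IsRep R x → IsRep R' x
      iff x ne ix y y<x yx with split yx
      ... | inj₁ r = ix y y<x r
      ... | inj₂ (inj₁ (_ , bx)) = ne (rep-unique E R? ix irb (symᴱ E (transᴱ E rrb bx)))
      ... | inj₂ (inj₂ (yb , ax)) = irb y (<-trans (subst (λ z → code y < code z) x≡ra y<x) lt)
              (transᴱ E yb (symᴱ E rrb))
        where
        x≡ra : x ≡ ra
        x≡ra = rep-unique E R? ix ira (symᴱ E (transᴱ E rra ax))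
      pointwise : ∀ x → ind (p x) ≡ ind (p' x) + ind (does (_≟X_ F x rb))
      pointwise x with _≟X_ F x rb
      ... | yes refl rewrite c rb irb | ≢true {p' rb} (λ e → s' rb e ra lt rab) = refl
      ... | no ne = trans (cong ind (bool-ext
                (λ e → c' x (iff x ne (s x e)))
                (λ e → c x λ y y<x yx → s' x e y y<x (sub yx)))) (sym (+-identityʳ _))

  classes-merge : ∀ {R R' p p'} (E : Equiv R) (E' : Equiv R') (R? : ∀ x y → Dec (R x y)) →
    (∀ {x y} → R x y → R' x y) → ∀ {a b} → ¬ R a b → R' a b →
    (∀ {x y} → R' x y → R x y ⊎ (R x a × R b y) ⊎ (R x b × R a y)) →
    Reps R p → Reps R' p' → count F p ≡ suc (count F p')
  classes-merge E E' R? sub {a} {b} ¬ab ab split h h' with rep E R? a | rep E R? b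
  ... | ra , rra , ira | rb , rrb , irb with <-cmp (code ra) (code rb)
  ... | tri< lt _ _ = merge′ E E' R? sub ab split ra rb rra ira rrb irb lt h h'
  ... | tri≈ _ e _ rewrite code-inj e = ⊥-elim (¬ab (transᴱ E (symᴱ E rra) rrb))
  ... | tri> _ _ gt = merge′ E E' R? sub (symᴱ E' ab)
    (λ r → [ inj₁ , (λ q → inj₂ ([ inj₂ , inj₁ ]′ q)) ]′ (split r)) rb ra rrb irb rra ira gt h h'

iter-+ : ∀ {X : Set} (f : X → X) k l x → iter (k + l) f x ≡ iter k f (iter l f x)
iter-+ f zero l x = refl
iter-+ f (suc k) l x = cong f (iter-+ f k l x)

iter-comm : ∀ {X : Set} (f : X → X) k x → iter k f (f x) ≡ f (iter k f x)
iter-comm f zero x = refl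
iter-comm f (suc k) x = cong f (iter-comm f k x)

iter-cong : ∀ {X : Set} {f g : X → X} → (∀ x → f x ≡ g x) → ∀ k x → iter k f x ≡ iter k g x
iter-cong h zero x = refl
iter-cong {g = g} h (suc k) x = trans (h _) (cong g (iter-cong h k x))

Orb : {X : Set} → (X → X) → X → X → Set
Orb f x y = ∃[ k ] iter k f x ≡ y

orb-refl : ∀ {X : Set} {f : X → X} {x} → Orb f x x
orb-refl = 0 , refl

orb-step : ∀ {X : Set} {f : X → X} {x} → Orb f x (f x)
orb-step = 1 , refl

orb-trans : ∀ {X : Set} {f : X → X} {x y z} → Orb f x y → Orb f y z → Orb f x z
orb-trans {f = f} {x} (k , refl) (l , refl) = l + k , iter-+ f l k x

orb-cong : ∀ {X : Set} {f g : X → X} → (∀ x → f x ≡ g x) → ∀ {x y} → Orb f x y → Orb g x y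
orb-cong h {x} (k , e) = k , trans (sym (iter-cong h k x)) e

-- One step of `f` may become any number of steps of `g`, including none, so orbits can be followed
-- through maps that insert or skip points.
orb-sim : ∀ {X Y : Set} {f : X → X} {g : Y → Y} (π : X → Y) →
  (∀ x → Orb g (π x) (π (f x))) → ∀ {x y} → Orb f x y → Orb g (π x) (π y)
orb-sim {f = f} {g} π h (zero , refl) = orb-refl
orb-sim {f = f} {g} π h {x} (suc k , refl) = orb-trans (orb-sim π h (k , refl)) (h (iter k f x))

record Perm {X : Set} (f : X → X) : Set where
  field
    inv  : X → X
    invˡ : ∀ x → inv (f x) ≡ x
    invʳ : ∀ x → f (inv x) ≡ x

  f-inj : ∀ {x y} → f x ≡ f y → x ≡ y
  f-inj {x} {y} e = trans (sym (invˡ x)) (trans (cong inv e) (invˡ y))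

  iter-inj : ∀ k {x y} → iter k f x ≡ iter k f y → x ≡ y
  iter-inj zero e = e
  iter-inj (suc k) e = iter-inj k (f-inj e)

open Perm public

module _ {X : Set} (F : Finite X) {f : X → X} (P : Perm f) where

  -- Among `suc (count F p)` successive iterates, all satisfying `p`, two coincide by the pigeonhole
  -- principle, and injectivity cancels the common initial steps.
  period-within : ∀ (p : X → Bool) x → (∀ k → p (iter k f x) ≡ true) →
    ∃[ t ] (0 < t × t ≤ count F p × iter t f x ≡ x)
  period-within p x h with
    firstBelow {λ j → ∃[ i ] (i < j × iter i f x ≡ iter j f x)}
      (λ j → anyN? (λ i → _≟X_ F (iter i f x) (iter j f x)) j) (suc (count F p))
  ... | inj₁ (j , lt , (i , i<j , e) , _) = j ∸ i , m<n⇒0<n∸m i<j , ≤-trans (m∸n≤m j i) (≤-pred lt) ,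
        sym (iter-inj P i (trans e (trans (cong (λ k → iter k f x) (sym (m+[n∸m]≡n (<⇒≤ i<j))))
          (iter-+ f i (j ∸ i) x))))
  ... | inj₂ no-rep = ⊥-elim (1+n≰n (count-inj F p (λ (i : Fin (suc (count F p))) → iter (toℕ i) f x)
          (λ i → h (toℕ i)) inj))
    where
    inj : ∀ (i j : Fin (suc (count F p))) → iter (toℕ i) f x ≡ iter (toℕ j) f x → i ≡ j
    inj i j e with <-cmp (toℕ i) (toℕ j)
    ... | tri< lt _ _ = ⊥-elim (no-rep (toℕ j) (toℕ<n j) (toℕ i , lt , e))
    ... | tri≈ _ q _ = toℕ-injective q
    ... | tri> _ _ gt = ⊥-elim (no-rep (toℕ i) (toℕ<n i) (toℕ j , gt , sym e))

  private
    size : ℕ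
    size = count F (λ _ → true)

  period : ∀ x → ∃[ t ] (0 < t × t ≤ size × iter t f x ≡ x)
  period x = period-within (λ _ → true) x (λ _ → refl)

  private
    iter-* : ∀ q {t x} → iter t f x ≡ x → iter (q * t) f x ≡ x
    iter-* zero e = refl
    iter-* (suc q) {t} {x} e = trans (iter-+ f t (q * t) x) (trans (cong (iter t f) (iter-* q e)) e)

  iter-reduce : ∀ {t x} → 0 < t → iter t f x ≡ x → ∀ k → ∃[ r ] (r < t × iter r f x ≡ iter k f x)
  iter-reduce pos e zero = 0 , pos , refl
  iter-reduce pos e (suc k) with iter-reduce pos e k
  ... | r , r<t , q with m≤n⇒m<n∨m≡n r<t
  ... | inj₁ lt = suc r , lt , cong f q
  ... | inj₂ refl = 0 , pos , trans (sym e) (cong f q)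

  orb-sym : ∀ {x y} → Orb f x y → Orb f y x
  orb-sym {x} (k , refl) with period x
  -- With period `suc t`, another `k * t` steps complete `k` full rounds.
  ... | suc t , _ , _ , e = k * t , trans (sym (iter-+ f (k * t) k x))
          (trans (cong (λ j → iter j f x) (lem k t)) (iter-* k {suc t} e))
    where
    lem : ∀ k t → k * t + k ≡ k * suc t
    lem = solve-∀

  orb-equiv : Equiv (Orb f)
  orb-equiv = record { reflᴱ = orb-refl ; symᴱ = orb-sym ; transᴱ = orb-trans }

  orb-bounded : ∀ {t x y} → 0 < t → iter t f x ≡ x → Orb f x y → ∃[ r ] (r < t × iter r f x ≡ y)
  orb-bounded pos e (k , refl) = iter-reduce pos e k

  orb? : ∀ x y → Dec (Orb f x y)
  orb? x y with anyN? (λ k → _≟X_ F (iter k f x) y) size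
  ... | yes (k , _ , e) = yes (k , e)
  ... | no ¬h = no λ o → let (t , pos , le , e) = period x
                             (r , r<t , q) = orb-bounded pos e o
                         in ¬h (r , <-≤-trans r<t le , q)

module Transposition {X : Set} (F : Finite X) where

  swap : X → X → X → X
  swap a b x with _≟X_ F x a
  ... | yes _ = b
  ... | no _ with _≟X_ F x b
  ...   | yes _ = a
  ...   | no _ = x

  swapˡ : ∀ a b → swap a b a ≡ b
  swapˡ a b with _≟X_ F a a
  ... | yes _ = refl
  ... | no ne = ⊥-elim (ne refl)

  swapʳ : ∀ a b → swap a b b ≡ a
  swapʳ a b with _≟X_ F b a
  ... | yes e = e
  ... | no _ with _≟X_ F b b
  ...   | yes _ = refl
  ...   | no ne = ⊥-elim (ne refl)

  swap-other : ∀ {a b x} → x ≢ a → x ≢ b → swap a b x ≡ x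
  swap-other {a} {b} {x} xa xb with _≟X_ F x a
  ... | yes e = ⊥-elim (xa e)
  ... | no _ with _≟X_ F x b
  ...   | yes e = ⊥-elim (xb e)
  ...   | no _ = refl

  swap-refl : ∀ a x → swap a a x ≡ x
  swap-refl a x with _≟X_ F x a
  ... | yes e = sym e
  ... | no _ with _≟X_ F x a
  ...   | yes e = sym e
  ...   | no _ = refl

  swap-cases : ∀ a b x → (x ≡ a × swap a b x ≡ b) ⊎ (x ≡ b × swap a b x ≡ a) ⊎ (x ≢ a × x ≢ b × swap a b x ≡ x)
  swap-cases a b x with _≟X_ F x a
  ... | yes e = inj₁ (e , refl)
  ... | no xa with _≟X_ F x b
  ...   | yes e = inj₂ (inj₁ (e , refl))
  ...   | no xb = inj₂ (inj₂ (xa , xb , refl))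

  swap-invol : ∀ a b x → swap a b (swap a b x) ≡ x
  swap-invol a b x with swap-cases a b x
  ... | inj₁ (refl , e) = trans (cong (swap a b) e) (swapʳ a b)
  ... | inj₂ (inj₁ (refl , e)) = trans (cong (swap a b) e) (swapˡ a b)
  ... | inj₂ (inj₂ (_ , _ , e)) = trans (cong (swap a b) e) e

  swap-perm : ∀ {f} → Perm f → ∀ a b → Perm (swap a b ∘ f)
  swap-perm {f} P a b = record
    { inv = inv P ∘ swap a b
    ; invˡ = λ x → trans (cong (inv P) (swap-invol a b (f x))) (invˡ P x)
    ; invʳ = λ x → trans (cong (swap a b) (invʳ P (swap a b x))) (swap-invol a b x) }

  module _ {f : X → X} (P : Perm f) {a b : X} (a≢b : a ≢ b) where

    private
      g : X → X
      g = swap a b ∘ f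

      P′ : Perm g
      P′ = swap-perm P a b

      arrive : ∀ c k → iter (suc k) f c ≡ c → (∀ j → 0 < j → j ≤ k → iter j f c ≢ a × iter j f c ≢ b) →
        Orb g c (inv P c)
      arrive c k e h = k , trans (same k ≤-refl) (f-inj P (trans e (sym (invʳ P c))))
        where
        same : ∀ j → j ≤ k → iter j g c ≡ iter j f c
        same zero _ = refl
        same (suc j) le = trans (cong g (same j (<⇒≤ le)))
          (swap-other (proj₁ (h (suc j) z<s le)) (proj₂ (h (suc j) z<s le)))

    -- If a and b lie on different cycles of f, following f from a up to its predecessor
    -- and then applying the transposition leads to b.
    orb-join : ¬ Orb f a b → Orb g a b
    orb-join ¬ab with period F P a
    ... | t , pos , _ , e with minimal {λ k → 0 < k × iter k f a ≡ a} (λ k → dec k) t (pos , e)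
      where
      dec : ∀ k → Dec (0 < k × iter k f a ≡ a)
      dec k with 0 <? k | _≟X_ F (iter k f a) a
      ... | yes p | yes q = yes (p , q)
      ... | yes _ | no q = no (q ∘ proj₂)
      ... | no p | _ = no (p ∘ proj₁)
    ... | suc k , _ , (_ , e′) , least = orb-trans (arrive a k e′ λ j pos′ le →
            (λ q → least j (s≤s le) (pos′ , q)) , λ q → ¬ab (j , q))
          (1 , trans (cong (swap a b) (invʳ P a)) (swapˡ a b))

    orb-lift : ¬ Orb f a b → ∀ {x y} → Orb f x y → Orb g x y
    orb-lift ¬ab = orb-sim id step
      where
      ab = orb-join ¬ab
      ba = orb-sym F P′ ab
      step : ∀ x → Orb g x (f x)
      step x with swap-cases a b (f x)
      ... | inj₁ (e , q) = orb-trans (1 , q) (subst (Orb g b) (sym e) ba)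
      ... | inj₂ (inj₁ (e , q)) = orb-trans (1 , q) (subst (Orb g a) (sym e) ab)
      ... | inj₂ (inj₂ (_ , _ , q)) = 1 , q

    -- Only arrivals at `a` or `b` are redirected, each to the other point. So it suffices to
    -- remember which of the two `x` leads to under `f` and where the latest redirection landed;
    -- landing where `x` leads anyway changes nothing.
    orb-cases : ∀ {x y} → Orb g x y → Orb f x y ⊎ (Orb f x a × Orb f b y) ⊎ (Orb f x b × Orb f a y)
    orb-cases (zero , refl) = inj₁ orb-refl
    orb-cases {x} (suc k , refl) with iter k g x | orb-cases {x} (k , refl)
    ... | z | ih with swap-cases a b (f z)
    ... | inj₂ (inj₂ (_ , _ , q)) rewrite q = ext ih
      where
      ext : _ → _
      ext (inj₁ o) = inj₁ (orb-trans o orb-step)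
      ext (inj₂ (inj₁ (o , o'))) = inj₂ (inj₁ (o , orb-trans o' orb-step))
      ext (inj₂ (inj₂ (o , o'))) = inj₂ (inj₂ (o , orb-trans o' orb-step))
    ... | inj₁ (e , q) rewrite q = ext ih
      where
      za : Orb f z a
      za = 1 , e
      ext : _ → _
      ext (inj₁ o) = inj₂ (inj₁ (orb-trans o za , orb-refl))
      ext (inj₂ (inj₁ (o , o'))) = inj₂ (inj₁ (o , orb-refl))
      ext (inj₂ (inj₂ (o , o'))) = inj₁ o
    ... | inj₂ (inj₁ (e , q)) rewrite q = ext ih
      where
      zb : Orb f z b
      zb = 1 , e
      ext : _ → _
      ext (inj₁ o) = inj₂ (inj₂ (orb-trans o zb , orb-refl))
      ext (inj₂ (inj₁ (o , o'))) = inj₁ o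
      ext (inj₂ (inj₂ (o , o'))) = inj₂ (inj₂ (o , orb-refl))

    -- If b is reached from a, the stretch a, f a, …, f⁻¹ b closes up to a cycle that avoids b.
    orb-split : Orb f a b → ¬ Orb g a b
    orb-split (t , e) with minimal (λ k → _≟X_ F (iter k f a) b) t e
    ... | zero , _ , e′ , _ = λ _ → a≢b e′
    ... | suc k , _ , e′ , least = λ (j , q) → let (i , le , r) = stay j in least i (s≤s le) (trans r q)
      where
      noreturn : ∀ i → 0 < i → i ≤ k → iter i f a ≢ a
      noreturn i pos le q = least (suc k ∸ i) (m>n⇒m∸n>0-lemma)
        (trans (cong (iter (suc k ∸ i) f) (sym q))
          (trans (sym (iter-+ f (suc k ∸ i) i a))
            (trans (cong (λ l → iter l f a) (m∸n+n≡m (m≤n⇒m≤1+n le))) e′)))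
        where
        m>n⇒m∸n>0-lemma : suc k ∸ i < suc k
        m>n⇒m∸n>0-lemma = ∸-monoʳ-< {suc k} {i} {0} pos (m≤n⇒m≤1+n le)
      stay : ∀ j → ∃[ i ] (i ≤ k × iter i f a ≡ iter j g a)
      stay zero = 0 , z≤n , refl
      stay (suc j) with stay j
      ... | i , le , r with m≤n⇒m<n∨m≡n le
      ... | inj₁ lt = suc i , lt , trans (sym (swap-other (noreturn (suc i) z<s lt)
                        (least (suc i) (s≤s lt)))) (cong g r)
      ... | inj₂ refl = 0 , z≤n , sym (trans (cong g (sym r)) (trans (cong (swap a b) e′) (swapʳ a b)))

-- Graphs and components

Gr : ℕ → Set
Gr n = Fin n → Fin n → Bool

-- Graphs are handled as functions, but counting needs propositional equality of graphs. Tabulated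
-- matrices provide it: pointwise equal functions give equal matrices, by `mk-cong`.
mk : ∀ {n} → Gr n → Adj n
mk a = tabulate λ i → tabulate (a i)

adj-mk : ∀ {n} (a : Gr n) i j → adj (mk a) i j ≡ a i j
adj-mk a i j = trans (cong (λ r → lookup r j) (lookup∘tabulate _ i)) (lookup∘tabulate _ j)

mk-adj : ∀ {n} (A : Adj n) → mk (adj A) ≡ A
mk-adj A = trans (tabulate-cong λ i → tabulate∘lookup (lookup A i)) (tabulate∘lookup A)

mk-cong : ∀ {n} {a b : Gr n} → (∀ i j → a i j ≡ b i j) → mk a ≡ mk b
mk-cong h = tabulate-cong λ i → tabulate-cong (h i)

Dart : ℕ → Set
Dart n = Fin n × Fin n

private
  unique-concatMap : ∀ {A B : Set} (f : A → List B) xs → Unique xs → (∀ x → Unique (f x)) →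
    (∀ {x y z} → z ∈ f x → z ∈ f y → x ≡ y) → Unique (concatMap f xs)
  unique-concatMap f [] u h d = []
  unique-concatMap f (x ∷ xs) (a ∷ u) h d =
    ++⁺ (h x) (unique-concatMap f xs u h d) λ (m , m') → apart a (back xs m') m
    where
    back : ∀ {z} ys → z ∈ concatMap f ys → ∃[ y ] (y ∈ ys × z ∈ f y)
    back (y ∷ ys) m with ∈-++⁻ (f y) m
    ... | inj₁ q = y , here refl , q
    ... | inj₂ q = let (w , m , r) = back ys q in w , there m , r
    apart : ∀ {ys z} → All (λ y → x ≢ y) ys → ∃[ y ] (y ∈ ys × z ∈ f y) → z ∈ f x → ⊥
    apart (ne ∷ _) (y , here refl , q) m = ne (d m q)
    apart (_ ∷ al) (y , there i , q) m = apart al (y , i , q) m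

∈-concatMap : ∀ {A B : Set} (f : A → List B) {x y} xs → x ∈ xs → y ∈ f x → y ∈ concatMap f xs
∈-concatMap f (x ∷ xs) (here refl) m = ∈-++⁺ˡ m
∈-concatMap f (x ∷ xs) (there i) m = ∈-++⁺ʳ (f x) (∈-concatMap f xs i m)

unique-products : ∀ {A B C : Set} (f : A → B → C) (xs : List A) (ys : List B) → Unique xs → Unique ys →
  (∀ {a a' b b'} → f a b ≡ f a' b' → a ≡ a' × b ≡ b') → Unique (concatMap (λ x → map (f x) ys) xs)
unique-products f xs ys ux uy inj = unique-concatMap _ xs ux
  (λ x → map⁺ (proj₂ ∘ inj) uy)
  λ m m' → let (_ , _ , e) = ∈-map⁻ _ m ; (_ , _ , e') = ∈-map⁻ _ m' in proj₁ (inj (trans (sym e) e'))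

dartFinite : ∀ n → Finite (Dart n)
dartFinite n = record
  { elems = concatMap (λ u → map (u ,_) (allFin n)) (allFin n)
  ; complete = λ (u , v) → ∈-concatMap _ (allFin n) (∈-allFin u) (∈-map⁺ (u ,_) (∈-allFin v))
  ; unique = unique-products _,_ (allFin n) (allFin n) (allFin⁺ n) (allFin⁺ n)
      λ e → ,-injectiveˡ e , ,-injectiveʳ e
  ; _≟X_ = ≡-dec _≟_ _≟_ }

sumDarts : ∀ n (f : Dart n → ℕ) → sumL f (elems (dartFinite n)) ≡ sumF n (λ u → sumF n (λ v → f (u , v)))
sumDarts n f = go (allFin n)
  where
  inner : ∀ u vs → sumL f (map (u ,_) vs) ≡ sumL (λ v → f (u , v)) vs
  inner u [] = refl
  inner u (v ∷ vs) = cong (f (u , v) +_) (inner u vs)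
  go : ∀ us → sumL f (concatMap (λ u → map (u ,_) (allFin n)) us) ≡
              sumL (λ u → sumL (λ v → f (u , v)) (allFin n)) us
  go [] = refl
  go (u ∷ us) = trans (sumL-++ f (map (u ,_) (allFin n)) _) (cong₂ _+_ (inner u (allFin n)) (go us))

dartCode-inj : ∀ {n} {x y : Dart n} → dartCode x ≡ dartCode y → x ≡ y
dartCode-inj {n} {u , v} {u' , v'} e = cong₂ _,_ (proj₁ pr) (proj₂ pr)
  where
  eq : ∀ (u v : Fin n) → toℕ (combine u v) ≡ dartCode (u , v)
  eq u v = trans (toℕ-combine u v) (cong (_+ toℕ v) (*-comm n (toℕ u)))
  pr = combine-injective u v u' v' (toℕ-injective (trans (eq u v) (trans e (sym (eq u' v')))))

data Path {n} (a : Gr n) : Fin n → Fin n → Set where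
  []  : ∀ {u} → Path a u u
  _∷_ : ∀ {u v w} → a u v ≡ true → Path a v w → Path a u w

infixr 5 _++ᴾ_
_++ᴾ_ : ∀ {n} {a : Gr n} {u v w} → Path a u v → Path a v w → Path a u w
[] ++ᴾ q = q
(e ∷ p) ++ᴾ q = e ∷ (p ++ᴾ q)

Symm : ∀ {n} → Gr n → Set
Symm a = ∀ u v → a u v ≡ true → a v u ≡ true

Irr : ∀ {n} → Gr n → Set
Irr a = ∀ u → a u u ≡ false

path-sym : ∀ {n} {a : Gr n} → Symm a → ∀ {u v} → Path a u v → Path a v u
path-sym s [] = []
path-sym s (e ∷ p) = path-sym s p ++ᴾ (s _ _ e ∷ [])

path-mono : ∀ {n} {a b : Gr n} → (∀ u v → a u v ≡ true → b u v ≡ true) → ∀ {u v} → Path a u v → Path b u v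
path-mono h [] = []
path-mono h (e ∷ p) = h _ _ e ∷ path-mono h p

path-equiv : ∀ {n} {a : Gr n} → Symm a → Equiv (Path a)
path-equiv s = record { reflᴱ = [] ; symᴱ = path-sym s ; transᴱ = _++ᴾ_ }

module _ {n} (A : Adj n) where

  reachIn-sound : ∀ k {s t} → reachIn A k s t ≡ true → Path (adj A) s t
  reachIn-sound zero {s} {t} e with refl ← eqF-true {i = s} {t} e = []
  reachIn-sound (suc k) e with ∨-true e
  ... | inj₁ q = reachIn-sound k q
  ... | inj₂ q = let (w , r) = anyF-true n q ; (x , y) = ∧-true r in reachIn-sound k x ++ᴾ (y ∷ [])

  private
    reach-suc : ∀ k {s t} → reachIn A k s t ≡ true → reachIn A (suc k) s t ≡ true
    reach-suc k = ∨-introˡ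

    reach-step : ∀ k {s w t} → reachIn A k s w ≡ true → adj A w t ≡ true → reachIn A (suc k) s t ≡ true
    reach-step k {s} {w} {t} r e = ∨-introʳ {reachIn A k s t} (anyF-intro n w (∧-intro r e))

    reach-mono : ∀ {k l s t} → k ≤′ l → reachIn A k s t ≡ true → reachIn A l s t ≡ true
    reach-mono ≤′-refl r = r
    reach-mono {l = suc l} (≤′-step le) r = reach-suc l (reach-mono le r)

    path-reach : ∀ {s w t} k → reachIn A k s w ≡ true → Path (adj A) w t → ∃[ l ] reachIn A l s t ≡ true
    path-reach k r [] = k , r
    path-reach k r (e ∷ p) = path-reach (suc k) (reach-step k r e) p

    At : Fin n → Fin n → ℕ → Set
    At s t k = reachIn A k s t ≡ true × (∀ j → j < k → ¬ (reachIn A j s t ≡ true))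

    layers : ∀ {s t} k → At s t k → ∀ j → j ≤ k → ∃[ w ] At s w j
    layers {s} {t} k h j le with m≤n⇒m<n∨m≡n le
    ... | inj₂ refl = t , h
    layers {s} {t} (suc k) (r , least) j le | inj₁ lt with ∨-true r
    ... | inj₁ q = ⊥-elim (least k ≤-refl q)
    ... | inj₂ q = let (w , r') = anyF-true n q ; (x , y) = ∧-true r'
                   in layers k (x , λ i i<k z → least (suc i) (s≤s i<k) (reach-step i z y)) j (≤-pred lt)

  -- `connected` searches only `n` steps. If `k` is the least number of steps that reaches `t`,
  -- there are vertices at exact distance 0, 1, ..., `k` from `s`; they are distinct, so `k + 1` is
  -- at most `n`.
  reachIn-complete : ∀ {s t} → Path (adj A) s t → connected A s t ≡ true
  reachIn-complete {s} {t} p with path-reach 0 (eqF-intro {i = s} refl) p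
  ... | l , r with minimal (λ k → reachIn A k s t ≟ᵇ true) l r
  ... | k , _ , q , least = reach-mono (≤⇒≤′ (<⇒≤ k<n)) q
    where
    layer : ∀ (i : Fin (suc k)) → ∃[ w ] At s w (toℕ i)
    layer i = layers k (q , least) (toℕ i) (≤-pred (toℕ<n i))
    sep : ∀ i j → proj₁ (layer i) ≡ proj₁ (layer j) → ¬ (toℕ i < toℕ j)
    sep i j e lt = proj₂ (proj₂ (layer j)) (toℕ i) lt
      (subst (λ w → reachIn A (toℕ i) s w ≡ true) e (proj₁ (proj₂ (layer i))))
    k<n : suc k ≤ n
    k<n = injective⇒≤ {f = proj₁ ∘ layer} inj
      where
      inj : ∀ {i j} → proj₁ (layer i) ≡ proj₁ (layer j) → i ≡ j
      inj {i} {j} e with <-cmp (toℕ i) (toℕ j)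
      ... | tri< lt _ _ = ⊥-elim (sep i j e lt)
      ... | tri≈ _ q _ = toℕ-injective q
      ... | tri> _ _ gt = ⊥-elim (sep j i (sym e) gt)

path-adj : ∀ {n} {a : Gr n} {u v} → Path a u v → Path (adj (mk a)) u v
path-adj {a = a} = path-mono λ u v e → trans (adj-mk a u v) e

adj-path : ∀ {n} {a : Gr n} {u v} → Path (adj (mk a)) u v → Path a u v
adj-path {a = a} = path-mono λ u v e → trans (sym (adj-mk a u v)) e

path? : ∀ {n} (a : Gr n) u v → Dec (Path a u v)
path? {n} a u v with connected (mk a) u v in eq
... | true = yes (adj-path (reachIn-sound (mk a) n eq))
... | false = no λ p → true≢false (reachIn-complete (mk a) (path-adj p)) eq

comps : ∀ {n} → Gr n → ℕ
comps a = components (mk a)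

module VC n = Classes (finFinite n) toℕ toℕ-injective
module DC n = Classes (dartFinite n) dartCode dartCode-inj

comp-reps : ∀ {n} (a : Gr n) →
  VC.Reps n (Path a) (λ v → allF n (λ u → not ((toℕ u <ᵇ toℕ v) ∧ connected (mk a) u v)))
comp-reps {n} a = (λ x e y lt p → true≢false
      (∧-intro (<ᵇ-intro lt) (reachIn-complete (mk a) (path-adj p)))
      (not-true (allF-true n e y)))
  , λ x h → allF-intro n λ u → not-intro λ e → let (lt , c) = ∧-true e
            in h u (<ᵇ-true lt) (adj-path (reachIn-sound (mk a) n c))

comps-anti : ∀ {n} {a b : Gr n} → (∀ {u v} → Path a u v → Path b u v) → comps b ≤ comps a
comps-anti {n} {a} {b} h = VC.classes-anti n h (comp-reps a) (comp-reps b)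

comps-join : ∀ {n} {a b : Gr n} → Symm a → Symm b → (∀ {x y} → Path a x y → Path b x y) →
  ∀ {u v} → ¬ Path a u v → Path b u v →
  (∀ {x y} → Path b x y → Path a x y ⊎ (Path a x u × Path a v y) ⊎ (Path a x v × Path a u y)) →
  comps a ≡ suc (comps b)
comps-join {n} {a} {b} sa sb sub ¬uv uv split =
  VC.classes-merge n (path-equiv sa) (path-equiv sb) (path? a) sub ¬uv uv split (comp-reps a) (comp-reps b)

comps-separated : ∀ {n} (a : Gr n) → Symm a → (s : Fin n → Bool) →
  (∀ u v → s u ≡ true → s v ≡ true → Path a u v → u ≡ v) → count (finFinite n) s ≤ comps a
comps-separated {n} a sa s sep = count-inj (finFinite n) _ (λ i → proj₁ (r i))
    (λ i → proj₂ (comp-reps a) _ (proj₂ (proj₂ (r i))))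
    λ i j e → nth-inj s (allFin n) (allFin⁺ n) i j
      (sep _ _ (nth-true s (allFin n) i) (nth-true s (allFin n) j)
        (path-sym sa (proj₁ (proj₂ (r i))) ++ᴾ subst (λ w → Path a w _) (sym e) (proj₁ (proj₂ (r j)))))
  where
  r : ∀ (i : Fin (count (finFinite n) s)) → _
  r i = VC.rep n (path-equiv sa) (path? a) (nth s (allFin n) i)

-- Rotation systems and genus

-- The successor is a permutation of all vertices, the identity off the neighbourhood. The face map
-- then permutes all ordered pairs, and edge operations compose it with transpositions on one fixed
-- set.
record Row {n} (r : Fin n → Bool) : Set where
  field
    nx   : Fin n → Fin n
    perm : Perm nx
    off  : ∀ z → r z ≡ false → nx z ≡ z
    cyc  : ∀ {z z'} → r z ≡ true → r z' ≡ true → Orb nx z z'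

open Row public

module TF n = Transposition (finFinite n)
module TD n = Transposition (dartFinite n)

row-closed : ∀ {n} {r : Fin n → Bool} (ρ : Row r) {z} → r z ≡ true → r (nx ρ z) ≡ true
row-closed {r = r} ρ {z} e with r (nx ρ z) in q
... | true = refl
... | false = ⊥-elim (true≢false e (subst (λ x → r x ≡ false) (f-inj (perm ρ) (off ρ _ q)) q))

row-fixed : ∀ {n} {r : Fin n → Bool} (ρ : Row r) {x y} → r x ≡ true → r y ≡ true → nx ρ x ≡ x → x ≡ y
row-fixed ρ {x} e e' fix with cyc ρ e e'
... | k , q = trans (sym (fixed k)) q
  where
  fixed : ∀ k → iter k (nx ρ) x ≡ x
  fixed zero = refl
  fixed (suc k) = trans (cong (nx ρ) (fixed k)) fix

row-cong : ∀ {n} {r r' : Fin n → Bool} → (∀ z → r z ≡ r' z) → Row r → Row r'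
row-cong h ρ = record { nx = nx ρ ; perm = perm ρ
  ; off = λ z e → off ρ z (trans (h z) e)
  ; cyc = λ e e' → cyc ρ (trans (h _) e) (trans (h _) e') }

plus : ∀ {n} → (Fin n → Bool) → Fin n → Fin n → Bool
plus r v z = r z ∨ does (z ≟ v)

minus : ∀ {n} → (Fin n → Bool) → Fin n → Fin n → Bool
minus r v z = r z ∧ not (does (z ≟ v))

minus-true : ∀ {n} {r : Fin n → Bool} {v z} → minus r v z ≡ true → r z ≡ true × z ≢ v
minus-true {v = v} {z} e = let (p , q) = ∧-true e in p , λ eq → true≢false (does-intro (z ≟ v) eq) (not-true q)

minus-false : ∀ {n} {r : Fin n → Bool} {v z} → minus r v z ≡ false → r z ≡ false ⊎ z ≡ v
minus-false {r = r} {v} {z} e with r z | z ≟ v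
... | false | _ = inj₁ refl
... | true | yes p = inj₂ p
minus-false () | true | no _

plus-true : ∀ {n} {r : Fin n → Bool} {v z} → plus r v z ≡ true → r z ≡ true ⊎ z ≡ v
plus-true {v = v} {z} e with ∨-true e
... | inj₁ p = inj₁ p
... | inj₂ p = inj₂ (does-true (z ≟ v) p)

plus-false : ∀ {n} {r : Fin n → Bool} {v z} → plus r v z ≡ false → r z ≡ false × z ≢ v
plus-false {r = r} {v} {z} e with r z | z ≟ v
plus-false () | true | _
plus-false () | false | yes _
... | false | no p = refl , p

module _ {n} {r : Fin n → Bool} (ρ : Row r) where
  open TF n

  -- Following `f` by the transposition of `v` and `f v` makes the predecessor of `v` point to
  -- `f v`, and `v` to itself.
  delRow : ∀ v → Row (minus r v)
  delRow v = record { nx = g ; perm = swap-perm (perm ρ) v (f v) ; off = off′ ; cyc = cyc′ }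
    where
    f = nx ρ
    g = swap v (f v) ∘ f
    off′ : ∀ z → minus r v z ≡ false → g z ≡ z
    off′ z e with minus-false {r = r} {v} {z} e | z ≟ v
    ... | _ | yes refl = swapʳ v (f v)
    ... | inj₂ q | no ne = ⊥-elim (ne q)
    ... | inj₁ q | no ne = trans (cong (swap v (f v)) (off ρ z q))
              (swap-other ne λ e' → ne (f-inj (perm ρ) (trans (off ρ z q) e')))
    -- Orbits of `f` are carried to the shortened cycle by moving the deleted point to its
    -- successor.
    π : Fin n → Fin n
    π x with x ≟ v
    ... | yes _ = f v
    ... | no _ = x
    π-other : ∀ {x} → x ≢ v → π x ≡ x
    π-other {x} ne with x ≟ v
    ... | yes e = ⊥-elim (ne e)
    ... | no _ = refl
    sim : ∀ x → Orb g (π x) (π (f x))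
    sim x with x ≟ v | f x ≟ v
    ... | yes refl | yes e = 0 , refl
    ... | yes refl | no _ = 0 , refl
    ... | no ne | yes e = 1 , trans (cong (swap v (f v)) e) (swapˡ v (f v))
    ... | no ne | no ne' = 1 , swap-other ne' (λ e → ne (f-inj (perm ρ) e))
    cyc′ : ∀ {z z'} → minus r v z ≡ true → minus r v z' ≡ true → Orb g z z'
    cyc′ e e' with minus-true {r = r} e | minus-true {r = r} e'
    ... | p , zv | p' , zv' = subst₂ (Orb g) (π-other zv) (π-other zv') (orb-sim π sim (cyc ρ p p'))

  insRow : ∀ v a → r v ≡ false → r a ≡ true → Row (plus r v)
  insRow v a rv ra = record { nx = g ; perm = P′ ; off = off′ ; cyc = cyc′ }
    where
    f = nx ρ
    g = swap v (f a) ∘ f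
    P′ = swap-perm (perm ρ) v (f a)
    gv : g v ≡ f a
    gv = trans (cong (swap v (f a)) (off ρ v rv)) (swapˡ v (f a))
    ga : g a ≡ v
    ga = swapʳ v (f a)
    off′ : ∀ z → plus r v z ≡ false → g z ≡ z
    off′ z e with plus-false {r = r} e
    ... | q , ne = trans (cong (swap v (f a)) (off ρ z q)) (swap-other ne λ e' →
            true≢false (subst (λ x → r x ≡ true) (sym (f-inj (perm ρ) (trans (off ρ z q) e'))) ra) q)
    sim : ∀ x → Orb g x (f x)
    sim x with x ≟ v | x ≟ a
    ... | yes refl | _ = 0 , sym (off ρ v rv)
    ... | no _ | yes refl = 2 , trans (cong g ga) gv
    ... | no ne | no ne' = 1 , swap-other (λ e → ne (f-inj (perm ρ) (trans e (sym (off ρ v rv)))))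
            (λ e → ne' (f-inj (perm ρ) e))
    lift : ∀ {z z'} → r z ≡ true → r z' ≡ true → Orb g z z'
    lift e e' = orb-sim id sim (cyc ρ e e')
    cyc′ : ∀ {z z'} → plus r v z ≡ true → plus r v z' ≡ true → Orb g z z'
    cyc′ e e' with plus-true {r = r} e | plus-true {r = r} e'
    ... | inj₁ p | inj₁ p' = lift p p'
    ... | inj₁ p | inj₂ refl = orb-trans (lift p ra) (1 , ga)
    ... | inj₂ refl | inj₁ p' = orb-trans (1 , gv) (lift (row-closed ρ ra) p')
    ... | inj₂ refl | inj₂ refl = orb-refl

  -- A single neighbour is a fixed point of the rotation, just as every non-neighbour is, so the
  -- permutation stays the same.
  soloRow : ∀ v → (∀ z → r z ≡ false) → Row (plus r v)
  soloRow v h = record { nx = nx ρ ; perm = perm ρ ; off = λ z _ → off ρ z (h z) ; cyc = cyc′ }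
    where
    cyc′ : ∀ {z z'} → plus r v z ≡ true → plus r v z' ≡ true → Orb (nx ρ) z z'
    cyc′ {z} {z'} e e' with plus-true {r = r} e | plus-true {r = r} e'
    ... | inj₁ p | _ = ⊥-elim (true≢false p (h z))
    ... | inj₂ refl | inj₁ p = ⊥-elim (true≢false p (h z'))
    ... | inj₂ refl | inj₂ refl = orb-refl

Emb : ∀ {n} → Gr n → Set
Emb a = ∀ v → Row (a v)

emb-cong : ∀ {n} {a b : Gr n} → (∀ i j → a i j ≡ b i j) → Emb a → Emb b
emb-cong h E v = row-cong (h v) (E v)

face : ∀ {n} {a : Gr n} → Emb a → Dart n → Dart n
face E (u , v) = v , nx (E v) u

face-perm : ∀ {n} {a : Gr n} (E : Emb a) → Perm (face E)
face-perm E = record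
  { inv = λ (v , w) → inv (perm (E v)) w , v
  ; invˡ = λ (u , v) → cong (_, v) (invˡ (perm (E v)) u)
  ; invʳ = λ (v , w) → cong (v ,_) (invʳ (perm (E v)) w) }

module _ (n : ℕ) where
  open TD n

  cycles : {f : Dart n → Dart n} → Perm f → ℕ
  cycles P = count (dartFinite n) (DC.repᵇ n (orb-equiv (dartFinite n) P) (orb? (dartFinite n) P))

  cycles-cong : ∀ {f g} (P : Perm f) (Q : Perm g) → (∀ x → f x ≡ g x) → cycles P ≡ cycles Q
  cycles-cong P Q h = DC.classes-cong n (orb-cong h) (orb-cong (λ x → sym (h x)))
    (DC.repᵇ-reps n (orb-equiv (dartFinite n) P) (orb? (dartFinite n) P)) (DC.repᵇ-reps n (orb-equiv (dartFinite n) Q) (orb? (dartFinite n) Q))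

  cycles-merge : ∀ {f g} (P : Perm f) (Q : Perm g) {x y} → (∀ z → g z ≡ swap x y (f z)) →
    ¬ Orb f x y → cycles P ≡ suc (cycles Q)
  cycles-merge P Q {x} {y} h ¬xy = DC.classes-merge n
      (orb-equiv (dartFinite n) P) (orb-equiv (dartFinite n) Q) (orb? (dartFinite n) P)
      (λ o → orb-cong (λ z → sym (h z)) (orb-lift P x≢y ¬xy o)) ¬xy
      (orb-cong (λ z → sym (h z)) (orb-join P x≢y ¬xy))
      (λ o → orb-cases P x≢y (orb-cong h o))
      (DC.repᵇ-reps n (orb-equiv (dartFinite n) P) (orb? (dartFinite n) P)) (DC.repᵇ-reps n (orb-equiv (dartFinite n) Q) (orb? (dartFinite n) Q))
    where
    x≢y : x ≢ y
    x≢y refl = ¬xy orb-refl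

  cycles-split : ∀ {f g} (P : Perm f) (Q : Perm g) {x y} → (∀ z → g z ≡ swap x y (f z)) →
    x ≢ y → Orb f x y → cycles Q ≡ suc (cycles P)
  cycles-split P Q {x} {y} h x≢y xy = cycles-merge Q P
    (λ z → sym (trans (cong (swap x y) (h z)) (swap-invol x y _)))
    λ o → orb-split P x≢y xy (orb-cong h o)

-- An edge is changed one end at a time. The relation in between is not symmetric, but each half
-- multiplies the face permutation by a single transposition, so the cycles can be counted for each
-- half separately.
updG : ∀ {n} → Gr n → Fin n → (Fin n → Bool) → Gr n
updG a u r v = if does (v ≟ u) then r else a v

updE : ∀ {n} {a : Gr n} → Emb a → ∀ u {r} → Row r → Emb (updG a u r)
updE E u ρ v with v ≟ u
... | yes _ = ρ
... | no _ = E v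

upd-same : ∀ {n} {a : Gr n} (E : Emb a) u {r} (ρ : Row r) z → nx (updE {a = a} E u ρ u) z ≡ nx ρ z
upd-same E u ρ z with u ≟ u
... | yes _ = refl
... | no ne = ⊥-elim (ne refl)

upd-other : ∀ {n} {a : Gr n} (E : Emb a) {u v r} (ρ : Row r) z → v ≢ u → nx (updE {a = a} E u ρ v) z ≡ nx (E v) z
upd-other E {u} {v} ρ z ne with v ≟ u
... | yes e = ⊥-elim (ne e)
... | no _ = refl

-- Every dart leaving `u` is the image under `face` of a dart entering `u`, so a transposition
-- applied to the rotation at `u` becomes the transposition of the corresponding darts leaving `u`.
face-upd : ∀ {n} {a : Gr n} (E : Emb a) u {x y r} (ρ : Row r) →
  (∀ z → nx ρ z ≡ TF.swap n x y (nx (E u) z)) →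
  ∀ d → face (updE {a = a} E u ρ) d ≡ TD.swap n (u , x) (u , y) (face E d)
face-upd {n} {a} E u {x} {y} ρ h (t , v) with decide (v ≟ u)
... | inj₂ ne = trans (cong (v ,_) (upd-other {a = a} E ρ t ne))
        (sym (TD.swap-other n (ne ∘ cong proj₁) (ne ∘ cong proj₁)))
... | inj₁ refl with TF.swap-cases n x y (nx (E u) t)
...   | inj₁ (e , q) = trans (cong (u ,_) (trans (upd-same {a = a} E u ρ t) (trans (h t) q)))
        (sym (trans (cong (λ w → TD.swap n (u , x) (u , y) (u , w)) e) (TD.swapˡ n (u , x) (u , y))))
...   | inj₂ (inj₁ (e , q)) = trans (cong (u ,_) (trans (upd-same {a = a} E u ρ t) (trans (h t) q)))
        (sym (trans (cong (λ w → TD.swap n (u , x) (u , y) (u , w)) e) (TD.swapʳ n (u , x) (u , y))))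
...   | inj₂ (inj₂ (p , p' , q)) = trans (cong (u ,_) (trans (upd-same {a = a} E u ρ t) (trans (h t) q)))
        (sym (TD.swap-other n (p ∘ cong proj₂) (p' ∘ cong proj₂)))

isolated : ∀ {n} → Gr n → Fin n → Bool
isolated {n} a v = countF n (a v) ≡ᵇ 0

iso : ∀ {n} → Gr n → ℕ
iso {n} a = countF n (isolated a)

degree : ∀ {n} → Gr n → Fin n → ℕ
degree {n} a v = countF n (a v)

isolated-intro : ∀ {n} {a : Gr n} {v} → (∀ z → a v z ≡ false) → isolated a v ≡ true
isolated-intro {n} h = ≡ᵇ-intro (trans (count-cong (finFinite n) h) (sumL-0 (allFin n)))

isolated-elim : ∀ {n} {a : Gr n} {v} → isolated a v ≡ true → ∀ z → a v z ≡ false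
isolated-elim {n} {a} {v} e z = ≢true λ p → contradiction
  (subst₂ _≤_ (cong ind p) (≡ᵇ-true {countF n (a v)} e) (sumL-∈ {f = λ x → ind (a v x)} (allFin n) (∈-allFin z))) λ ()

halfDarts : ℕ → ℕ
halfDarts n = count (dartFinite n) λ (u , v) → toℕ u ≤ᵇ toℕ v

-- By cycles + edges = faces + halfDarts this is Euler's inequality 2c + E ≤ n + F + 2g; the cycles of
-- face on non-adjacent pairs have length at most two.
Genus : ∀ {n} → ℕ → (a : Gr n) → Emb a → Set
Genus {n} g a E = 2 * comps a + halfDarts n ≤ n + cycles n (face-perm E) + iso a + 2 * g

record Good {n} (g : ℕ) (a : Gr n) : Set where
  field
    gsym  : Symm a
    girr  : Irr a
    emb   : Emb a
    genus : Genus g a emb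

open Good public

good-cong : ∀ {n g} {a b : Gr n} → (∀ i j → a i j ≡ b i j) → Good g a → Good g b
good-cong {n} {g} {a} {b} h G = record
  { gsym = λ u v e → trans (sym (h v u)) (gsym G u v (trans (h u v) e))
  ; girr = λ u → trans (sym (h u u)) (girr G u)
  ; emb = emb-cong h (emb G)
  ; genus = subst₂ (λ c i → 2 * c + halfDarts n ≤ n + cycles n (face-perm (emb G)) + i + 2 * g)
      (cong components (mk-cong h))
      (sumL-cong (allFin n) λ v → cong (λ d → ind (d ≡ᵇ 0)) (count-cong (finFinite n) (h v)))
      (genus G) }

-- Deleting and inserting edges without raising the genus

isPair : ∀ {n} → Fin n → Fin n → Fin n → Fin n → Bool
isPair u v x y = (does (x ≟ u) ∧ does (y ≟ v)) ∨ (does (x ≟ v) ∧ does (y ≟ u))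

isPair-true : ∀ {n} (u v x y : Fin n) → isPair u v x y ≡ true → (x ≡ u × y ≡ v) ⊎ (x ≡ v × y ≡ u)
isPair-true u v x y e with ∨-true e
... | inj₁ q = let (p , r) = ∧-true q in inj₁ (does-true (x ≟ u) p , does-true (y ≟ v) r)
... | inj₂ q = let (p , r) = ∧-true q in inj₂ (does-true (x ≟ v) p , does-true (y ≟ u) r)

isPair-introˡ : ∀ {n} (u v : Fin n) → isPair u v u v ≡ true
isPair-introˡ u v = ∨-introˡ (∧-intro (does-intro (u ≟ u) refl) (does-intro (v ≟ v) refl))

isPair-introʳ : ∀ {n} (u v : Fin n) → isPair u v v u ≡ true
isPair-introʳ u v = ∨-introʳ {does (v ≟ u) ∧ does (u ≟ v)} (∧-intro (does-intro (v ≟ v) refl) (does-intro (u ≟ u) refl))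

delE : ∀ {n} → Gr n → Fin n → Fin n → Gr n
delE a u v x y = a x y ∧ not (isPair u v x y)

addE : ∀ {n} → Gr n → Fin n → Fin n → Gr n
addE a u v x y = a x y ∨ isPair u v x y

delE-true : ∀ {n} (a : Gr n) u v x y → delE a u v x y ≡ true → a x y ≡ true × ¬ (isPair u v x y ≡ true)
delE-true a u v x y e = let (p , q) = ∧-true e in p , λ r → true≢false r (not-true q)

delE-intro : ∀ {n} (a : Gr n) u v x y → a x y ≡ true → ¬ (isPair u v x y ≡ true) → delE a u v x y ≡ true
delE-intro a u v x y e h = ∧-intro e (not-intro h)

delE-sub : ∀ {n} {a : Gr n} {u v} x y → delE a u v x y ≡ true → a x y ≡ true
delE-sub x y e = proj₁ (∧-true e)

isPair-sym : ∀ {n} (u v x y : Fin n) → isPair u v x y ≡ true → isPair u v y x ≡ true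
isPair-sym u v x y e with isPair-true u v x y e
... | inj₁ (refl , refl) = isPair-introʳ x y
... | inj₂ (refl , refl) = isPair-introˡ y x

delE-symm : ∀ {n} {a : Gr n} {u v} → Symm a → Symm (delE a u v)
delE-symm {a = a} {u} {v} s x y e = let (p , q) = delE-true a u v x y e
  in delE-intro a u v y x (s x y p) λ r → q (isPair-sym u v y x r)

addE-symm : ∀ {n} {a : Gr n} {u v} → Symm a → Symm (addE a u v)
addE-symm {a = a} {u} {v} s x y e with ∨-true e
... | inj₁ p = ∨-introˡ (s x y p)
... | inj₂ p = ∨-introʳ {a y x} (isPair-sym u v x y p)

delE-upd : ∀ {n} (a : Gr n) {u v} → u ≢ v → let a₁ = updG a u (minus (a u) v) in
  ∀ x y → updG a₁ v (minus (a₁ v) u) x y ≡ delE a u v x y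
delE-upd a {u} {v} ne x y with v ≟ u | x ≟ v | x ≟ u
... | yes e | _ | _ = ⊥-elim (ne (sym e))
... | no _ | yes refl | yes e = ⊥-elim (ne (sym e))
... | no _ | yes refl | no _ = refl
... | no _ | no _ | yes refl with y ≟ v
...   | yes _ = refl
...   | no _ = refl
delE-upd a {u} {v} ne x y | no _ | no _ | no _ with a x y
... | true = refl
... | false = refl

addE-upd : ∀ {n} (a : Gr n) {u v} → u ≢ v → let a₁ = updG a u (plus (a u) v) in
  ∀ x y → updG a₁ v (plus (a₁ v) u) x y ≡ addE a u v x y
addE-upd a {u} {v} ne x y with v ≟ u | x ≟ v | x ≟ u
... | yes e | _ | _ = ⊥-elim (ne (sym e))
... | no _ | yes refl | yes e = ⊥-elim (ne (sym e))
... | no _ | yes refl | no _ = refl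
... | no _ | no _ | yes refl with y ≟ v
...   | yes _ = refl
...   | no _ = refl
addE-upd a {u} {v} ne x y | no _ | no _ | no _ with a x y
... | true = refl
... | false = refl

updG-other : ∀ {n} (a : Gr n) {u r v} → v ≢ u → ∀ z → updG a u r v z ≡ a v z
updG-other a {u} {r} {v} ne z rewrite does-false (v ≟ u) ne = refl

updG-same : ∀ {n} (a : Gr n) u {r} z → updG a u r u z ≡ r z
updG-same a u z rewrite does-intro (u ≟ u) refl = refl

size : ∀ {n} → Gr n → ℕ
size {n} a = sumF n (degree a)

degree-minus : ∀ {n} (r : Fin n → Bool) {v} → r v ≡ true → countF n r ≡ suc (countF n (minus r v))
degree-minus {n} r {v} e = trans (sumL-cong (allFin n) pt)
    (trans (sumL-+ (λ z → ind (does (z ≟ v))) (λ z → ind (minus r v z)) (allFin n))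
      (cong (_+ countF n (minus r v)) (count-single (finFinite n) v)))
  where
  pt : ∀ z → ind (r z) ≡ ind (does (z ≟ v)) + ind (minus r v z)
  pt z with z ≟ v
  ... | yes refl rewrite e = refl
  ... | no _ with r z
  ...   | true = refl
  ...   | false = refl

degree-plus : ∀ {n} (r : Fin n → Bool) {v} → r v ≡ false → countF n (plus r v) ≡ suc (countF n r)
degree-plus {n} r {v} e = trans (sumL-cong (allFin n) pt)
    (trans (sumL-+ (λ z → ind (does (z ≟ v))) (λ z → ind (r z)) (allFin n))
      (cong (_+ countF n r) (count-single (finFinite n) v)))
  where
  pt : ∀ z → ind (plus r v z) ≡ ind (does (z ≟ v)) + ind (r z)
  pt z with z ≟ v
  ... | yes refl rewrite e = refl
  ... | no _ with r z
  ...   | true = refl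
  ...   | false = refl

sum-upd : ∀ {n} (f f' : Fin n → ℕ) u → (∀ x → x ≢ u → f x ≡ f' x) → sumF n f' + f u ≡ sumF n f + f' u
sum-upd {n} f f' u h = trans (cong (sumF n f' +_) (sym (single (f u))))
  (trans (sym (sumL-+ f' _ (allFin n)))
  (trans (sumL-cong (allFin n) pt)
  (trans (sumL-+ f _ (allFin n)) (cong (sumF n f +_) (single (f' u))))))
  where
  at : ℕ → Fin n → ℕ
  at c x = if does (x ≟ u) then c else 0
  single : ∀ c → sumF n (at c) ≡ c
  single c = trans (sum-single (finFinite n) (at c) u
      (λ x ne → cong (λ b → if b then c else 0) (does-false (x ≟ u) ne)))
    (cong (λ b → if b then c else 0) (does-intro (u ≟ u) refl))
  pt : ∀ x → f' x + at (f u) x ≡ f x + at (f' u) x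
  pt x with x ≟ u
  ... | yes refl = +-comm (f' x) (f x)
  ... | no ne = cong (_+ 0) (sym (h x ne))

size-updG : ∀ {n} (a : Gr n) u r → size (updG a u r) + degree a u ≡ size a + countF n r
size-updG {n} a u r = trans (sum-upd (degree a) (degree (updG a u r)) u
    (λ x ne → sym (count-cong (finFinite n) (updG-other a ne))))
  (cong (size a +_) (count-cong (finFinite n) (updG-same a u)))

private
  cancel-suc : ∀ {x y d} → x + suc d ≡ y + d → y ≡ suc x
  cancel-suc {x} {y} {d} e = +-cancelʳ-≡ d y (suc x) (trans (sym e) (+-suc x d))

size-delE : ∀ {n} {a : Gr n} {u v} → u ≢ v → a u v ≡ true → a v u ≡ true → size a ≡ 2 + size (delE a u v)
size-delE {n} {a} {u} {v} ne e e' = trans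
    (cancel-suc (trans (cong (size a₁ +_) (sym (degree-minus (a u) e))) (size-updG a u (minus (a u) v))))
    (cong suc (trans (cancel-suc (trans (cong (size b +_) (sym (degree-minus (a₁ v) e₁))) (size-updG a₁ v _)))
      (cong suc (sumL-cong (allFin n) λ x → count-cong (finFinite n) (delE-upd a ne x)))))
  where
  a₁ = updG a u (minus (a u) v)
  b = updG a₁ v (minus (a₁ v) u)
  e₁ : a₁ v u ≡ true
  e₁ = trans (updG-other a (ne ∘ sym) u) e'

size-addE : ∀ {n} {a : Gr n} {u v} → u ≢ v → a u v ≡ false → a v u ≡ false → size (addE a u v) ≡ 2 + size a
size-addE {n} {a} {u} {v} ne e e' = trans
    (sym (sumL-cong (allFin n) λ x → count-cong (finFinite n) (addE-upd a ne x)))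
    (trans (cancel-suc (trans (cong (size a₁ +_) (sym (degree-plus (a₁ v) e₁))) (sym (size-updG a₁ v _))))
      (cong suc (cancel-suc (trans (cong (size a +_) (sym (degree-plus (a u) e))) (sym (size-updG a u _))))))
  where
  a₁ = updG a u (plus (a u) v)
  e₁ : a₁ v u ≡ false
  e₁ = trans (updG-other a (ne ∘ sym) u) e'

addE-path : ∀ {n} {a : Gr n} u v {x y} → Path (addE a u v) x y →
  Path a x y ⊎ (Path a x u × Path a v y) ⊎ (Path a x v × Path a u y)
addE-path u v [] = inj₁ []
addE-path {a = a} u v (_∷_ {x} {z} e p) with ∨-true e | addE-path u v p
... | inj₁ q | inj₁ r = inj₁ (q ∷ r)
... | inj₁ q | inj₂ (inj₁ (r , s)) = inj₂ (inj₁ (q ∷ r , s))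
... | inj₁ q | inj₂ (inj₂ (r , s)) = inj₂ (inj₂ (q ∷ r , s))
... | inj₂ q | ih with isPair-true u v x z q | ih
...   | inj₁ (refl , refl) | inj₁ r = inj₂ (inj₁ ([] , r))
...   | inj₁ (refl , refl) | inj₂ (inj₁ (r , s)) = inj₂ (inj₁ ([] , s))
...   | inj₁ (refl , refl) | inj₂ (inj₂ (r , s)) = inj₁ s
...   | inj₂ (refl , refl) | inj₁ r = inj₂ (inj₂ ([] , r))
...   | inj₂ (refl , refl) | inj₂ (inj₁ (r , s)) = inj₁ s
...   | inj₂ (refl , refl) | inj₂ (inj₂ (r , s)) = inj₂ (inj₂ ([] , s))

comps-addE : ∀ {n} {a : Gr n} {u v} → Symm a → ¬ Path a u v → comps a ≡ suc (comps (addE a u v))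
comps-addE {a = a} {u} {v} s ¬p = comps-join s (addE-symm {a = a} {u} {v} s) (path-mono λ _ _ → ∨-introˡ) ¬p
  (∨-introʳ {a u v} (isPair-introˡ u v) ∷ []) (addE-path u v)

addE-delE : ∀ {n} {a : Gr n} {u v} → Symm a → a u v ≡ true → ∀ x y → addE (delE a u v) u v x y ≡ a x y
addE-delE {a = a} {u} {v} s e x y with isPair u v x y in q
... | false with a x y
...   | true = refl
...   | false = refl
addE-delE {a = a} {u} {v} s e x y | true with a x y in q'
... | true = refl
... | false with isPair-true u v x y q
...   | inj₁ (refl , refl) = ⊥-elim (true≢false e q')
...   | inj₂ (refl , refl) = ⊥-elim (true≢false (s _ _ e) q')

-- Paths through the deleted edge are rerouted along the given one.
comps-delE-connected : ∀ {n} {a : Gr n} {u v} → Symm a → a u v ≡ true →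
  Path (delE a u v) u v → comps (delE a u v) ≤ comps a
comps-delE-connected {a = a} {u} {v} s e p = comps-anti through
  where
  through : ∀ {x y} → Path a x y → Path (delE a u v) x y
  through [] = []
  through (_∷_ {x} {y} q r) with isPair u v x y in eq
  ... | false = delE-intro a u v x y q (λ t → true≢false t eq) ∷ through r
  ... | true with isPair-true u v x y eq
  ...   | inj₁ (refl , refl) = p ++ᴾ through r
  ...   | inj₂ (refl , refl) = path-sym (delE-symm {a = a} {u} {v} s) p ++ᴾ through r

comps-delE : ∀ {n} {a : Gr n} {u v} → Symm a → a u v ≡ true →
  comps (delE a u v) ≤ suc (comps a)
comps-delE {a = a} {u} {v} s e with path? (delE a u v) u v
... | no ¬p = ≤-reflexive (trans (comps-addE (delE-symm {a = a} {u} {v} s) ¬p)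
        (cong (suc ∘ components) (mk-cong (addE-delE s e))))
... | yes p = m≤n⇒m≤1+n (comps-delE-connected s e p)

module _ {n} {a : Gr n} where

  -- Isolated vertices count as faces. When the last dart at `u` goes, the permutation is unchanged
  -- and no cycle splits, but `u` becomes isolated; the sum still grows by one, as in a genuine
  -- split.
  euler : Emb a → ℕ
  euler E = cycles n (face-perm E) + iso a

  private
    D = dartFinite n

  face-adj : Symm a → (E : Emb a) → ∀ k {u v} → a u v ≡ true →
    let (s , t) = iter k (face E) (u , v) in a s t ≡ true
  face-adj s E zero e = e
  face-adj s E (suc k) {u} {v} e with iter k (face E) (u , v) | face-adj s E k {u} {v} e
  ... | (x , y) | ih = row-closed (E y) (s x y ih)

  face-nonadj : Symm a → (E : Emb a) → ∀ k {u v} → a u v ≡ false →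
    let (s , t) = iter k (face E) (u , v) in a s t ≡ false
  face-nonadj s E zero e = e
  face-nonadj s E (suc k) {u} {v} e with iter k (face E) (u , v) | face-nonadj s E k {u} {v} e
  ... | (x , y) | ih = trans (cong (a y) (off (E y) x yx)) yx
    where
    yx : a y x ≡ false
    yx = ≢true λ p → true≢false (s y x p) ih

  nonadj-apart : Symm a → (E : Emb a) → ∀ {u v s t} → a u v ≡ false → a s t ≡ true →
    ¬ Orb (face E) (u , v) (s , t)
  nonadj-apart s E e e' (k , q) = true≢false
    (subst (λ d → a (proj₁ d) (proj₂ d) ≡ true) (sym q) e') (face-nonadj s E k e)

  delHalf : Emb a → ∀ u v → Emb (updG a u (minus (a u) v))
  delHalf E u v = updE E u (delRow (E u) v)

  face-delHalf : (E : Emb a) → ∀ u v d →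
    face (delHalf E u v) d ≡ TD.swap n (u , v) (u , nx (E u) v) (face E d)
  face-delHalf E u v = face-upd E u (delRow (E u) v) λ _ → refl

  iso-minus : ∀ u v → iso a ≤ iso (updG a u (minus (a u) v))
  iso-minus u v = count-mono (finFinite n) go
    where
    go : ∀ z → isolated a z ≡ true → isolated (updG a u (minus (a u) v)) z ≡ true
    go z e = isolated-intro {a = updG a u (minus (a u) v)} {z} row
      where
      row : ∀ t → updG a u (minus (a u) v) z t ≡ false
      row t with z ≟ u
      ... | yes refl rewrite isolated-elim {a = a} e t = refl
      ... | no _ = isolated-elim {a = a} e t

  iso-minus-last : (E : Emb a) → ∀ u v → a u v ≡ true → nx (E u) v ≡ v →
    suc (iso a) ≤ iso (updG a u (minus (a u) v))
  iso-minus-last E u v e fix = subst (_≤ iso a₁)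
      (trans (sumL-+ (λ z → ind (does (z ≟ u))) (λ z → ind (isolated a z)) (allFin n))
        (cong (_+ iso a) (count-single (finFinite n) u)))
      (sumL-mono (allFin n) pt)
    where
    a₁ = updG a u (minus (a u) v)
    empty : ∀ t → a₁ u t ≡ false
    empty t = ≢true λ q → let (p , ne) = minus-true {r = a u} {v} (trans (sym (updG-same a u t)) q)
                          in ne (sym (row-fixed (E u) e p fix))
    pt : ∀ z → ind (does (z ≟ u)) + ind (isolated a z) ≤ ind (isolated a₁ z)
    pt z with decide (z ≟ u)
    ... | inj₁ refl = ≤-reflexive (trans (cong₂ _+_ (cong ind (does-intro (z ≟ z) refl))
            (cong ind (≢true {isolated a z} λ i → true≢false e (isolated-elim {a = a} i v))))
          (sym (cong ind (isolated-intro {a = a₁} {z} empty))))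
    ... | inj₂ ne = ≤-trans (≤-reflexive (cong (λ b → ind b + ind (isolated a z)) (does-false (z ≟ u) ne)))
          (ind-mono {isolated a z} λ q → isolated-intro {a = a₁} {z}
            λ t → trans (updG-other a ne t) (isolated-elim {a = a} q t))

module _ {n} {a : Gr n} (E : Emb a) (u v : Fin n) (e : a u v ≡ true) where

  private
    E₁ = delHalf E u v

  delHalf-split : Orb (face E) (u , v) (u , nx (E u) v) → suc (euler E) ≤ euler E₁
  delHalf-split o with nx (E u) v ≟ v
  ... | yes fix = ≤-trans (≤-reflexive (sym (+-suc (cycles n (face-perm E)) (iso a))))
        (+-mono-≤ (≤-reflexive (cycles-cong n (face-perm E) (face-perm E₁) same))
          (iso-minus-last E u v e fix))
    where
    same : ∀ d → face E d ≡ face E₁ d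
    same d = sym (trans (face-delHalf E u v d)
      (trans (cong (λ w → TD.swap n (u , v) (u , w) (face E d)) fix) (TD.swap-refl n (u , v) (face E d))))
  ... | no ne = +-mono-≤ (≤-reflexive (sym (cycles-split n (face-perm E) (face-perm E₁) (face-delHalf E u v)
          (λ q → ne (sym (,-injectiveʳ q))) o)))
        (iso-minus u v)

  delHalf-merge : ¬ Orb (face E) (u , v) (u , nx (E u) v) → euler E ≤ suc (euler E₁)
  delHalf-merge ¬o = +-mono-≤
    (≤-reflexive (cycles-merge n (face-perm E) (face-perm E₁) (face-delHalf E u v) ¬o))
    (iso-minus u v)

module _ {n g} {a : Gr n} (G : Good g a) (u v : Fin n) (e : a u v ≡ true) where

  private
    E = emb G
    a₁ = updG a u (minus (a u) v)
    E₁ = delHalf E u v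
    E₂ = delHalf E₁ v u

    u≢v : u ≢ v
    u≢v refl = true≢false e (girr G u)

    e₁ : a₁ v u ≡ true
    e₁ = trans (updG-other a (u≢v ∘ sym) u) (gsym G u v e)

    -- After the first half the face runs from `(v , u)` to `(u , v)` and on to the successor of `u`
    -- at `v`. So the two darts exchanged by the second half lie on one cycle, and the second half
    -- always splits.
    second : suc (euler E₁) ≤ euler E₂
    second = delHalf-split E₁ v u e₁ (orb-trans
        (1 , trans (face-delHalf E u v (v , u)) (TD.swapʳ n (u , v) (u , nx (E u) v)))
        orb-step)

    iso-del : iso (updG a₁ v (minus (a₁ v) u)) ≡ iso (delE a u v)
    iso-del = sumL-cong (allFin n) λ x → cong (λ d → ind (d ≡ᵇ 0)) (count-cong (finFinite n) (delE-upd a u≢v x))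

    same-face : Orb (face E) (u , v) (v , u) → 2 + euler E ≤ euler E₂
    same-face o = ≤-trans (s≤s (delHalf-split E u v e (orb-trans o orb-step))) second

    other-face : ¬ Orb (face E) (u , v) (v , u) → euler E ≤ euler E₂
    other-face ¬o = ≤-pred (≤-trans (s≤s (delHalf-merge E u v e λ o → ¬o
      (orb-trans o (orb-sym (dartFinite n) (face-perm E) orb-step)))) (s≤s second))

    -- The face on one side of uv that does not contain the other side is a closed walk
    -- through uv exactly once, so its remainder joins v to u.
    around : ¬ Orb (face E) (u , v) (v , u) → Path (delE a u v) v u
    around ¬o with period (dartFinite n) (face-perm E) (u , v)
    ... | suc t , _ , _ , q = case walk t of λ where
            (inj₁ p) → p
            (inj₂ p) → subst (Path (delE a u v) v) (cong proj₁ q) p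
      where
      advance : ∀ k {x y} → iter k (face E) (u , v) ≡ (x , y) → a x y ≡ true → Path (delE a u v) v x →
        Path (delE a u v) v u ⊎ Path (delE a u v) v y
      advance k {x} {y} q xy p with isPair u v x y in r
      ... | false = inj₂ (p ++ᴾ (delE-intro a u v x y xy (λ s → true≢false s r) ∷ []))
      ... | true with isPair-true u v x y r
      ...   | inj₁ (refl , _) = inj₁ p
      ...   | inj₂ (refl , refl) = ⊥-elim (¬o (k , q))
      walk : ∀ k → Path (delE a u v) v u ⊎ Path (delE a u v) v (proj₁ (iter (suc k) (face E) (u , v)))
      walk zero = inj₂ []
      walk (suc k) with walk k
      ... | inj₁ p = inj₁ p
      ... | inj₂ p = advance (suc k) refl (face-adj (gsym G) E (suc k) {u} {v} e) p

    shift : ∀ n c i g → 2 + (n + c + i + 2 * g) ≡ n + (2 + (c + i)) + 2 * g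
    shift = solve-∀

    two : ∀ c h → 2 * suc c + h ≡ 2 + (2 * c + h)
    two = solve-∀

    after : n + euler E₂ + 2 * g ≡ n + cycles n (face-perm E₂) + iso (delE a u v) + 2 * g
    after = cong (_+ 2 * g) (trans (cong (λ i → n + (cycles n (face-perm E₂) + i)) iso-del) (sym (+-assoc n _ _)))

    bound : Orb (face E) (u , v) (v , u) ⊎ ¬ Orb (face E) (u , v) (v , u) →
      2 * comps (delE a u v) + halfDarts n ≤ n + euler E₂ + 2 * g
    bound (inj₂ ¬o) = ≤-trans (+-monoˡ-≤ (halfDarts n) (*-monoʳ-≤ 2 (comps-delE-connected (gsym G) e
              (path-sym (delE-symm {a = a} {u} {v} (gsym G)) (around ¬o)))))
            (≤-trans (genus G) (+-monoˡ-≤ (2 * g)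
              (≤-trans (≤-reflexive (+-assoc n _ _)) (+-monoʳ-≤ n (other-face ¬o)))))
    bound (inj₁ o) = ≤-trans (+-monoˡ-≤ (halfDarts n) (*-monoʳ-≤ 2 (comps-delE (gsym G) e)))
            (≤-trans (≤-reflexive (two (comps a) (halfDarts n)))
            (≤-trans (s≤s (s≤s (genus G)))
            (≤-trans (≤-reflexive (shift n _ _ g)) (+-monoˡ-≤ (2 * g) (+-monoʳ-≤ n (same-face o))))))

    genus-del : 2 * comps (delE a u v) + halfDarts n ≤ n + cycles n (face-perm E₂) + iso (delE a u v) + 2 * g
    genus-del = ≤-trans (bound (decide (orb? (dartFinite n) (face-perm E) (u , v) (v , u)))) (≤-reflexive after)

  -- If both sides of the edge lie on one face, both halves split a cycle, and this gain of two pays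
  -- for at most one new component. Otherwise a merge and a split cancel, and the rest of the face
  -- on one side is a detour, so no component is added.
  delete : Good g (delE a u v)
  delete = record
    { gsym = delE-symm {a = a} {u} {v} (gsym G)
    ; girr = λ x → ≢true λ q → true≢false (delE-sub {a = a} {u} {v} x x q) (girr G x)
    ; emb = emb-cong (delE-upd a u≢v) E₂
    ; genus = genus-del }

  delete-nx-other : ∀ t z → t ≢ u → t ≢ v → nx (emb delete t) z ≡ nx (emb G t) z
  delete-nx-other t z tu tv = trans (upd-other {a = a₁} E₁ (delRow (E₁ v) u) z tv)
    (upd-other {a = a} E (delRow (E u) v) z tu)

  delete-nxˡ : ∀ z → nx (emb delete u) z ≡ TF.swap n v (nx (emb G u) v) (nx (emb G u) z)
  delete-nxˡ z = trans (upd-other {a = a₁} E₁ (delRow (E₁ v) u) z u≢v) (upd-same {a = a} E u (delRow (E u) v) z)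

  delete-nxʳ : ∀ z → nx (emb delete v) z ≡ TF.swap n u (nx (emb G v) u) (nx (emb G v) z)
  delete-nxʳ z = trans (upd-same {a = a₁} E₁ v (delRow (E₁ v) u) z)
    (cong₂ (λ x y → TF.swap n u x y) (old u) (old z))
    where
    old : ∀ t → nx (E₁ v) t ≡ nx (E v) t
    old t = upd-other {a = a} E (delRow (E u) v) t (u≢v ∘ sym)

row-closed-inv : ∀ {n} {r : Fin n → Bool} (ρ : Row r) {z} → r z ≡ true → r (inv (perm ρ) z) ≡ true
row-closed-inv {r = r} ρ {z} e with r (inv (perm ρ) z) in q
... | true = refl
... | false = ⊥-elim (true≢false (subst (λ x → r x ≡ true)
        (trans (sym (invʳ (perm ρ) z)) (off ρ _ q)) e) q)

module _ {n} {a : Gr n} (E : Emb a) (u v t : Fin n) (uv : a u v ≡ false) (ut : a u t ≡ true) where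

  insHalf : Emb (updG a u (plus (a u) v))
  insHalf = updE E u (insRow (E u) v t uv ut)

  face-insHalf : ∀ d → face insHalf d ≡ TD.swap n (u , v) (u , nx (E u) t) (face E d)
  face-insHalf = face-upd E u (insRow (E u) v t uv ut) λ _ → refl

addE-irr : ∀ {n} {a : Gr n} {u v} → u ≢ v → Irr a → Irr (addE a u v)
addE-irr {a = a} {u} {v} ne irr x = ≢true λ q → case ∨-true q of λ where
  (inj₁ p) → true≢false p (irr x)
  (inj₂ p) → case isPair-true u v x x p of λ where
    (inj₁ (r , s)) → ne (trans (sym r) s)
    (inj₂ (r , s)) → ne (trans (sym s) r)

module _ {n g} {a : Gr n} (G : Good g a) (v x y : Fin n) (vx : a v x ≡ true) (vy : a v y ≡ true)
         (cons : nx (emb G v) x ≡ y) (x≢y : x ≢ y) (xy : a x y ≡ false) where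

  private
    E = emb G
    yx : a y x ≡ false
    yx = ≢true λ q → true≢false (gsym G y x q) xy
    yv : a y v ≡ true
    yv = gsym G v y vy
    xv : a x v ≡ true
    xv = gsym G v x vx
    y≢v : y ≢ v
    y≢v refl = true≢false vy (girr G y)

    a₁ = updG a y (plus (a y) x)
    E₁ = insHalf E y x v yx yv
    prev = inv (perm (E₁ x)) v

    other₁ : ∀ z → a₁ x z ≡ a x z
    other₁ = updG-other a x≢y
    x₁y : a₁ x y ≡ false
    x₁y = trans (other₁ y) xy
    x₁p : a₁ x prev ≡ true
    x₁p = row-closed-inv (E₁ x) (trans (other₁ v) xv)
    E₂ = insHalf E₁ x y prev x₁y x₁p

    first : cycles n (face-perm E) ≡ suc (cycles n (face-perm E₁))
    first = cycles-merge n (face-perm E) (face-perm E₁) (face-insHalf E y x v yx yv)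
      (nonadj-apart (gsym G) E yx (row-closed (E y) yv))

    triangle : Orb (face E₁) (x , v) (x , y)
    triangle = 3 , trans (cong (face E₁) (trans (cong (face E₁) step₁) step₂)) step₃
      where
      step₁ : face E₁ (x , v) ≡ (v , y)
      step₁ = cong (v ,_) (trans (upd-other {a = a} E (insRow (E y) x v yx yv) x (y≢v ∘ sym)) cons)
      step₂ : face E₁ (v , y) ≡ (y , x)
      step₂ = trans (face-insHalf E y x v yx yv (v , y)) (TD.swapʳ n (y , x) (y , nx (E y) v))
      step₃ : face E₁ (y , x) ≡ (x , y)
      step₃ = cong (x ,_) (off (E₁ x) y x₁y)

    second : cycles n (face-perm E₂) ≡ suc (cycles n (face-perm E₁))
    second = cycles-split n (face-perm E₁) (face-perm E₂) (face-insHalf E₁ x y prev x₁y x₁p)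
      (λ q → y≢v (trans (,-injectiveʳ q) back))
      (subst (λ w → Orb (face E₁) (x , y) (x , w)) (sym back) (orb-sym (dartFinite n) (face-perm E₁) triangle))
      where
      back : nx (E₁ x) prev ≡ v
      back = invʳ (perm (E₁ x)) v

    iso-le : iso a ≤ iso (addE a y x)
    iso-le = count-mono (finFinite n) λ z e → isolated-intro {a = addE a y x} {z} λ t → ≢true λ q →
      case ∨-true q of λ where
        (inj₁ p) → true≢false p (isolated-elim {a = a} e t)
        (inj₂ p) → case isPair-true y x z t p of λ where
          (inj₁ (refl , _)) → true≢false yv (isolated-elim {a = a} e v)
          (inj₂ (refl , _)) → true≢false xv (isolated-elim {a = a} e v)

    genus-ins : 2 * comps (addE a y x) + halfDarts n ≤ n + cycles n (face-perm E₂) + iso (addE a y x) + 2 * g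
    genus-ins = ≤-trans (+-monoˡ-≤ (halfDarts n) (*-monoʳ-≤ 2 (comps-anti {a = a} {addE a y x} (path-mono λ _ _ → ∨-introˡ))))
      (≤-trans (genus G) (+-monoˡ-≤ (2 * g) (+-mono-≤ (+-monoʳ-≤ n (≤-reflexive (trans first (sym second)))) iso-le)))

  -- The non-adjacent `x` and `y` form a trivial cycle of two darts. The first half merges it into
  -- the face passing the corner at `v`, the second splits off the triangle `x`, `v`, `y`, which
  -- restores the number of cycles.
  corner : Good g (addE a y x)
  corner = record
    { gsym = addE-symm {a = a} {y} {x} (gsym G)
    ; girr = addE-irr {a = a} (x≢y ∘ sym) (girr G)
    ; emb = emb-cong (addE-upd a (x≢y ∘ sym)) E₂
    ; genus = genus-ins }

  corner-nx : ∀ t z → t ≢ x → t ≢ y → nx (emb corner t) z ≡ nx (emb G t) z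
  corner-nx t z tx ty = trans (upd-other {a = a₁} E₁ (insRow (E₁ x) y prev x₁y x₁p) z tx)
    (upd-other {a = a} E (insRow (E y) x v yx yv) z ty)

module _ {n g} {a : Gr n} (G : Good g a) (v w t : Fin n) (vt : a v t ≡ true)
         (v≢w : v ≢ w) (wi : ∀ z → a w z ≡ false) where

  private
    E = emb G
    vw : a v w ≡ false
    vw = ≢true λ q → true≢false (gsym G v w q) (wi v)
    a₁ = updG a v (plus (a v) w)
    E₁ = insHalf E v w t vw vt
    wi₁ : ∀ z → a₁ w z ≡ false
    wi₁ z = trans (updG-other a (v≢w ∘ sym) z) (wi z)
    E₂ = updE E₁ w (soloRow (E₁ w) v wi₁)

    first : cycles n (face-perm E) ≡ suc (cycles n (face-perm E₁))
    first = cycles-merge n (face-perm E) (face-perm E₁) (face-insHalf E v w t vw vt)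
      (nonadj-apart (gsym G) E vw (row-closed (E v) vt))

    second : cycles n (face-perm E₁) ≡ cycles n (face-perm E₂)
    second = cycles-cong n (face-perm E₁) (face-perm E₂) λ d → sym (trans
      (face-upd E₁ w {v} {v} (soloRow (E₁ w) v wi₁) (λ z → sym (TF.swap-refl n v _)) d)
      (TD.swap-refl n (w , v) (face E₁ d)))

    iso-le : iso a ≤ suc (iso (addE a v w))
    iso-le = subst (iso a ≤_)
      (trans (sumL-+ (λ z → ind (does (z ≟ w))) (λ z → ind (isolated (addE a v w) z)) (allFin n))
        (cong (_+ iso (addE a v w)) (count-single (finFinite n) w)))
      (sumL-mono (allFin n) pt)
      where
      pt : ∀ z → ind (isolated a z) ≤ ind (does (z ≟ w)) + ind (isolated (addE a v w) z)
      pt z with decide (z ≟ w)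
      ... | inj₁ e = ≤-trans (ind-mono {isolated a z} λ _ → does-intro (z ≟ w) e) (m≤m+n _ _)
      ... | inj₂ ne = ≤-trans (ind-mono {isolated a z} λ i → isolated-intro {a = addE a v w} {z} λ s → ≢true λ q →
            case ∨-true q of λ where
              (inj₁ p) → true≢false p (isolated-elim {a = a} i s)
              (inj₂ p) → case isPair-true v w z s p of λ where
                (inj₁ (refl , _)) → true≢false vt (isolated-elim {a = a} i t)
                (inj₂ (e , _)) → ne e)
            (m≤n+m _ (ind (does (z ≟ w))))

    from-w : ∀ {z} → Path a w z → w ≡ z
    from-w [] = refl
    from-w (e ∷ _) = ⊥-elim (true≢false e (wi _))

    genus-pend : 2 * comps (addE a v w) + halfDarts n ≤ n + cycles n (face-perm E₂) + iso (addE a v w) + 2 * g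
    genus-pend = +-cancelˡ-≤ 2 _ _ (≤-trans (≤-reflexive (two (comps (addE a v w)) (halfDarts n)))
      (≤-trans (subst (λ c → 2 * c + halfDarts n ≤ n + cycles n (face-perm E) + iso a + 2 * g)
          (comps-addE (gsym G) λ p → v≢w (sym (from-w (path-sym (gsym G) p)))) (genus G))
      (≤-trans (+-monoˡ-≤ (2 * g) (+-mono-≤ (≤-reflexive (cong (n +_) (trans first (cong suc second)))) iso-le))
        (≤-reflexive (shift n (cycles n (face-perm E₂)) (iso (addE a v w)) g)))))
      where
      two : ∀ c h → 2 + (2 * c + h) ≡ 2 * suc c + h
      two = solve-∀
      shift : ∀ n c i g → n + suc c + suc i + 2 * g ≡ 2 + (n + c + i + 2 * g)
      shift = solve-∀

  -- One cycle and one isolated vertex are lost. This balances the component that disappears, since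
  -- components count twice.
  pendant : Good g (addE a v w)
  pendant = record
    { gsym = addE-symm {a = a} {v} {w} (gsym G)
    ; girr = addE-irr {a = a} v≢w (girr G)
    ; emb = emb-cong (addE-upd a v≢w) E₂
    ; genus = genus-pend }

  pendant-nx : ∀ z → nx (emb pendant v) z ≡ TF.swap n w (nx (emb G v) t) (nx (emb G v) z)
  pendant-nx z = trans (upd-other {a = a₁} E₁ (soloRow (E₁ w) v wi₁) z v≢w)
    (upd-same {a = a} E v (insRow (E v) w t vw vt) z)

-- Agreement of embeddings with the Boolean definitions

isSimple-sound : ∀ {n} (A : Adj n) → isSimple A ≡ true → Irr (adj A) × Symm (adj A)
isSimple-sound {n} A e = (λ i → not-true (proj₁ (row i)))
  , λ i j p → trans (sym (eqB-true (allF-true n (proj₂ (row i)) j))) p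
  where
  row : ∀ i → _
  row i = ∧-true (allF-true n e i)
  eqB-true : ∀ {x y} → eqB x y ≡ true → x ≡ y
  eqB-true {true} {true} _ = refl
  eqB-true {false} {false} _ = refl

isSimple-complete : ∀ {n} (A : Adj n) → Irr (adj A) → Symm (adj A) → isSimple A ≡ true
isSimple-complete {n} A irr s = allF-intro n λ i → ∧-intro (not-intro λ e → true≢false e (irr i))
  (allF-intro n λ j → eqB-intro (bool-ext (s i j) (s j i)))
  where
  eqB-intro : ∀ {x y} → x ≡ y → eqB x y ≡ true
  eqB-intro {true} refl = refl
  eqB-intro {false} refl = refl

edgeCount : ∀ {n} → Gr n → ℕ
edgeCount {n} a = sumF n (λ i → countF n (λ j → (toℕ i <ᵇ toℕ j) ∧ a i j))

size-edges : ∀ {n} {a : Gr n} → Irr a → Symm a → size a ≡ 2 * edgeCount a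
size-edges {n} {a} irr s = trans (sumL-cong (allFin n) λ i →
      trans (sumL-cong (allFin n) (pt i)) (sumL-+ (λ j → up i j) (λ j → up j i) (allFin n)))
    (trans (sumL-+ _ _ (allFin n))
      (trans (cong (edgeCount a +_) (sumL-swap (λ i j → up j i) (allFin n) (allFin n)))
        (cong (edgeCount a +_) (sym (+-identityʳ _)))))
  where
  up : Fin n → Fin n → ℕ
  up i j = ind ((toℕ i <ᵇ toℕ j) ∧ a i j)
  below : ∀ {i j} → toℕ i < toℕ j → ind (a i j) ≡ up i j + up j i
  below {i} {j} lt rewrite <ᵇ-intro lt | ≢true {toℕ j <ᵇ toℕ i} (λ e → <-asym lt (<ᵇ-true e)) = sym (+-identityʳ _)
  pt : ∀ i j → ind (a i j) ≡ up i j + up j i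
  pt i j with <-cmp (toℕ i) (toℕ j)
  ... | tri< lt _ _ = below lt
  ... | tri≈ _ e _ with toℕ-injective e
  ...   | refl rewrite irr i | ≢true {toℕ i <ᵇ toℕ i} (λ q → <-irrefl refl (<ᵇ-true {toℕ i} {toℕ i} q)) = refl
  pt i j | tri> _ _ gt = trans (cong ind (bool-ext (s i j) (s j i))) (trans (below gt) (+-comm (up j i) (up i j)))

module _ {n} {a : Gr n} (E : Emb a) where

  faceRep : Dart n → Bool
  faceRep = DC.repᵇ n (orb-equiv (dartFinite n) (face-perm E)) (orb? (dartFinite n) (face-perm E))

  faceRep-reps : DC.Reps n (Orb (face E)) faceRep
  faceRep-reps = DC.repᵇ-reps n (orb-equiv (dartFinite n) (face-perm E)) (orb? (dartFinite n) (face-perm E))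

  adjFaces : ℕ
  adjFaces = count (dartFinite n) λ (u , v) → faceRep (u , v) ∧ a u v

  private
    lexicographic : ∀ {i j : Fin n} → toℕ j < toℕ i → dartCode (j , i) < dartCode (i , j)
    lexicographic {i} {j} lt = ≤-trans (+-monoʳ-< (toℕ j * n) (toℕ<n i))
      (≤-trans (≤-trans (≤-reflexive (+-comm (toℕ j * n) n)) (*-monoˡ-≤ n lt)) (m≤m+n _ (toℕ j)))

  -- The identity holds dart by dart. On an edge, `i < j` and `i ≤ j` mean the same; off the edges
  -- `face` exchanges `(i , j)` and `(j , i)`, and the one of smaller code is the one with `i ≤ j`.
  cycles+edges : Irr a → Symm a → cycles n (face-perm E) + edgeCount a ≡ adjFaces + halfDarts n
  cycles+edges irr s = trans (cong (cycles n (face-perm E) +_) (sym (sumDarts n λ (i , j) → ind ((toℕ i <ᵇ toℕ j) ∧ a i j))))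
    (trans (sym (sumL-+ _ _ ds)) (trans (sumL-cong ds pt) (sumL-+ _ _ ds)))
    where
    ds = elems (dartFinite n)
    two-cycle : ∀ {i j} → a i j ≡ false → ∀ k → iter k (face E) (i , j) ≡ (i , j) ⊎ iter k (face E) (i , j) ≡ (j , i)
    two-cycle ij zero = inj₁ refl
    two-cycle {i} {j} ij (suc k) with two-cycle ij k
    ... | inj₁ e = inj₂ (trans (cong (face E) e) (cong (j ,_) (off (E j) i (≢true λ q → true≢false (s j i q) ij))))
    ... | inj₂ e = inj₁ (trans (cong (face E) e) (cong (i ,_) (off (E i) j ij)))
    nonadj : ∀ i j → a i j ≡ false → faceRep (i , j) ≡ (toℕ i ≤ᵇ toℕ j)
    nonadj i j ij = bool-ext
      (λ e → ≤ᵇ-intro {toℕ i} {toℕ j} (≮⇒≥ λ lt → proj₁ faceRep-reps (i , j) e (j , i) (lexicographic lt)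
        (1 , cong (i ,_) (off (E i) j ij))))
      (λ e → proj₂ faceRep-reps (i , j) λ y lt o →
        case orb-sym (dartFinite n) (face-perm E) o of λ (k , q) → case two-cycle ij k of λ where
          (inj₁ r) → <-irrefl (cong dartCode (trans (sym q) r)) lt
          (inj₂ r) → later (≤ᵇ-true {toℕ i} {toℕ j} e) (subst (λ z → dartCode z < dartCode (i , j)) (trans (sym q) r) lt))
      where
      later : toℕ i ≤ toℕ j → ¬ (dartCode (j , i) < dartCode (i , j))
      later le lt with m≤n⇒m<n∨m≡n le
      ... | inj₁ i<j = <-asym (lexicographic i<j) lt
      ... | inj₂ e with toℕ-injective e
      ...   | refl = <-irrefl refl lt
    pt : ∀ d → ind (faceRep d) + ind ((toℕ (proj₁ d) <ᵇ toℕ (proj₂ d)) ∧ a (proj₁ d) (proj₂ d))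
             ≡ ind (faceRep d ∧ a (proj₁ d) (proj₂ d)) + ind (toℕ (proj₁ d) ≤ᵇ toℕ (proj₂ d))
    pt (i , j) with a i j in eq
    ... | false = go (nonadj i j eq)
      where
      go : ∀ {x y z} → x ≡ y → ind x + ind (z ∧ false) ≡ ind (x ∧ false) + ind y
      go {false} {z = false} refl = refl
      go {false} {z = true} refl = refl
      go {true} {z = false} refl = refl
      go {true} {z = true} refl = refl
    ... | true = go (bool-ext (λ q → ≤ᵇ-intro {toℕ i} {toℕ j} (<⇒≤ (<ᵇ-true {toℕ i} {toℕ j} q))) (λ q → <ᵇ-intro (≤∧≢⇒< (≤ᵇ-true {toℕ i} {toℕ j} q) i≢j)))
      where
      i≢j : toℕ i ≢ toℕ j
      i≢j e with toℕ-injective e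
      ... | refl = true≢false eq (irr i)
      go : ∀ {x y z} → z ≡ y → ind x + ind (z ∧ true) ≡ ind (x ∧ true) + ind y
      go {x} {false} refl = cong (_+ 0) (cong ind (∧-r x))
        where
        ∧-r : ∀ x → x ≡ x ∧ true
        ∧-r true = refl
        ∧-r false = refl
      go {false} {true} refl = refl
      go {true} {true} refl = refl

  face-period : Irr a → Symm a → ∀ {u v} → a u v ≡ true →
    ∃[ t ] (0 < t × t ≤ 2 * edgeCount a × iter t (face E) (u , v) ≡ (u , v))
  face-period irr s {u} {v} e with period-within (dartFinite n) (face-perm E) (λ d → a (proj₁ d) (proj₂ d)) (u , v)
                                     (λ k → face-adj s E k {u} {v} e)
  ... | t , pos , le , q = t , pos , ≤-trans le (≤-reflexive (trans (sumDarts n λ d → ind (a (proj₁ d) (proj₂ d)))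
          (size-edges irr s))) , q

∈-allVecsOf : ∀ {A : Set} {xs : List A} → (∀ x → x ∈ xs) → ∀ {k} (v : Vec A k) → v ∈ allVecsOf xs k
∈-allVecsOf c [] = here refl
∈-allVecsOf {xs = xs} c (x ∷ v) = ∈-concatMap _ xs (c x) (∈-map⁺ (x ∷_) (∈-allVecsOf c v))

unique-allVecsOf : ∀ {A : Set} {xs : List A} → Unique xs → ∀ k → Unique (allVecsOf xs k)
unique-allVecsOf u zero = [] ∷ []
unique-allVecsOf {xs = xs} u (suc k) = unique-products _∷_ xs (allVecsOf xs k) u (unique-allVecsOf u k)
  λ { refl → refl , refl }

euler-shift : ∀ {c h n z i g e f} → z + e ≡ f + h → 2 * c + e ≤ n + (f + i) + 2 * g → 2 * c + h ≤ n + z + i + 2 * g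
euler-shift {c} {h} {n} {z} {i} {g} {e} {f} eq le = +-cancelʳ-≤ e _ _ (≤-trans (≤-reflexive (l1 c h e))
  (≤-trans (+-monoˡ-≤ h le) (≤-reflexive (trans (l2 n f i g h) (trans (cong (λ x → x + (n + i + 2 * g)) (sym eq)) (l3 n z e i g))))))
  where
  l1 : ∀ c h e → 2 * c + h + e ≡ 2 * c + e + h
  l1 = solve-∀
  l2 : ∀ n f i g h → n + (f + i) + 2 * g + h ≡ (f + h) + (n + i + 2 * g)
  l2 = solve-∀
  l3 : ∀ n z e i g → (z + e) + (n + i + 2 * g) ≡ n + z + i + 2 * g + e
  l3 = solve-∀

euler-unshift : ∀ {c h n z i g e f} → z + e ≡ f + h → 2 * c + h ≤ n + z + i + 2 * g → 2 * c + e ≤ n + (f + i) + 2 * g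
euler-unshift {c} {h} {n} {z} {i} {g} {e} {f} eq le = +-cancelʳ-≤ h _ _ (≤-trans (≤-reflexive (l1 c h e))
  (≤-trans (+-monoˡ-≤ e le) (≤-reflexive (trans (l2 n z i g e) (trans (cong (λ x → x + (n + i + 2 * g)) eq) (l3 n f h i g))))))
  where
  l1 : ∀ c h e → 2 * c + e + h ≡ 2 * c + h + e
  l1 = solve-∀
  l2 : ∀ n z i g e → n + z + i + 2 * g + e ≡ (z + e) + (n + i + 2 * g)
  l2 = solve-∀
  l3 : ∀ n f h i g → (f + h) + (n + i + 2 * g) ≡ n + (f + i) + 2 * g + h
  l3 = solve-∀

module FromRotation {n} (A : Adj n) (irr : Irr (adj A)) (s : Symm (adj A)) (R : Rot n) (valid : validRot A R ≡ true) where

  private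
    a = adj A

    module _ (v : Fin n) where
      d = deg A v
      f = rot R v

      valid-at : ∀ {u} → a v u ≡ true →
        ((∀ k → k < d → a v (iter k f u) ≡ true) × (∀ k → k < d → ∀ k' → k' < k → iter k f u ≢ iter k' f u))
        × iter d f u ≡ u
      valid-at {u} e with ∨-true (allF-true n (allF-true n valid v) u)
      ... | inj₁ q = ⊥-elim (true≢false e (not-true q))
      ... | inj₂ q with ∧-true q
      ...   | q₁ , q₂ = ((λ k lt → proj₁ (∧-true (allN-true d q₁ k lt)))
                , λ k lt k' lt' eq → true≢false (eqF-intro eq)
                    (not-true (allN-true k (proj₂ (∧-true (allN-true d q₁ k lt))) k' lt')))
              , eqF-true q₂

      d-pos : ∀ {u} → a v u ≡ true → 0 < d
      d-pos {u} e = subst (_≤ d) (cong ind e) (sumL-∈ {f = λ x → ind (a v x)} (allFin n) (∈-allFin u))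

      adj-iter : ∀ {u} → a v u ≡ true → ∀ k → k ≤ d → a v (iter k f u) ≡ true
      adj-iter {u} e k le with m≤n⇒m<n∨m≡n le
      ... | inj₁ lt = proj₁ (proj₁ (valid-at e)) k lt
      ... | inj₂ refl = trans (cong (a v) (proj₂ (valid-at e))) e

      -- A rotation has arbitrary values at non-neighbours; they are replaced by the identity to
      -- obtain a permutation.
      step : (k : ℕ) → Fin n → Fin n
      step k u = if a v u then iter k f u else u

      step-adj : ∀ {u} k → a v u ≡ true → step k u ≡ iter k f u
      step-adj {u} k e = cong (λ b → if b then iter k f u else u) e

      step-off : ∀ {u} k → a v u ≡ false → step k u ≡ u
      step-off {u} k e = cong (λ b → if b then iter k f u else u) e

      -- One step is undone by `d ∸ 1` steps. The guard `0 < d` takes care of the truncated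
      -- subtraction; it holds as soon as there is a neighbour.
      round : ∀ k l {u} → (0 < d → k + l ≡ d) → step k (step l u) ≡ u
      round k l {u} eq with a v u in e
      ... | false = step-off k e
      ... | true = trans (step-adj k (adj-iter e l (≤-trans (m≤n+m l k) (≤-reflexive (eq (d-pos e))))))
              (trans (sym (iter-+ f k l u)) (trans (cong (λ j → iter j f u) (eq (d-pos e))) (proj₂ (valid-at e))))

      row-perm : Perm (step 1)
      row-perm = record { inv = step (d ∸ 1) ; invˡ = λ u → round (d ∸ 1) 1 m∸n+n≡m ; invʳ = λ u → round 1 (d ∸ 1) m+[n∸m]≡n }

      iter-step : ∀ {u} → a v u ≡ true → ∀ k → k ≤ d → iter k (step 1) u ≡ iter k f u
      iter-step e zero le = refl
      iter-step {u} e (suc k) le = trans (cong (step 1) (iter-step e k (<⇒≤ le)))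
        (step-adj 1 (adj-iter e k (<⇒≤ le)))

      row-cyc : ∀ {z z'} → a v z ≡ true → a v z' ≡ true → Orb (step 1) z z'
      row-cyc {z} {z'} e e' with anyN? (λ k → iter k f z ≟ z') d
      ... | yes (k , lt , q) = k , trans (iter-step e k (<⇒≤ lt)) q
      ... | no ¬q = ⊥-elim (1+n≰n (count-inj (finFinite n) (a v) g g-adj g-inj))
        where
        g : Fin (suc d) → Fin n
        g zero = z'
        g (suc i) = iter (toℕ i) f z
        g-adj : ∀ i → a v (g i) ≡ true
        g-adj zero = e'
        g-adj (suc i) = adj-iter e (toℕ i) (<⇒≤ (toℕ<n i))
        g-inj : ∀ i j → g i ≡ g j → i ≡ j
        g-inj zero zero _ = refl
        g-inj zero (suc j) q = ⊥-elim (¬q (toℕ j , toℕ<n j , sym q))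
        g-inj (suc i) zero q = ⊥-elim (¬q (toℕ i , toℕ<n i , q))
        g-inj (suc i) (suc j) q with <-cmp (toℕ i) (toℕ j)
        ... | tri< lt _ _ = ⊥-elim (proj₂ (proj₁ (valid-at e)) (toℕ j) (toℕ<n j) (toℕ i) lt (sym q))
        ... | tri≈ _ r _ = cong suc (toℕ-injective r)
        ... | tri> _ _ gt = ⊥-elim (proj₂ (proj₁ (valid-at e)) (toℕ i) (toℕ<n i) (toℕ j) gt q)

  rotEmb : Emb a
  rotEmb v = record { nx = step v 1 ; perm = row-perm v ; off = λ z e → step-off v 1 e ; cyc = row-cyc v }

  private
    face-iter : ∀ k {u v} → a u v ≡ true → iter k (facePerm R) (u , v) ≡ iter k (face rotEmb) (u , v)
    face-iter zero e = refl
    face-iter (suc k) {u} {v} e = trans (cong (facePerm R) (face-iter k e))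
      (sym (cong (proj₂ (iter k (face rotEmb) (u , v)) ,_)
        (step-adj _ 1 (s _ _ (face-adj s rotEmb k {u} {v} e)))))

  -- `faces` compares codes along `2 * edges A` iterates only. The period of a face made of darts
  -- along edges is at most that number, so the test sees the whole face.
  faces-le : faces A R ≤ adjFaces rotEmb + iso a
  faces-le = +-monoˡ-≤ (iso a) (≤-trans (≤-reflexive (sym (sumDarts n (λ (u , v) → ind (a u v
      ∧ allN (2 * edges A) (λ k → dartCode (u , v) ≤ᵇ dartCode (iter k (facePerm R) (u , v))))))))
    (count-mono (dartFinite n) λ (u , v) q → least u v (∧-true q)))
    where
    least : ∀ u v → _ × _ → faceRep rotEmb (u , v) ∧ a u v ≡ true
    least u v (e , al) = ∧-intro (proj₂ (faceRep-reps rotEmb) (u , v) λ y lt o → below y lt (orb-sym (dartFinite n) (face-perm rotEmb) o)) e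
      where
      below : ∀ y → dartCode y < dartCode (u , v) → ¬ Orb (face rotEmb) (u , v) y
      below y lt o with face-period rotEmb irr s e
      ... | t , pos , le , q with orb-bounded (dartFinite n) (face-perm rotEmb) pos q o
      ...   | r , r<t , q' = <⇒≱ lt (subst (λ z → dartCode (u , v) ≤ dartCode z)
                (trans (face-iter r e) q') (≤ᵇ-true (allN-true (2 * edges A) al r (<-≤-trans r<t le))))

good-from : ∀ {n} g (A : Adj n) → isSimple A ≡ true → genusAtMost g A ≡ true → Good g (adj A)
good-from {n} g A simple ge with isSimple-sound A simple | anyL-true (allRot n) ge
... | irr , s | R , q with ∧-true q
... | valid , gen = record { gsym = s ; girr = irr ; emb = rotEmb ; genus =
        euler-shift {comps (adj A)} {n = n} {i = iso (adj A)} {g = g} (cycles+edges rotEmb irr s)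
          (≤-trans (subst (λ B → 2 * components B + edges A ≤ n + faces A R + 2 * g) (sym (mk-adj A)) (≤ᵇ-true gen))
            (+-monoˡ-≤ (2 * g) (+-monoʳ-≤ n faces-le))) }
  where
  open FromRotation A irr s R valid

row-cycle : ∀ {n} {r : Fin n → Bool} (ρ : Row r) {u} → r u ≡ true →
  (∀ t → 0 < t → t < countF n r → iter t (nx ρ) u ≢ u) × iter (countF n r) (nx ρ) u ≡ u
row-cycle {n} {r} ρ {u} e = short , full
  where
  short : ∀ t → 0 < t → t < countF n r → iter t (nx ρ) u ≢ u
  short t pos lt q = <⇒≱ lt (count-cover (finFinite n) r (λ (i : Fin t) → iter (toℕ i) (nx ρ) u) λ x rx →
    let (k , k<t , q') = orb-bounded (finFinite n) (perm ρ) pos q (cyc ρ e rx)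
    in fromℕ< k<t , trans (cong (λ j → iter j (nx ρ) u) (toℕ-fromℕ< k<t)) q')
  stays : ∀ k → r (iter k (nx ρ) u) ≡ true
  stays zero = e
  stays (suc k) = row-closed ρ (stays k)
  full : iter (countF n r) (nx ρ) u ≡ u
  full with period-within (finFinite n) (perm ρ) r u stays
  ... | t , pos , le , q with m≤n⇒m<n∨m≡n le
  ...   | inj₁ lt = ⊥-elim (short t pos lt q)
  ...   | inj₂ refl = q

module ToRotation {n} g (A : Adj n) (G : Good g (adj A)) where

  private
    a = adj A
    E = emb G

    R : Rot n
    R = tabulate λ v → tabulate λ u → nx (E v) u

    rot-R : ∀ v u → rot R v u ≡ nx (E v) u
    rot-R v u = trans (cong (λ w → lookup w u) (lookup∘tabulate _ v)) (lookup∘tabulate _ u)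

    iter-R : ∀ v k u → iter k (rot R v) u ≡ iter k (nx (E v)) u
    iter-R v = iter-cong (rot-R v)

    stays : ∀ v {u} → a v u ≡ true → ∀ k → a v (iter k (nx (E v)) u) ≡ true
    stays v e zero = e
    stays v e (suc k) = row-closed (E v) (stays v e k)

    distinct : ∀ v {u} → a v u ≡ true → ∀ k → k < deg A v → ∀ k' → k' < k → iter k (rot R v) u ≢ iter k' (rot R v) u
    distinct v {u} e k lt k' lt' q = proj₁ (row-cycle (E v) e) (k ∸ k') (m<n⇒0<n∸m lt') (≤-<-trans (m∸n≤m k k') lt)
      (iter-inj (perm (E v)) k' (trans (sym (iter-+ _ k' (k ∸ k') u))
        (trans (cong (λ j → iter j (nx (E v)) u) (m+[n∸m]≡n (<⇒≤ lt')))
          (trans (sym (iter-R v k u)) (trans q (iter-R v k' u))))))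

    implies : ∀ {x y} → (x ≡ true → y ≡ true) → not x ∨ y ≡ true
    implies {true} h = h refl
    implies {false} h = refl

    valid : validRot A R ≡ true
    valid = allF-intro n λ v → allF-intro n λ u → implies {adj A v u} λ e → ∧-intro
      (allN-intro (deg A v) λ k lt → ∧-intro (trans (cong (a v) (iter-R v k u)) (stays v e k))
        (allN-intro k λ k' lt' → not-intro λ q → distinct v e k lt k' lt' (eqF-true q)))
      (eqF-intro (trans (iter-R v (deg A v) u) (proj₂ (row-cycle (E v) e))))

    faces-ge : adjFaces E + iso a ≤ faces A R
    faces-ge = +-monoˡ-≤ (iso a) (≤-trans (count-mono (dartFinite n) {q = λ (u , v) → a u v
          ∧ allN (2 * edges A) (λ k → dartCode (u , v) ≤ᵇ dartCode (iter k (facePerm R) (u , v)))}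
        λ (u , v) q → let (rp , e) = ∧-true q in ∧-intro e (allN-intro (2 * edges A) λ k _ → ≤ᵇ-intro (≮⇒≥ λ lt →
          proj₁ (faceRep-reps E) (u , v) rp _ lt (orb-sym (dartFinite n) (face-perm E)
            (k , sym (iter-cong (λ (x , y) → cong (y ,_) (rot-R y x)) k (u , v)))))))
      (≤-reflexive (sumDarts n _)))

  genus-true : genusAtMost g A ≡ true
  genus-true = anyL-intro (allRot n) (∈-allVecsOf (∈-allVecsOf ∈-allFin) R) (∧-intro valid (≤ᵇ-intro
    (≤-trans (subst (λ B → 2 * components B + edges A ≤ n + (adjFaces E + iso a) + 2 * g) (mk-adj A)
      (euler-unshift {comps a} {n = n} {i = iso a} {g = g} (cycles+edges E (girr G) (gsym G)) (genus G)))
      (+-monoˡ-≤ (2 * g) (+-monoʳ-≤ n faces-ge)))))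

good-mk : ∀ {n g} {a : Gr n} → Good g a → isSimple (mk a) ≡ true × genusAtMost g (mk a) ≡ true
good-mk {n} {g} {a} G = isSimple-complete (mk a) (girr G′) (gsym G′) , ToRotation.genus-true g (mk a) G′
  where
  G′ : Good g (adj (mk a))
  G′ = good-cong (λ i j → sym (adj-mk a i j)) G

-- Contraction and splitting

Iff : Set → Set → Set
Iff P Q = (P → Q) × (Q → P)

common : ∀ {n} → Gr n → Fin n → Fin n → ℕ
common {n} a w x = countF n λ z → a w z ∧ a x z

-- The vertex `w` remains as an isolated vertex: the vertex set is fixed, and the freed label is
-- used again when the rotation at the high vertex is divided.
Contracted : ∀ {n} → Gr n → Fin n → Fin n → Fin n → Fin n → Set
Contracted a w x i j = i ≢ w × j ≢ w ×
  (a i j ≡ true ⊎ (i ≡ x × a w j ≡ true × j ≢ x) ⊎ (j ≡ x × a w i ≡ true × i ≢ x))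

irr≢ : ∀ {n} {a : Gr n} → Irr a → ∀ {u v} → a u v ≡ true → u ≢ v
irr≢ irr e refl = true≢false e (irr _)

-- Among the neighbours of `w`, `x` is not a neighbour of `x`.
common<degree : ∀ {n} {a : Gr n} → Irr a → ∀ {w x} → a w x ≡ true → common a w x < degree a w
common<degree {n} {a} irr {w} {x} wx = ≤-trans (s≤s (count-mono (finFinite n) λ z e → let (p , q) = ∧-true e in
    ∧-intro p (not-intro λ r → irr≢ {a = a} irr q (sym (does-true (z ≟ x) r)))))
  (≤-reflexive (sym (degree-minus (a w) wx)))

-- Contract the edge wx by sliding the edges at w along it, one rotation step at a time.
contract : ∀ {n g} d {a : Gr n} → Good g a → ∀ w x → a w x ≡ true → degree a w ≡ d →
  Σ[ b ∈ Gr n ] (Good g b × (∀ i j → Iff (b i j ≡ true) (Contracted a w x i j))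
                × size a ≡ size b + 2 * suc (common a w x))
contract {n} zero {a} G w x wx eq = ⊥-elim (<⇒≱ (subst (1 ≤_) eq (subst (_≤ degree a w) (cong ind wx)
  (sumL-∈ {f = λ z → ind (a w z)} (allFin n) (∈-allFin x)))) z≤n)
contract {n} {g} (suc d) {a} G w x wx eq with decide (nx (emb G w) x ≟ x)
... | inj₁ fix = delE a w x , delete G w x wx , spec , size-eq
  where
  only : ∀ {t} → a w t ≡ true → t ≡ x
  only e = sym (row-fixed (emb G w) wx e fix)
  w≢x = irr≢ {a = a} (girr G) wx
  spec : ∀ i j → Iff (delE a w x i j ≡ true) (Contracted a w x i j)
  spec i j = (λ e → let (p , q) = delE-true a w x i j e in
      (λ { refl → q (subst (λ t → isPair w x w t ≡ true) (sym (only p)) (isPair-introˡ w x)) })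
    , (λ { refl → q (subst (λ t → isPair w x t w ≡ true) (sym (only (gsym G _ _ p))) (isPair-introʳ w x)) })
    , inj₁ p)
    , λ where
        (iw , jw , inj₁ p) → delE-intro a w x i j p λ q → case isPair-true w x i j q of λ where
          (inj₁ (r , _)) → iw r
          (inj₂ (_ , r)) → jw r
        (iw , jw , inj₂ (inj₁ (_ , p , ne))) → ⊥-elim (ne (only p))
        (iw , jw , inj₂ (inj₂ (_ , p , ne))) → ⊥-elim (ne (only p))
  none : common a w x ≡ 0
  none = trans (count-cong (finFinite n) {q = λ _ → false} λ t → ≢true λ e → let (p , q) = ∧-true e in
    true≢false (subst (λ t → a x t ≡ true) (only p) q) (girr G x)) (sumL-0 (allFin n))
  size-eq : size a ≡ size (delE a w x) + 2 * suc (common a w x)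
  size-eq rewrite none = trans (size-delE w≢x wx (gsym G w x wx)) (+-comm 2 (size (delE a w x)))
... | inj₂ z≢x = by-adjacency (a x z) refl
  where
  z = nx (emb G w) x
  wz : a w z ≡ true
  wz = row-closed (emb G w) wx
  w≢x = irr≢ {a = a} (girr G) wx
  w≢z = irr≢ {a = a} (girr G) wz
  off-pair : ∀ {i j} → i ≢ w → j ≢ w → ¬ (isPair w z i j ≡ true)
  off-pair iw jw q = case isPair-true w z _ _ q of λ where
    (inj₁ (r , _)) → iw r
    (inj₂ (_ , r)) → jw r
  Result : Set
  Result = Σ[ b ∈ Gr n ] (Good g b × (∀ i j → Iff (b i j ≡ true) (Contracted a w x i j))
                × size a ≡ size b + 2 * suc (common a w x))
  by-adjacency : ∀ y → a x z ≡ y → Result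
  -- The successor `z` of `x` is a common neighbour. Sliding its edge to `x` would double an edge,
  -- so it is deleted and counted as a loss.
  by-adjacency true xz with contract d (delete G w z wz) w x
      (delE-intro a w z w x wx λ q → case isPair-true w z w x q of λ where
        (inj₁ (_ , r)) → z≢x (sym r)
        (inj₂ (r , _)) → w≢z r)
      (suc-injective (trans (trans (cong suc (count-cong (finFinite n) row)) (sym (degree-minus (a w) wz))) eq))
    where
    row : ∀ t → delE a w z w t ≡ minus (a w) z t
    row t = bool-ext
      (λ e → let (p , q) = delE-true a w z w t e in ∧-intro p (not-intro λ r → q
        (subst (λ s → isPair w z w s ≡ true) (sym (does-true (t ≟ z) r)) (isPair-introˡ w z))))
      (λ e → let (p , q) = minus-true {r = a w} e in delE-intro a w z w t p λ r → case isPair-true w z w t r of λ where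
        (inj₁ (_ , s)) → q s
        (inj₂ (s , _)) → w≢z s)
  ... | b , B , spec , sz = b , B , (λ i j → to ∘ proj₁ (spec i j) , proj₂ (spec i j) ∘ from)
      , trans (size-delE w≢z wz (gsym G w z wz)) (trans (cong (2 +_) sz) (trans (lem (size b) _)
          (cong (λ c → size b + 2 * suc c) (sym common-eq))))
    where
    to : ∀ {i j} → Contracted (delE a w z) w x i j → Contracted a w x i j
    to (iw , jw , inj₁ p) = iw , jw , inj₁ (delE-sub {a = a} {w} {z} _ _ p)
    to (iw , jw , inj₂ (inj₁ (e , p , ne))) = iw , jw , inj₂ (inj₁ (e , delE-sub {a = a} {w} {z} _ _ p , ne))
    to (iw , jw , inj₂ (inj₂ (e , p , ne))) = iw , jw , inj₂ (inj₂ (e , delE-sub {a = a} {w} {z} _ _ p , ne))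
    keep : ∀ {j} → j ≢ w → a w j ≡ true → j ≢ z → delE a w z w j ≡ true
    keep jw p jz = delE-intro a w z w _ p λ q → case isPair-true w z w _ q of λ where
      (inj₁ (_ , r)) → jz r
      (inj₂ (r , _)) → w≢z r
    from : ∀ {i j} → Contracted a w x i j → Contracted (delE a w z) w x i j
    from (iw , jw , inj₁ p) = iw , jw , inj₁ (delE-intro a w z _ _ p (off-pair iw jw))
    from {i} {j} (iw , jw , inj₂ (inj₁ (refl , p , ne))) with decide (j ≟ z)
    ... | inj₁ e = iw , jw , inj₁ (delE-intro a w z _ _ (subst (λ t → a x t ≡ true) (sym e) xz) (off-pair iw jw))
    ... | inj₂ jz = iw , jw , inj₂ (inj₁ (refl , keep jw p jz , ne))
    from {i} {j} (iw , jw , inj₂ (inj₂ (refl , p , ne))) with decide (i ≟ z)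
    ... | inj₁ e = iw , jw , inj₁ (delE-intro a w z _ _ (gsym G _ _ (subst (λ t → a x t ≡ true) (sym e) xz)) (off-pair iw jw))
    ... | inj₂ iz = iw , jw , inj₂ (inj₂ (refl , keep iw p iz , ne))
    lem : ∀ s c → 2 + (s + 2 * suc c) ≡ s + 2 * suc (suc c)
    lem = solve-∀
    common-eq : common a w x ≡ suc (common (delE a w z) w x)
    common-eq = trans (degree-minus (λ t → a w t ∧ a x t) (∧-intro wz xz))
      (cong suc (count-cong (finFinite n) λ t → bool-ext
        (λ e → let (p , ne) = minus-true {r = λ t → a w t ∧ a x t} e ; (p₁ , p₂) = ∧-true p in
          ∧-intro (keep (λ { refl → true≢false p₁ (girr G w) }) p₁ ne)
            (delE-intro a w z x t p₂ (off-pair {x} {t} (w≢x ∘ sym) λ { refl → true≢false p₁ (girr G w) })))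
        (λ e → let (p₁ , p₂) = ∧-true e ; (q , np) = delE-true a w z w t p₁ in
          ∧-intro (∧-intro q (delE-sub {a = a} {w} {z} _ _ p₂)) (not-intro λ r → np
            (subst (λ s → isPair w z w s ≡ true) (sym (does-true (t ≟ z) r)) (isPair-introˡ w z))))))
  -- Otherwise the edge from `z` slides from `w` to `x` through the corner at `w`, without loss.
  by-adjacency false xz with contract d (delete C w z wz′) w x wx′
      (suc-injective (trans (trans (cong suc (count-cong (finFinite n) row)) (sym (degree-minus (a w) wz))) eq))
    where
    C = corner G w x z wx wz refl (z≢x ∘ sym) xz
    a′ = addE a z x
    wz′ : a′ w z ≡ true
    wz′ = ∨-introˡ wz
    wx′ : delE a′ w z w x ≡ true
    wx′ = delE-intro a′ w z w x (∨-introˡ wx) λ q → case isPair-true w z w x q of λ where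
      (inj₁ (_ , r)) → z≢x (sym r)
      (inj₂ (r , _)) → w≢z r
    row : ∀ t → delE a′ w z w t ≡ minus (a w) z t
    row t = bool-ext
      (λ e → let (p , q) = delE-true a′ w z w t e in ∧-intro
        (case ∨-true p of λ where
          (inj₁ p') → p'
          (inj₂ p') → case isPair-true z x w t p' of λ where
            (inj₁ (r , _)) → ⊥-elim (w≢z r)
            (inj₂ (r , _)) → ⊥-elim (w≢x r))
        (not-intro λ r → q (subst (λ s → isPair w z w s ≡ true) (sym (does-true (t ≟ z) r)) (isPair-introˡ w z))))
      (λ e → let (p , q) = minus-true {r = a w} e in delE-intro a′ w z w t (∨-introˡ p) λ r → case isPair-true w z w t r of λ where
        (inj₁ (_ , s)) → q s
        (inj₂ (s , _)) → w≢z s)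
  ... | b , B , spec , sz = b , B , (λ i j → to ∘ proj₁ (spec i j) , proj₂ (spec i j) ∘ from)
      , trans (suc-injective (suc-injective (trans (sym (size-addE z≢x zx xz))
          (size-delE w≢z (∨-introˡ wz) (∨-introˡ (gsym G w z wz))))))
        (trans sz (cong (λ c → size b + 2 * suc c) (sym common-eq)))
    where
    a′ = addE a z x
    a₁ = delE a′ w z
    zx : a z x ≡ false
    zx = ≢true λ q → true≢false (gsym G z x q) xz
    old : ∀ {j} → a₁ w j ≡ true → a w j ≡ true × j ≢ z
    old {j} e with delE-true a′ w z w j e
    ... | p , np with ∨-true p
    ...   | inj₁ p' = p' , λ { refl → np (isPair-introˡ w z) }
    ...   | inj₂ p' with isPair-true z x w j p'
    ...     | inj₁ (r , _) = ⊥-elim (w≢z r)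
    ...     | inj₂ (r , _) = ⊥-elim (w≢x r)
    to : ∀ {i j} → Contracted a₁ w x i j → Contracted a w x i j
    to {i} {j} (iw , jw , inj₁ p) with ∨-true (delE-sub {a = a′} {w} {z} _ _ p)
    ... | inj₁ q = iw , jw , inj₁ q
    ... | inj₂ q with isPair-true z x i j q
    ...   | inj₁ (refl , refl) = iw , jw , inj₂ (inj₂ (refl , wz , z≢x))
    ...   | inj₂ (refl , refl) = iw , jw , inj₂ (inj₁ (refl , wz , z≢x))
    to (iw , jw , inj₂ (inj₁ (e , p , ne))) = iw , jw , inj₂ (inj₁ (e , proj₁ (old p) , ne))
    to (iw , jw , inj₂ (inj₂ (e , p , ne))) = iw , jw , inj₂ (inj₂ (e , proj₁ (old p) , ne))
    keep : ∀ {j} → j ≢ w → a w j ≡ true → j ≢ z → a₁ w j ≡ true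
    keep jw p jz = delE-intro a′ w z w _ (∨-introˡ p) λ q → case isPair-true w z w _ q of λ where
      (inj₁ (_ , r)) → jz r
      (inj₂ (r , _)) → w≢z r
    from : ∀ {i j} → Contracted a w x i j → Contracted a₁ w x i j
    from (iw , jw , inj₁ p) = iw , jw , inj₁ (delE-intro a′ w z _ _ (∨-introˡ p) (off-pair iw jw))
    from {i} {j} (iw , jw , inj₂ (inj₁ (refl , p , ne))) with decide (j ≟ z)
    ... | inj₁ e = iw , jw , inj₁ (delE-intro a′ w z _ _ (∨-introʳ {a x j} (subst (λ t → isPair z x x t ≡ true) (sym e) (isPair-introʳ z x))) (off-pair iw jw))
    ... | inj₂ jz = iw , jw , inj₂ (inj₁ (refl , keep jw p jz , ne))
    from {i} {j} (iw , jw , inj₂ (inj₂ (refl , p , ne))) with decide (i ≟ z)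
    ... | inj₁ e = iw , jw , inj₁ (delE-intro a′ w z _ _ (∨-introʳ {a i x} (subst (λ t → isPair z x t x ≡ true) (sym e) (isPair-introˡ z x))) (off-pair iw jw))
    ... | inj₂ iz = iw , jw , inj₂ (inj₂ (refl , keep iw p iz , ne))
    common-eq : common a w x ≡ common a₁ w x
    common-eq = count-cong (finFinite n) λ t → bool-ext
      (λ e → let (p₁ , p₂) = ∧-true e ; t≢w = λ { refl → true≢false p₁ (girr G w) } in
        ∧-intro (keep t≢w p₁ λ { refl → true≢false p₂ xz })
          (delE-intro a′ w z x t (∨-introˡ p₂) (off-pair {x} {t} (w≢x ∘ sym) t≢w)))
      (λ e → let (p₁ , p₂) = ∧-true e ; (q , tz) = old p₁ in ∧-intro q
        (case ∨-true (delE-sub {a = a′} {w} {z} _ _ p₂) of λ where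
          (inj₁ r) → r
          (inj₂ r) → case isPair-true z x x t r of λ where
            (inj₁ (s , _)) → ⊥-elim (z≢x (sym s))
            (inj₂ (_ , s)) → ⊥-elim (tz s)))

-- Splitting a vertex off along an interval of a rotation

Chained : {X : Set} → (X → X) → List X → Set
Chained f [] = ⊤
Chained f (x ∷ []) = ⊤
Chained f (x ∷ y ∷ zs) = f x ≡ y × Chained f (y ∷ zs)

chained-cong : ∀ {X : Set} {f f' : X → X} xs → (∀ t → t ∈ xs → f t ∈ xs → f' t ≡ f t) → Chained f xs → Chained f' xs
chained-cong [] h c = tt
chained-cong (x ∷ []) h c = tt
chained-cong (x ∷ y ∷ zs) h (e , c) = trans (h x (here refl) (there (here e))) e
  , chained-cong (y ∷ zs) (λ t m m' → h t (there m) (there m')) c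

chained-tail : ∀ {X : Set} {f : X → X} x xs → Chained f (x ∷ xs) → Chained f xs
chained-tail x [] c = tt
chained-tail x (y ∷ xs) (_ , c) = c

fresh : ∀ {X : Set} {x y : X} {xs} → Unique (x ∷ xs) → y ∈ xs → x ≢ y
fresh (ne ∷ _ ∷ u) (here refl) = ne-head ne
  where
  ne-head : _ → _
  ne-head (p ∷ _) = p
fresh ((_ ∷ a) ∷ _ ∷ u) (there m) = fresh (a ∷ u) m

fresh-tail : ∀ {X : Set} {x : X} {xs} → Unique (x ∷ xs) → Unique xs
fresh-tail (_ ∷ u) = u

unique-skip : ∀ {X : Set} {x y : X} {xs} → Unique (x ∷ y ∷ xs) → Unique (x ∷ xs)
unique-skip ((_ ∷ p) ∷ _ ∷ q) = p ∷ q

-- The part of an interval that loses its edges to `v`; the flag spares the last vertex.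
dropped : {X : Set} → Bool → List X → List X
dropped f [] = []
dropped f (z ∷ []) = if f then [] else z ∷ []
dropped f (z ∷ zs@(_ ∷ _)) = z ∷ dropped f zs

dropped-⊆ : ∀ {X : Set} f (xs : List X) {t} → t ∈ dropped f xs → t ∈ xs
dropped-⊆ true (x ∷ []) ()
dropped-⊆ false (x ∷ []) m = m
dropped-⊆ f (x ∷ y ∷ xs) (here r) = here r
dropped-⊆ f (x ∷ y ∷ xs) (there m) = there (dropped-⊆ f (y ∷ xs) m)

Touching : ∀ {n} → Fin n → List (Fin n) → Fin n → Fin n → Set
Touching v zs i j = (i ≡ v × j ∈ zs) ⊎ (j ≡ v × i ∈ zs)

Moved : ∀ {n} → Gr n → (v w : Fin n) (zs dr : List (Fin n)) → Fin n → Fin n → Set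
Moved a v w zs dr i j = Touching w zs i j ⊎ (a i j ≡ true × ¬ Touching v dr i j)

module _ {n : ℕ} where

  Unmoved : (f f' : Fin n → Fin n) (w : Fin n) (zs : List (Fin n)) → Set
  Unmoved f f' w zs = ∀ t → t ∉ zs → t ≢ w → f t ∉ zs → f t ≢ w → f' t ≡ f t

  record Step {g} {a : Gr n} (G : Good g a) (v w z : Fin n) (drop : Bool) : Set where
    field
      {result} : Gr n
      good   : Good g result
      spec   : ∀ i j → Iff (result i j ≡ true) (Moved a v w (z ∷ []) (if drop then z ∷ [] else []) i j)
      nx-w   : nx (emb good v) w ≡ (if drop then nx (emb G v) z else nx (emb G v) w)
      nx-t   : ∀ t → nx (emb G v) t ≢ z → t ≢ z → nx (emb good v) t ≡ nx (emb G v) t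
      sizes  : size result + (if drop then 2 else 0) ≡ 2 + size a

  open Step

  -- Since `w` directly precedes `z` in the rotation at `v`, the edge `w z` fits into that corner.
  -- Deleting `v z` afterwards puts `w` before the old successor of `z`, ready for the next vertex.
  step : ∀ {g} {a : Gr n} (G : Good g a) v w z → v ≢ w → w ≢ z → a v w ≡ true → a v z ≡ true → a w z ≡ false →
    nx (emb G v) w ≡ z → ∀ drop → Step G v w z drop
  step {g} {a} G v w z v≢w w≢z vw vz wz cons false = record
    { good = corner G v w z vw vz cons w≢z wz
    ; spec = λ i j → (λ e → case ∨-true e of λ where
          (inj₁ p) → inj₂ (p , λ { (inj₁ (_ , ())) ; (inj₂ (_ , ())) })
          (inj₂ p) → case isPair-true z w i j p of λ where
            (inj₁ (r , s)) → inj₁ (inj₂ (s , here r))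
            (inj₂ (r , s)) → inj₁ (inj₁ (r , here s)))
        , λ where
            (inj₁ (inj₁ (refl , here refl))) → ∨-introʳ {a i j} (isPair-introʳ z w)
            (inj₁ (inj₂ (refl , here refl))) → ∨-introʳ {a i j} (isPair-introˡ z w)
            (inj₂ (p , _)) → ∨-introˡ p
    ; nx-w = corner-nx G v w z vw vz cons w≢z wz v w v≢w v≢z
    ; nx-t = λ t _ _ → corner-nx G v w z vw vz cons w≢z wz v t v≢w v≢z
    ; sizes = trans (+-identityʳ _) (size-addE (w≢z ∘ sym) (≢true λ q → true≢false (gsym G z w q) wz) wz) }
    where
    v≢z = irr≢ {a = a} (girr G) vz
  step {g} {a} G v w z v≢w w≢z vw vz wz cons true = record
    { good = delete C v z vz′
    ; spec = λ i j → (λ e → let (p , np) = delE-true a′ v z i j e in case ∨-true p of λ where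
          (inj₁ q) → inj₂ (q , λ { (inj₁ (refl , here refl)) → np (isPair-introˡ v z)
                                 ; (inj₂ (refl , here refl)) → np (isPair-introʳ v z) })
          (inj₂ q) → case isPair-true z w i j q of λ where
            (inj₁ (r , s)) → inj₁ (inj₂ (s , here r))
            (inj₂ (r , s)) → inj₁ (inj₁ (r , here s)))
        , λ where
            (inj₁ (inj₁ (refl , here refl))) → delE-intro a′ v z w z (∨-introʳ {a w z} (isPair-introʳ z w))
              λ q → case isPair-true v z w z q of λ { (inj₁ (r , _)) → v≢w (sym r) ; (inj₂ (r , _)) → w≢z r }
            (inj₁ (inj₂ (refl , here refl))) → delE-intro a′ v z z w (∨-introʳ {a z w} (isPair-introˡ z w))
              λ q → case isPair-true v z z w q of λ { (inj₁ (_ , r)) → w≢z r ; (inj₂ (_ , r)) → v≢w (sym r) }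
            (inj₂ (p , np)) → delE-intro a′ v z i j (∨-introˡ p) λ q → case isPair-true v z i j q of λ where
              (inj₁ (r , s)) → np (inj₁ (r , here s))
              (inj₂ (r , s)) → np (inj₂ (s , here r))
    ; nx-w = trans (row w) (trans (cong (TF.swap n z _) cons) (TF.swapˡ n z _))
    ; nx-t = λ t tz t≢z → trans (row t) (TF.swap-other n tz λ e → t≢z (f-inj (perm (emb G v)) e))
    ; sizes = trans (+-comm (size (delE a′ v z)) 2) (trans (sym (size-delE v≢z vz′ (gsym C v z vz′)))
        (size-addE (w≢z ∘ sym) (≢true λ q → true≢false (gsym G z w q) wz) wz)) }
    where
    v≢z = irr≢ {a = a} (girr G) vz
    C = corner G v w z vw vz cons w≢z wz
    a′ = addE a z w
    vz′ : a′ v z ≡ true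
    vz′ = ∨-introˡ vz
    row : ∀ t → nx (emb (delete C v z vz′) v) t ≡ TF.swap n z (nx (emb G v) z) (nx (emb G v) t)
    row t = trans (delete-nxˡ C v z vz′ t) (cong₂ (TF.swap n z)
      (corner-nx G v w z vw vz cons w≢z wz v z v≢w v≢z) (corner-nx G v w z vw vz cons w≢z wz v t v≢w v≢z))

  moved-∷ : ∀ {a b : Gr n} {v w z zs dr} drop → v ≢ w → v ≢ z →
    (∀ i j → Iff (b i j ≡ true) (Moved a v w (z ∷ []) (if drop then z ∷ [] else []) i j)) →
    ∀ i j → Iff (Moved b v w zs dr i j) (Moved a v w (z ∷ zs) ((if drop then z ∷ [] else []) ++ dr) i j)
  moved-∷ {a} {b} {v} {w} {z} {zs} {dr} drop v≢w v≢z spec i j = to , from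
    where
    dz = if drop then z ∷ [] else []
    w-touch : ∀ {dr} i j → Touching w (z ∷ []) i j → ¬ Touching v dr i j
    w-touch i j (inj₁ (refl , here refl)) (inj₁ (r , _)) = v≢w (sym r)
    w-touch i j (inj₁ (refl , here refl)) (inj₂ (r , _)) = v≢z (sym r)
    w-touch i j (inj₂ (refl , here refl)) (inj₁ (r , _)) = v≢z (sym r)
    w-touch i j (inj₂ (refl , here refl)) (inj₂ (r , _)) = v≢w (sym r)
    to : Moved b v w zs dr i j → Moved a v w (z ∷ zs) (dz ++ dr) i j
    to (inj₁ (inj₁ (r , m))) = inj₁ (inj₁ (r , there m))
    to (inj₁ (inj₂ (r , m))) = inj₁ (inj₂ (r , there m))
    to (inj₂ (e , nt)) with proj₁ (spec i j) e
    ... | inj₁ (inj₁ (r , here s)) = inj₁ (inj₁ (r , here s))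
    ... | inj₁ (inj₂ (r , here s)) = inj₁ (inj₂ (r , here s))
    ... | inj₂ (p , nt') = inj₂ (p , λ where
            (inj₁ (r , m)) → case ∈-++⁻ dz m of λ { (inj₁ q) → nt' (inj₁ (r , q)) ; (inj₂ q) → nt (inj₁ (r , q)) }
            (inj₂ (r , m)) → case ∈-++⁻ dz m of λ { (inj₁ q) → nt' (inj₂ (r , q)) ; (inj₂ q) → nt (inj₂ (r , q)) })
    from : Moved a v w (z ∷ zs) (dz ++ dr) i j → Moved b v w zs dr i j
    from (inj₁ (inj₁ (r , there m))) = inj₁ (inj₁ (r , m))
    from (inj₁ (inj₂ (r , there m))) = inj₁ (inj₂ (r , m))
    from (inj₁ (inj₁ (r , here s))) = inj₂ (proj₂ (spec i j) (inj₁ (inj₁ (r , here s)))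
      , w-touch i j (inj₁ (r , here s)))
    from (inj₁ (inj₂ (r , here s))) = inj₂ (proj₂ (spec i j) (inj₁ (inj₂ (r , here s)))
      , w-touch i j (inj₂ (r , here s)))
    from (inj₂ (p , nt)) = inj₂ (proj₂ (spec i j) (inj₂ (p , λ where
        (inj₁ (r , m)) → nt (inj₁ (r , ∈-++⁺ˡ m))
        (inj₂ (r , m)) → nt (inj₂ (r , ∈-++⁺ˡ m))))
      , λ where
        (inj₁ (r , m)) → nt (inj₁ (r , ∈-++⁺ʳ dz m))
        (inj₂ (r , m)) → nt (inj₂ (r , ∈-++⁺ʳ dz m)))

  record Absorbed {g} {a : Gr n} (G : Good g a) (v w : Fin n) (zs : List (Fin n)) (keep : Bool) : Set where
    field
      {result′} : Gr n
      good′  : Good g result′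
      spec′  : ∀ i j → Iff (result′ i j ≡ true) (Moved a v w zs (dropped keep zs) i j)
      unmoved : Unmoved (nx (emb G v)) (nx (emb good′ v)) w zs
      sizes′ : size result′ ≡ size a + (if keep then 2 else 0)

  open Absorbed

  -- Each absorbed vertex trades its edge to `v` for one to `w`, so the number of edges grows only
  -- if the last vertex keeps both.
  absorb : ∀ keep z zs {g} {a : Gr n} (G : Good g a) v w → v ≢ w → a v w ≡ true →
    Chained (nx (emb G v)) (w ∷ z ∷ zs) → Unique (w ∷ z ∷ zs) →
    (∀ t → t ∈ z ∷ zs → a v t ≡ true × a w t ≡ false) → Absorbed G v w (z ∷ zs) keep
  absorb true z [] {a = a} G v w v≢w vw (c , _) u h = record
    { good′ = good S ; spec′ = spec S
    ; unmoved = λ t t∉ _ ft∉ _ → nx-t S t (λ e → ft∉ (here e)) (λ e → t∉ (here e))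
    ; sizes′ = trans (sym (+-identityʳ _)) (trans (sizes S) (+-comm 2 (size a))) }
    where
    S = step G v w z v≢w (fresh u (here refl)) vw (proj₁ (h z (here refl))) (proj₂ (h z (here refl))) c false
  absorb false z [] {a = a} G v w v≢w vw (c , _) u h = record
    { good′ = good S ; spec′ = spec S
    ; unmoved = λ t t∉ _ ft∉ _ → nx-t S t (λ e → ft∉ (here e)) (λ e → t∉ (here e))
    ; sizes′ = trans (+-cancelʳ-≡ 2 _ _ (trans (sizes S) (+-comm 2 (size a)))) (sym (+-identityʳ (size a))) }
    where
    S = step G v w z v≢w (fresh u (here refl)) vw (proj₁ (h z (here refl))) (proj₂ (h z (here refl))) c true
  absorb keep z (z' ∷ zs) {a = a} G v w v≢w vw (c , c' , cs) u h = record
    { good′ = good′ A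
    ; spec′ = λ i j → proj₁ (moved i j) ∘ proj₁ (spec′ A i j) , proj₂ (spec′ A i j) ∘ proj₂ (moved i j)
    ; unmoved = λ t t∉ tw ft∉ ftw → let e = nx-t S t (λ e → ft∉ (here e)) (λ e → t∉ (here e)) in
        trans (unmoved A t (t∉ ∘ there) tw (λ m → ft∉ (there (subst (_∈ z' ∷ zs) e m))) (ftw ∘ trans (sym e))) e
    ; sizes′ = trans (sizes′ A) (cong (_+ (if keep then 2 else 0))
        (+-cancelʳ-≡ 2 _ _ (trans (sizes S) (+-comm 2 (size a))))) }
    where
    w≢z = fresh u (here refl)
    vz = proj₁ (h z (here refl))
    v≢z = irr≢ {a = a} (girr G) vz
    S = step G v w z v≢w w≢z vw vz (proj₂ (h z (here refl))) c true
    b = result S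
    z∉ : ∀ {t} → t ∈ z' ∷ zs → z ≢ t
    z∉ = fresh (fresh-tail u)
    chain : Chained (nx (emb (good S) v)) (w ∷ z' ∷ zs)
    chain = trans (nx-w S) c' , chained-cong (z' ∷ zs) (λ t m m' →
      nx-t S t (λ e → z∉ m' (sym e)) (λ e → z∉ m (sym e))) cs
    uniq : Unique (w ∷ z' ∷ zs)
    uniq = unique-skip u
    vw′ : b v w ≡ true
    vw′ = proj₂ (spec S v w) (inj₂ (vw , λ where
      (inj₁ (_ , here r)) → w≢z r
      (inj₂ (r , _)) → v≢w (sym r)))
    props : ∀ t → t ∈ z' ∷ zs → b v t ≡ true × b w t ≡ false
    props t m = proj₂ (spec S v t) (inj₂ (proj₁ (h t (there m)) , λ where
          (inj₁ (_ , here r)) → z∉ m (sym r)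
          (inj₂ (_ , here r)) → v≢z r))
      , ≢true λ e → case proj₁ (spec S w t) e of λ where
          (inj₁ (inj₁ (_ , here r))) → z∉ m (sym r)
          (inj₁ (inj₂ (_ , here r))) → w≢z r
          (inj₂ (p , _)) → true≢false p (proj₂ (h t (there m)))
    A = absorb keep z' zs (good S) v w v≢w vw′ chain uniq props
    moved = moved-∷ {a} {b} {v} {w} {z} {z' ∷ zs} {dropped keep (z' ∷ zs)} true v≢w v≢z (spec S)

SplitOff : ∀ {n} → Gr n → (v w : Fin n) (zs dr : List (Fin n)) → Bool → Fin n → Fin n → Set
SplitOff a v w zs dr β i j =
  (i ≡ w × (j ∈ zs ⊎ (β ≡ true × j ≡ v))) ⊎
  (j ≡ w × (i ∈ zs ⊎ (β ≡ true × i ≡ v))) ⊎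
  (a i j ≡ true × ¬ Touching v dr i j)

optional : {X : Set} → Bool → X → List X
optional true x = []
optional false x = x ∷ []

∉-optional : ∀ {X : Set} b {x y : X} → x ≢ y → y ∉ optional b x
∉-optional false ne (here r) = ne (sym r)

module _ {n g} {a : Gr n} (G : Good g a) (v w z₁ z₂ : Fin n) (zs : List (Fin n)) (v≢w : v ≢ w)
         (wi : ∀ z → a w z ≡ false) (chain : Chained (nx (emb G v)) (z₁ ∷ z₂ ∷ zs))
         (uniq : Unique (z₁ ∷ z₂ ∷ zs)) (nbr : ∀ t → t ∈ z₁ ∷ z₂ ∷ zs → a v t ≡ true) where

  -- The three switches are the edge `v w` and the edges from `v` to the first and to the last
  -- vertex of the interval. Each adds one edge to the balance, so any loss between zero and three
  -- can be made up exactly.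
  record Split (β kf kl : Bool) : Set where
    field
      {graph} : Gr n
      good    : Good g graph
      spec    : ∀ i j → Iff (graph i j ≡ true) (SplitOff a v w (z₁ ∷ z₂ ∷ zs) (optional kf z₁ ++ dropped kl (z₂ ∷ zs)) β i j)
      unmoved : Unmoved (nx (emb G v)) (nx (emb good v)) w (z₁ ∷ z₂ ∷ zs)
      sizes   : size graph ≡ size a + 2 * (ind β + ind kf + ind kl)

  private
    iw : ∀ z → a z w ≡ false
    iw z = ≢true λ e → true≢false (gsym G z w e) (wi z)
    w∉ : ∀ {t} → a v t ≡ true → w ≢ t
    w∉ e refl = true≢false e (iw v)
    vz₁ = nbr z₁ (here refl)
    w≢z₁ = w∉ vz₁
    w≢z₂ = w∉ (nbr z₂ (there (here refl)))
    v≢z₁ = irr≢ {a = a} (girr G) vz₁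
    z₁≢z₂ : z₁ ≢ z₂
    z₁≢z₂ = fresh uniq (here refl)
    f = nx (emb G v)

    -- Hung between `z₁` and `z₂` in the rotation at `v`, the vertex `w` forms a corner with either;
    -- `z₁` is joined at once, the others are left to `absorb`.
    P = pendant G v w z₁ vz₁ v≢w wi
    aP = addE a v w
    fP : ∀ t → nx (emb P v) t ≡ TF.swap n w z₂ (f t)
    fP t = trans (pendant-nx G v w z₁ vz₁ v≢w wi t) (cong (λ y → TF.swap n w y (f t)) (proj₁ chain))
    fPz₁ : nx (emb P v) z₁ ≡ w
    fPz₁ = trans (fP z₁) (trans (cong (TF.swap n w z₂) (proj₁ chain)) (TF.swapʳ n w z₂))
    z₁w : aP z₁ w ≡ false
    z₁w = ≢true λ e → case ∨-true e of λ where
      (inj₁ p) → true≢false p (iw z₁)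
      (inj₂ p) → case isPair-true v w z₁ w p of λ where
        (inj₁ (r , _)) → v≢z₁ (sym r)
        (inj₂ (r , _)) → w≢z₁ (sym r)
    vwP : aP v w ≡ true
    vwP = ∨-introʳ {a v w} (isPair-introˡ v w)

    C = corner P v z₁ w (∨-introˡ vz₁) vwP fPz₁ (w≢z₁ ∘ sym) z₁w
    aC = addE aP w z₁
    fC : ∀ t → nx (emb C v) t ≡ TF.swap n w z₂ (f t)
    fC t = trans (corner-nx P v z₁ w (∨-introˡ vz₁) vwP fPz₁ (w≢z₁ ∘ sym) z₁w v t v≢z₁ v≢w) (fP t)
    fCw : nx (emb C v) w ≡ z₂
    fCw = trans (fC w) (trans (cong (TF.swap n w z₂) (off (emb G v) w (iw v))) (TF.swapˡ n w z₂))
    fCz₁ : nx (emb C v) z₁ ≡ w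
    fCz₁ = trans (fC z₁) (trans (cong (TF.swap n w z₂) (proj₁ chain)) (TF.swapʳ n w z₂))
    vz₁C : aC v z₁ ≡ true
    vz₁C = ∨-introˡ (∨-introˡ vz₁)

    sizeC : size aC ≡ 4 + size a
    sizeC = trans (size-addE w≢z₁ (≢true λ e → true≢false (gsym P w z₁ e) z₁w) z₁w)
      (cong (2 +_) (size-addE v≢w (iw v) (wi v)))

    First : List (Fin n) → Fin n → Fin n → Set
    First dr i j = Touching w (z₁ ∷ v ∷ []) i j ⊎ (a i j ≡ true × ¬ Touching v dr i j)

    specC : ∀ i j → Iff (aC i j ≡ true) (First [] i j)
    specC i j = (λ e → case ∨-true e of λ where
          (inj₂ p) → case isPair-true w z₁ i j p of λ where
            (inj₁ (r , s)) → inj₁ (inj₁ (r , here s))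
            (inj₂ (r , s)) → inj₁ (inj₂ (s , here r))
          (inj₁ p) → case ∨-true p of λ where
            (inj₁ q) → inj₂ (q , λ { (inj₁ (_ , ())) ; (inj₂ (_ , ())) })
            (inj₂ q) → case isPair-true v w i j q of λ where
              (inj₁ (r , s)) → inj₁ (inj₂ (s , there (here r)))
              (inj₂ (r , s)) → inj₁ (inj₁ (r , there (here s))))
      , λ where
          (inj₁ (inj₁ (refl , here refl))) → ∨-introʳ {aP w z₁} (isPair-introˡ w z₁)
          (inj₁ (inj₁ (refl , there (here refl)))) → ∨-introˡ (∨-introʳ {a w v} (isPair-introʳ v w))
          (inj₁ (inj₂ (refl , here refl))) → ∨-introʳ {aP z₁ w} (isPair-introʳ w z₁)
          (inj₁ (inj₂ (refl , there (here refl)))) → ∨-introˡ (∨-introʳ {a v w} (isPair-introˡ v w))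
          (inj₂ (p , _)) → ∨-introˡ (∨-introˡ p)

    record Start (kf : Bool) : Set where
      field
        {graph₁} : Gr n
        good₁  : Good g graph₁
        spec₁  : ∀ i j → Iff (graph₁ i j ≡ true) (First (optional kf z₁) i j)
        nx-w   : nx (emb good₁ v) w ≡ z₂
        nx-t   : ∀ t → t ≢ z₁ → t ≢ w → f t ≢ z₁ → f t ≢ w → nx (emb good₁ v) t ≡ f t
        sizes₁ : size graph₁ ≡ size a + 2 * suc (ind kf)

    open Start

    fC-t : ∀ t → t ≢ z₁ → f t ≢ w → nx (emb C v) t ≡ f t
    fC-t t tz fw = trans (fC t) (TF.swap-other n fw λ e → tz (f-inj (perm (emb G v)) (trans e (sym (proj₁ chain)))))

    start : ∀ kf → Start kf
    start true = record { good₁ = C ; spec₁ = specC ; nx-w = fCw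
      ; nx-t = λ t tz _ _ fw → fC-t t tz fw
      ; sizes₁ = trans sizeC (+-comm 4 (size a)) }
    start false = record { good₁ = delete C v z₁ vz₁C
      ; spec₁ = λ i j → (λ e → let (p , np) = delE-true aC v z₁ i j e in case proj₁ (specC i j) p of λ where
            (inj₁ q) → inj₁ q
            (inj₂ (q , _)) → inj₂ (q , λ where
              (inj₁ (refl , here refl)) → np (isPair-introˡ v z₁)
              (inj₂ (refl , here refl)) → np (isPair-introʳ v z₁)))
          , λ where
            (inj₁ q) → delE-intro aC v z₁ i j (proj₂ (specC i j) (inj₁ q)) λ r → touch q (isPair-true v z₁ i j r)
            (inj₂ (q , nt)) → delE-intro aC v z₁ i j (proj₂ (specC i j) (inj₂ (q , λ { (inj₁ (_ , ())) ; (inj₂ (_ , ())) })))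
              λ r → case isPair-true v z₁ i j r of λ where
                (inj₁ (r , s)) → nt (inj₁ (r , here s))
                (inj₂ (r , s)) → nt (inj₂ (s , here r))
      ; nx-w = trans (row w) (trans (cong (TF.swap n z₁ w) fCw) (TF.swap-other n (z₁≢z₂ ∘ sym) (w≢z₂ ∘ sym)))
      ; nx-t = λ t tz tw fz fw → trans (row t) (trans (cong (TF.swap n z₁ w) (fC-t t tz fw)) (TF.swap-other n fz fw))
      ; sizes₁ = +-cancelˡ-≡ 2 _ _ (trans (sym (size-delE v≢z₁ vz₁C (gsym C v z₁ vz₁C))) (trans sizeC
          (cong (2 +_) (+-comm 2 (size a))))) }
      where
      row : ∀ t → nx (emb (delete C v z₁ vz₁C) v) t ≡ TF.swap n z₁ w (nx (emb C v) t)
      row t = trans (delete-nxˡ C v z₁ vz₁C t) (cong (λ y → TF.swap n z₁ y (nx (emb C v) t)) fCz₁)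
      touch : ∀ {i j} → Touching w (z₁ ∷ v ∷ []) i j → ¬ ((i ≡ v × j ≡ z₁) ⊎ (i ≡ z₁ × j ≡ v))
      touch (inj₁ (refl , _)) (inj₁ (r , _)) = v≢w (sym r)
      touch (inj₁ (refl , _)) (inj₂ (r , _)) = w≢z₁ r
      touch (inj₂ (refl , _)) (inj₁ (_ , r)) = w≢z₁ r
      touch (inj₂ (refl , _)) (inj₂ (_ , r)) = v≢w (sym r)

  splitOff : ∀ β kf kl → Split β kf kl
  splitOff β kf kl = finish β
    where
    S = start kf
    a₁ = graph₁ S
    z₁∉ : ∀ {t} → t ∈ z₂ ∷ zs → z₁ ≢ t
    z₁∉ = fresh uniq
    w∉zs : ∀ {t} → t ∈ z₂ ∷ zs → w ≢ t
    w∉zs m = w∉ (nbr _ (there m))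
    chain₁ : Chained (nx (emb (good₁ S) v)) (w ∷ z₂ ∷ zs)
    chain₁ = nx-w S , chained-cong (z₂ ∷ zs) (λ t m m' → nx-t S t
      (z₁∉ m ∘ sym) (w∉zs m ∘ sym) (z₁∉ m' ∘ sym) (w∉zs m' ∘ sym)) (proj₂ chain)
    uniq₁ : Unique (w ∷ z₂ ∷ zs)
    uniq₁ = Data.List.Relation.Unary.All.tabulate (λ m → w∉zs m) ∷ fresh-tail uniq
    vw₁ : a₁ v w ≡ true
    vw₁ = proj₂ (spec₁ S v w) (inj₁ (inj₂ (refl , there (here refl))))
    not-dropped : ∀ {t} → z₁ ≢ t → t ∉ optional kf z₁
    not-dropped = ∉-optional kf
    v∉ : v ∉ optional kf z₁
    v∉ m = not-dropped (v≢z₁ ∘ sym) m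
    props : ∀ t → t ∈ z₂ ∷ zs → a₁ v t ≡ true × a₁ w t ≡ false
    props t m = proj₂ (spec₁ S v t) (inj₂ (nbr t (there m) , λ where
          (inj₁ (_ , q)) → not-dropped (z₁∉ m) q
          (inj₂ (_ , q)) → v∉ q))
      , ≢true λ e → case proj₁ (spec₁ S w t) e of λ where
          (inj₁ (inj₁ (_ , here r))) → z₁∉ m (sym r)
          (inj₁ (inj₁ (_ , there (here r)))) → true≢false (nbr t (there m)) (subst (λ y → a y t ≡ false) r (girr G t))
          (inj₁ (inj₂ (r , _))) → w∉zs m (sym r)
          (inj₂ (p , _)) → true≢false p (wi t)
    A = absorb kl z₂ zs (good₁ S) v w v≢w vw₁ chain₁ uniq₁ props
    a₂ = Absorbed.result′ A
    dr = dropped kl (z₂ ∷ zs)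

    v∉dr : ∀ {t} → t ∈ optional kf z₁ ++ dr → t ≢ v × t ≢ w
    v∉dr m with ∈-++⁻ (optional kf z₁) m
    ... | inj₁ q = (λ { refl → v∉ q }) , λ { refl → not-dropped (w≢z₁ ∘ sym) q }
    ... | inj₂ q = (λ { refl → true≢false (nbr v (there (dropped-⊆ kl _ q))) (girr G v) }) , λ { refl → w∉zs (dropped-⊆ kl _ q) refl }

    spec₂ : ∀ i j → Iff (a₂ i j ≡ true) (SplitOff a v w (z₁ ∷ z₂ ∷ zs) (optional kf z₁ ++ dr) true i j)
    spec₂ i j = to ∘ proj₁ (Absorbed.spec′ A i j) , proj₂ (Absorbed.spec′ A i j) ∘ from
      where
      to : Moved a₁ v w (z₂ ∷ zs) dr i j → SplitOff a v w (z₁ ∷ z₂ ∷ zs) (optional kf z₁ ++ dr) true i j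
      to (inj₁ (inj₁ (r , m))) = inj₁ (r , inj₁ (there m))
      to (inj₁ (inj₂ (r , m))) = inj₂ (inj₁ (r , inj₁ (there m)))
      to (inj₂ (e , nt)) with proj₁ (spec₁ S i j) e
      ... | inj₁ (inj₁ (r , here s)) = inj₁ (r , inj₁ (here s))
      ... | inj₁ (inj₁ (r , there (here s))) = inj₁ (r , inj₂ (refl , s))
      ... | inj₁ (inj₂ (r , here s)) = inj₂ (inj₁ (r , inj₁ (here s)))
      ... | inj₁ (inj₂ (r , there (here s))) = inj₂ (inj₁ (r , inj₂ (refl , s)))
      ... | inj₂ (p , nt') = inj₂ (inj₂ (p , λ where
              (inj₁ (r , m)) → case ∈-++⁻ (optional kf z₁) m of λ { (inj₁ q) → nt' (inj₁ (r , q)) ; (inj₂ q) → nt (inj₁ (r , q)) }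
              (inj₂ (r , m)) → case ∈-++⁻ (optional kf z₁) m of λ { (inj₁ q) → nt' (inj₂ (r , q)) ; (inj₂ q) → nt (inj₂ (r , q)) }))
      clear : Touching w (z₁ ∷ v ∷ []) i j → ¬ Touching v dr i j
      clear (inj₁ (refl , _)) (inj₁ (r , _)) = v≢w (sym r)
      clear (inj₁ (refl , _)) (inj₂ (_ , m)) = proj₂ (v∉dr (∈-++⁺ʳ (optional kf z₁) m)) refl
      clear (inj₂ (refl , _)) (inj₁ (_ , m)) = proj₂ (v∉dr (∈-++⁺ʳ (optional kf z₁) m)) refl
      clear (inj₂ (refl , _)) (inj₂ (r , _)) = v≢w (sym r)
      touch : Touching w (z₁ ∷ v ∷ []) i j → Moved a₁ v w (z₂ ∷ zs) dr i j
      touch t = inj₂ (proj₂ (spec₁ S i j) (inj₁ t) , clear t)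
      from : SplitOff a v w (z₁ ∷ z₂ ∷ zs) (optional kf z₁ ++ dr) true i j → Moved a₁ v w (z₂ ∷ zs) dr i j
      from (inj₁ (r , inj₁ (here s))) = touch (inj₁ (r , here s))
      from (inj₁ (r , inj₁ (there m))) = inj₁ (inj₁ (r , m))
      from (inj₁ (r , inj₂ (_ , s))) = touch (inj₁ (r , there (here s)))
      from (inj₂ (inj₁ (r , inj₁ (here s)))) = touch (inj₂ (r , here s))
      from (inj₂ (inj₁ (r , inj₁ (there m)))) = inj₁ (inj₂ (r , m))
      from (inj₂ (inj₁ (r , inj₂ (_ , s)))) = touch (inj₂ (r , there (here s)))
      from (inj₂ (inj₂ (p , nt))) = inj₂ (proj₂ (spec₁ S i j) (inj₂ (p , λ where
          (inj₁ (r , m)) → nt (inj₁ (r , ∈-++⁺ˡ m))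
          (inj₂ (r , m)) → nt (inj₂ (r , ∈-++⁺ˡ m))))
        , λ where
          (inj₁ (r , m)) → nt (inj₁ (r , ∈-++⁺ʳ (optional kf z₁) m))
          (inj₂ (r , m)) → nt (inj₂ (r , ∈-++⁺ʳ (optional kf z₁) m)))

    unmoved₂ : Unmoved f (nx (emb (Absorbed.good′ A) v)) w (z₁ ∷ z₂ ∷ zs)
    unmoved₂ t t∉ tw ft∉ ftw = trans (Absorbed.unmoved A t (t∉ ∘ there) tw
        (λ m → ft∉ (there (subst (_∈ z₂ ∷ zs) e m))) (ftw ∘ trans (sym e))) e
      where
      e : nx (emb (good₁ S) v) t ≡ f t
      e = nx-t S t (t∉ ∘ here) tw (ft∉ ∘ here) ftw

    double : ∀ b → (if b then 2 else 0) ≡ 2 * ind b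
    double true = refl
    double false = refl

    size₂ : size a₂ ≡ size a + 2 * suc (ind kf + ind kl)
    size₂ = trans (Absorbed.sizes′ A) (trans (cong₂ _+_ (sizes₁ S) (double kl)) (lem (size a) (ind kf) (ind kl)))
      where
      lem : ∀ s x y → s + 2 * suc x + 2 * y ≡ s + 2 * suc (x + y)
      lem = solve-∀

    finish : ∀ β → Split β kf kl
    finish true = record { good = Absorbed.good′ A ; spec = spec₂ ; unmoved = unmoved₂ ; sizes = size₂ }
    -- The edge `v w` is a side of every corner used so far, so it is given up only at the end.
    finish false = record { good = delete (Absorbed.good′ A) v w vw₂
      ; spec = λ i j → (λ e → let (p , np) = delE-true a₂ v w i j e in case proj₁ (spec₂ i j) p of λ where
            (inj₁ (r , inj₁ m)) → inj₁ (r , inj₁ m)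
            (inj₁ (refl , inj₂ (_ , refl))) → ⊥-elim (np (isPair-introʳ v w))
            (inj₂ (inj₁ (r , inj₁ m))) → inj₂ (inj₁ (r , inj₁ m))
            (inj₂ (inj₁ (refl , inj₂ (_ , refl)))) → ⊥-elim (np (isPair-introˡ v w))
            (inj₂ (inj₂ q)) → inj₂ (inj₂ q))
          , λ where
            (inj₁ (refl , inj₁ m)) → delE-intro a₂ v w i j (proj₂ (spec₂ i j) (inj₁ (refl , inj₁ m))) λ q →
              case isPair-true v w i j q of λ where
                (inj₁ (r , _)) → v≢w (sym r)
                (inj₂ (_ , refl)) → true≢false (nbr v m) (girr G v)
            (inj₂ (inj₁ (refl , inj₁ m))) → delE-intro a₂ v w i j (proj₂ (spec₂ i j) (inj₂ (inj₁ (refl , inj₁ m)))) λ q →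
              case isPair-true v w i j q of λ where
                (inj₁ (refl , _)) → true≢false (nbr v m) (girr G v)
                (inj₂ (_ , r)) → v≢w (sym r)
            (inj₂ (inj₂ (p , nt))) → delE-intro a₂ v w i j (proj₂ (spec₂ i j) (inj₂ (inj₂ (p , nt)))) λ q →
              case isPair-true v w i j q of λ where
                (inj₁ (refl , refl)) → true≢false p (iw v)
                (inj₂ (refl , refl)) → true≢false p (wi v)
      ; unmoved = λ t t∉ tw ft∉ ftw → let e = unmoved₂ t t∉ tw ft∉ ftw in
          trans (delete-nxˡ (Absorbed.good′ A) v w vw₂ t) (trans (TF.swap-other n (ftw ∘ trans (sym e))
            (λ q → tw (f-inj (perm (emb (Absorbed.good′ A) v)) q))) e)
      ; sizes = +-cancelˡ-≡ 2 _ _ (trans (sym (size-delE v≢w vw₂ (gsym (Absorbed.good′ A) v w vw₂)))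
          (trans size₂ (lem (size a) (ind kf + ind kl)))) }
      where
      vw₂ : a₂ v w ≡ true
      vw₂ = proj₂ (spec₂ v w) (inj₂ (inj₁ (refl , inj₂ (refl , refl))))
      lem : ∀ s x → s + 2 * suc x ≡ 2 + (s + 2 * (0 + x))
      lem = solve-∀

-- Euler's inequality with hubs

-- In use, `y` is the first member of `S` after `x`. Unlike an equation for the successor, this
-- survives the deletion of points outside `S`, so a cyclic order can be passed on to a subgraph.
data Arc {X : Set} (f : X → X) (S : List X) : X → X → Set where
  stop : ∀ {x y} → f x ≡ y → Arc f S x y
  pass   : ∀ {x y} → f x ∉ S → Arc f S (f x) y → Arc f S x y

arc-cong : ∀ {X : Set} {f f' : X → X} {S} → (∀ x → f' x ≡ f x) → ∀ {x y} → Arc f S x y → Arc f' S x y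
arc-cong h {x} (stop e) = stop (trans (h x) e)
arc-cong {f' = f'} {S} h {x} {y} (pass ne p) = pass (λ m → ne (subst (_∈ S) (h x) m))
  (subst (λ z → Arc f' S z y) (sym (h x)) (arc-cong h p))

module _ {n} {f f' : Fin n → Fin n} {S} (P : Perm f) p (h : ∀ z → f' z ≡ TF.swap n p (f p) (f z)) (p∉ : p ∉ S) where

  arc-delete : ∀ {x y} → x ≢ p → y ≢ p → Arc f S x y → Arc f' S x y
  arc-skip : ∀ {x y z} → f x ≡ z → z ≡ p → x ≢ p → y ≢ p → Arc f S z y → Arc f' S x y

  arc-delete {x} {y} xp yp (stop e) = stop (trans (h x) (trans (TF.swap-other n
    (λ q → yp (trans (sym e) q)) (λ q → xp (f-inj P q))) e))
  arc-delete {x} {y} xp yp (pass ne q) with decide (f x ≟ p)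
  ... | inj₂ fp = pass (λ m → ne (subst (_∈ S) same m)) (subst (λ z → Arc f' S z y) (sym same) (arc-delete fp yp q))
    where
    same : f' x ≡ f x
    same = trans (h x) (TF.swap-other n fp λ r → xp (f-inj P r))
  ... | inj₁ e = arc-skip refl e xp yp q

  arc-skip {x} {y} {z} e refl xp yp q = past q
    where
    same : f' x ≡ f p
    same = trans (h x) (trans (cong (TF.swap n p (f p)) e) (TF.swapˡ n p (f p)))
    past : Arc f S p y → Arc f' S x y
    past (stop r) = stop (trans same r)
    past (pass ne' r) = pass (λ m → ne' (subst (_∈ S) same m)) (subst (λ z → Arc f' S z y) (sym same)
      (arc-delete (λ s → xp (f-inj P (trans e (sym s)))) yp r))

arc-next : ∀ {X : Set} {f : X → X} {S x y} → f x ∈ S → Arc f S x y → f x ≡ y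
arc-next m (stop e) = e
arc-next m (pass ne _) = ⊥-elim (ne m)

record Restriction {n g} {a : Gr n} (G : Good g a) (k : Gr n) (ds : List (Dart n)) : Set where
  field
    {graph} : Gr n
    good  : Good g graph
    above : ∀ u v → k u v ≡ true → graph u v ≡ true
    done  : ∀ u v → (u , v) ∈ ds → graph u v ≡ true → k u v ≡ true
    arcs  : ∀ w S → (∀ t → t ∈ S → k w t ≡ true) → ∀ {x y} → x ∈ S → y ∈ S →
            Arc (nx (emb G w)) S x y → Arc (nx (emb good w)) S x y

restrictTo : ∀ {n g} {a k : Gr n} (G : Good g a) → Symm k → (∀ u v → k u v ≡ true → a u v ≡ true) → ∀ ds → Restriction G k ds
restrictTo G sk sub [] = record { good = G ; above = sub ; done = λ _ _ () ; arcs = λ _ _ _ _ _ p → p }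
restrictTo {n} {g} {a} {k} G sk sub ((u , v) ∷ ds) = by-edge (restrictTo G sk sub ds)
  where
  module R = Restriction
  by-edge : Restriction G k ds → Restriction G k ((u , v) ∷ ds)
  by-edge r with R.graph r u v in e | k u v in e'
  ... | true | true = record { good = R.good r ; above = R.above r
        ; done = λ { _ _ (here refl) _ → e' ; x y (there m) q → R.done r x y m q } ; arcs = R.arcs r }
  ... | false | _ = record { good = R.good r ; above = R.above r
        ; done = λ { _ _ (here refl) q → ⊥-elim (true≢false q e) ; x y (there m) q → R.done r x y m q } ; arcs = R.arcs r }
  ... | true | false = record { good = D
        ; above = λ x y q → delE-intro b u v x y (R.above r x y q) λ s → case isPair-true u v x y s of λ where
            (inj₁ (refl , refl)) → true≢false q e'
            (inj₂ (refl , refl)) → true≢false (sk _ _ q) e'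
        ; done = λ { _ _ (here refl) q → ⊥-elim (proj₂ (delE-true b u v u v q) (isPair-introˡ u v))
                   ; x y (there m) q → R.done r x y m (proj₁ (delE-true b u v x y q)) }
        ; arcs = λ w S h mx my p → further w S h mx my (R.arcs r w S h mx my p) }
    where
    b = R.graph r
    D = delete (R.good r) u v e
    further : ∀ w S → (∀ t → t ∈ S → k w t ≡ true) → ∀ {x y} → x ∈ S → y ∈ S →
      Arc (nx (emb (R.good r) w)) S x y → Arc (nx (emb D w)) S x y
    further w S h mx my p with decide (w ≟ u) | decide (w ≟ v)
    ... | inj₁ refl | _ = arc-delete (perm (emb (R.good r) w)) v (delete-nxˡ (R.good r) u v e) v∉
            (λ { refl → v∉ mx }) (λ { refl → v∉ my }) p
      where
      v∉ : v ∉ S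
      v∉ m = true≢false (h v m) e'
    ... | inj₂ _ | inj₁ refl = arc-delete (perm (emb (R.good r) w)) u (delete-nxʳ (R.good r) u v e) u∉
            (λ { refl → u∉ mx }) (λ { refl → u∉ my }) p
      where
      u∉ : u ∉ S
      u∉ m = true≢false (sk _ _ (h u m)) e'
    ... | inj₂ wu | inj₂ wv = arc-cong (λ z → delete-nx-other (R.good r) u v e w z wu wv) p

record Sub {n g} {a : Gr n} (G : Good g a) (k : Gr n) : Set where
  field
    good : Good g k
    arcs : ∀ w S → (∀ t → t ∈ S → k w t ≡ true) → (∀ t → k w t ≡ true → t ∈ S) → ∀ {x y} → x ∈ S → y ∈ S →
           Arc (nx (emb G w)) S x y → nx (emb good w) x ≡ y

-- Deleting the unwanted edges one by one preserves arcs. Once `S` is the whole neighbourhood of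
-- `w`, the very next vertex lies in `S`, and the arc turns into an equation for the successor.
subgraph : ∀ {n g} {a k : Gr n} (G : Good g a) → Symm k → (∀ u v → k u v ≡ true → a u v ≡ true) → Sub G k
subgraph {n} {g} {a} {k} G sk sub = record
  { good = K
  ; arcs = λ w S h h' {x} mx my p → arc-next (h' _ (row-closed (emb K w) (h x mx))) (R.arcs w S h mx my p) }
  where
  module R = Restriction (restrictTo G sk sub (elems (dartFinite n)))
  K : Good g k
  K = good-cong (λ i j → bool-ext (R.done i j (complete (dartFinite n) (i , j))) (R.above i j)) R.good

module _ {n g} {k : Gr n} (G : Good g k) (H : Fin n → Bool)
  (hub : ∀ u v → k u v ≡ true → ∃[ s ] ∃[ t ] (H s ≡ true × k s t ≡ true × Orb (face (emb G)) (u , v) (s , t)))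
  (next : ∀ s t → H s ≡ true → k s t ≡ true → nx (emb G s) t ≡ t ⊎
    ∃[ s' ] ∃[ t' ] (H s' ≡ true × k s' t' ≡ true × (s' , t') ≢ (s , t) × Orb (face (emb G)) (s , t) (s' , t')))
  where

  private
    E = emb G
    D = dartFinite n
    orbE : Equiv (Orb (face E))
    orbE = orb-equiv D (face-perm E)

    token : Dart n → Bool
    token (u , v) = H u ∧ plus (k u) u v

    rep : Dart n → Bool
    rep (u , v) = faceRep E (u , v) ∧ k u v

    -- A hub of degree one is counted by its diagonal dart.
    Of : Dart n → Dart n → Set
    Of r d = (k (proj₁ d) (proj₂ d) ≡ true × Orb (face E) r d) ⊎
             (proj₁ d ≡ proj₂ d × ∃[ t ] (k (proj₁ d) t ≡ true × Orb (face E) r (proj₁ d , t) × nx (E (proj₁ d)) t ≡ t))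

    of-unique : ∀ {r r' d} → rep r ≡ true → rep r' ≡ true → Of r d → Of r' d → r ≡ r'
    of-unique {r} {r'} {d} e e' p p' = DC.rep-unique n orbE (orb? D (face-perm E))
        (proj₁ (faceRep-reps E) r (proj₁ (∧-true e))) (proj₁ (faceRep-reps E) r' (proj₁ (∧-true e'))) (link p p')
      where
      link : Of r d → Of r' d → Orb (face E) r r'
      link (inj₁ (_ , o)) (inj₁ (_ , o')) = orb-trans o (symᴱ orbE o')
      link (inj₁ (q , _)) (inj₂ (refl , _)) = ⊥-elim (true≢false q (girr G _))
      link (inj₂ (refl , _)) (inj₁ (q , _)) = ⊥-elim (true≢false q (girr G _))
      link (inj₂ (_ , t , q , o , fix)) (inj₂ (_ , t' , q' , o' , _)) with row-fixed (E (proj₁ d)) q q' fix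
      ... | refl = orb-trans o (symᴱ orbE o')

    Tokens : Dart n → Set
    Tokens r = Σ[ d ∈ (Fin 2 → Dart n) ] ((∀ b → token (d b) ≡ true) × (∀ b → Of r (d b)) × d zero ≢ d (suc zero))

    tokens : ∀ r → rep r ≡ true → Tokens r
    tokens (u , v) e with hub u v (proj₂ (∧-true {faceRep E (u , v)} e))
    ... | s , t , hs , st , o with next s t hs st
    ...   | inj₁ fix = (λ { zero → s , t ; (suc zero) → s , s })
            , (λ { zero → ∧-intro hs (∨-introˡ st) ; (suc zero) → ∧-intro hs (∨-introʳ {k s s} (does-intro (s ≟ s) refl)) })
            , (λ { zero → inj₁ (st , o) ; (suc zero) → inj₂ (refl , t , st , o , fix) })
            , λ q → true≢false (subst (λ x → k s x ≡ true) (,-injectiveʳ q) st) (girr G s)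
    ...   | inj₂ (s' , t' , hs' , st' , ne , o') = (λ { zero → s , t ; (suc zero) → s' , t' })
            , (λ { zero → ∧-intro hs (∨-introˡ st) ; (suc zero) → ∧-intro hs' (∨-introˡ st') })
            , (λ { zero → inj₁ (st , o) ; (suc zero) → inj₁ (st' , orb-trans o o') })
            , ne ∘ sym

    twice-faces : adjFaces E * 2 ≤ count D token
    twice-faces = count-twice D D rep token (λ r e → proj₁ (tokens r e)) (λ r e → proj₁ (proj₂ (tokens r e)))
      (λ r r' e e' b b' q → of-unique e e' (proj₁ (proj₂ (proj₂ (tokens r e))) b)
        (subst (Of r') (sym q) (proj₁ (proj₂ (proj₂ (tokens r' e'))) b')))
      (λ r e → proj₂ (proj₂ (proj₂ (tokens r e))))

    hubDegrees otherDegrees : ℕ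
    hubDegrees = sumF n λ u → if H u then degree k u else 0
    otherDegrees = sumF n λ u → if H u then 0 else degree k u

    token-count : count D token ≡ hubDegrees + countF n H
    token-count = trans (sumDarts n (ind ∘ token)) (trans (sumL-cong (allFin n) pt) (sumL-+ _ _ (allFin n)))
      where
      pt : ∀ u → countF n (λ v → token (u , v)) ≡ (if H u then degree k u else 0) + ind (H u)
      pt u with H u
      ... | false = sumL-0 (allFin n)
      ... | true = trans (degree-plus (k u) (girr G u)) (+-comm 1 _)

    size-count : size k ≡ hubDegrees + otherDegrees
    size-count = trans (sumL-cong (allFin n) pt) (sumL-+ _ _ (allFin n))
      where
      pt : ∀ u → degree k u ≡ (if H u then degree k u else 0) + (if H u then 0 else degree k u)
      pt u with H u
      ... | false = refl
      ... | true = sym (+-identityʳ _)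

  -- Euler's inequality with twice the number of faces bounded by the darts leaving H, so that
  -- vertices of degree two outside H contribute nothing.
  eulerHub : ∀ q → q + iso k ≤ comps k →
    4 * q + 2 * iso k + sumF n (λ u → if H u then 0 else degree k u) ≤ 2 * n + countF n H + 4 * g
  eulerHub q hq = +-cancelˡ-≤ (hubDegrees + 2 * iso k) _ _ (begin
    hubDegrees + 2 * iso k + (4 * q + 2 * iso k + otherDegrees) ≡⟨ l1 hubDegrees (iso k) q otherDegrees ⟩
    4 * (q + iso k) + (hubDegrees + otherDegrees)   ≤⟨ +-monoˡ-≤ _ (*-monoʳ-≤ 4 hq) ⟩
    4 * comps k + (hubDegrees + otherDegrees)       ≡⟨ cong (4 * comps k +_) (trans (sym size-count) (size-edges (girr G) (gsym G))) ⟩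
    4 * comps k + 2 * edgeCount k                   ≡⟨ l2 (comps k) (edgeCount k) ⟩
    2 * (2 * comps k + edgeCount k)                 ≤⟨ *-monoʳ-≤ 2 (euler-unshift {comps k} {n = n} {i = iso k} {g = g} (cycles+edges E (girr G) (gsym G)) (genus G)) ⟩
    2 * (n + (adjFaces E + iso k) + 2 * g)          ≡⟨ l3 n (adjFaces E) (iso k) g ⟩
    2 * n + adjFaces E * 2 + 2 * iso k + 4 * g      ≤⟨ +-monoˡ-≤ (4 * g) (+-monoˡ-≤ (2 * iso k) (+-monoʳ-≤ (2 * n) (≤-trans twice-faces (≤-reflexive token-count)))) ⟩
    2 * n + (hubDegrees + countF n H) + 2 * iso k + 4 * g ≡⟨ l4 (2 * n) hubDegrees (countF n H) (iso k) (4 * g) ⟩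
    hubDegrees + 2 * iso k + (2 * n + countF n H + 4 * g) ∎)
    where
    open ≤-Reasoning
    l1 : ∀ h i q o → h + 2 * i + (4 * q + 2 * i + o) ≡ 4 * (q + i) + (h + o)
    l1 = solve-∀
    l2 : ∀ c e → 4 * c + 2 * e ≡ 2 * (2 * c + e)
    l2 = solve-∀
    l3 : ∀ n f i g → 2 * (n + (f + i) + 2 * g) ≡ 2 * n + f * 2 + 2 * i + 4 * g
    l3 = solve-∀
    l4 : ∀ n h c i g → n + (h + c) + 2 * i + g ≡ h + 2 * i + (n + c + g)
    l4 = solve-∀

  -- Every vertex outside H with an edge has degree at least two, and those in I have degree three or more.
  hub-bound : ∀ q → q + iso k ≤ comps k → (I : Fin n → Bool) →
    (∀ u → H u ≡ false → isolated k u ≡ false → 2 + ind (I u) ≤ degree k u) →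
    (∀ u → I u ≡ true → H u ≡ false × isolated k u ≡ false) →
    4 * q + countF n I ≤ 3 * countF n H + 4 * g
  hub-bound q hq I deg≥ off-I = +-cancelˡ-≤ (2 * n) _ _ (begin
    2 * n + (4 * q + countF n I)                ≡⟨ l1 (2 * n) (4 * q) (countF n I) ⟩
    4 * q + (2 * n + countF n I)                ≤⟨ +-monoʳ-≤ (4 * q) lower ⟩
    4 * q + (2 * countF n H + (2 * iso k + otherDegrees)) ≡⟨ l2 (4 * q) (2 * countF n H) (2 * iso k) otherDegrees ⟩
    2 * countF n H + (4 * q + 2 * iso k + otherDegrees) ≤⟨ +-monoʳ-≤ (2 * countF n H) (eulerHub q hq) ⟩
    2 * countF n H + (2 * n + countF n H + 4 * g) ≡⟨ l3 n (countF n H) g ⟩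
    2 * n + (3 * countF n H + 4 * g)            ∎)
    where
    open ≤-Reasoning
    l1 : ∀ n q i → n + (q + i) ≡ q + (n + i)
    l1 = solve-∀
    l2 : ∀ q h i o → q + (h + (i + o)) ≡ h + (q + i + o)
    l2 = solve-∀
    l3 : ∀ n h g → 2 * h + (2 * n + h + 4 * g) ≡ 2 * n + (3 * h + 4 * g)
    l3 = solve-∀
    pt : ∀ u → 2 + ind (I u) ≤ 2 * ind (H u) + (2 * ind (isolated k u) + (if H u then 0 else degree k u))
    pt u with H u in hu | isolated k u in iu | I u in e
    ... | true | _ | true = ⊥-elim (true≢false hu (proj₁ (off-I u e)))
    ... | true | _ | false = m≤m+n 2 _
    ... | false | true | true = ⊥-elim (true≢false iu (proj₂ (off-I u e)))
    ... | false | true | false = m≤m+n 2 _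
    ... | false | false | b = subst (λ x → 2 + ind x ≤ degree k u) e (deg≥ u hu iu)
    lower : 2 * n + countF n I ≤ 2 * countF n H + (2 * iso k + otherDegrees)
    lower = begin
      2 * n + countF n I ≡⟨ cong (_+ countF n I) (trans (*-comm 2 n) (trans (cong (_* 2) (sym (length-allFin n))) (sym (sumL-const 2 (allFin n))))) ⟩
      sumF n (λ _ → 2) + countF n I ≡⟨ sym (sumL-+ _ _ (allFin n)) ⟩
      sumF n (λ u → 2 + ind (I u)) ≤⟨ sumL-mono (allFin n) pt ⟩
      sumF n (λ u → 2 * ind (H u) + (2 * ind (isolated k u) + (if H u then 0 else degree k u)))
        ≡⟨ trans (sumL-+ (λ u → 2 * ind (H u)) _ (allFin n)) (cong₂ _+_ (sumL-*ˡ 2 (λ u → ind (H u)) (allFin n))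
             (trans (sumL-+ (λ u → 2 * ind (isolated k u)) _ (allFin n)) (cong (_+ otherDegrees) (sumL-*ˡ 2 (λ u → ind (isolated k u)) (allFin n))))) ⟩
      2 * countF n H + (2 * iso k + otherDegrees) ∎

module _ {n g} {a : Gr n} (G : Good g a) (H I : Fin n → Bool)
  (low : ∀ w → I w ≡ true → H w ≡ false) (high : ∀ w x → I w ≡ true → a w x ≡ true → H x ≡ true)
  (deg≥3 : ∀ w → I w ≡ true → 3 ≤ degree a w) where

  private
    k : Gr n
    k u v = a u v ∧ (I u ∨ I v)

    k-sym : Symm k
    k-sym u v e = let (p , q) = ∧-true e in ∧-intro (gsym G u v p) (case ∨-true q of λ where
      (inj₁ r) → ∨-introʳ {I v} r
      (inj₂ r) → ∨-introˡ r)

    K : Good g k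
    K = Sub.good (subgraph G k-sym λ u v e → proj₁ (∧-true e))

    E = emb K

    at-I : ∀ {w} → I w ≡ true → ∀ x → a w x ≡ k w x
    at-I {w} iw x = bool-ext (λ e → ∧-intro e (∨-introˡ iw)) (λ e → proj₁ (∧-true e))

    ends : ∀ {u v} → k u v ≡ true → (I u ≡ true × H v ≡ true) ⊎ (H u ≡ true × I v ≡ true)
    ends {u} {v} e = let (p , q) = ∧-true e in case ∨-true q of λ where
      (inj₁ r) → inj₁ (r , high u v r p)
      (inj₂ r) → inj₂ (high v u r (gsym G u v p) , r)

    ends-H : ∀ {u v} → H u ≡ true → k u v ≡ true → I v ≡ true
    ends-H {u} hu e with ends e
    ... | inj₁ (iu , _) = ⊥-elim (true≢false hu (low u iu))
    ... | inj₂ (_ , iv) = iv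

    ends-I : ∀ {u v} → I u ≡ true → k u v ≡ true → H v ≡ true
    ends-I {u} iu e with ends e
    ... | inj₁ (_ , hv) = hv
    ... | inj₂ (hu , _) = ⊥-elim (true≢false hu (low u iu))

    hub : ∀ u v → k u v ≡ true → ∃[ s ] ∃[ t ] (H s ≡ true × k s t ≡ true × Orb (face E) (u , v) (s , t))
    hub u v e with ends e
    ... | inj₁ (_ , hv) = v , nx (E v) u , hv , row-closed (E v) (k-sym u v e) , orb-step
    ... | inj₂ (hu , _) = u , v , hu , e , orb-refl

    turns : ∀ {t s} → I t ≡ true → k t s ≡ true → nx (E t) s ≢ s
    turns {t} {s} it e fix = <⇒≱ (deg≥3 t it) (≤-trans (≤-reflexive (count-cong (finFinite n) (at-I it)))
      (≤-trans (count-cover (finFinite n) (k t) (λ (_ : Fin 1) → s) λ x kx → zero , row-fixed (E t) e kx fix) (s≤s z≤n)))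

    next : ∀ s t → H s ≡ true → k s t ≡ true → nx (E s) t ≡ t ⊎
      ∃[ s' ] ∃[ t' ] (H s' ≡ true × k s' t' ≡ true × (s' , t') ≢ (s , t) × Orb (face E) (s , t) (s' , t'))
    next s t hs e = inj₂ (s' , nx (E s') t , ends-I it ts' , row-closed (E s') (k-sym t s' ts')
        , (λ q → turns it (k-sym s t e) (,-injectiveˡ q)) , (2 , refl))
      where
      s' = nx (E t) s
      it = ends-H hs e
      ts' : k t s' ≡ true
      ts' = row-closed (E t) (k-sym s t e)

    deg≥ : ∀ u → H u ≡ false → isolated k u ≡ false → 2 + ind (I u) ≤ degree k u
    deg≥ u hu iu = by-membership (I u) refl
      where
      by-membership : ∀ b → I u ≡ b → 2 + ind b ≤ degree k u
      by-membership true e = ≤-trans (deg≥3 u e) (≤-reflexive (count-cong (finFinite n) (at-I e)))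
      by-membership false e = ⊥-elim (true≢false (isolated-intro {a = k} {u} λ v → ≢true λ q → case ends q of λ where
            (inj₁ (p , _)) → true≢false p e
            (inj₂ (p , _)) → true≢false p hu) iu)

    off-I : ∀ u → I u ≡ true → H u ≡ false × isolated k u ≡ false
    off-I u e = low u e , ≢true λ q → <⇒≱ (deg≥3 u e) (≤-trans
      (≤-reflexive (trans (count-cong (finFinite n) (at-I e)) (≡ᵇ-true {countF n (k u)} q))) z≤n)

    isolated-apart : iso k ≤ comps k
    isolated-apart = comps-separated k k-sym (isolated k) λ where
      u v iu _ [] → refl
      u v iu _ (e ∷ _) → ⊥-elim (true≢false e (isolated-elim {a = k} iu _))

  -- Only the edges at `I` are kept, so faces alternate between `I` and hubs. At a vertex of `I`,
  -- having degree at least three, the rotation moves on to a different hub, so every face has two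
  -- hub darts.
  all-hub-bound : countF n I ≤ 3 * countF n H + 4 * g
  all-hub-bound = hub-bound K H hub next 0 isolated-apart I deg≥ off-I

-- Crossing paths and the faces they bound

s4 : Fin 4 → Fin 4
s4 zero = suc zero
s4 (suc zero) = suc (suc zero)
s4 (suc (suc zero)) = suc (suc (suc zero))
s4 (suc (suc (suc zero))) = zero

opp : Fin 4 → Fin 4
opp r = s4 (s4 r)

private
  s4-opp-s4 : ∀ r → s4 (opp (s4 r)) ≡ r
  s4-opp-s4 zero = refl
  s4-opp-s4 (suc zero) = refl
  s4-opp-s4 (suc (suc zero)) = refl
  s4-opp-s4 (suc (suc (suc zero))) = refl

  s4≢ : ∀ r → s4 r ≢ r
  s4≢ zero ()
  s4≢ (suc zero) ()
  s4≢ (suc (suc zero)) ()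
  s4≢ (suc (suc (suc zero))) ()

  opp≢ : ∀ r → opp r ≢ r
  opp≢ zero ()
  opp≢ (suc zero) ()
  opp≢ (suc (suc zero)) ()
  opp≢ (suc (suc (suc zero))) ()

  s4-opp≢ : ∀ r → s4 (opp r) ≢ r
  s4-opp≢ zero ()
  s4-opp≢ (suc zero) ()
  s4-opp≢ (suc (suc zero)) ()
  s4-opp≢ (suc (suc (suc zero))) ()

  opp-opp : ∀ r → opp (opp r) ≡ r
  opp-opp r = s4-opp-s4 r

corners : ∀ {n} → (Fin 4 → Fin n) → List (Fin n)
corners p = map p (allFin 4)

∈-corners : ∀ {n} (p : Fin 4 → Fin n) r → p r ∈ corners p
∈-corners p r = ∈-map⁺ p (∈-allFin r)

-- Two paths p 0 — w — p 2 and p 1 — w — p 3 that cross at w; each closes up to a triangle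
-- unless both its ends are hubs.
record Bow {n g} {a : Gr n} (G : Good g a) (H : Fin n → Bool) (w : Fin n) (p : Fin 4 → Fin n) : Set where
  field
    spokes   : ∀ r → a w (p r) ≡ true
    distinct : ∀ {r r'} → p r ≡ p r' → r ≡ r'
    order    : ∀ r → Arc (nx (emb G w)) (corners p) (p r) (p (s4 r))
    chords   : ∀ r → a (p r) (p (opp r)) ≡ true ⊎ (H (p r) ≡ true × H (p (opp r)) ≡ true)

Petal : ∀ {n} → (Fin 4 → Fin n) → Fin n → Fin n → Set
Petal p w x = x ≡ w ⊎ ∃[ r ] x ≡ p r

-- A chord between two hubs is left out: it need not exist in the graph, and a face leaving `w` for
-- a hub meets a hub dart there anyway.
data BowEdge {n} (H I : Fin n → Bool) (p : Fin n → Fin 4 → Fin n) : Fin n → Fin n → Set where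
  spoke : ∀ {w} r → I w ≡ true → BowEdge H I p w (p w r)
  ekops : ∀ {w} r → I w ≡ true → BowEdge H I p (p w r) w
  chord : ∀ {w} r → I w ≡ true → H (p w r) ∧ H (p w (opp r)) ≡ false → BowEdge H I p (p w r) (p w (opp r))

-- H′ enlarges H so that every petal contains a hub.
module BowFaces {n g} {k : Gr n} (K : Good g k) (H H′ I : Fin n → Bool) (p : Fin n → Fin 4 → Fin n)
  (k→KE : ∀ {u v} → k u v ≡ true → BowEdge H I p u v) (KE→k : ∀ {u v} → BowEdge H I p u v → k u v ≡ true)
  (distinct : ∀ {w} → I w ≡ true → ∀ {r r'} → p w r ≡ p w r' → r ≡ r')
  (own : ∀ {w w' r r'} → I w ≡ true → I w' ≡ true → H (p w r) ≡ false → p w r ≡ p w' r' → w ≡ w' × p w r ≡ p w r')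
  (not-point : ∀ {w w' r} → I w ≡ true → I w' ≡ true → w ≢ p w' r)
  (nx-centre : ∀ {w} → I w ≡ true → ∀ r → nx (emb K w) (p w r) ≡ p w (s4 r))
  (unhub : ∀ {x} → H′ x ≡ false → H x ≡ false)
  (low′ : ∀ {w} → I w ≡ true → H′ w ≡ false)
  (has-hub : ∀ {w} → I w ≡ true → ∃[ r ] H′ (p w r) ≡ true)
  where

  private
    KE = BowEdge H I p
    k-sym = gsym K
    E = emb K

    half-low : ∀ {w r} → H (p w r) ≡ false → H (p w r) ∧ H (p w (opp r)) ≡ false
    half-low {w} {r} h = ≢true λ e → true≢false (proj₁ (∧-true e)) h

    -- A non-hub point belongs to one bow only, by `own`. Within `k` it sees just `w` and the
    -- opposite point, so the way of a face through it is forced.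
    nbr-point : ∀ {w r t} → I w ≡ true → H (p w r) ≡ false → KE (p w r) t → t ≡ w ⊎ t ≡ p w (opp r)
    nbr-point {w} {r} iw h e = go e refl
      where
      go : ∀ {u t} → KE u t → u ≡ p w r → t ≡ w ⊎ t ≡ p w (opp r)
      go (spoke r' iw') eq = ⊥-elim (not-point iw' iw eq)
      go (ekops {w'} r' iw') eq with own {w} {w'} {r} {r'} iw iw' h (sym eq)
      ... | refl , _ = inj₁ refl
      go (chord {w'} r' iw' _) eq with own {w} {w'} {r} {r'} iw iw' h (sym eq)
      ... | refl , q with distinct iw q
      ...   | refl = inj₂ refl

    module _ {w r} (iw : I w ≡ true) (h : H (p w r) ≡ false) where
      private
        kw : k (p w r) w ≡ true
        kw = KE→k (ekops r iw)
        ko : k (p w r) (p w (opp r)) ≡ true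
        ko = KE→k (chord r iw (half-low {w} {r} h))
        w≢o : w ≢ p w (opp r)
        w≢o = not-point iw iw

      nx-pointʷ : nx (E (p w r)) w ≡ p w (opp r)
      nx-pointʷ with nbr-point {w} {r} iw h (k→KE (row-closed (E (p w r)) kw))
      ... | inj₁ e = ⊥-elim (w≢o (row-fixed (E (p w r)) kw ko e))
      ... | inj₂ e = e

      nx-pointᵒ : nx (E (p w r)) (p w (opp r)) ≡ w
      nx-pointᵒ with nbr-point {w} {r} iw h (k→KE (row-closed (E (p w r)) ko))
      ... | inj₁ e = e
      ... | inj₂ e = ⊥-elim (w≢o (sym (row-fixed (E (p w r)) ko kw e)))

    HubDart : Dart n → Dart n → Set
    HubDart d (s , t) = H′ s ≡ true × k s t ≡ true × Orb (face E) d (s , t)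

    Leave : ∀ w (r : Fin 4) → Set
    Leave w r = (∃[ t ] HubDart (w , p w r) (p w r , t)) ⊎ (∃[ t ] HubDart (w , p w r) (p w (opp r) , t)) ⊎
      (H′ (p w r) ≡ false × H′ (p w (opp r)) ≡ false × Orb (face E) (w , p w r) (w , p w (s4 (opp r))))

    -- After the spoke to `p w r` a face meets a hub there or at the opposite point; or both are
    -- low, and it runs round the triangle and leaves `w` again along the spoke after the opposite
    -- one.
    leave : ∀ {w} → I w ≡ true → ∀ r → Leave w r
    leave {w} iw r with bool-cases (H′ (p w r))
    ... | inj₁ h = inj₁ (nx (E (p w r)) w , h , row-closed (E (p w r)) (KE→k (ekops r iw)) , orb-step)
    ... | inj₂ h with bool-cases (H′ (p w (opp r)))
    ...   | inj₁ h' = inj₂ (inj₁ (nx (E (p w (opp r))) (p w r) , h'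
              , row-closed (E (p w (opp r))) (k-sym _ _ (KE→k (chord r iw (half-low {w} {r} (unhub h)))))
              , (2 , cong (face E) (cong (p w r ,_) (nx-pointʷ iw (unhub h))))))
    ...   | inj₂ h' = inj₂ (inj₂ (h , h' , (3 , trans (cong (face E) (trans (cong (face E) (cong (p w r ,_) (nx-pointʷ iw (unhub h))))
              (cong (p w (opp r) ,_) (trans (cong (nx (E (p w (opp r)))) (cong (p w) (sym (opp-opp r)))) (nx-pointᵒ {w} {opp r} iw (unhub h'))))))
              (cong (w ,_) (nx-centre iw (opp r))))))

    all-low : ∀ {w r} → I w ≡ true → H′ (p w r) ≡ false → H′ (p w (opp r)) ≡ false →
      H′ (p w (s4 (opp r))) ≡ false → H′ (p w (opp (s4 (opp r)))) ≡ false → ⊥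
    all-low {w} {r} iw h₀ h₁ h₂ h₃ = let (s , e) = has-hub iw in true≢false e (cover r s h₀ h₁ h₂ h₃)
      where
      cover : ∀ r s → H′ (p w r) ≡ false → H′ (p w (opp r)) ≡ false →
        H′ (p w (s4 (opp r))) ≡ false → H′ (p w (opp (s4 (opp r)))) ≡ false → H′ (p w s) ≡ false
      cover zero zero h₀ h₁ h₂ h₃ = h₀
      cover zero (suc zero) h₀ h₁ h₂ h₃ = h₃
      cover zero (suc (suc zero)) h₀ h₁ h₂ h₃ = h₁
      cover zero (suc (suc (suc zero))) h₀ h₁ h₂ h₃ = h₂
      cover (suc zero) zero h₀ h₁ h₂ h₃ = h₂
      cover (suc zero) (suc zero) h₀ h₁ h₂ h₃ = h₀
      cover (suc zero) (suc (suc zero)) h₀ h₁ h₂ h₃ = h₃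
      cover (suc zero) (suc (suc (suc zero))) h₀ h₁ h₂ h₃ = h₁
      cover (suc (suc zero)) zero h₀ h₁ h₂ h₃ = h₁
      cover (suc (suc zero)) (suc zero) h₀ h₁ h₂ h₃ = h₂
      cover (suc (suc zero)) (suc (suc zero)) h₀ h₁ h₂ h₃ = h₀
      cover (suc (suc zero)) (suc (suc (suc zero))) h₀ h₁ h₂ h₃ = h₃
      cover (suc (suc (suc zero))) zero h₀ h₁ h₂ h₃ = h₃
      cover (suc (suc (suc zero))) (suc zero) h₀ h₁ h₂ h₃ = h₁
      cover (suc (suc (suc zero))) (suc (suc zero)) h₀ h₁ h₂ h₃ = h₂
      cover (suc (suc (suc zero))) (suc (suc (suc zero))) h₀ h₁ h₂ h₃ = h₀

    -- As the paths cross, the spoke after the opposite one belongs to the other path. Two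
    -- successive trips without a hub would thus make all four points low, against `has-hub`.
    reach : ∀ {w} → I w ≡ true → ∀ r → ∃[ s ] ∃[ t ] HubDart (w , p w r) (s , t)
    reach {w} iw r with leave iw r
    ... | inj₁ (t , h) = p w r , t , h
    ... | inj₂ (inj₁ (t , h)) = p w (opp r) , t , h
    ... | inj₂ (inj₂ (h , h' , o)) with leave iw (s4 (opp r))
    ...   | inj₁ (t , x , y , o') = _ , t , x , y , orb-trans o o'
    ...   | inj₂ (inj₁ (t , x , y , o')) = _ , t , x , y , orb-trans o o'
    ...   | inj₂ (inj₂ (h₂ , h₃ , _)) = ⊥-elim (all-low {w} {r} iw h h' h₂ h₃)

    enter : ∀ {w} → I w ≡ true → ∀ r → Orb (face E) (p w r , w) (w , p w (s4 r))
    enter iw r = 1 , cong (_ ,_) (nx-centre iw r)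

    cross : ∀ {w r} → I w ≡ true → H′ (p w (opp r)) ≡ false → Orb (face E) (p w r , p w (opp r)) (w , p w (s4 (opp r)))
    cross {w} {r} iw h = orb-trans (1 , cong (p w (opp r) ,_)
      (trans (cong (nx (E (p w (opp r)))) (cong (p w) (sym (opp-opp r)))) (nx-pointᵒ {w} {opp r} iw (unhub h)))) (enter iw (opp r))

    hub : ∀ u v → k u v ≡ true → ∃[ s ] ∃[ t ] HubDart (u , v) (s , t)
    hub u v e = go (k→KE e)
      where
      after : ∀ {d d' : Dart n} → Orb (face E) d d' → ∃[ s ] ∃[ t ] HubDart d' (s , t) → ∃[ s ] ∃[ t ] HubDart d (s , t)
      after o (s , t , x , y , o') = s , t , x , y , orb-trans o o'
      go : ∀ {u v} → KE u v → ∃[ s ] ∃[ t ] HubDart (u , v) (s , t)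
      go (spoke r iw) = reach iw r
      go (ekops r iw) = after (enter iw r) (reach iw (s4 r))
      go e@(chord {w} r iw nh) with bool-cases (H′ (p w (opp r)))
      ... | inj₁ h = p w (opp r) , nx (E (p w (opp r))) (p w r) , h , row-closed (E (p w (opp r))) (k-sym _ _ (KE→k e)) , orb-step
      ... | inj₂ h = after (cross {w} {r} iw h) (reach iw (s4 (opp r)))

    Next : Fin n → Fin n → Set
    Next s t = nx (E s) t ≡ t ⊎
      ∃[ s' ] ∃[ t' ] (H′ s' ≡ true × k s' t' ≡ true × (s' , t') ≢ (s , t) × Orb (face E) (s , t) (s' , t'))

    -- A face that comes back along the same edge goes on with the next dart at `s`. This is a
    -- second hub dart unless `s` has degree one, the case `nx (E s) t ≡ t`.
    back-again : ∀ {s t} → H′ s ≡ true → k s t ≡ true → Orb (face E) (s , t) (t , s) → Next s t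
    back-again {s} {t} hs e o with decide (nx (E s) t ≟ t)
    ... | inj₁ fix = inj₁ fix
    ... | inj₂ ne = inj₂ (s , nx (E s) t , hs , row-closed (E s) e , (ne ∘ ,-injectiveʳ) , orb-trans o orb-step)

    elsewhere : ∀ {w r r' t t' d} → I w ≡ true → r' ≢ r → Orb (face E) (p w r , t) d → HubDart d (p w r' , t') → Next (p w r) t
    elsewhere {w} {r} {r'} {t' = t'} iw ne o (h , e , o') = inj₂ (p w r' , t' , h , e
      , (λ q → ne (distinct iw (,-injectiveˡ q))) , orb-trans o o')

    next : ∀ s t → H′ s ≡ true → k s t ≡ true → Next s t
    next s t hs e = go (k→KE e) hs
      where
      go : ∀ {s t} → KE s t → H′ s ≡ true → Next s t
      go (spoke r iw) hs = ⊥-elim (true≢false hs (low′ iw))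
      go ke@(ekops {w} r iw) hs with leave iw (s4 r)
      ... | inj₁ (_ , h) = elsewhere {w} {r} {s4 r} iw (s4≢ r) (enter iw r) h
      ... | inj₂ (inj₁ (_ , h)) = elsewhere {w} {r} {opp (s4 r)} iw (s4-opp≢ r) (enter iw r) h
      ... | inj₂ (inj₂ (_ , _ , o)) = back-again hs (KE→k ke)
              (orb-trans (enter iw r) (subst (λ x → Orb (face E) (w , p w (s4 r)) (w , p w x)) (s4-opp-s4 r) o))
      go ke@(chord {w} r iw nh) hs with bool-cases (H′ (p w (opp r)))
      ... | inj₁ h = inj₂ (p w (opp r) , nx (E (p w (opp r))) (p w r) , h
              , row-closed (E (p w (opp r))) (k-sym _ _ (KE→k ke)) , (λ q → opp≢ r (distinct iw (,-injectiveˡ q))) , orb-step)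
      ... | inj₂ h with leave iw (s4 (opp r))
      ...   | inj₁ (_ , hd) = elsewhere {w} {r} {s4 (opp r)} iw (s4-opp≢ r) (cross {w} {r} iw h) hd
      ...   | inj₂ (inj₁ (_ , hd)) = elsewhere {w} {r} {opp (s4 (opp r))} iw (λ q → s4≢ r (trans (sym (opp-opp (s4 r))) q))
                (cross {w} {r} iw h) hd
      ...   | inj₂ (inj₂ (_ , _ , o)) = back-again hs (KE→k ke) (orb-trans (cross {w} {r} iw h)
                (orb-trans (subst (λ x → Orb (face E) (w , p w (s4 (opp r))) (w , p w x)) (s4-opp-s4 (opp r)) o)
                  (1 , cong (p w (opp r) ,_) (trans (nx-pointʷ {w} {opp r} iw (unhub h)) (cong (p w) (opp-opp r))))))

    deg≥ : ∀ u → H′ u ≡ false → isolated k u ≡ false → 2 + ind (I u) ≤ degree k u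
    deg≥ u h iu = by-membership (I u) refl
      where
      two : ∀ {u t} → KE u t → H′ u ≡ false → I u ≡ false → 2 ≤ degree k u
      two (spoke r iw) _ iu = ⊥-elim (true≢false iw iu)
      two (ekops {w} r iw) h _ = count-inj (finFinite n) (k (p w r)) (λ { zero → w ; (suc zero) → p w (opp r) })
        (λ { zero → KE→k (ekops r iw) ; (suc zero) → KE→k (chord r iw (half-low {w} {r} (unhub h))) })
        λ { zero zero _ → refl ; (suc zero) (suc zero) _ → refl
          ; zero (suc zero) q → ⊥-elim (not-point iw iw q)
          ; (suc zero) zero q → ⊥-elim (not-point iw iw (sym q)) }
      two (chord {w} r iw _) h iu = two (ekops {w = w} r iw) h iu
      outside : I u ≡ false → ∀ b → anyF n (k u) ≡ b → 2 ≤ degree k u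
      outside e true q = two (k→KE (proj₂ (anyF-true n q))) h e
      outside e false q = ⊥-elim (true≢false (isolated-intro {a = k} {u} λ v → ≢true λ x → true≢false (anyF-intro n v x) q) iu)
      by-membership : ∀ b → I u ≡ b → 2 + ind b ≤ degree k u
      by-membership true e = ≤-trans (n≤1+n 3) (count-inj (finFinite n) (k u) (p u) (λ r → KE→k (spoke r e)) λ _ _ → distinct e)
      by-membership false e = outside e (anyF n (k u)) refl

    off-I : ∀ u → I u ≡ true → H′ u ≡ false × isolated k u ≡ false
    off-I u iu = low′ iu , ≢true λ e → true≢false (KE→k (spoke zero iu)) (isolated-elim {a = k} e (p u zero))

  face-hub : ∀ u v → k u v ≡ true → ∃[ s ] ∃[ t ] (H′ s ≡ true × k s t ≡ true × Orb (face (emb K)) (u , v) (s , t))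
  face-hub = hub

  face-next : ∀ s t → H′ s ≡ true → k s t ≡ true → nx (emb K s) t ≡ t ⊎
    ∃[ s' ] ∃[ t' ] (H′ s' ≡ true × k s' t' ≡ true × (s' , t') ≢ (s , t) × Orb (face (emb K)) (s , t) (s' , t'))
  face-next = next

  bow-degree : ∀ u → H′ u ≡ false → isolated k u ≡ false → 2 + ind (I u) ≤ degree k u
  bow-degree = deg≥

  bow-off : ∀ u → I u ≡ true → H′ u ≡ false × isolated k u ≡ false
  bow-off = off-I

  nbr-low : ∀ {w r t} → I w ≡ true → H (p w r) ≡ false → k (p w r) t ≡ true → t ≡ w ⊎ t ≡ p w (opp r)
  nbr-low {w} {r} iw h e = nbr-point {w} {r} iw h (k→KE e)

module _ {n g} {a : Gr n} (G : Good g a) (H I : Fin n → Bool) (p : Fin n → Fin 4 → Fin n)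
  (low : ∀ w → I w ≡ true → H w ≡ false)
  (bow : ∀ w → I w ≡ true → Bow G H w (p w))
  (disjoint : ∀ w w' x → I w ≡ true → I w' ≡ true → H x ≡ false → Petal (p w) w x → Petal (p w') w' x → w ≡ w')
  where

  private
    module B {w} (iw : I w ≡ true) = Bow (bow w iw)

    KE = BowEdge H I p

    edgeAt : Fin n → Fin n → Fin n → Fin 4 → Bool
    edgeAt u v w r = (eqF u w ∧ eqF v (p w r)) ∨ (eqF u (p w r) ∧ eqF v w) ∨
      (eqF u (p w r) ∧ (eqF v (p w (opp r)) ∧ not (H (p w r) ∧ H (p w (opp r)))))

    abstract
      k : Gr n
      k u v = anyF n λ w → I w ∧ anyF 4 (edgeAt u v w)

      k→KE : ∀ {u v} → k u v ≡ true → KE u v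
      k→KE {u} {v} e with anyF-true n e
      ... | w , e₁ with ∧-true e₁
      ...   | iw , e₂ with anyF-true 4 {edgeAt u v w} e₂
      ...     | r , e₃ with ∨-true e₃
      ...       | inj₁ q with ∧-true q
      ...         | q₁ , q₂ with eqF-true {i = u} {w} q₁ | eqF-true {i = v} {p w r} q₂
      ...           | refl | refl = spoke r iw
      k→KE {u} {v} e | w , e₁ | iw , e₂ | r , e₃ | inj₂ q′ with ∨-true q′
      ... | inj₁ q with ∧-true q
      ...   | q₁ , q₂ with eqF-true {i = u} {p w r} q₁ | eqF-true {i = v} {w} q₂
      ...     | refl | refl = ekops r iw
      k→KE {u} {v} e | w , e₁ | iw , e₂ | r , e₃ | inj₂ q′ | inj₂ q with ∧-true q
      ... | q₁ , q₂ with ∧-true q₂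
      ...   | q₃ , q₄ with eqF-true {i = u} {p w r} q₁ | eqF-true {i = v} {p w (opp r)} q₃
      ...     | refl | refl = chord r iw (not-true q₄)

      KE→k : ∀ {u v} → KE u v → k u v ≡ true
      KE→k (spoke {w} r iw) = anyF-intro n w (∧-intro iw (anyF-intro 4 {edgeAt w (p w r) w} r
        (∨-introˡ (∧-intro (eqF-intro {i = w} refl) (eqF-intro {i = p w r} refl)))))
      KE→k (ekops {w} r iw) = anyF-intro n w (∧-intro iw (anyF-intro 4 {edgeAt (p w r) w w} r
        (∨-introʳ {eqF (p w r) w ∧ eqF w (p w r)} (∨-introˡ (∧-intro (eqF-intro {i = p w r} refl) (eqF-intro {i = w} refl))))))
      KE→k (chord {w} r iw nh) = anyF-intro n w (∧-intro iw (anyF-intro 4 {edgeAt (p w r) (p w (opp r)) w} r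
        (∨-introʳ {eqF (p w r) w ∧ eqF (p w (opp r)) (p w r)} (∨-introʳ {eqF (p w r) (p w r) ∧ eqF (p w (opp r)) w}
          (∧-intro (eqF-intro {i = p w r} refl) (∧-intro (eqF-intro {i = p w (opp r)} refl) (not-intro λ e → true≢false e nh)))))))

    KE-sym : ∀ {u v} → KE u v → KE v u
    KE-sym (spoke r iw) = ekops r iw
    KE-sym (ekops r iw) = spoke r iw
    KE-sym (chord {w} r iw nh) = subst (λ s → KE (p w (opp r)) (p w s)) (opp-opp r)
      (chord (opp r) iw (≢true λ e → true≢false (let (x , y) = ∧-true e in
        ∧-intro (subst (λ s → H (p w s) ≡ true) (opp-opp r) y) x) nh))

    k-sym : Symm k
    k-sym u v e = KE→k (KE-sym (k→KE e))

    KE-sub : ∀ {u v} → KE u v → a u v ≡ true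
    KE-sub (spoke r iw) = B.spokes iw r
    KE-sub (ekops r iw) = gsym G _ _ (B.spokes iw r)
    KE-sub (chord r iw nh) with B.chords iw r
    ... | inj₁ e = e
    ... | inj₂ (h , h') = ⊥-elim (true≢false (∧-intro h h') nh)

    S : Sub G k
    S = subgraph G k-sym λ u v e → KE-sub (k→KE e)

    K : Good g k
    K = Sub.good S

    E = emb K

    own : ∀ {w w' r r'} → I w ≡ true → I w' ≡ true → H (p w r) ≡ false → p w r ≡ p w' r' → w ≡ w' × p w r ≡ p w r'
    own {w} {w'} {r} {r'} iw iw' h e with disjoint w w' (p w r) iw iw' h (inj₂ (r , refl)) (inj₂ (r' , e))
    ... | refl = refl , e

    not-point : ∀ {w w' r} → I w ≡ true → I w' ≡ true → w ≢ p w' r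
    not-point {w} {w'} {r} iw iw' e with disjoint w w' w iw iw' (low w iw) (inj₁ refl) (inj₂ (r , e))
    ... | refl = irr≢ {a = a} (girr G) (B.spokes iw r) e

    nbr-centre : ∀ {w t} → I w ≡ true → KE w t → ∃[ r ] t ≡ p w r
    nbr-centre {w} iw e = go e refl
      where
      go : ∀ {u t} → KE u t → u ≡ w → ∃[ r ] t ≡ p w r
      go (spoke r _) refl = r , refl
      go (ekops r iw') eq = ⊥-elim (not-point iw iw' (sym eq))
      go (chord r iw' _) eq = ⊥-elim (not-point iw iw' (sym eq))

    nx-centre : ∀ {w} → I w ≡ true → ∀ r → nx (E w) (p w r) ≡ p w (s4 r)
    nx-centre {w} iw r = Sub.arcs S w (corners (p w))
      (λ t m → let (s , _ , e) = ∈-map⁻ (p w) m in KE→k (subst (KE w) (sym e) (spoke s iw)))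
      (λ t e → let (s , q) = nbr-centre iw (k→KE e) in subst (_∈ corners (p w)) (sym q) (∈-corners (p w) s))
      (∈-corners (p w) r) (∈-corners (p w) (s4 r)) (B.order iw r)

    -- A bow without hubs is a component of its own. Promoting one of its points to a hub costs
    -- three in `hub-bound`, while the extra component gains four.
    unhubbed : Fin n → Bool
    unhubbed w = I w ∧ not (anyF 4 λ r → H (p w r))

    abstract
      H′ : Fin n → Bool
      H′ u = H u ∨ anyF n λ w → unhubbed w ∧ eqF u (p w zero)

      H′-cases : ∀ {u} → H′ u ≡ true → H u ≡ true ⊎ ∃[ w ] (unhubbed w ≡ true × u ≡ p w zero)
      H′-cases {u} e = case ∨-true e of λ where
        (inj₁ h) → inj₁ h
        (inj₂ q) → let (w , s) = anyF-true n q ; (uw , eq) = ∧-true s in inj₂ (w , uw , eqF-true {i = u} eq)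

      H⊆H′ : ∀ {u} → H u ≡ true → H′ u ≡ true
      H⊆H′ = ∨-introˡ

      new-hub : ∀ {w} → unhubbed w ≡ true → H′ (p w zero) ≡ true
      new-hub {w} uw = ∨-introʳ {H (p w zero)} (anyF-intro n w (∧-intro uw (eqF-intro {i = p w zero} refl)))

    unhubbed-low : ∀ {w} → unhubbed w ≡ true → I w ≡ true × (∀ r → H (p w r) ≡ false)
    unhubbed-low {w} e = let (iw , q) = ∧-true e in iw , λ r → ≢true λ h →
      true≢false (anyF-intro 4 {λ r → H (p w r)} r h) (not-true q)

    low′ : ∀ {w} → I w ≡ true → H′ w ≡ false
    low′ {w} iw = ≢true λ e → case H′-cases e of λ where
      (inj₁ h) → true≢false h (low w iw)
      (inj₂ (w' , uw' , eq)) → not-point iw (proj₁ (unhubbed-low uw')) eq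

    has-hub : ∀ {w} → I w ≡ true → ∃[ r ] H′ (p w r) ≡ true
    has-hub {w} iw with anyF 4 (λ r → H (p w r)) in q
    ... | true = let (r , h) = anyF-true 4 {λ r → H (p w r)} q in r , H⊆H′ h
    ... | false = zero , new-hub (∧-intro iw (not-intro λ e → true≢false e q))

    module F = BowFaces K H H′ I p k→KE KE→k (λ iw → B.distinct iw) own not-point nx-centre
      (λ h → ≢true λ e → true≢false (H⊆H′ e) h) low′ has-hub

    special : Fin n → Bool
    special u = unhubbed u ∨ isolated k u

    petal-closed : ∀ {w u t} → unhubbed w ≡ true → Petal (p w) w u → Path k u t → Petal (p w) w t
    petal-closed uw m [] = m
    petal-closed {w} uw m (e ∷ q) = petal-closed uw (one m e) q
      where
      iw = proj₁ (unhubbed-low uw)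
      one : ∀ {u v} → Petal (p w) w u → k u v ≡ true → Petal (p w) w v
      one (inj₁ refl) e = inj₂ (nbr-centre iw (k→KE e))
      one (inj₂ (r , refl)) e with F.nbr-low {w} {r} iw (proj₂ (unhubbed-low uw) r) e
      ... | inj₁ q = inj₁ q
      ... | inj₂ q = inj₂ (opp r , q)

    isolated-end : ∀ {u v} → isolated k u ≡ true → Path k u v → u ≡ v
    isolated-end iu [] = refl
    isolated-end iu (e ∷ _) = ⊥-elim (true≢false e (isolated-elim {a = k} iu _))

    special-apart : ∀ u v → special u ≡ true → special v ≡ true → Path k u v → u ≡ v
    special-apart u v su sv q with ∨-true su | ∨-true sv
    ... | inj₂ iu | _ = isolated-end iu q
    ... | inj₁ _ | inj₂ iv = sym (isolated-end iv (path-sym k-sym q))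
    ... | inj₁ uu | inj₁ uv = disjoint u v v (proj₁ (unhubbed-low uu)) (proj₁ (unhubbed-low uv))
            (low v (proj₁ (unhubbed-low uv))) (petal-closed uu (inj₁ refl) q) (inj₁ refl)

    comps≥ : countF n unhubbed + iso k ≤ comps k
    comps≥ = ≤-trans (≤-reflexive (trans (sym (sumL-+ _ _ (allFin n))) (sumL-cong (allFin n) pt)))
      (comps-separated k k-sym special special-apart)
      where
      pt : ∀ u → ind (unhubbed u) + ind (isolated k u) ≡ ind (special u)
      pt u with unhubbed u in q
      ... | false = refl
      ... | true = cong (λ b → suc (ind b)) (proj₂ (F.bow-off u (proj₁ (unhubbed-low q))))

    hubs≤ : countF n H′ ≤ countF n H + countF n unhubbed
    hubs≤ = begin
      countF n H′ ≤⟨ sumL-mono (allFin n) pt ⟩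
      sumF n (λ u → ind (H u) + sumF n (λ w → at w u)) ≡⟨ sumL-+ (λ u → ind (H u)) _ (allFin n) ⟩
      countF n H + sumF n (λ u → sumF n (λ w → at w u)) ≡⟨ cong (countF n H +_) (sumL-swap (λ u w → at w u) (allFin n) (allFin n)) ⟩
      countF n H + sumF n (λ w → sumF n (λ u → at w u)) ≡⟨ cong (countF n H +_) (sumL-cong (allFin n) λ w →
          trans (sumL-*ˡ (ind (unhubbed w)) _ (allFin n)) (trans (cong (ind (unhubbed w) *_) (count-single (finFinite n) (p w zero))) (*-identityʳ _))) ⟩
      countF n H + countF n unhubbed ∎
      where
      open ≤-Reasoning
      at : Fin n → Fin n → ℕ
      at w u = ind (unhubbed w) * ind (does (u ≟ p w zero))
      pt : ∀ u → ind (H′ u) ≤ ind (H u) + sumF n (λ w → at w u)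
      pt u = by-hub (H′ u) refl
        where
        by-hub : ∀ b → H′ u ≡ b → ind b ≤ ind (H u) + sumF n (λ w → at w u)
        by-hub false _ = z≤n
        by-hub true e with H′-cases e
        ... | inj₁ h = ≤-trans (≤-reflexive (cong ind (sym h))) (m≤m+n _ _)
        ... | inj₂ (w , uw , eq) = ≤-trans (≤-trans
                (≤-reflexive (sym (cong₂ _*_ (cong ind uw) (cong ind (does-intro (u ≟ p w zero) eq)))))
                (sumL-∈ {f = λ w → at w u} (allFin n) (∈-allFin w))) (m≤n+m _ (ind (H u)))

  bow-bound : countF n I ≤ 3 * countF n H + 4 * g
  bow-bound = +-cancelˡ-≤ (4 * q) _ _ (begin
    4 * q + countF n I         ≤⟨ hub-bound K H′ F.face-hub F.face-next q comps≥ I F.bow-degree F.bow-off ⟩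
    3 * countF n H′ + 4 * g    ≤⟨ +-monoˡ-≤ (4 * g) (*-monoʳ-≤ 3 hubs≤) ⟩
    3 * (countF n H + q) + 4 * g ≤⟨ m≤m+n _ q ⟩
    3 * (countF n H + q) + 4 * g + q ≡⟨ lem (countF n H) q (4 * g) ⟩
    4 * q + (3 * countF n H + 4 * g) ∎)
    where
    open ≤-Reasoning
    q = countF n unhubbed
    lem : ∀ h q g → 3 * (h + q) + g + q ≡ 4 * q + (3 * h + g)
    lem = solve-∀

-- Existence of crossing paths at a crowded vertex

module _ {n g} {a : Gr n} (G : Good g a) (H : Fin n → Bool) (w u₀ : Fin n) (wu : a w u₀ ≡ true)
         (crowded : ∀ y → a w y ≡ true → H y ≡ false → 3 ≤ common a w y) (d≥4 : 4 ≤ degree a w) where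

  private
    ρ = emb G w
    f = nx ρ
    d = degree a w

    -- The rotation at `w` is unrolled: positions are natural numbers, repeating with period `d` and
    -- distinct within any window of length `d`, so cyclic order becomes the order of numbers.
    x : ℕ → Fin n
    x j = iter j f u₀

    x-adj : ∀ j → a w (x j) ≡ true
    x-adj zero = wu
    x-adj (suc j) = row-closed ρ (x-adj j)

    x-+ : ∀ i j → x (i + j) ≡ iter i f (x j)
    x-+ i j = iter-+ f i j u₀

    x-period : ∀ j → x (j + d) ≡ x j
    x-period j = trans (x-+ j d) (cong (iter j f) (proj₂ (row-cycle ρ wu)))

    x-sep : ∀ {s t} → s < t → t < s + d → x s ≢ x t
    x-sep {s} {t} s<t t<s+d e = proj₁ (row-cycle ρ (x-adj s)) (t ∸ s) (m<n⇒0<n∸m s<t)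
      (+-cancelˡ-< s _ _ (subst (_< s + d) (sym (m+[n∸m]≡n (<⇒≤ s<t))) t<s+d))
      (trans (sym (x-+ (t ∸ s) s)) (trans (cong x (m∸n+n≡m (<⇒≤ s<t))) (sym e)))

    x-cover : ∀ q {y} → a w y ≡ true → ∃[ r ] (r < d × x (q + r) ≡ y)
    x-cover q e with orb-bounded (finFinite n) (perm ρ) (≤-trans (s≤s z≤n) d≥4) (proj₂ (row-cycle ρ (x-adj q))) (cyc ρ (x-adj q) e)
    ... | r , r<d , eq = r , r<d , trans (trans (cong x (+-comm q r)) (x-+ r q)) eq

    Joined : Fin n → Fin n → Set
    Joined u v = a u v ≡ true ⊎ (H u ≡ true × H v ≡ true)

    joined-sym : ∀ {u v} → Joined u v → Joined v u
    joined-sym (inj₁ e) = inj₁ (gsym G _ _ e)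
    joined-sym (inj₂ (h , h')) = inj₂ (h' , h)

    record Crossing : Set where
      field
        {i j k l} : ℕ
        i<j  : i < j
        j<k  : j < k
        k<l  : k < l
        l<   : l < i + d
        even : Joined (x i) (x k)
        odd  : Joined (x j) (x l)

    Chord : ℕ → Set
    Chord q = ∃[ z ] (2 + q ≤ z × 2 + z ≤ q + d × a (x q) (x z) ≡ true)

    -- A low neighbour shares at least three neighbours with `w`, and only two of them can be next
    -- to it in the rotation; a third lies at a more distant position.
    chord-at : ∀ q → H (x q) ≡ false → Chord q
    chord-at q h with anyN? (λ r → chord? r) d
      where
      chord? : ∀ r → Dec (2 ≤ r × 2 + r ≤ d × a (x q) (x (q + r)) ≡ true)
      chord? r with 2 ≤? r | (2 + r) ≤? d | a (x q) (x (q + r)) ≟ᵇ true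
      ... | yes p | yes p' | yes p'' = yes (p , p' , p'')
      ... | no ¬p | _ | _ = no (¬p ∘ proj₁)
      ... | yes _ | no ¬p | _ = no (¬p ∘ proj₁ ∘ proj₂)
      ... | yes _ | yes _ | no ¬p = no (¬p ∘ proj₂ ∘ proj₂)
    ... | yes (r , _ , p , p' , e) = q + r , subst (_≤ q + r) (+-comm q 2) (+-monoʳ-≤ q p)
          , subst (_≤ q + d) (lem q r) (+-monoʳ-≤ q p') , e
      where
      lem : ∀ q r → q + (2 + r) ≡ 2 + (q + r)
      lem = solve-∀
    ... | no ¬c = ⊥-elim (<⇒≱ (crowded (x q) (x-adj q) h)
          (count-cover (finFinite n) (λ z → a w z ∧ a (x q) z) ends λ z e → let (wz , qz) = ∧-true e in near z wz qz))
      where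
      ends : Fin 2 → Fin n
      ends zero = x (q + 1)
      ends (suc zero) = x (q + (d ∸ 1))
      near : ∀ z → a w z ≡ true → a (x q) z ≡ true → ∃[ i ] ends i ≡ z
      near z wz qz with x-cover q wz
      ... | zero , _ , eq = ⊥-elim (irr≢ {a = a} (girr G) qz (trans (cong x (sym (+-identityʳ q))) eq))
      ... | suc zero , _ , eq = zero , eq
      ... | suc (suc r) , r<d , eq with m≤n⇒m<n∨m≡n r<d
      ...   | inj₁ lt = ⊥-elim (¬c (suc (suc r) , r<d , s≤s (s≤s z≤n) , lt , subst (λ y → a (x q) y ≡ true) (sym eq) qz))
      ...   | inj₂ e = suc zero , trans (cong (λ k → x (q + (k ∸ 1))) (sym e)) eq

    -- If no vertex strictly between s and t is a hub, the chord of s + 1 either crosses the chord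
    -- from s to t or spans a shorter interval of the same kind.
    enclosed : ∀ m s t → t ≤ m + s → 2 + s ≤ t → t < s + d → Joined (x s) (x t) →
      (∀ q → s < q → q < t → H (x q) ≡ false) → Crossing
    enclosed zero s t le lt _ _ _ = ⊥-elim (<⇒≱ lt (≤-trans le (n≤1+n s)))
    enclosed (suc m) s t le lt t<s+d st low with chord-at (suc s) (low (suc s) ≤-refl lt)
    ... | z , lo , hi , e with z ≤? t
    ... | yes z≤t = enclosed m (suc s) z (≤-trans z≤t (subst (t ≤_) (sym (+-suc m s)) le)) lo
            (≤-trans (n≤1+n (suc z)) hi) (inj₁ e)
            (λ q a b → low q (<-trans ≤-refl a) (<-≤-trans b z≤t))
    ... | no z≰t = record { i<j = ≤-refl {suc s} ; j<k = lt ; k<l = ≰⇒> z≰t ; l< = ≤-pred hi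
            ; even = st ; odd = inj₁ e }

    hub-between? : ∀ s t → (∃[ q ] (s < q × q < t × H (x q) ≡ true)) ⊎ (∀ q → s < q → q < t → H (x q) ≡ false)
    hub-between? s t with anyN? (λ q → between? q) t
      where
      between? : ∀ q → Dec (s < q × H (x q) ≡ true)
      between? q with s <? q | H (x q) ≟ᵇ true
      ... | yes p | yes p' = yes (p , p')
      ... | no ¬p | _ = no (¬p ∘ proj₁)
      ... | yes _ | no ¬p = no (¬p ∘ proj₂)
    ... | yes (q , q<t , s<q , h) = inj₁ (q , s<q , q<t , h)
    ... | no ¬q = inj₂ λ q s<q q<t → ≢true λ h → ¬q (q , q<t , s<q , h)

    -- If one side of the chord from `q` has no hub strictly inside, `enclosed` applies to that
    -- side. Otherwise a hub on each side gives a pair that counts as joined and crosses the chord.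
    from-low : ∀ q → H (x q) ≡ false → Crossing
    from-low q h with chord-at q h
    ... | z , lo , hi , e with hub-between? q z
    ... | inj₂ low = enclosed z q z (m≤m+n z q) lo (≤-trans (n≤1+n (suc z)) hi) (inj₁ e) low
    ... | inj₁ (p , q<p , p<z , hp) with hub-between? z (q + d)
    ...   | inj₂ low = enclosed (q + d) z (q + d) (m≤m+n (q + d) z) hi
              (+-monoˡ-< d (≤-trans (n≤1+n (suc q)) lo))
              (inj₁ (subst (λ y → a (x z) y ≡ true) (sym (x-period q)) (gsym G _ _ e))) low
    ...   | inj₁ (r , z<r , r<q+d , hr) = record { i<j = q<p ; j<k = p<z ; k<l = z<r ; l< = r<q+d
              ; even = inj₁ e ; odd = inj₂ (hp , hr) }

    crossing : Crossing
    crossing with H (x 0) in h₀ | H (x 1) in h₁ | H (x 2) in h₂ | H (x 3) in h₃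
    ... | false | _ | _ | _ = from-low 0 h₀
    ... | true | false | _ | _ = from-low 1 h₁
    ... | true | true | false | _ = from-low 2 h₂
    ... | true | true | true | false = from-low 3 h₃
    -- Four consecutive hubs give two crossing pairs; degree at least four keeps the four positions
    -- within one round.
    ... | true | true | true | true = record { i<j = s≤s {0} z≤n ; j<k = s≤s {1} (s≤s z≤n) ; k<l = s≤s {2} (s≤s (s≤s z≤n))
            ; l< = d≥4 ; even = inj₂ (h₀ , h₂) ; odd = inj₂ (h₁ , h₃) }

    open Crossing crossing

    p : Fin 4 → Fin n
    p zero = x i
    p (suc zero) = x j
    p (suc (suc zero)) = x k
    p (suc (suc (suc zero))) = x l

    i<k : i < k
    i<k = <-trans i<j j<k
    j<l : j < l
    j<l = <-trans j<k k<l
    i<l : i < l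
    i<l = <-trans i<k k<l
    j< : j < i + d
    j< = <-trans j<l l<
    k< : k < i + d
    k< = <-trans k<l l<
    widen : ∀ {s t} → i < s → t < i + d → t < s + d
    widen lt lt' = <-trans lt' (+-monoˡ-< d lt)

    p-distinct : ∀ r r' → p r ≡ p r' → r ≡ r'
    p-distinct zero zero e = refl
    p-distinct zero (suc zero) e = ⊥-elim (x-sep i<j j< e)
    p-distinct zero (suc (suc zero)) e = ⊥-elim (x-sep i<k k< e)
    p-distinct zero (suc (suc (suc zero))) e = ⊥-elim (x-sep i<l l< e)
    p-distinct (suc zero) zero e = ⊥-elim (x-sep i<j j< (sym e))
    p-distinct (suc zero) (suc zero) e = refl
    p-distinct (suc zero) (suc (suc zero)) e = ⊥-elim (x-sep j<k (widen i<j k<) e)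
    p-distinct (suc zero) (suc (suc (suc zero))) e = ⊥-elim (x-sep j<l (widen i<j l<) e)
    p-distinct (suc (suc zero)) zero e = ⊥-elim (x-sep i<k k< (sym e))
    p-distinct (suc (suc zero)) (suc zero) e = ⊥-elim (x-sep j<k (widen i<j k<) (sym e))
    p-distinct (suc (suc zero)) (suc (suc zero)) e = refl
    p-distinct (suc (suc zero)) (suc (suc (suc zero))) e = ⊥-elim (x-sep k<l (widen i<k l<) e)
    p-distinct (suc (suc (suc zero))) zero e = ⊥-elim (x-sep i<l l< (sym e))
    p-distinct (suc (suc (suc zero))) (suc zero) e = ⊥-elim (x-sep j<l (widen i<j l<) (sym e))
    p-distinct (suc (suc (suc zero))) (suc (suc zero)) e = ⊥-elim (x-sep k<l (widen i<k l<) (sym e))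
    p-distinct (suc (suc (suc zero))) (suc (suc (suc zero))) e = refl

    walk : ∀ m s t → t ≤ m + s → s < t → (∀ q → s < q → q < t → x q ∉ corners p) → Arc f (corners p) (x s) (x t)
    walk zero s t le lt h = ⊥-elim (<⇒≱ lt le)
    walk (suc m) s t le lt h with m≤n⇒m<n∨m≡n lt
    ... | inj₂ refl = stop refl
    ... | inj₁ lt' = pass (h (suc s) ≤-refl lt') (walk m (suc s) t (subst (t ≤_) (sym (+-suc m s)) le) lt'
            λ q a b → h q (<-trans ≤-refl a) b)

    outside : ∀ q → i < q → q < i + d → q ≢ j → q ≢ k → q ≢ l → x q ∉ corners p
    outside q i<q q< qj qk ql (here e) = x-sep i<q q< (sym e)
    outside q i<q q< qj qk ql (there (here e)) with <-cmp q j
    ... | tri< lt _ _ = x-sep lt (widen i<q j<) e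
    ... | tri≈ _ r _ = qj r
    ... | tri> _ _ gt = x-sep gt (widen i<j q<) (sym e)
    outside q i<q q< qj qk ql (there (there (here e))) with <-cmp q k
    ... | tri< lt _ _ = x-sep lt (widen i<q k<) e
    ... | tri≈ _ r _ = qk r
    ... | tri> _ _ gt = x-sep gt (widen i<k q<) (sym e)
    outside q i<q q< qj qk ql (there (there (there (here e)))) with <-cmp q l
    ... | tri< lt _ _ = x-sep lt (widen i<q l<) e
    ... | tri≈ _ r _ = ql r
    ... | tri> _ _ gt = x-sep gt (widen i<l q<) (sym e)

    arcs : ∀ r → Arc f (corners p) (p r) (p (s4 r))
    arcs zero = walk j i j (m≤m+n j i) i<j λ q lo hi → outside q lo (<-trans hi j<)
      (<⇒≢ hi) (<⇒≢ (<-trans hi j<k)) (<⇒≢ (<-trans hi j<l))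
    arcs (suc zero) = walk k j k (m≤m+n k j) j<k λ q lo hi → outside q (<-trans i<j lo) (<-trans hi k<)
      (>⇒≢ lo) (<⇒≢ hi) (<⇒≢ (<-trans hi k<l))
    arcs (suc (suc zero)) = walk l k l (m≤m+n l k) k<l λ q lo hi → outside q (<-trans i<k lo) (<-trans hi l<)
      (>⇒≢ (<-trans j<k lo)) (>⇒≢ lo) (<⇒≢ hi)
    arcs (suc (suc (suc zero))) = subst (Arc f (corners p) (x l)) (x-period i)
      (walk (i + d) l (i + d) (m≤m+n (i + d) l) l< λ q lo hi → outside q (<-trans i<l lo) hi
        (>⇒≢ (<-trans j<l lo)) (>⇒≢ (<-trans k<l lo)) (>⇒≢ lo))

    joined : ∀ r → Joined (p r) (p (opp r))
    joined zero = even
    joined (suc zero) = odd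
    joined (suc (suc zero)) = joined-sym even
    joined (suc (suc (suc zero))) = joined-sym odd

  crowded-bow : Σ[ p ∈ (Fin 4 → Fin n) ] Bow G H w p
  crowded-bow = p , record
    { spokes = λ { zero → x-adj i ; (suc zero) → x-adj j ; (suc (suc zero)) → x-adj k ; (suc (suc (suc zero))) → x-adj l }
    ; distinct = λ {r} {r'} → p-distinct r r' ; order = arcs ; chords = joined }

-- Greedy packing

module Greedy {V : Set} (X : V → Bool) (conflict : V → V → Bool)
  (conflict-sym : ∀ {v w} → conflict v w ≡ true → conflict w v ≡ true) where

  greedy : List V → List V
  greedy [] = []
  greedy (w ∷ ws) = if X w ∧ not (anyL (conflict w) (greedy ws)) then w ∷ greedy ws else greedy ws

  greedy-X : ∀ ws {w} → w ∈ greedy ws → X w ≡ true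
  greedy-X (v ∷ ws) m with X v ∧ not (anyL (conflict v) (greedy ws)) in e
  greedy-X (v ∷ ws) m | false = greedy-X ws m
  greedy-X (v ∷ ws) (here refl) | true = proj₁ (∧-true e)
  greedy-X (v ∷ ws) (there m) | true = greedy-X ws m

  greedy-apart : ∀ ws {w w'} → w ∈ greedy ws → w' ∈ greedy ws → conflict w w' ≡ true → w ≡ w'
  greedy-apart (v ∷ ws) m m' c with X v ∧ not (anyL (conflict v) (greedy ws)) in e
  greedy-apart (v ∷ ws) m m' c | false = greedy-apart ws m m' c
  greedy-apart (v ∷ ws) (here refl) (here refl) c | true = refl
  greedy-apart (v ∷ ws) (there m) (there m') c | true = greedy-apart ws m m' c
  greedy-apart (v ∷ ws) (here refl) (there m) c | true =
    ⊥-elim (true≢false (anyL-intro (greedy ws) m c) (not-true (proj₂ (∧-true {X v} e))))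
  greedy-apart (v ∷ ws) (there m) (here refl) c | true =
    ⊥-elim (true≢false (anyL-intro (greedy ws) m (conflict-sym c)) (not-true (proj₂ (∧-true {X v} e))))

  greedy-maximal : ∀ ws {w} → w ∈ ws → X w ≡ true → conflict w w ≡ true → ∃[ v ] (v ∈ greedy ws × conflict v w ≡ true)
  greedy-maximal (v ∷ ws) m xw self with X v ∧ not (anyL (conflict v) (greedy ws)) in e
  greedy-maximal (v ∷ ws) (here refl) xw self | true = v , here refl , self
  greedy-maximal (v ∷ ws) (there m) xw self | true = let (u , q , c) = greedy-maximal ws m xw self in u , there q , c
  greedy-maximal (v ∷ ws) (there m) xw self | false = greedy-maximal ws m xw self
  greedy-maximal (v ∷ ws) (here refl) xw self | false = found (bool-cases (anyL (conflict v) (greedy ws)))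
    where
    search : ∀ us → anyL (conflict v) us ≡ true → ∃[ u ] (u ∈ us × conflict u v ≡ true)
    search (u ∷ us) r with ∨-true r
    ... | inj₁ c = u , here refl , conflict-sym c
    ... | inj₂ s = let (y , my , c) = search us s in y , there my , c
    found : anyL (conflict v) (greedy ws) ≡ true ⊎ anyL (conflict v) (greedy ws) ≡ false →
      ∃[ u ] (u ∈ greedy ws × conflict u v ≡ true)
    found (inj₁ q) = search (greedy ws) q
    found (inj₂ q) = ⊥-elim (true≢false (∧-intro xw (not-intro λ r → true≢false r q)) e)

module _ {n g} {a : Gr n} (G : Good g a) where

  hubs : ℕ → Fin n → Bool
  hubs t u = t <ᵇ degree a u

  non-hub : ∀ {t u} → hubs t u ≡ false → degree a u ≤ t
  non-hub {t} h = ≮⇒≥ λ lt → true≢false (<ᵇ-intro {t} lt) h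

  hub-count : ∀ t → t * countF n (hubs t) ≤ size a
  hub-count t = ≤-trans (≤-reflexive (sym (sumL-*ˡ t (ind ∘ hubs t) (allFin n)))) (sumL-mono (allFin n) pt)
    where
    pt : ∀ u → t * ind (hubs t u) ≤ degree a u
    pt u with bool-cases (hubs t u)
    ... | inj₁ e = ≤-trans (≤-reflexive (trans (cong (λ b → t * ind b) e) (*-identityʳ t))) (<⇒≤ (<ᵇ-true {t} e))
    ... | inj₂ e = ≤-trans (≤-reflexive (trans (cong (λ b → t * ind b) e) (*-zeroʳ t))) z≤n

  Crowded : ℕ → Fin n → Set
  Crowded t w = ∀ y → a w y ≡ true → degree a y ≤ t → 3 ≤ common a w y

  nbhd : Fin n → Fin n → Bool
  nbhd w = plus (a w) w

  nbhd-self : ∀ w → nbhd w w ≡ true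
  nbhd-self w = ∨-introʳ {a w w} (does-intro (w ≟ w) refl)

  nbhd-count : ∀ w → countF n (nbhd w) ≡ suc (degree a w)
  nbhd-count w = degree-plus (a w) (girr G w)

  nbhd-sym : ∀ {w z} → nbhd w z ≡ true → nbhd z w ≡ true
  nbhd-sym {w} {z} e with plus-true {r = a w} {w} {z} e
  ... | inj₁ q = ∨-introˡ (gsym G w z q)
  ... | inj₂ refl = e

  module Packing (lo : ℕ) (X : Fin n → Bool) where

    lowᵇ : Fin n → Bool
    lowᵇ z = degree a z ≤ᵇ lo

    -- Vertices conflict when their closed neighbourhoods share a vertex of degree at most `lo`.
    -- Hubs may be shared freely, and the degree gap rules out neighbours in between.
    conflictAt : Fin n → Fin n → Fin n → Bool
    conflictAt w x z = lowᵇ z ∧ (nbhd w z ∧ nbhd x z)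

    conflict : Fin n → Fin n → Bool
    conflict w x = anyF n (conflictAt w x)

    conflict-elim : ∀ {w x} → conflict w x ≡ true → ∃[ z ] (lowᵇ z ≡ true × nbhd w z ≡ true × nbhd x z ≡ true)
    conflict-elim {w} {x} e = let (z , q) = anyF-true n {conflictAt w x} e
                                  (l , r) = ∧-true {lowᵇ z} {nbhd w z ∧ nbhd x z} q
                              in z , l , ∧-true {nbhd w z} r

    conflict-intro : ∀ {w x} z → degree a z ≤ lo → nbhd w z ≡ true → nbhd x z ≡ true → conflict w x ≡ true
    conflict-intro {w} {x} z l p q = anyF-intro n {conflictAt w x} z
      (∧-intro {lowᵇ z} (≤ᵇ-intro l) (∧-intro {nbhd w z} p q))

    conflict-sym : ∀ {w x} → conflict w x ≡ true → conflict x w ≡ true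
    conflict-sym {w} {x} e = let (z , l , p , q) = conflict-elim {w} {x} e
      in conflict-intro {x} {w} z (≤ᵇ-true {degree a z} l) q p

    conflict-count : ∀ w → countF n (conflict w) ≤ suc (degree a w) * suc lo
    conflict-count w = begin
      countF n (conflict w) ≤⟨ sumL-mono (allFin n) pt ⟩
      sumF n (λ x → sumF n (λ z → both z * ind (nbhd z x))) ≡⟨ sumL-swap (λ x z → both z * ind (nbhd z x)) (allFin n) (allFin n) ⟩
      sumF n (λ z → sumF n (λ x → both z * ind (nbhd z x))) ≤⟨ sumL-mono (allFin n) column ⟩
      sumF n (λ z → suc lo * ind (nbhd w z)) ≡⟨ sumL-*ˡ (suc lo) (ind ∘ nbhd w) (allFin n) ⟩
      suc lo * countF n (nbhd w) ≡⟨ trans (cong (suc lo *_) (nbhd-count w)) (*-comm (suc lo) _) ⟩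
      suc (degree a w) * suc lo ∎
      where
      open ≤-Reasoning
      both : Fin n → ℕ
      both z = ind (lowᵇ z ∧ nbhd w z)
      pt : ∀ x → ind (conflict w x) ≤ sumF n (λ z → both z * ind (nbhd z x))
      pt x with bool-cases (conflict w x)
      ... | inj₂ e = ≤-trans (≤-reflexive (cong ind e)) z≤n
      ... | inj₁ e with conflict-elim {w} {x} e
      ...   | z , l , p , p' = ≤-trans (≤-reflexive (trans (cong ind e)
                      (sym (cong₂ _*_ (cong ind (∧-intro {lowᵇ z} l p)) (cong ind (nbhd-sym {x} {z} p'))))))
                    (sumL-∈ {f = λ z → both z * ind (nbhd z x)} (allFin n) (∈-allFin z))
      column : ∀ z → sumF n (λ x → both z * ind (nbhd z x)) ≤ suc lo * ind (nbhd w z)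
      column z = ≤-trans (≤-reflexive (trans (sumL-*ˡ (both z) (ind ∘ nbhd z) (allFin n)) (cong (both z *_) (nbhd-count z)))) (fits (bool-cases (lowᵇ z)))
        where
        fits : lowᵇ z ≡ true ⊎ lowᵇ z ≡ false → both z * suc (degree a z) ≤ suc lo * ind (nbhd w z)
        fits (inj₁ e) = ≤-trans (*-mono-≤ (ind-mono {lowᵇ z ∧ nbhd w z} {nbhd w z} (proj₂ ∘ ∧-true {lowᵇ z})) (s≤s (≤ᵇ-true {degree a z} e)))
          (≤-reflexive (*-comm (ind (nbhd w z)) (suc lo)))
        fits (inj₂ e) = ≤-trans (≤-reflexive (cong (λ b → ind (b ∧ nbhd w z) * suc (degree a z)) e)) z≤n

    open Greedy X conflict (λ {w} {x} → conflict-sym {w} {x})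

    chosen : Fin n → Bool
    chosen w = anyL (eqF w) (greedy (allFin n))

    chosen-∈ : ∀ {w} → chosen w ≡ true → w ∈ greedy (allFin n)
    chosen-∈ {w} e = search (greedy (allFin n)) e
      where
      search : ∀ us → anyL (eqF w) us ≡ true → w ∈ us
      search (u ∷ us) r with ∨-true r
      ... | inj₁ q = here (eqF-true q)
      ... | inj₂ s = there (search us s)

    -- A chosen vertex conflicts with at most `suc m * suc lo` vertices: it has at most `suc m`
    -- vertices to share, and each low one is seen by at most `suc lo`. By maximality these
    -- conflicts cover `X`.
    packing : ∀ m → (∀ w → X w ≡ true → degree a w ≤ m × degree a w ≤ lo) →
      countF n X ≤ countF n chosen * (suc m * suc lo)
    packing m small = begin
      countF n X ≤⟨ sumL-mono (allFin n) pt ⟩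
      sumF n (λ x → sumF n (λ w → ind (chosen w) * ind (conflict w x))) ≡⟨ sumL-swap (λ x w → ind (chosen w) * ind (conflict w x)) (allFin n) (allFin n) ⟩
      sumF n (λ w → sumF n (λ x → ind (chosen w) * ind (conflict w x))) ≤⟨ sumL-mono (allFin n) row ⟩
      sumF n (λ w → (suc m * suc lo) * ind (chosen w)) ≡⟨ trans (sumL-*ˡ (suc m * suc lo) (ind ∘ chosen) (allFin n)) (*-comm (suc m * suc lo) _) ⟩
      countF n chosen * (suc m * suc lo) ∎
      where
      open ≤-Reasoning
      pt : ∀ x → ind (X x) ≤ sumF n (λ w → ind (chosen w) * ind (conflict w x))
      pt x with bool-cases (X x)
      ... | inj₂ e = ≤-trans (≤-reflexive (cong ind e)) z≤n
      ... | inj₁ e with greedy-maximal (allFin n) (∈-allFin x) e (conflict-intro {x} {x} x (proj₂ (small x e)) (nbhd-self x) (nbhd-self x))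
      ...   | v , mv , c = ≤-trans (≤-reflexive (trans (cong ind e)
                (sym (cong₂ _*_ (cong ind (anyL-intro (greedy (allFin n)) mv (eqF-intro {i = v} refl))) (cong ind c)))))
              (sumL-∈ {f = λ w → ind (chosen w) * ind (conflict w x)} (allFin n) (∈-allFin v))
      row : ∀ w → sumF n (λ x → ind (chosen w) * ind (conflict w x)) ≤ (suc m * suc lo) * ind (chosen w)
      row w = ≤-trans (≤-reflexive (sumL-*ˡ (ind (chosen w)) (ind ∘ conflict w) (allFin n))) (fits (bool-cases (chosen w)))
        where
        fits : chosen w ≡ true ⊎ chosen w ≡ false → ind (chosen w) * countF n (conflict w) ≤ (suc m * suc lo) * ind (chosen w)
        fits (inj₂ e) = ≤-trans (≤-reflexive (cong (λ b → ind b * countF n (conflict w)) e)) z≤n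
        fits (inj₁ e) = ≤-trans (*-monoʳ-≤ (ind (chosen w)) (≤-trans (conflict-count w)
            (*-monoˡ-≤ (suc lo) (s≤s (proj₁ (small w (greedy-X (allFin n) (chosen-∈ e))))))))
          (≤-reflexive (*-comm (ind (chosen w)) _))

  -- X consists of crowded vertices without neighbours of degree in the band from lo to hi.
  band-bound : ∀ lo hi (X : Fin n → Bool) → 6 ≤ lo → lo ≤ hi →
    (∀ w → X w ≡ true → degree a w ≤ 6 × 4 ≤ degree a w × Crowded hi w) →
    (∀ w y → X w ≡ true → a w y ≡ true → degree a y ≤ hi → degree a y ≤ lo) →
    countF n X ≤ (3 * countF n (hubs hi) + 4 * g) * (7 * suc lo)
  band-bound lo hi X lo≥6 lo≤hi small gap = ≤-trans
    (packing 6 λ w xw → proj₁ (small w xw) , ≤-trans (proj₁ (small w xw)) lo≥6)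
    (*-monoˡ-≤ (7 * suc lo) (bow-bound G (hubs hi) chosen p low bow disjoint))
    where
    open Packing lo X
    open Greedy X conflict (λ {w} {x} → conflict-sym {w} {x})
    inX : ∀ {w} → chosen w ≡ true → X w ≡ true
    inX e = greedy-X (allFin n) (chosen-∈ e)
    low : ∀ w → chosen w ≡ true → hubs hi w ≡ false
    low w e = ≢true λ h → <⇒≱ (<ᵇ-true {hi} h) (≤-trans (proj₁ (small w (inX e))) (≤-trans lo≥6 lo≤hi))
    bow-at : ∀ w → chosen w ≡ true → Σ[ q ∈ (Fin 4 → Fin n) ] Bow G (hubs hi) w q
    bow-at w e with small w (inX e)
    ... | _ , d≥4 , crowd with anyF n (a w) in q
    ...   | true = let (u , wu) = anyF-true n q in
            crowded-bow G (hubs hi) w u wu (λ y wy h → crowd y wy (non-hub h)) d≥4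
    ...   | false = ⊥-elim (<⇒≱ d≥4 (≤-trans (≤-reflexive (trans (count-cong (finFinite n) {q = λ _ → false} (λ z → ≢true λ e → true≢false (anyF-intro n z e) q)) (sumL-0 (allFin n)))) z≤n))
    choose : ∀ w → chosen w ≡ true ⊎ chosen w ≡ false → Fin 4 → Fin n
    choose w (inj₁ e) = proj₁ (bow-at w e)
    choose w (inj₂ _) _ = w
    p : Fin n → Fin 4 → Fin n
    p w = choose w (bool-cases (chosen w))
    bow : ∀ w → chosen w ≡ true → Bow G (hubs hi) w (p w)
    bow w e with bool-cases (chosen w)
    ... | inj₁ e' = proj₂ (bow-at w e')
    ... | inj₂ e' = ⊥-elim (true≢false e e')
    near : ∀ {w x} → chosen w ≡ true → hubs hi x ≡ false → Petal (p w) w x → nbhd w x ≡ true × degree a x ≤ lo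
    near {w} e h (inj₁ refl) = nbhd-self w , ≤-trans (proj₁ (small w (inX e))) lo≥6
    near {w} {x} e h (inj₂ (r , refl)) = ∨-introˡ (Bow.spokes (bow w e) r) , gap w x (inX e) (Bow.spokes (bow w e) r) (non-hub h)
    disjoint : ∀ w w' x → chosen w ≡ true → chosen w' ≡ true → hubs hi x ≡ false →
      Petal (p w) w x → Petal (p w') w' x → w ≡ w'
    disjoint w w' x e e' h m m' = greedy-apart (allFin n) (chosen-∈ e) (chosen-∈ e')
      (conflict-intro {w} {w'} x (proj₂ (near e h m)) (proj₁ (near e h m)) (proj₁ (near e' h m')))

-- Linearly many removable vertices

sumN : ℕ → (ℕ → ℕ) → ℕ
sumN zero f = 0
sumN (suc T) f = sumN T f + f T

sumN-mono : ∀ T {f h : ℕ → ℕ} → (∀ i → i < T → f i ≤ h i) → sumN T f ≤ sumN T h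
sumN-mono zero le = z≤n
sumN-mono (suc T) le = +-mono-≤ (sumN-mono T λ i lt → le i (m<n⇒m<1+n lt)) (le T ≤-refl)

sumN-const : ∀ T c → sumN T (λ _ → c) ≡ T * c
sumN-const zero c = refl
sumN-const (suc T) c = trans (cong (_+ c) (sumN-const T c)) (+-comm (T * c) c)

sumN-swap : ∀ {A : Set} T (f : ℕ → A → ℕ) xs → sumN T (λ i → sumL (f i) xs) ≡ sumL (λ x → sumN T λ i → f i x) xs
sumN-swap zero f xs = sym (sumL-0 xs)
sumN-swap (suc T) f xs = trans (cong (_+ sumL (f T) xs) (sumN-swap T f xs)) (sym (sumL-+ _ _ xs))

sumN-*ˡ : ∀ T c f → sumN T (λ i → c * f i) ≡ c * sumN T f
sumN-*ˡ zero c f = sym (*-zeroʳ c)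
sumN-*ˡ (suc T) c f = trans (cong (_+ c * f T) (sumN-*ˡ T c f)) (sym (*-distribˡ-+ c _ _))

easy : ∀ {n} → Gr n → ℕ → Fin n → Fin n → Bool
easy a D w x = a w x ∧ ((degree a x ≤ᵇ D) ∧ (common a w x ≤ᵇ 2))

-- A vertex of degree at most two needs no neighbour of bounded degree: its contraction loses at
-- most two edges and is undone by naming a vertex, or a dart and one bit.
removable : ∀ {n} → Gr n → ℕ → Fin n → Bool
removable {n} a D w = (degree a w ≤ᵇ 6) ∧ ((degree a w ≤ᵇ 2) ∨ anyF n (easy a D w))

module _ {n g} {a : Gr n} (G : Good g a) (Q T : ℕ) (D : ℕ → ℕ)
  (D₀ : 6 ≤ D 0) (D-suc : ∀ i → D (suc i) ≡ Q * suc (D i)) (Q≥1 : 1 ≤ Q) where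

  private
    D-step : ∀ i → D i ≤ D (suc i)
    D-step i = ≤-trans (≤-trans (n≤1+n (D i)) (≤-reflexive (sym (*-identityˡ _))))
      (≤-trans (*-monoˡ-≤ (suc (D i)) Q≥1) (≤-reflexive (sym (D-suc i))))

    D-mono : ∀ {i j} → i ≤′ j → D i ≤ D j
    D-mono ≤′-refl = ≤-refl
    D-mono {j = suc j} (≤′-step le) = ≤-trans (D-mono le) (D-step j)

    D≥6 : ∀ i → 6 ≤ D i
    D≥6 i = ≤-trans D₀ (D-mono (z≤′n {i}))

    -- Irremovable small vertices have degree at least three. At degree three there are at most two
    -- common neighbours with any neighbour, so all neighbours must be hubs; from degree four on,
    -- crossing paths are available.
    small good bad₃ bad₄ : Fin n → Bool
    small w = degree a w ≤ᵇ 6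
    good = removable a (D T)
    bad₃ w = small w ∧ (not (good w) ∧ (degree a w ≤ᵇ 3))
    bad₄ w = small w ∧ (not (good w) ∧ (3 <ᵇ degree a w))

    bad-crowded : ∀ w → small w ≡ true → good w ≡ false → 3 ≤ degree a w × Crowded G (D T) w
    bad-crowded w s b = ≰⇒> (λ le → contra (∨-introˡ (≤ᵇ-intro le)))
      , λ y wy dy → ≰⇒> λ c → contra (∨-introʳ {degree a w ≤ᵇ 2} (anyF-intro n y
          (∧-intro {a w y} wy (∧-intro {degree a y ≤ᵇ D T} (≤ᵇ-intro dy) (≤ᵇ-intro c)))))
      where
      contra : ((degree a w ≤ᵇ 2) ∨ anyF n (easy a (D T) w)) ≡ true → ⊥
      contra e = true≢false (∧-intro {small w} s e) b

    bad₃-elim : ∀ {w} → bad₃ w ≡ true → small w ≡ true × good w ≡ false × degree a w ≤ 3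
    bad₃-elim {w} e = let (s , q) = ∧-true {small w} e ; (b , d) = ∧-true {not (good w)} q
      in s , not-true b , ≤ᵇ-true {degree a w} d

    bad₄-elim : ∀ {w} → bad₄ w ≡ true → small w ≡ true × good w ≡ false × 3 < degree a w
    bad₄-elim {w} e = let (s , q) = ∧-true {small w} e ; (b , d) = ∧-true {not (good w)} q
      in s , not-true b , <ᵇ-true {3} d

    split-small : countF n small ≤ countF n good + (countF n bad₃ + countF n bad₄)
    split-small = ≤-trans (sumL-mono (allFin n) pt) (≤-reflexive (trans (sumL-+ (ind ∘ good) _ (allFin n))
        (cong (countF n good +_) (sumL-+ (ind ∘ bad₃) _ (allFin n)))))
      where
      pt : ∀ w → ind (small w) ≤ ind (good w) + (ind (bad₃ w) + ind (bad₄ w))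
      pt w = cases (small w) (good w) (degree a w ≤ᵇ 3) (3 <ᵇ degree a w) (λ h → case ≤-<-connex (degree a w) 3 of λ where
          (inj₁ le) → true≢false (≤ᵇ-intro le) (proj₁ h)
          (inj₂ lt) → true≢false (<ᵇ-intro lt) (proj₂ h))
        where
        cases : ∀ s b x y → ¬ (x ≡ false × y ≡ false) → ind s ≤ ind b + (ind (s ∧ (not b ∧ x)) + ind (s ∧ (not b ∧ y)))
        cases false b x y h = z≤n
        cases true true x y h = s≤s z≤n
        cases true false true y h = s≤s z≤n
        cases true false false true h = s≤s z≤n
        cases true false false false h = ⊥-elim (h (refl , refl))

    -- A vertex that is not small contributes at least seven to the degree sum.
    many-small : 7 * n ≤ 7 * countF n small + size a
    many-small = begin
      7 * n ≡⟨ trans (*-comm 7 n) (trans (cong (_* 7) (sym (length-allFin n))) (sym (sumL-const 7 (allFin n)))) ⟩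
      sumF n (λ _ → 7) ≤⟨ sumL-mono (allFin n) pt ⟩
      sumF n (λ w → 7 * ind (small w) + degree a w) ≡⟨ trans (sumL-+ _ _ (allFin n)) (cong (_+ size a) (sumL-*ˡ 7 (ind ∘ small) (allFin n))) ⟩
      7 * countF n small + size a ∎
      where
      open ≤-Reasoning
      pt : ∀ w → 7 ≤ 7 * ind (small w) + degree a w
      pt w with bool-cases (small w)
      ... | inj₁ e = ≤-trans (≤-reflexive (cong (λ b → 7 * ind b) (sym e))) (m≤m+n _ (degree a w))
      ... | inj₂ e = ≤-trans (≰⇒> λ le → true≢false (≤ᵇ-intro le) e) (m≤n+m (degree a w) (7 * ind (small w)))

    bad₃-bound : countF n bad₃ ≤ 3 * countF n (hubs G (D T)) + 4 * g
    bad₃-bound = all-hub-bound G (hubs G (D T)) bad₃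
      (λ w e → ≢true λ h → <⇒≱ (<ᵇ-true {D T} h) (≤-trans (≤ᵇ-true {degree a w} (proj₁ (bad₃-elim e))) (D≥6 T)))
      (λ w x e wx → case bool-cases (hubs G (D T) x) of λ where
        (inj₁ h) → h
        (inj₂ h) → let (s , b , d) = bad₃-elim e in ⊥-elim (<⇒≱ (≤-trans (common<degree {a = a} (girr G) wx) d)
          (proj₂ (bad-crowded w s b) x wx (non-hub G h))))
      (λ w e → let (s , b , _) = bad₃-elim e in proj₁ (bad-crowded w s b))

    band : ℕ → Fin n → Bool
    band i x = (D i <ᵇ degree a x) ∧ (degree a x ≤ᵇ D (suc i))

    touches : ℕ → Fin n → Bool
    touches i w = anyF n λ x → a w x ∧ band i x

    inside outside : ℕ → Fin n → Bool
    inside i w = bad₄ w ∧ touches i w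
    outside i w = bad₄ w ∧ not (touches i w)

    inside+outside : ∀ i → countF n bad₄ ≡ countF n (inside i) + countF n (outside i)
    inside+outside i = trans (sumL-cong (allFin n) λ w → pt (bad₄ w) (touches i w)) (sumL-+ (ind ∘ inside i) _ (allFin n))
      where
      pt : ∀ x y → ind x ≡ ind (x ∧ y) + ind (x ∧ not y)
      pt false y = refl
      pt true true = refl
      pt true false = refl

    bands-disjoint : ∀ t x → sumN t (λ i → ind (band i x)) ≤ ind (degree a x ≤ᵇ D t)
    bands-disjoint zero x = z≤n
    bands-disjoint (suc t) x = by-cases (bool-cases (band t x))
      where
      by-cases : band t x ≡ true ⊎ band t x ≡ false → sumN t (λ i → ind (band i x)) + ind (band t x) ≤ ind (degree a x ≤ᵇ D (suc t))
      by-cases (inj₁ e) = let (p , q) = ∧-true {D t <ᵇ degree a x} e in ≤-trans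
        (+-mono-≤ (≤-trans (bands-disjoint t x) (≤-reflexive (cong ind (≢true {degree a x ≤ᵇ D t} λ r → <⇒≱ (<ᵇ-true {D t} p) (≤ᵇ-true {degree a x} r)))))
          (≤-reflexive (cong ind e))) (≤-reflexive (sym (cong ind q)))
      by-cases (inj₂ e) = ≤-trans (≤-reflexive (trans (cong (λ b → sumN t _ + ind b) e) (+-identityʳ _)))
        (≤-trans (bands-disjoint t x) (ind-mono {degree a x ≤ᵇ D t} λ q → ≤ᵇ-intro (≤-trans (≤ᵇ-true {degree a x} q) (D-step t))))

    -- The bands are disjoint, so each neighbour accounts for at most one touched band.
    touch-count : ∀ w → sumN T (λ i → ind (touches i w)) ≤ degree a w
    touch-count w = begin
      sumN T (λ i → ind (touches i w)) ≤⟨ sumN-mono T (λ i _ → pt i) ⟩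
      sumN T (λ i → sumF n (λ x → ind (a w x) * ind (band i x))) ≡⟨ sumN-swap T _ (allFin n) ⟩
      sumF n (λ x → sumN T (λ i → ind (a w x) * ind (band i x))) ≤⟨ sumL-mono (allFin n) column ⟩
      degree a w ∎
      where
      open ≤-Reasoning
      pt : ∀ i → ind (touches i w) ≤ sumF n (λ x → ind (a w x) * ind (band i x))
      pt i with bool-cases (touches i w)
      ... | inj₂ e = ≤-trans (≤-reflexive (cong ind e)) z≤n
      ... | inj₁ e with anyF-true n e
      ...   | x , q with ∧-true {a w x} q
      ...     | p , p' = ≤-trans (≤-reflexive (trans (cong ind e) (sym (cong₂ _*_ (cong ind p) (cong ind p')))))
                  (sumL-∈ {f = λ x → ind (a w x) * ind (band i x)} (allFin n) (∈-allFin x))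
      column : ∀ x → sumN T (λ i → ind (a w x) * ind (band i x)) ≤ ind (a w x)
      column x = ≤-trans (≤-reflexive (sumN-*ˡ T (ind (a w x)) _)) (≤-trans (*-monoʳ-≤ (ind (a w x))
        (≤-trans (bands-disjoint T x) (ind-mono {y = true} λ _ → refl))) (≤-reflexive (*-identityʳ _)))

    inside-total : sumN T (λ i → countF n (inside i)) ≤ 6 * countF n bad₄
    inside-total = begin
      sumN T (λ i → countF n (inside i)) ≡⟨ sumN-swap T (λ i → ind ∘ inside i) (allFin n) ⟩
      sumF n (λ w → sumN T (λ i → ind (inside i w))) ≤⟨ sumL-mono (allFin n) pt ⟩
      sumF n (λ w → 6 * ind (bad₄ w)) ≡⟨ sumL-*ˡ 6 (ind ∘ bad₄) (allFin n) ⟩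
      6 * countF n bad₄ ∎
      where
      open ≤-Reasoning
      pt : ∀ w → sumN T (λ i → ind (inside i w)) ≤ 6 * ind (bad₄ w)
      pt w = by-cases (bool-cases (bad₄ w))
        where
        by-cases : bad₄ w ≡ true ⊎ bad₄ w ≡ false → sumN T (λ i → ind (inside i w)) ≤ 6 * ind (bad₄ w)
        by-cases (inj₁ e) = ≤-trans (sumN-mono T λ i _ → ind-mono {inside i w} {touches i w} λ q → proj₂ (∧-true {bad₄ w} q))
          (≤-trans (touch-count w) (≤-trans (≤ᵇ-true {degree a w} (proj₁ (bad₄-elim e))) (≤-reflexive (cong (λ b → 6 * ind b) (sym e)))))
        by-cases (inj₂ e) = ≤-trans (sumN-mono T {h = λ _ → 0} λ i _ → ≤-reflexive (cong (λ b → ind (b ∧ touches i w)) e))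
          (≤-trans (≤-reflexive (trans (sumN-const T 0) (*-zeroʳ T))) z≤n)

    outside-bound : ∀ i → i < T → countF n (outside i) ≤ (3 * countF n (hubs G (D (suc i))) + 4 * g) * (7 * suc (D i))
    outside-bound i i<T = band-bound G (D i) (D (suc i)) (outside i) (D≥6 i) (D-step i)
      (λ w e → let (s , b , d) = bad₄-elim (proj₁ (∧-true {bad₄ w} e)) in ≤ᵇ-true {degree a w} s , d
        , λ y wy dy → proj₂ (bad-crowded w s b) y wy (≤-trans dy (D-mono (≤⇒≤′ i<T))))
      (λ w y e wy dy → ≮⇒≥ λ lt → true≢false
        (anyF-intro n y (∧-intro {a w y} wy (∧-intro {D i <ᵇ degree a y} (<ᵇ-intro lt) (≤ᵇ-intro dy))))
        (not-true (proj₂ (∧-true {bad₄ w} e))))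

    -- Each of these vertices has degree at most six and touches at most six of the twelve bands; on
    -- average a band is touched by at most half of them.
    bad₄-bound : T ≡ 12 → ∃[ i ] (i < T × countF n bad₄ ≤ 2 * countF n (outside i))
    bad₄-bound T≡12 with anyN? (λ i → 2 * countF n (inside i) ≤? countF n bad₄) T
    ... | yes (i , i<T , le) = i , i<T , ≤-trans (≤-reflexive (inside+outside i)) (≤-trans (+-monoˡ-≤ (countF n (outside i)) minority)
            (≤-reflexive (cong (countF n (outside i) +_) (sym (+-identityʳ _)))))
      where
      minority : countF n (inside i) ≤ countF n (outside i)
      minority = +-cancelˡ-≤ (countF n (inside i)) _ _ (≤-trans (≤-reflexive (cong (countF n (inside i) +_) (sym (+-identityʳ _))))
        (≤-trans le (≤-reflexive (inside+outside i))))
    ... | no ¬h = ⊥-elim (<⇒≱ (≤-refl {suc (12 * countF n bad₄)}) (begin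
      suc (12 * countF n bad₄) ≤⟨ m≤m+n _ 11 ⟩
      suc (12 * countF n bad₄) + 11 ≡⟨ lem (countF n bad₄) ⟩
      12 * suc (countF n bad₄) ≡⟨ cong (_* suc (countF n bad₄)) (sym T≡12) ⟩
      T * suc (countF n bad₄) ≡⟨ sym (sumN-const T _) ⟩
      sumN T (λ _ → suc (countF n bad₄)) ≤⟨ sumN-mono T (λ i i<T → ≰⇒> λ le → ¬h (i , i<T , le)) ⟩
      sumN T (λ i → 2 * countF n (inside i)) ≡⟨ sumN-*ˡ T 2 _ ⟩
      2 * sumN T (λ i → countF n (inside i)) ≤⟨ *-monoʳ-≤ 2 inside-total ⟩
      2 * (6 * countF n bad₄) ≡⟨ sym (*-assoc 2 6 (countF n bad₄)) ⟩
      12 * countF n bad₄ ∎))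
      where
      open ≤-Reasoning
      lem : ∀ b → suc (12 * b) + 11 ≡ 12 * suc b
      lem = solve-∀

  -- The weight `Q` is chosen for `Q * suc (D i)` to be `D (suc i)`: the factor `suc (D i)` lost in
  -- the greedy packing is absorbed by `hub-count`, which bounds `D (suc i)` times the number of
  -- hubs by the degree sum.
  removable-weighted : T ≡ 12 → Q * (7 * n) ≤ 7 * (Q * countF n (removable a (D T))) + (315 + Q) * size a + 420 * (g * D T)
  removable-weighted T≡12 with bad₄-bound T≡12
  ... | i , i<T , le = begin
    Q * (7 * n) ≤⟨ *-monoʳ-≤ Q many-small ⟩
    Q * (7 * countF n small + S) ≤⟨ *-monoʳ-≤ Q (+-monoˡ-≤ S (*-monoʳ-≤ 7 split-small)) ⟩
    Q * (7 * (countF n good + (countF n bad₃ + countF n bad₄)) + S) ≡⟨ l1 Q (countF n good) (countF n bad₃) (countF n bad₄) S ⟩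
    7 * (Q * countF n good) + 7 * (Q * countF n bad₃) + 7 * (Q * countF n bad₄) + Q * S
      ≤⟨ +-monoˡ-≤ (Q * S) (+-mono-≤ (+-monoʳ-≤ (7 * (Q * countF n good)) (*-monoʳ-≤ 7 weighted₃)) (*-monoʳ-≤ 7 weighted₄)) ⟩
    7 * (Q * countF n good) + 7 * (3 * S + 4 * (g * D T)) + 7 * (42 * S + 56 * (g * D T)) + Q * S
      ≡⟨ l2 (7 * (Q * countF n good)) S (g * D T) Q ⟩
    7 * (Q * countF n good) + (315 + Q) * S + 420 * (g * D T) ∎
    where
    open ≤-Reasoning
    S = size a
    l1 : ∀ Q x y z S → Q * (7 * (x + (y + z)) + S) ≡ 7 * (Q * x) + 7 * (Q * y) + 7 * (Q * z) + Q * S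
    l1 = solve-∀
    l2 : ∀ X S g Q → X + 7 * (3 * S + 4 * g) + 7 * (42 * S + 56 * g) + Q * S ≡ X + (315 + Q) * S + 420 * g
    l2 = solve-∀
    Q≤D : Q ≤ D T
    Q≤D = subst (λ t → Q ≤ D t) (sym T≡12) (≤-trans (≤-trans (≤-reflexive (sym (*-identityʳ Q))) (*-monoʳ-≤ Q (s≤s z≤n))) (≤-reflexive (sym (D-suc 11))))
    weighted₃ : Q * countF n bad₃ ≤ 3 * S + 4 * (g * D T)
    weighted₃ = begin
      Q * countF n bad₃ ≤⟨ *-mono-≤ Q≤D bad₃-bound ⟩
      D T * (3 * countF n (hubs G (D T)) + 4 * g) ≡⟨ lem (D T) (countF n (hubs G (D T))) g ⟩
      3 * (D T * countF n (hubs G (D T))) + 4 * (g * D T) ≤⟨ +-monoˡ-≤ _ (*-monoʳ-≤ 3 (hub-count G (D T))) ⟩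
      3 * S + 4 * (g * D T) ∎
      where
      lem : ∀ D h g → D * (3 * h + 4 * g) ≡ 3 * (D * h) + 4 * (g * D)
      lem = solve-∀
    weighted₄ : Q * countF n bad₄ ≤ 42 * S + 56 * (g * D T)
    weighted₄ = begin
      Q * countF n bad₄ ≤⟨ *-monoʳ-≤ Q (≤-trans le (*-monoʳ-≤ 2 (outside-bound i i<T))) ⟩
      Q * (2 * ((3 * h + 4 * g) * (7 * suc (D i)))) ≡⟨ lem Q h g (suc (D i)) ⟩
      42 * ((Q * suc (D i)) * h) + 56 * (g * (Q * suc (D i))) ≡⟨ cong (λ y → 42 * (y * h) + 56 * (g * y)) (sym (D-suc i)) ⟩
      42 * (D (suc i) * h) + 56 * (g * D (suc i)) ≤⟨ +-mono-≤ (*-monoʳ-≤ 42 (hub-count G (D (suc i)))) (*-monoʳ-≤ 56 (*-monoʳ-≤ g (D-mono (≤⇒≤′ i<T)))) ⟩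
      42 * S + 56 * (g * D T) ∎
      where
      h = countF n (hubs G (D (suc i)))
      lem : ∀ Q h g d → Q * (2 * ((3 * h + 4 * g) * (7 * d))) ≡ 42 * ((Q * d) * h) + 56 * (g * (Q * d))
      lem = solve-∀

-- The coefficient 315 is `7 * 3 + 7 * 42`. With a degree sum of about `6 * n`, the weighted
-- inequality requires `6 * (315 + Q) < 7 * Q`, that is `Q > 1890`. Twice this value leaves
-- `1890 * n` against `7 * Q` times the number of removable vertices, hence the factor 14.
scale : ℕ → ℕ
scale zero = 6
scale (suc i) = 3780 * suc (scale i)

private
  solve-for-n : ∀ q n R S g x → 1 ≤ q → S ≤ 6 * n + 12 * g →
    12 * q * (7 * n) ≤ 7 * (12 * q * R) + (q + 12 * q) * S + 420 * x → n ≤ 14 * R + (26 * g + 70 * x)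
  solve-for-n q@(suc _) n R S g x _ S≤ le = *-cancelˡ-≤ (6 * q) (+-cancelˡ-≤ (78 * q * n) _ _ (begin
    78 * q * n + 6 * q * n ≡⟨ l1 q n ⟩
    12 * q * (7 * n) ≤⟨ le ⟩
    7 * (12 * q * R) + (q + 12 * q) * S + 420 * x ≤⟨ +-mono-≤ (+-monoʳ-≤ (7 * (12 * q * R)) (*-monoʳ-≤ (q + 12 * q) S≤)) (*-monoʳ-≤ 420 (m≤n*m x q)) ⟩
    7 * (12 * q * R) + (q + 12 * q) * (6 * n + 12 * g) + 420 * (q * x) ≡⟨ l2 q n R g x ⟩
    78 * q * n + 6 * q * (14 * R + (26 * g + 70 * x)) ∎))
    where
    open ≤-Reasoning
    l1 : ∀ q n → 78 * q * n + 6 * q * n ≡ 12 * q * (7 * n)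
    l1 = solve-∀
    l2 : ∀ q n R g x → 7 * (12 * q * R) + (q + 12 * q) * (6 * n + 12 * g) + 420 * (q * x) ≡ 78 * q * n + 6 * q * (14 * R + (26 * g + 70 * x))
    l2 = solve-∀

-- `lowDegree` exceeds `3780 ^ 12` and will occur in exponents, so it is kept symbolic.
abstract
  lowDegree : ℕ
  lowDegree = scale 12

  deficit : ℕ → ℕ
  deficit g = 26 * g + 70 * (g * lowDegree)

  many-removable : ∀ {n g} {a : Gr n} → Good g a → size a ≤ 6 * n + 12 * g →
    n ≤ 14 * countF n (removable a lowDegree) + deficit g
  many-removable {n} {g} {a} G le = solve-for-n 315 n (countF n (removable a lowDegree)) (size a) g (g * lowDegree) (s≤s z≤n) le
    (removable-weighted G 3780 12 scale ≤-refl (λ _ → refl) (s≤s z≤n) refl)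

-- The encoding

-- With `E` linear in `n` and `L` constant, each case has O(n) values: an isolated vertex names
-- itself; a leaf names its neighbour; a vertex of degree two names a dart of the contracted graph
-- and whether that edge existed before; otherwise `x` and two masks on its neighbourhood tell the
-- former neighbours of `w` and of `x`.
data Undo (n E L : ℕ) : Set where
  lone : Fin n → Undo n E L
  leaf : Fin n → Undo n E L
  path : Fin E → Bool → Undo n E L
  fan  : Fin n → Vec Bool L → Vec Bool L → Undo n E L

lone-inj : ∀ {n E L} {x y : Fin n} → lone {n} {E} {L} x ≡ lone y → x ≡ y
lone-inj refl = refl

path-injˡ : ∀ {n E L} {e e' : Fin E} {y y'} → path {n} {E} {L} e y ≡ path e' y' → e ≡ e'
path-injˡ refl = refl

path-injʳ : ∀ {n E L} {e e' : Fin E} {y y'} → path {n} {E} {L} e y ≡ path e' y' → y ≡ y'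
path-injʳ refl = refl

dartCount : ∀ {n} → Gr n → ℕ
dartCount {n} a = count (dartFinite n) λ d → a (proj₁ d) (proj₂ d)

nthDart : ∀ {n} (b : Gr n) → Fin (dartCount b) → Dart n
nthDart {n} b = nth (λ d → b (proj₁ d) (proj₂ d)) (elems (dartFinite n))

nthNbr : ∀ {n} (b : Gr n) x → Fin (degree b x) → Fin n
nthNbr {n} b x = nth (b x) (allFin n)

ContractedTo : ∀ {n} → Gr n → Fin n → Fin n → Gr n → Set
ContractedTo a w x b = ∀ i j → Iff (b i j ≡ true) (Contracted a w x i j)

-- The data from which the removal of w is undone, given the resulting graph b and w itself.
data Cert {n E L} (a : Gr n) (w : Fin n) (b : Gr n) : Undo n E L → Set where
  lone : (∀ z → a w z ≡ false) → (∀ i j → b i j ≡ a i j) → Cert a w b (lone w)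
  leaf : ∀ {x} → a w x ≡ true → (∀ z → a w z ≡ true → z ≡ x) → ContractedTo a w x b → Cert a w b (leaf x)
  path : ∀ {x z} → a w x ≡ true → a w z ≡ true → (∀ t → a w t ≡ true → t ≡ x ⊎ t ≡ z) → ContractedTo a w x b →
         (i : Fin (dartCount b)) → nthDart b i ≡ (x , z) → (le : dartCount b ≤ E) → Cert a w b (path (inject≤ i le) (a x z))
  fan  : ∀ {x p q} → a w x ≡ true → ContractedTo a w x b → (le : degree b x ≤ L) →
         (∀ i → lookup p (inject≤ i le) ≡ a w (nthNbr b x i)) → (∀ i → lookup q (inject≤ i le) ≡ a x (nthNbr b x i)) →
         Cert a w b (fan x p q)

private
  module _ {n} {a a' b : Gr n} {w x : Fin n} (s : Symm a) (s' : Symm a')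
    (C : ContractedTo a w x b) (C' : ContractedTo a' w x b)
    (same : ∀ z → a w z ≡ a' w z) (old : ∀ z → a w z ≡ true → a x z ≡ a' x z) where

    expand : ∀ i j → a i j ≡ true → a' i j ≡ true
    expand i j e with decide (i ≟ w) | decide (j ≟ w)
    ... | inj₁ refl | _ = trans (sym (same j)) e
    ... | inj₂ _ | inj₁ refl = s' _ _ (trans (sym (same i)) (s _ _ e))
    ... | inj₂ iw | inj₂ jw with proj₁ (C' i j) (proj₂ (C i j) (iw , jw , inj₁ e))
    ...   | _ , _ , inj₁ e' = e'
    ...   | _ , _ , inj₂ (inj₁ (refl , wj , _)) = trans (sym (old j (trans (same j) wj))) e
    ...   | _ , _ , inj₂ (inj₂ (refl , wi , _)) = s' _ _ (trans (sym (old i (trans (same i) wi))) (s _ _ e))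

  -- A contraction forgets only the neighbours of `w` and which of them were also neighbours of `x`;
  -- every other adjacency can be read off `b`.
  expand-eq : ∀ {n} {a a' b : Gr n} {w x : Fin n} → Symm a → Symm a' → ContractedTo a w x b → ContractedTo a' w x b →
    (∀ z → a w z ≡ a' w z) → (∀ z → a w z ≡ true → a x z ≡ a' x z) → ∀ i j → a i j ≡ a' i j
  expand-eq {w = w} s s' C C' same old i j = bool-ext (expand s s' C C' same old i j)
    (expand s' s C' C (λ z → sym (same z)) (λ z e → sym (old z (trans (same z) e))) i j)

cert-inj : ∀ {n E L} {a a' b : Gr n} {w} {u : Undo n E L} → Symm a → Symm a' → Irr a → Irr a' →
  Cert a w b u → Cert a' w b u → ∀ i j → a i j ≡ a' i j
cert-inj s s' r r' (lone _ e) (lone _ e') i j = trans (sym (e i j)) (e' i j)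
cert-inj {a = a} {a'} s s' r r' (leaf {x} wx only C) (leaf wx' only' C') = expand-eq s s' C C'
  (λ z → bool-ext (λ e → trans (cong (a' _) (only z e)) wx') (λ e → trans (cong (a _) (only' z e)) wx))
  (λ z e → trans (cong (a x) (only z e)) (trans (trans (r x) (sym (r' x))) (cong (a' x) (sym (only z e)))))
cert-inj {n} {E} {L} {a} {a'} {b} {w} s s' r r' (path {x} {z} wx wz two C i ei le) c′ = helper c′ refl
  where
  helper : ∀ {u : Undo n E L} → Cert a' w b u → u ≡ path (inject≤ i le) (a x z) → ∀ i j → a i j ≡ a' i j
  helper (lone _ _) ()
  helper (leaf _ _ _) ()
  helper (fan _ _ _ _ _) ()
  helper (path {x'} {z'} wx' wz' two' C' i' ei' le') q = go (inject≤-injective le le' i i' (sym (path-injˡ q))) (sym (path-injʳ q))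
    where
    go : i ≡ i' → a x z ≡ a' x' z' → ∀ i j → a i j ≡ a' i j
    go refl yq with trans (sym ei) ei'
    ... | refl = expand-eq s s' C C'
          (λ t → bool-ext (λ e → [ (λ q → trans (cong (a' w) q) wx') , (λ q → trans (cong (a' w) q) wz') ]′ (two t e))
                          (λ e → [ (λ q → trans (cong (a w) q) wx) , (λ q → trans (cong (a w) q) wz) ]′ (two' t e)))
          (λ t e → [ (λ q → trans (cong (a x) q) (trans (trans (r x) (sym (r' x))) (cong (a' x) (sym q))))
                   , (λ q → trans (cong (a x) q) (trans yq (cong (a' x) (sym q)))) ]′ (two t e))
cert-inj {n} {a = a} {a'} {b} {w} s s' r r' (fan {x} {p} {q} wx C le hp hq) (fan wx' C' le' hp' hq') =
  expand-eq s s' C C' (λ z → bool-ext (into {a} {a'} r wx C wx' le le' hp hp' z) (into {a'} {a} r' wx' C' wx le' le hp' hp z))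
    λ z e → by-equality z e (decide (z ≟ x))
  where
  at : ∀ z → b x z ≡ true → ∃[ i ] nthNbr b x i ≡ z
  at z e = index (b x) (allFin n) (∈-allFin z) e
  agree : (m : Vec Bool _) {y y' : Bool} (i : Fin (degree b x)) → ∀ le le' → lookup m (inject≤ i le) ≡ y → lookup m (inject≤ i le') ≡ y' → y ≡ y'
  agree m i le le' e e' = trans (sym e) (trans (cong (lookup m) (toℕ-injective (trans (toℕ-inject≤ i le) (sym (toℕ-inject≤ i le'))))) e')
  linked : ∀ {c : Gr n} → Irr c → c w x ≡ true → ContractedTo c w x b → ∀ z → c w z ≡ true → z ≢ x → b x z ≡ true
  linked {c} rc cwx Cc z e ne = proj₂ (Cc x z) ((λ q → irr≢ {a = c} rc cwx (sym q)) , (λ q → irr≢ {a = c} rc e (sym q)) , inj₂ (inj₁ (refl , e , ne)))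
  into : ∀ {c c' : Gr n} → Irr c → c w x ≡ true → ContractedTo c w x b → c' w x ≡ true → ∀ le le' →
    (∀ i → lookup p (inject≤ i le) ≡ c w (nthNbr b x i)) → (∀ i → lookup p (inject≤ i le') ≡ c' w (nthNbr b x i)) →
    ∀ z → c w z ≡ true → c' w z ≡ true
  into {c} {c'} rc cwx Cc cwx' le le' h h' z e with decide (z ≟ x)
  ... | inj₁ refl = cwx'
  ... | inj₂ ne with at z (linked {c} rc cwx Cc z e ne)
  ...   | i , refl = trans (sym (agree p i le le' (h i) (h' i))) e
  by-equality : ∀ z → a w z ≡ true → z ≡ x ⊎ z ≢ x → a x z ≡ a' x z
  by-equality z e (inj₁ refl) = trans (r x) (sym (r' x))
  by-equality z e (inj₂ ne) with at z (linked {a} r wx C z e ne)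
  ... | i , refl = agree q i le le' (hq i) (hq' i)

-- As for `label`: a vertex that lost nothing will get no edge to `v` and cannot be recognised among
-- the neighbours of `v`, so the undo data must name it.
record Removal {n} (g E L : ℕ) (a : Gr n) (w : Fin n) : Set where
  field
    {result} : Adj n
  graph : Gr n
  graph = adj result
  field
    good  : Good g graph
    lost  : Fin 4
    sizes : size a ≡ size graph + 2 * toℕ lost
    undo  : Undo n E L
    cert  : Cert a w graph undo
    label : toℕ lost ≡ 0 → undo ≡ lone w
    gone  : ∀ z → graph w z ≡ false
    keeps : ∀ u → (∀ z → a u z ≡ false) → ∀ z → graph u z ≡ false
    degree-drop : ∀ v → v ≢ w → degree a v ≤ suc (degree graph v)

maskBit : ∀ {n} (b : Gr n) (x : Fin n) → (Fin n → Bool) → ∀ {t} → Dec (t < degree b x) → Bool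
maskBit b x h (yes lt) = h (nthNbr b x (fromℕ< lt))
maskBit b x h (no _) = false

maskOf : ∀ L {n} (b : Gr n) (x : Fin n) → (Fin n → Bool) → Vec Bool L
maskOf L b x h = tabulate λ t → maskBit b x h (toℕ t <? degree b x)

lookup-mask : ∀ {L n} (b : Gr n) (x : Fin n) h (le : degree b x ≤ L) i → lookup (maskOf L b x h) (inject≤ i le) ≡ h (nthNbr b x i)
lookup-mask {L} b x h le i = trans (lookup∘tabulate _ (inject≤ i le)) (at (toℕ (inject≤ i le) <? degree b x))
  where
  at : (d : Dec (toℕ (inject≤ i le) < degree b x)) → maskBit b x h d ≡ h (nthNbr b x i)
  at (yes lt) = cong (h ∘ nthNbr b x) (trans (fromℕ<-cong _ _ (toℕ-inject≤ i le) lt (toℕ<n i)) (fromℕ<-toℕ i (toℕ<n i)))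
  at (no nlt) = ⊥-elim (nlt (subst (_< degree b x) (sym (toℕ-inject≤ i le)) (toℕ<n i)))

remove : ∀ {n g E} (A : Adj n) (D : ℕ) → Good g (adj A) → size (adj A) ≤ E → ∀ w → removable (adj A) D w ≡ true →
  Removal g E (D + 6) (adj A) w
remove {n} {g} {E} A D G size≤ w rem = start (bool-cases (anyF n (a w)))
  where
  a = adj A
  -- The merged vertex has at most `D` neighbours from `x` and six from `w`.
  L = D + 6
  small : degree a w ≤ 6
  small = ≤ᵇ-true {degree a w} (proj₁ (∧-true {degree a w ≤ᵇ 6} rem))

  module Contraction (x : Fin n) (wx : a w x ≡ true) (few : common a w x ≤ 2) where
    K = contract (degree a w) G w x wx refl
    same = adj-mk (proj₁ K)
    b = adj (mk (proj₁ K))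
    B : Good g b
    B = good-cong (λ i j → sym (same i j)) (proj₁ (proj₂ K))
    C : ContractedTo a w x b
    C i j = let (to , from) = proj₁ (proj₂ (proj₂ K)) i j in to ∘ trans (sym (same i j)) , trans (same i j) ∘ from
    sizes′ : size a ≡ size b + 2 * suc (common a w x)
    sizes′ = trans (proj₂ (proj₂ (proj₂ K))) (cong (_+ 2 * suc (common a w x))
      (sumL-cong (allFin n) λ i → count-cong (finFinite n) λ j → sym (same i j)))
    three : suc (common a w x) < 4
    three = s≤s (s≤s few)
    smaller : size b ≤ size a
    smaller = ≤-trans (m≤m+n _ _) (≤-reflexive (sym sizes′))
    darts≤ : dartCount b ≤ E
    darts≤ = ≤-trans (≤-reflexive (sumDarts n λ d → ind (b (proj₁ d) (proj₂ d)))) (≤-trans smaller size≤)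
    degree-b : degree b x ≤ degree a x + degree a w
    degree-b = ≤-trans (sumL-mono (allFin n) pt) (≤-reflexive (sumL-+ _ _ (allFin n)))
      where
      pt : ∀ z → ind (b x z) ≤ ind (a x z) + ind (a w z)
      pt z with bool-cases (b x z)
      ... | inj₂ e = ≤-trans (≤-reflexive (cong ind e)) z≤n
      ... | inj₁ e with proj₁ (C x z) e
      ...   | _ , _ , inj₁ p = ≤-trans (≤-reflexive (trans (cong ind e) (cong ind (sym p)))) (m≤m+n _ _)
      ...   | _ , _ , inj₂ (inj₁ (_ , p , _)) = ≤-trans (≤-reflexive (trans (cong ind e) (cong ind (sym p)))) (m≤n+m _ (ind (a x z)))
      ...   | _ , _ , inj₂ (inj₂ (_ , _ , ne)) = ⊥-elim (ne refl)
    degree-drop′ : ∀ v → v ≢ w → degree a v ≤ suc (degree b v)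
    degree-drop′ v vw = ≤-trans (sumL-mono (allFin n) pt) (≤-reflexive (trans (sumL-+ (λ z → ind (does (z ≟ w))) _ (allFin n))
        (cong (_+ degree b v) (count-single (finFinite n) w))))
      where
      pt : ∀ z → ind (a v z) ≤ ind (does (z ≟ w)) + ind (b v z)
      pt z with decide (z ≟ w)
      ... | inj₁ e = ≤-trans (ind-mono {a v z} λ _ → does-intro (z ≟ w) e) (m≤m+n _ _)
      ... | inj₂ ne = ≤-trans (ind-mono {a v z} λ e → proj₂ (C v z) (vw , ne , inj₁ e)) (m≤n+m _ (ind (does (z ≟ w))))
    removal : ∀ {u : Undo n E L} → Cert a w b u → Removal g E L a w
    removal {u} c = record { result = mk (proj₁ K) ; good = B ; lost = fromℕ< three
      ; sizes = trans sizes′ (cong (λ l → size b + 2 * l) (sym (toℕ-fromℕ< three)))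
      ; undo = u ; cert = c
      ; label = λ e → case trans (sym (toℕ-fromℕ< three)) e of λ ()
      ; gone = λ z → ≢true λ e → proj₁ (proj₁ (C w z) e) refl
      ; keeps = λ v h z → ≢true λ e → case proj₂ (proj₂ (proj₁ (C v z) e)) of λ where
          (inj₁ p) → true≢false p (h z)
          (inj₂ (inj₁ (refl , _ , _))) → true≢false (gsym G w x wx) (h w)
          (inj₂ (inj₂ (_ , p , _))) → true≢false (gsym G w v p) (h w)
      ; degree-drop = degree-drop′ }

  start : anyF n (a w) ≡ true ⊎ anyF n (a w) ≡ false → Removal g E L a w
  start (inj₂ none) = record { result = A ; good = G ; lost = zero ; sizes = sym (+-identityʳ _) ; undo = lone w
    ; cert = lone empty (λ _ _ → refl) ; label = λ _ → refl ; gone = empty ; keeps = λ _ h → h ; degree-drop = λ v _ → n≤1+n _ }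
    where
    empty : ∀ z → a w z ≡ false
    empty z = ≢true λ e → true≢false (anyF-intro n z e) none
  start (inj₁ some) = by-degree (∨-true {degree a w ≤ᵇ 2} (proj₂ (∧-true {degree a w ≤ᵇ 6} rem)))
    where
    x₀ = proj₁ (anyF-true n some)
    wx₀ : a w x₀ ≡ true
    wx₀ = proj₂ (anyF-true n some)
    by-degree : (degree a w ≤ᵇ 2) ≡ true ⊎ anyF n (easy a D w) ≡ true → Removal g E L a w
    by-degree (inj₂ ez) with anyF-true n ez
    ... | x , q with ∧-true {a w x} q
    ...   | wx , r with ∧-true {degree a x ≤ᵇ D} r
    ...     | dx , few = removal (fan {p = maskOf L b x (a w)} {maskOf L b x (a x)} wx C le
              (lookup-mask b x (a w) le) (lookup-mask b x (a x) le))
      where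
      open Contraction x wx (≤ᵇ-true {common a w x} few)
      le : degree b x ≤ L
      le = ≤-trans degree-b (+-mono-≤ (≤ᵇ-true {degree a x} dx) small)
    by-degree (inj₁ d≤) = second (bool-cases (anyF n (minus (a w) x₀)))
      where
      d≤2 : degree a w ≤ 2
      d≤2 = ≤ᵇ-true {degree a w} d≤
      open Contraction x₀ wx₀ (<⇒≤ (<-≤-trans (common<degree {a = a} (girr G) wx₀) d≤2))
      second : anyF n (minus (a w) x₀) ≡ true ⊎ anyF n (minus (a w) x₀) ≡ false → Removal g E L a w
      second (inj₂ none) = removal (leaf wx₀ only C)
        where
        only : ∀ z → a w z ≡ true → z ≡ x₀
        only z e with decide (z ≟ x₀)
        ... | inj₁ q = q
        ... | inj₂ ne = ⊥-elim (true≢false (anyF-intro n z (∧-intro e (not-intro λ r → ne (does-true (z ≟ x₀) r)))) none)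
      second (inj₁ more) with anyF-true n more
      ... | z , q with minus-true {r = a w} {x₀} q
      ...   | wz , zx = removal (path wx₀ wz two C (proj₁ at) (proj₂ at) darts≤)
        where
        xz : b x₀ z ≡ true
        xz = proj₂ (C x₀ z) ((λ r → irr≢ {a = a} (girr G) wx₀ (sym r)) , (λ r → irr≢ {a = a} (girr G) wz (sym r)) , inj₂ (inj₁ (refl , wz , zx)))
        at : ∃[ i ] nthDart b i ≡ (x₀ , z)
        at = index (λ d → b (proj₁ d) (proj₂ d)) (elems (dartFinite n)) (complete (dartFinite n) (x₀ , z)) xz
        two : ∀ t → a w t ≡ true → t ≡ x₀ ⊎ t ≡ z
        two t e with decide (t ≟ x₀) | decide (t ≟ z)
        ... | inj₁ r | _ = inj₁ r
        ... | inj₂ _ | inj₁ r = inj₂ r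
        ... | inj₂ tx | inj₂ tz = ⊥-elim (<⇒≱ (s≤s d≤2) (count-inj (finFinite n) (a w) pts pts-adj pts-inj))
          where
          pts : Fin 3 → Fin n
          pts zero = x₀
          pts (suc zero) = z
          pts (suc (suc zero)) = t
          pts-adj : ∀ i → a w (pts i) ≡ true
          pts-adj zero = wx₀
          pts-adj (suc zero) = wz
          pts-adj (suc (suc zero)) = e
          pts-inj : ∀ i j → pts i ≡ pts j → i ≡ j
          pts-inj zero zero _ = refl
          pts-inj zero (suc zero) r = ⊥-elim (zx (sym r))
          pts-inj zero (suc (suc zero)) r = ⊥-elim (tx (sym r))
          pts-inj (suc zero) zero r = ⊥-elim (zx r)
          pts-inj (suc zero) (suc zero) _ = refl
          pts-inj (suc zero) (suc (suc zero)) r = ⊥-elim (tz (sym r))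
          pts-inj (suc (suc zero)) zero r = ⊥-elim (tx r)
          pts-inj (suc (suc zero)) (suc zero) r = ⊥-elim (tz r)
          pts-inj (suc (suc zero)) (suc (suc zero)) _ = refl

-- Sequences of contractions

member : ∀ {n} → List (Fin n) → Fin n → Bool
member W w = anyL (eqF w) W

member-true : ∀ {n} {W : List (Fin n)} {w} → member W w ≡ true → w ∈ W
member-true {W = u ∷ us} {w} e with ∨-true {eqF w u} e
... | inj₁ q = here (eqF-true {i = w} q)
... | inj₂ q = there (member-true q)

member-intro : ∀ {n} {W : List (Fin n)} {w} → w ∈ W → member W w ≡ true
member-intro {W = W} {w} m = anyL-intro {p = eqF w} W m (eqF-intro {i = w} refl)

-- Freed vertices are isolated and hence removable again; excluding them keeps the chosen vertices
-- distinct.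
candidate : ∀ {n} → ℕ → List (Fin n) → Adj n → Fin n → Bool
candidate D W A w = removable (adj A) D w ∧ not (member W w)

data Trace {n : ℕ} (D c E L : ℕ) : List (Fin n) → Adj n → ∀ {k} → Vec (Fin c) k → Adj n → Vec (Fin n) k → Vec (Undo n E L) k → Set where
  []   : ∀ {W A} → Trace D c E L W A [] A [] []
  onward : ∀ {W A k i B F w u} {is : Vec (Fin c) k} {ws us} (le : c ≤ countF n (candidate D W A)) →
         nth (candidate D W A) (allFin n) (inject≤ i le) ≡ w → Symm (adj A) → Irr (adj A) → Cert (adj A) w (adj B) u →
         Trace D c E L (w ∷ W) B is F ws us → Trace D c E L W A (i ∷ is) F (w ∷ ws) (u ∷ us)

-- Decoding runs backwards: the later steps determine the graph after the present one, the
-- certificate the graph before it, and the position of `w` among the candidates there is the choice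
-- made.
trace-inj : ∀ {n D c E L W} {A A' F : Adj n} {k} {is is' : Vec (Fin c) k} {ws us} →
  Trace D c E L W A is F ws us → Trace D c E L W A' is' F ws us → A ≡ A' × is ≡ is'
trace-inj [] [] = refl , refl
trace-inj {n} {D} {c} {W = W} {A} {A'} (onward {i = i} {w = w} le e s r cert t) (onward {i = i'} le' e' s' r' cert' t') with trace-inj t t'
... | refl , refl with trans (sym (mk-adj A)) (trans (mk-cong (cert-inj s s' r r' cert cert')) (mk-adj A'))
...   | refl = refl , cong (_∷ _) (inject≤-injective le le' i i' (nth-inj (candidate D W A) (allFin n) (allFin⁺ n) _ _ (trans e (sym e'))))

vecSum : ∀ {k} → Vec (Fin 4) k → ℕ
vecSum [] = 0
vecSum (l ∷ ls) = toℕ l + vecSum ls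

record Outcome {n} (g D c E k : ℕ) (W : List (Fin n)) (A : Adj n) (v : Fin n) (is : Vec (Fin c) k) : Set where
  field
    {final} : Adj n
    good   : Good g (adj final)
    {ws}   : Vec (Fin n) k
    {lost} : Vec (Fin 4) k
    {undos} : Vec (Undo n E (D + 6)) k
    trace  : Trace D c E (D + 6) W A is final ws undos
    sizes  : size (adj A) ≡ size (adj final) + 2 * vecSum lost
    new    : ∀ j → lookup ws j ∉ W
    distinct : ∀ i j → lookup ws i ≡ lookup ws j → i ≡ j
    empty  : ∀ j z → adj final (lookup ws j) z ≡ false
    keeps  : ∀ u → (∀ z → adj A u z ≡ false) → ∀ z → adj final u z ≡ false
    degree-drop : degree (adj A) v ≤ k + degree (adj final) v
    avoids : ∀ j → lookup ws j ≢ v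
    labels : ∀ j → toℕ (lookup lost j) ≡ 0 → lookup undos j ≡ lone (lookup ws j)

candidates : ∀ {n} D W (A : Adj n) → countF n (removable (adj A) D) ≤ countF n (candidate D W A) + length W
candidates {n} D W A = ≤-trans (sumL-mono (allFin n) pt) (≤-trans (≤-reflexive (sumL-+ (ind ∘ candidate D W A) _ (allFin n)))
  (+-monoʳ-≤ (countF n (candidate D W A)) (count-cover (finFinite n) (member W) (Data.List.lookup W) λ x e →
    let m = member-true {W = W} e in Data.List.Relation.Unary.Any.index m , sym (lookup-index m))))
  where
  pt : ∀ w → ind (removable (adj A) D w) ≤ ind (candidate D W A w) + ind (member W w)
  pt w = cases (removable (adj A) D w) (member W w)
    where
    cases : ∀ x y → ind x ≤ ind (x ∧ not y) + ind y
    cases false y = z≤n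
    cases true true = s≤s z≤n
    cases true false = s≤s z≤n

-- Each contraction costs `v` at most one edge, so its degree stays above six and `v` is never a
-- candidate. The condition on `n` leaves `c` candidates outside `W` at every step.
run : ∀ {n g c} k (W : List (Fin n)) (A : Adj n) v → Good g (adj A) → size (adj A) ≤ 6 * n + 12 * g →
  14 * (c + (length W + k)) + deficit g ≤ n → 7 + k ≤ degree (adj A) v →
  (is : Vec (Fin c) k) → Outcome g lowDegree c (6 * n + 12 * g) k W A v is
run zero W A v G size≤ room deg [] = record { good = G ; ws = [] ; lost = [] ; undos = [] ; trace = []
  ; sizes = sym (+-identityʳ _) ; new = λ () ; distinct = λ () ; empty = λ () ; keeps = λ _ h → h
  ; degree-drop = ≤-refl ; avoids = λ () ; labels = λ () }
run {n} {g} {c} (suc k) W A v G size≤ room deg (i ∷ is) = record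
  { good = O.good ; ws = w ∷ O.ws ; lost = R.lost ∷ O.lost ; undos = R.undo ∷ O.undos
  ; trace = onward le refl (gsym G) (girr G) R.cert O.trace
  ; sizes = trans R.sizes (trans (cong (_+ 2 * toℕ R.lost) O.sizes) (lem (size (adj O.final)) (toℕ R.lost) (vecSum O.lost)))
  ; new = λ { zero → w∉W ; (suc j) m → O.new j (there m) }
  ; distinct = λ { zero zero _ → refl ; zero (suc j) e → ⊥-elim (O.new j (here (sym e)))
                 ; (suc i) zero e → ⊥-elim (O.new i (here e)) ; (suc i) (suc j) e → cong suc (O.distinct i j e) }
  ; empty = λ { zero → O.keeps w R.gone ; (suc j) → O.empty j }
  ; keeps = λ u h → O.keeps u (R.keeps u h)
  ; degree-drop = ≤-trans (R.degree-drop v (w≢v ∘ sym)) (s≤s O.degree-drop)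
  ; avoids = λ { zero → w≢v ; (suc j) → O.avoids j }
  ; labels = λ { zero → R.label ; (suc j) → O.labels j } }
  where
  lem : ∀ s x y → s + 2 * y + 2 * x ≡ s + 2 * (x + y)
  lem = solve-∀
  le : c ≤ countF n (candidate lowDegree W A)
  le = +-cancelʳ-≤ (length W) _ _ (≤-trans (≤-trans (+-monoʳ-≤ c (m≤m+n (length W) (suc k)))
    (*-cancelˡ-≤ 14 (+-cancelʳ-≤ (deficit g) _ _ (≤-trans room (many-removable G size≤))))) (candidates lowDegree W A))
  w = nth (candidate lowDegree W A) (allFin n) (inject≤ i le)
  w-ok = ∧-true {removable (adj A) lowDegree w} (nth-true (candidate lowDegree W A) (allFin n) (inject≤ i le))
  w∉W : w ∉ W
  w∉W m = true≢false (member-intro m) (not-true (proj₂ w-ok))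
  w≢v : w ≢ v
  w≢v e = <⇒≱ (≤-trans (m≤m+n 7 (suc k)) deg) (subst (λ u → degree (adj A) u ≤ 6) e
    (≤ᵇ-true {degree (adj A) w} (proj₁ (∧-true {degree (adj A) w ≤ᵇ 6} (proj₁ w-ok)))))
  module R = Removal (remove A lowDegree G size≤ w (proj₁ w-ok))
  B = R.result
  smaller : size (adj B) ≤ 6 * n + 12 * g
  smaller = ≤-trans (≤-trans (m≤m+n _ _) (≤-reflexive (sym R.sizes))) size≤
  room′ : 14 * (c + (length (w ∷ W) + k)) + deficit g ≤ n
  room′ = subst (λ x → 14 * (c + x) + deficit g ≤ n) (+-suc (length W) k) room
  module O = Outcome (run k (w ∷ W) B v R.good smaller room′ (≤-pred (≤-trans deg (R.degree-drop v (w≢v ∘ sym)))) is)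

-- Handing out intervals of the rotation to freed vertices

record Piece (n : ℕ) : Set where
  constructor piece
  field
    hub         : Fin n
    lostEdges   : Fin 4
    first next  : Fin n
    others      : List (Fin n)

  block : List (Fin n)
  block = first ∷ next ∷ others

  -- The switches come on one after the other, so a loss of `l` edges turns on exactly `l` of them.
  -- A block has at least two vertices, so its first and last edges to `v` differ.
  joined keepsFirst keepsLast : Bool
  joined = 0 <ᵇ toℕ lostEdges
  keepsFirst = 1 <ᵇ toℕ lostEdges
  keepsLast = 2 <ᵇ toℕ lostEdges

  cutOff : List (Fin n)
  cutOff = optional keepsFirst first ++ dropped keepsLast (next ∷ others)

open Piece

lastOf : ∀ {X : Set} → X → List X → X
lastOf z [] = z
lastOf z (y ∷ ys) = lastOf y ys

kept-last : ∀ {X : Set} f (z : X) zs {t} → t ∈ z ∷ zs → t ∉ dropped f (z ∷ zs) → t ≡ lastOf z zs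
kept-last true z [] (here e) _ = e
kept-last false z [] m nd = ⊥-elim (nd m)
kept-last f z (y ∷ ys) (here e) nd = ⊥-elim (nd (here e))
kept-last f z (y ∷ ys) (there m) nd = kept-last f y ys m (nd ∘ there)

optional-⊆ : ∀ {X : Set} b {x t : X} → t ∈ optional b x → t ≡ x
optional-⊆ false (here e) = e

cutOff-⊆ : ∀ {n} (P : Piece n) {t} → t ∈ cutOff P → t ∈ block P
cutOff-⊆ P m with ∈-++⁻ (optional (keepsFirst P) (first P)) m
... | inj₁ q = here (optional-⊆ (keepsFirst P) q)
... | inj₂ q = there (dropped-⊆ (keepsLast P) _ q)

kept : ∀ {n} (P : Piece n) {t} → t ∈ block P → t ∉ cutOff P → t ≡ first P ⊎ t ≡ lastOf (next P) (others P)
kept P (here e) nd = inj₁ e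
kept P (there m) nd = inj₂ (kept-last (keepsLast P) (next P) (others P) m (nd ∘ ∈-++⁺ʳ (optional (keepsFirst P) (first P))))

module _ {n : ℕ} where

  -- `cover` lists, three per piece, all vertices that may still be adjacent to `v` once its whole
  -- rotation has been handed out. This bounds the length of the mask in the code.
  hubsOf rest cover : List (Piece n) → List (Fin n)
  hubsOf [] = []
  hubsOf (P ∷ Ps) = hub P ∷ hubsOf Ps
  rest [] = []
  rest (P ∷ Ps) = block P ++ rest Ps
  cover [] = []
  cover (P ∷ Ps) = hub P ∷ first P ∷ lastOf (next P) (others P) ∷ cover Ps

  assign : List (Piece n) → List (Fin n × Fin n)
  assign [] = []
  assign (P ∷ Ps) = map (_, hub P) (block P) ++ assign Ps

  assign-hub : ∀ Ps {z w} → (z , w) ∈ assign Ps → z ∈ rest Ps × w ∈ hubsOf Ps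
  assign-hub (P ∷ Ps) m with ∈-++⁻ (map (_, hub P) (block P)) m
  ... | inj₁ q with ∈-map⁻ (_, hub P) q
  ...   | z , mz , refl = ∈-++⁺ˡ mz , here refl
  assign-hub (P ∷ Ps) m | inj₂ q = let (x , y) = assign-hub Ps q in ∈-++⁺ʳ (block P) x , there y

  assigned : ∀ Ps {z} → z ∈ rest Ps → ∃[ w ] ((z , w) ∈ assign Ps)
  assigned (P ∷ Ps) m with ∈-++⁻ (block P) m
  ... | inj₁ q = hub P , ∈-++⁺ˡ (∈-map⁺ (_, hub P) q)
  ... | inj₂ q = let (w , r) = assigned Ps q in w , ∈-++⁺ʳ (map (_, hub P) (block P)) r

  assign-rest : ∀ Ps → map proj₁ (assign Ps) ≡ rest Ps
  assign-rest [] = refl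
  assign-rest (P ∷ Ps) = go (block P)
    where
    go : ∀ bs → map proj₁ (map (_, hub P) bs ++ assign Ps) ≡ bs ++ rest Ps
    go [] = assign-rest Ps
    go (x ∷ bs) = cong (x ∷_) (go bs)

  data Splits (v : Fin n) : Gr n → List (Piece n) → Gr n → Set where
    []  : ∀ {a} → Splits v a [] a
    _∷_ : ∀ {a a₁ b P Ps} → Symm a₁ × Irr a₁ × (∀ i j → Iff (a₁ i j ≡ true) (SplitOff a v (hub P) (block P) (cutOff P) (joined P) i j)) →
          Splits v a₁ Ps b → Splits v a (P ∷ Ps) b

  record Setup (v : Fin n) (a : Gr n) (Ps : List (Piece n)) : Set where
    field
      symm   : Symm a
      irr    : Irr a
      empty  : ∀ {w} → w ∈ hubsOf Ps → ∀ z → a w z ≡ false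
      unique-hubs : Unique (hubsOf Ps)
      v∉     : v ∉ hubsOf Ps
      nbrs   : ∀ {z} → z ∈ rest Ps → a v z ≡ true
      unique-rest : Unique (rest Ps)

    rest-hub : ∀ {z w} → z ∈ rest Ps → w ∈ hubsOf Ps → z ≢ w
    rest-hub mz mw refl = true≢false (symm v _ (nbrs mz)) (empty mw v)

    rest≢v : ∀ {z} → z ∈ rest Ps → z ≢ v
    rest≢v mz refl = true≢false (nbrs mz) (irr v)

  private
    unique-++ʳ : ∀ {X : Set} (xs : List X) {ys} → Unique (xs ++ ys) → Unique ys
    unique-++ʳ [] u = u
    unique-++ʳ (x ∷ xs) (_ ∷ u) = unique-++ʳ xs u

    unique-apart : ∀ {X : Set} (xs : List X) {ys x} → Unique (xs ++ ys) → x ∈ xs → x ∉ ys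
    unique-apart (x ∷ xs) u (here refl) m = fresh u (∈-++⁺ʳ xs m) refl
    unique-apart (x ∷ xs) (_ ∷ u) (there m) m' = unique-apart xs u m m'

    unique-++ˡ : ∀ {X : Set} (xs : List X) {ys} → Unique (xs ++ ys) → Unique xs
    unique-++ˡ [] u = []
    unique-++ˡ (x ∷ xs) u@(_ ∷ u') = Data.List.Relation.Unary.All.tabulate (λ m → fresh u (∈-++⁺ˡ m)) ∷ unique-++ˡ xs u'

  setup-next : ∀ {v a a₁ P Ps} → Setup v a (P ∷ Ps) → Symm a₁ → Irr a₁ →
    (∀ i j → Iff (a₁ i j ≡ true) (SplitOff a v (hub P) (block P) (cutOff P) (joined P) i j)) → Setup v a₁ Ps
  setup-next {v} {a} {a₁} {P} {Ps} S s₁ i₁ spec = record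
    { symm = s₁ ; irr = i₁
    ; empty = λ {w} mw z → ≢true λ e → case proj₁ (spec w z) e of λ where
        (inj₁ (r , _)) → fresh S.unique-hubs mw (sym r)
        (inj₂ (inj₁ (_ , inj₁ m))) → S.rest-hub (∈-++⁺ˡ m) (there mw) refl
        (inj₂ (inj₁ (_ , inj₂ (_ , r)))) → S.v∉ (subst (_∈ hubsOf (P ∷ Ps)) r (there mw))
        (inj₂ (inj₂ (p , _))) → true≢false p (S.empty (there mw) z)
    ; unique-hubs = fresh-tail S.unique-hubs
    ; v∉ = S.v∉ ∘ there
    ; nbrs = λ {z} m → proj₂ (spec v z) (inj₂ (inj₂ (S.nbrs (∈-++⁺ʳ (block P) m) , λ where
        (inj₁ (_ , q)) → unique-apart (block P) S.unique-rest (cutOff-⊆ P q) m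
        (inj₂ (r , _)) → S.rest≢v (∈-++⁺ʳ (block P) m) r)))
    ; unique-rest = unique-++ʳ (block P) S.unique-rest }
    where
    module S = Setup S

  -- Once the hubs are known, `at-hub` reads the assignment off `b`, and `away` the edges of `a`
  -- that avoid `v`.
  record Facts (v : Fin n) (a : Gr n) (Ps : List (Piece n)) (b : Gr n) : Set where
    field
      at-hub  : ∀ {w z} → w ∈ hubsOf Ps → z ≢ v → Iff (b w z ≡ true) ((z , w) ∈ assign Ps)
      away    : ∀ {u t} → u ∉ hubsOf Ps → t ∉ hubsOf Ps → u ≢ v → t ≢ v → Iff (b u t ≡ true) (a u t ≡ true)
      at-v    : ∀ {u} → u ∉ hubsOf Ps → b v u ≡ true → a v u ≡ true
      at-v⁺   : ∀ {u} → u ∉ hubsOf Ps → u ∉ rest Ps → a v u ≡ true → b v u ≡ true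
      covered : ∀ {t} → b v t ≡ true → t ∈ cover Ps ⊎ (a v t ≡ true × t ∉ hubsOf Ps × t ∉ rest Ps)
      linked  : ∀ {P} → P ∈ Ps → joined P ≡ true → b v (hub P) ≡ true
      bsym    : Symm b

  facts : ∀ {v a Ps b} → Setup v a Ps → Splits v a Ps b → Facts v a Ps b
  facts S [] = record { at-hub = λ () ; away = λ _ _ _ _ → id , id ; at-v = λ _ → id ; at-v⁺ = λ _ _ → id
    ; covered = λ e → inj₂ (e , (λ ()) , λ ()) ; linked = λ () ; bsym = Setup.symm S }
  facts {v} {a} {P ∷ Ps} {b} S ((s₁ , i₁ , spec) ∷ sp) = record
    { at-hub = at-hub′ ; away = away′ ; at-v = at-v′ ; at-v⁺ = at-v⁺′ ; covered = covered′ ; linked = linked′ ; bsym = F.bsym }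
    where
    module S = Setup S
    S₁ = setup-next {P = P} S s₁ i₁ spec
    module S₁ = Setup S₁
    module F = Facts (facts S₁ sp)
    w = hub P
    w∉ : w ∉ hubsOf Ps
    w∉ m = fresh S.unique-hubs m refl
    w∉rest : w ∉ rest Ps
    w∉rest m = S.rest-hub (∈-++⁺ʳ (block P) m) (here refl) refl
    w≢v : w ≢ v
    w≢v e = S.v∉ (here (sym e))
    at-first : ∀ {z} → z ≢ v → z ∈ hubsOf Ps ⊎ z ∉ hubsOf Ps → Iff (b w z ≡ true) ((z , w) ∈ assign (P ∷ Ps))
    at-first {z} zv (inj₁ mz) = (λ e → ⊥-elim (w∉rest (proj₁ (assign-hub Ps (proj₁ (F.at-hub mz w≢v) (F.bsym w z e))))))
      , λ m → ⊥-elim (S.rest-hub (proj₁ (assign-hub (P ∷ Ps) m)) (there mz) refl)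
    at-first {z} zv (inj₂ nz) = to , from
      where
      to : b w z ≡ true → (z , w) ∈ assign (P ∷ Ps)
      to e with proj₁ (spec w z) (proj₁ (F.away w∉ nz w≢v zv) e)
      ... | inj₁ (_ , inj₁ m) = ∈-++⁺ˡ (∈-map⁺ (_, w) m)
      ... | inj₁ (_ , inj₂ (_ , r)) = ⊥-elim (zv r)
      ... | inj₂ (inj₁ (_ , inj₁ m)) = ⊥-elim (S.rest-hub (∈-++⁺ˡ m) (here refl) refl)
      ... | inj₂ (inj₁ (_ , inj₂ (_ , r))) = ⊥-elim (w≢v r)
      ... | inj₂ (inj₂ (p , _)) = ⊥-elim (true≢false p (S.empty (here refl) z))
      from : (z , w) ∈ assign (P ∷ Ps) → b w z ≡ true
      from m with ∈-++⁻ (map (_, w) (block P)) m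
      ... | inj₂ q = ⊥-elim (w∉ (proj₂ (assign-hub Ps q)))
      ... | inj₁ q with ∈-map⁻ (_, w) q
      ...   | _ , mz , refl = proj₂ (F.away w∉ nz w≢v zv) (proj₂ (spec w z) (inj₁ (refl , inj₁ mz)))
    hub? : ∀ z → z ∈ hubsOf Ps ⊎ z ∉ hubsOf Ps
    hub? z with bool-cases (member (hubsOf Ps) z)
    ... | inj₁ e = inj₁ (member-true e)
    ... | inj₂ e = inj₂ λ m → true≢false (member-intro m) e
    at-hub′ : ∀ {u z} → u ∈ w ∷ hubsOf Ps → z ≢ v → Iff (b u z ≡ true) ((z , u) ∈ assign (P ∷ Ps))
    at-hub′ {u} {z} (here refl) zv = at-first zv (hub? z)
    at-hub′ {u} {z} (there m) zv = (λ e → ∈-++⁺ʳ (map (_, w) (block P)) (proj₁ (F.at-hub m zv) e)) , from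
      where
      from : (z , u) ∈ assign (P ∷ Ps) → b u z ≡ true
      from q with ∈-++⁻ (map (_, w) (block P)) q
      ... | inj₂ r = proj₂ (F.at-hub m zv) r
      ... | inj₁ r with ∈-map⁻ (_, w) r
      ...   | _ , _ , refl = ⊥-elim (w∉ m)
    away′ : ∀ {u t} → u ∉ w ∷ hubsOf Ps → t ∉ w ∷ hubsOf Ps → u ≢ v → t ≢ v → Iff (b u t ≡ true) (a u t ≡ true)
    away′ {u} {t} nu nt uv tv = to , from
      where
      to : b u t ≡ true → a u t ≡ true
      to e with proj₁ (spec u t) (proj₁ (F.away (nu ∘ there) (nt ∘ there) uv tv) e)
      ... | inj₁ (r , _) = ⊥-elim (nu (here r))
      ... | inj₂ (inj₁ (r , _)) = ⊥-elim (nt (here r))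
      ... | inj₂ (inj₂ (p , _)) = p
      from : a u t ≡ true → b u t ≡ true
      from e = proj₂ (F.away (nu ∘ there) (nt ∘ there) uv tv) (proj₂ (spec u t) (inj₂ (inj₂ (e , λ where
        (inj₁ (r , _)) → uv r
        (inj₂ (r , _)) → tv r))))
    at-v′ : ∀ {u} → u ∉ w ∷ hubsOf Ps → b v u ≡ true → a v u ≡ true
    at-v′ {u} nu e with proj₁ (spec v u) (F.at-v (nu ∘ there) e)
    ... | inj₁ (r , _) = ⊥-elim (w≢v (sym r))
    ... | inj₂ (inj₁ (r , _)) = ⊥-elim (nu (here r))
    ... | inj₂ (inj₂ (p , _)) = p
    at-v⁺′ : ∀ {u} → u ∉ w ∷ hubsOf Ps → u ∉ rest (P ∷ Ps) → a v u ≡ true → b v u ≡ true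
    at-v⁺′ {u} nu nr e = F.at-v⁺ (nu ∘ there) (nr ∘ ∈-++⁺ʳ (block P)) (proj₂ (spec v u) (inj₂ (inj₂ (e , λ where
      (inj₁ (_ , m)) → nr (∈-++⁺ˡ (cutOff-⊆ P m))
      (inj₂ (r , _)) → true≢false e (subst (λ t → a v t ≡ false) (sym r) (S.irr v))))))
    covered′ : ∀ {t} → b v t ≡ true → t ∈ cover (P ∷ Ps) ⊎ (a v t ≡ true × t ∉ w ∷ hubsOf Ps × t ∉ rest (P ∷ Ps))
    covered′ {t} e with F.covered e
    ... | inj₁ m = inj₁ (there (there (there m)))
    ... | inj₂ (p , nh , nr) with proj₁ (spec v t) p
    ...   | inj₁ (r , _) = ⊥-elim (w≢v (sym r))
    ...   | inj₂ (inj₁ (r , _)) = inj₁ (here r)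
    ...   | inj₂ (inj₂ (q , nt)) with bool-cases (member (block P) t)
    ...     | inj₁ m = inj₁ ([ there ∘ here , there ∘ there ∘ here ]′ (kept P (member-true m) λ c → nt (inj₁ (refl , c))))
    ...     | inj₂ nm = inj₂ (q , (λ where
                (here refl) → true≢false (S.symm v w q) (S.empty (here refl) v)
                (there m) → nh m)
              , λ m → [ (λ x → true≢false (member-intro x) nm) , nr ]′ (∈-++⁻ (block P) m))
    linked′ : ∀ {R} → R ∈ P ∷ Ps → joined R ≡ true → b v (hub R) ≡ true
    linked′ (here refl) j = F.at-v⁺ w∉ w∉rest (proj₂ (spec v w) (inj₂ (inj₁ (refl , inj₂ (j , refl)))))
    linked′ (there m) j = F.linked m j

  pieceSum : List (Piece n) → ℕ
  pieceSum [] = 0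
  pieceSum (P ∷ Ps) = toℕ (lostEdges P) + pieceSum Ps

  split-pieces : ∀ {g a} (G : Good g a) v Ps → Setup v a Ps → Chained (nx (emb G v)) (rest Ps) →
    Σ[ b ∈ Gr n ] (Good g b × Splits v a Ps b × size b ≡ size a + 2 * pieceSum Ps)
  split-pieces {g} {a} G v [] S c = a , G , [] , sym (+-identityʳ _)
  split-pieces {g} {a} G v (P ∷ Ps) S c =
    let (b , B , sp , sz) = split-pieces (Split.good X) v Ps (setup-next {P = P} S (gsym (Split.good X)) (girr (Split.good X)) (Split.spec X)) chain
    in b , B , (gsym (Split.good X) , girr (Split.good X) , Split.spec X) ∷ sp
       , trans sz (trans (cong (_+ 2 * pieceSum Ps) (Split.sizes X)) (lem (size a) _ (pieceSum Ps) (bits (lostEdges P))))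
    where
    module S = Setup S
    w = hub P
    chained-++ˡ : ∀ {f : Fin n → Fin n} xs {ys} → Chained f (xs ++ ys) → Chained f xs
    chained-++ˡ [] c = tt
    chained-++ˡ (x ∷ []) c = tt
    chained-++ˡ (x ∷ y ∷ xs) (e , c) = e , chained-++ˡ (y ∷ xs) c
    chained-++ʳ : ∀ {f : Fin n → Fin n} xs {ys} → Chained f (xs ++ ys) → Chained f ys
    chained-++ʳ [] c = c
    chained-++ʳ (x ∷ xs) c = chained-++ʳ xs (chained-tail x _ c)
    X = splitOff G v w (first P) (next P) (others P) (λ e → S.v∉ (here e)) (S.empty (here refl))
      (chained-++ˡ (block P) c) (unique-++ˡ (block P) S.unique-rest) (λ t m → S.nbrs (∈-++⁺ˡ m))
      (joined P) (keepsFirst P) (keepsLast P)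
    chain : Chained (nx (emb (Split.good X) v)) (rest Ps)
    chain = chained-cong (rest Ps) (λ t m m' → Split.unmoved X t
        (λ q → unique-apart (block P) S.unique-rest q m) (S.rest-hub (∈-++⁺ʳ (block P) m) (here refl))
        (λ q → unique-apart (block P) S.unique-rest q m') (S.rest-hub (∈-++⁺ʳ (block P) m') (here refl)))
      (chained-++ʳ (block P) c)
    bits : ∀ (l : Fin 4) → ind (0 <ᵇ toℕ l) + ind (1 <ᵇ toℕ l) + ind (2 <ᵇ toℕ l) ≡ toℕ l
    bits zero = refl
    bits (suc zero) = refl
    bits (suc (suc zero)) = refl
    bits (suc (suc (suc zero))) = refl
    lem : ∀ s x y {l} → x ≡ l → s + 2 * x + 2 * y ≡ s + 2 * (l + y)
    lem s x y refl = lem′ s x y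
      where
      lem′ : ∀ s x y → s + 2 * x + 2 * y ≡ s + 2 * (x + y)
      lem′ = solve-∀

  -- A letter `c` is written as an interval of length `2 + c`. The last interval takes whatever
  -- remains of the rotation, so `suc k` vertices carry only `k` letters.
  data Cut {s : ℕ} : ∀ {k} → Vec (Fin n) (suc k) → Vec (Fin 4) (suc k) → Vec (Fin s) k → List (Piece n) → Set where
    whole : ∀ {w l} z₁ z₂ zs → Cut (w ∷ []) (l ∷ []) [] (piece w l z₁ z₂ zs ∷ [])
    cut   : ∀ {k w l c} {ws : Vec (Fin n) (suc k)} {ls cs Ps} z₁ z₂ zs → length zs ≡ toℕ c →
            Cut ws ls cs Ps → Cut (w ∷ ws) (l ∷ ls) (c ∷ cs) (piece w l z₁ z₂ zs ∷ Ps)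

  -- Each interval but the last takes at most `suc s` vertices, as its letter is below `s`; the last
  -- needs two.
  cutUp : ∀ {s k} (ws : Vec (Fin n) (suc k)) ls (cs : Vec (Fin s) k) xs → 2 + k * suc s ≤ length xs →
    Σ[ Ps ∈ List (Piece n) ] (Cut ws ls cs Ps × rest Ps ≡ xs)
  cutUp (w ∷ []) (l ∷ []) [] (z₁ ∷ []) (s≤s ())
  cutUp (w ∷ []) (l ∷ []) [] (z₁ ∷ z₂ ∷ zs) le = piece w l z₁ z₂ zs ∷ [] , whole z₁ z₂ zs , ++-identityʳ _
  cutUp (w ∷ w' ∷ ws) (l ∷ ls) (c ∷ cs) (z₁ ∷ []) (s≤s ())
  cutUp {s} {suc k} (w ∷ w' ∷ ws) (l ∷ ls) (c ∷ cs) (z₁ ∷ z₂ ∷ zs) (s≤s (s≤s le)) =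
    let (Ps , C , e) = cutUp (w' ∷ ws) ls cs (drop (toℕ c) zs) room
    in piece w l z₁ z₂ (take (toℕ c) zs) ∷ Ps
       , cut z₁ z₂ (take (toℕ c) zs) (trans (length-take (toℕ c) zs) (m≤n⇒m⊓n≡m c≤)) C
       , cong (λ ys → z₁ ∷ z₂ ∷ ys) (trans (cong (take (toℕ c) zs ++_) e) (take++drop≡id (toℕ c) zs))
    where
    c<s : toℕ c < s
    c<s = toℕ<n c
    c≤ : toℕ c ≤ length zs
    c≤ = ≤-trans (≤-trans (<⇒≤ c<s) (≤-trans (n≤1+n s) (m≤m+n (suc s) (k * suc s)))) le
    room : 2 + k * suc s ≤ length (drop (toℕ c) zs)
    room = subst (2 + k * suc s ≤_) (sym (length-drop (toℕ c) zs))
      (m+n≤o⇒m≤o∸n _ (≤-trans (≤-trans (≤-reflexive (lem (k * suc s) (toℕ c))) (+-monoˡ-≤ (k * suc s) (s≤s c<s))) le))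
      where
      lem : ∀ x c → 2 + x + c ≡ suc (suc c) + x
      lem = solve-∀

  private
    peel : ∀ {w : Fin n} (xs ys : List (Fin n)) {R R' : List (Fin n × Fin n)} → (∀ {z} → (z , w) ∉ R) → (∀ {z} → (z , w) ∉ R') →
      map (_, w) xs ++ R ≡ map (_, w) ys ++ R' → xs ≡ ys × R ≡ R'
    peel [] [] h h' e = refl , e
    peel [] (y ∷ ys) h h' refl = ⊥-elim (h (here refl))
    peel (x ∷ xs) [] h h' refl = ⊥-elim (h' (here refl))
    peel (x ∷ xs) (y ∷ ys) h h' e with ∷-injective e
    ... | e₁ , e₂ with peel xs ys h h' e₂
    ...   | refl , r = cong (_∷ xs) (,-injectiveˡ e₁) , r

  -- In `assign` the members of an interval are marked with their hub. Hubs being distinct, the runs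
  -- of equal marks are the intervals, whose order and lengths give vertices and letters.
  cut-inj : ∀ {s k} {ws ws' : Vec (Fin n) (suc k)} {ls ls'} {cs cs' : Vec (Fin s) k} {Ps Ps'} →
    Cut ws ls cs Ps → Cut ws' ls' cs' Ps' → Unique (hubsOf Ps) → Unique (hubsOf Ps') → assign Ps ≡ assign Ps' → ws ≡ ws' × cs ≡ cs'
  cut-inj (whole _ _ _) (whole _ _ _) u u' e = cong (_∷ []) (,-injectiveʳ (proj₁ (∷-injective e))) , refl
  cut-inj (cut {w = w} {Ps = Ps} z₁ z₂ zs len C) (cut {w = w'} {Ps = Ps'} z₁' z₂' zs' len' C') u u' e
    with ,-injectiveʳ (proj₁ (∷-injective e))
  ... | refl with peel (z₁ ∷ z₂ ∷ zs) (z₁' ∷ z₂' ∷ zs') (λ m → fresh u (proj₂ (assign-hub Ps m)) refl)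
                      (λ m → fresh u' (proj₂ (assign-hub Ps' m)) refl) e
  ...   | refl , r with cut-inj C C' (fresh-tail u) (fresh-tail u') r
  ...     | refl , refl = refl , cong (_∷ _) (toℕ-injective (trans (sym len) len'))

  -- Distinct first components leave an included pair only one place to be.
  same-pairs : ∀ (xs ys : List (Fin n × Fin n)) → map proj₁ xs ≡ map proj₁ ys → Unique (map proj₁ ys) →
    (∀ {x} → x ∈ xs → x ∈ ys) → xs ≡ ys
  same-pairs [] [] e u h = refl
  same-pairs (x ∷ xs) (y ∷ ys) e u h with ∷-injective e
  ... | e₁ , e₂ = cong₂ _∷_ x≡y (same-pairs xs ys e₂ (fresh-tail u) λ {x'} m → later m (h (there m)))
    where
    x≡y : x ≡ y
    x≡y with h (here refl)
    ... | here q = q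
    ... | there m = ⊥-elim (fresh u (∈-map⁺ proj₁ m) (sym e₁))
    later : ∀ {x'} → x' ∈ xs → x' ∈ y ∷ ys → x' ∈ ys
    later m (there q) = q
    later m (here refl) = ⊥-elim (fresh u (subst (proj₁ y ∈_) e₂ (∈-map⁺ proj₁ m)) refl)

iterates : {X : Set} → ℕ → (X → X) → X → List X
iterates zero f x = []
iterates (suc d) f x = x ∷ iterates d f (f x)

module _ {X : Set} {f : X → X} where

  iterates-chained : ∀ d x → Chained f (iterates d f x)
  iterates-chained zero x = tt
  iterates-chained (suc zero) x = tt
  iterates-chained (suc (suc d)) x = refl , iterates-chained (suc d) (f x)

  ∈-iterates : ∀ d x k → k < d → iter k f x ∈ iterates d f x
  ∈-iterates (suc d) x zero lt = here refl
  ∈-iterates (suc d) x (suc k) lt = there (subst (_∈ iterates d f (f x)) (iter-comm f k x) (∈-iterates d (f x) k (≤-pred lt)))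

  iterates-∈ : ∀ d x {y} → y ∈ iterates d f x → ∃[ k ] (k < d × iter k f x ≡ y)
  iterates-∈ (suc d) x (here refl) = 0 , z<s , refl
  iterates-∈ (suc d) x (there m) = let (k , lt , e) = iterates-∈ d (f x) m in suc k , s≤s lt , trans (sym (iter-comm f k x)) e

  iterates-unique : ∀ d x → (∀ i j → i < j → j < d → iter i f x ≢ iter j f x) → Unique (iterates d f x)
  iterates-unique zero x h = []
  iterates-unique (suc d) x h = Data.List.Relation.Unary.All.tabulate (λ m e → let (k , lt , q) = iterates-∈ d (f x) m in
      h 0 (suc k) z<s (s≤s lt) (trans e (trans (sym q) (iter-comm f k x))))
    ∷ iterates-unique d (f x) λ i j i<j j<d e → h (suc i) (suc j) (s≤s i<j) (s≤s j<d)
        (trans (sym (iter-comm f i x)) (trans e (iter-comm f j x)))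

  iterates-length : ∀ d x → length (iterates d f x) ≡ d
  iterates-length zero x = refl
  iterates-length (suc d) x = cong suc (iterates-length d (f x))

module Rotation {n g} {a : Gr n} (G : Good g a) (v : Fin n) (pos : 0 < degree a v) where

  start : Fin n
  -- Starting at the first listed neighbour makes the list a function of the embedding.
  start = nthNbr a v (fromℕ< pos)

  start-adj : a v start ≡ true
  start-adj = nth-true (a v) (allFin n) (fromℕ< pos)

  rotation : List (Fin n)
  rotation = iterates (degree a v) (nx (emb G v)) start

  private
    f = nx (emb G v)
    cycle = row-cycle (emb G v) start-adj

  rotation-adj : ∀ {t} → t ∈ rotation → a v t ≡ true
  rotation-adj m = let (k , _ , e) = iterates-∈ (degree a v) start m in subst (λ t → a v t ≡ true) e (stays k)
    where
    stays : ∀ k → a v (iter k f start) ≡ true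
    stays zero = start-adj
    stays (suc k) = row-closed (emb G v) (stays k)

  adj-rotation : ∀ {t} → a v t ≡ true → t ∈ rotation
  adj-rotation e = let (k , lt , q) = orb-bounded (finFinite n) (perm (emb G v)) pos (proj₂ cycle) (cyc (emb G v) start-adj e)
    in subst (_∈ rotation) q (∈-iterates (degree a v) start k lt)

  rotation-unique : Unique rotation
  rotation-unique = iterates-unique (degree a v) start λ i j i<j j<d e → proj₁ cycle (j ∸ i) (m<n⇒0<n∸m i<j)
    (≤-<-trans (m∸n≤m j i) j<d)
    (iter-inj (perm (emb G v)) i (trans (sym (iter-+ f i (j ∸ i) start))
      (trans (cong (λ m → iter m f start) (m+[n∸m]≡n (<⇒≤ i<j))) (sym e))))

facts-cong : ∀ {n} {v} {a b b' : Gr n} {Ps} → (∀ i j → b i j ≡ b' i j) → Facts v a Ps b → Facts v a Ps b'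
facts-cong {v = v} h F = record
  { at-hub = λ m zv → proj₁ (F.at-hub m zv) ∘ trans (h _ _) , trans (sym (h _ _)) ∘ proj₂ (F.at-hub m zv)
  ; away = λ p q r s → proj₁ (F.away p q r s) ∘ trans (h _ _) , trans (sym (h _ _)) ∘ proj₂ (F.away p q r s)
  ; at-v = λ p → F.at-v p ∘ trans (h v _)
  ; at-v⁺ = λ p q e → trans (sym (h v _)) (F.at-v⁺ p q e)
  ; covered = λ e → F.covered (trans (h v _) e)
  ; linked = λ m j → trans (sym (h v _)) (F.linked m j)
  ; bsym = λ u t e → trans (sym (h t u)) (F.bsym u t (trans (h u t) e)) }
  where
  module F = Facts F

module _ {n : ℕ} where

  cut-hub : ∀ {s k} {ws : Vec (Fin n) (suc k)} {ls} {cs : Vec (Fin s) k} {Ps} → Cut ws ls cs Ps →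
    ∀ {w} → w ∈ hubsOf Ps → ∃[ j ] lookup ws j ≡ w
  cut-hub (whole _ _ _) (here e) = zero , sym e
  cut-hub (cut _ _ _ _ C) (here e) = zero , sym e
  cut-hub (cut _ _ _ _ C) (there m) = let (j , e) = cut-hub C m in suc j , e

  cut-piece : ∀ {s k} {ws : Vec (Fin n) (suc k)} {ls} {cs : Vec (Fin s) k} {Ps} → Cut ws ls cs Ps →
    ∀ j → ∃[ P ] (P ∈ Ps × Piece.hub P ≡ lookup ws j × Piece.lostEdges P ≡ lookup ls j)
  cut-piece (whole _ _ _) zero = _ , here refl , refl , refl
  cut-piece (cut _ _ _ _ C) zero = _ , here refl , refl , refl
  cut-piece (cut _ _ _ _ C) (suc j) = let (P , m , e) = cut-piece C j in P , there m , e

  piece-hub : ∀ {P : Piece n} {Ps} → P ∈ Ps → Piece.hub P ∈ hubsOf Ps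
  piece-hub (here refl) = here refl
  piece-hub (there m) = there (piece-hub m)

  cut-unique : ∀ {s k} {ws : Vec (Fin n) (suc k)} {ls} {cs : Vec (Fin s) k} {Ps} → Cut ws ls cs Ps →
    (∀ i j → lookup ws i ≡ lookup ws j → i ≡ j) → Unique (hubsOf Ps)
  cut-unique (whole _ _ _) d = [] ∷ []
  cut-unique (cut _ _ _ _ C) d = Data.List.Relation.Unary.All.tabulate (λ m e → let (j , q) = cut-hub C m in
      case d zero (suc j) (trans e (sym q)) of λ ())
    ∷ cut-unique C λ i j e → case d (suc i) (suc j) e of λ { refl → refl }

  cut-sum : ∀ {s k} {ws : Vec (Fin n) (suc k)} {ls} {cs : Vec (Fin s) k} {Ps} → Cut ws ls cs Ps → pieceSum Ps ≡ vecSum ls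
  cut-sum (whole _ _ _) = refl
  cut-sum (cut {l = l} _ _ _ _ C) = cong (toℕ l +_) (cut-sum C)

  cut-cover : ∀ {s k} {ws : Vec (Fin n) (suc k)} {ls} {cs : Vec (Fin s) k} {Ps} → Cut ws ls cs Ps → length (cover Ps) ≡ 3 * suc k
  cut-cover (whole _ _ _) = refl
  cut-cover {k = suc k} (cut _ _ _ _ C) = trans (cong (3 +_) (cut-cover C)) (sym (*-suc 3 (suc k)))

uip : ∀ {x : Bool} (p q : x ≡ true) → p ≡ q
uip refl refl = refl

-- The embedding of `F` is derived afresh from the Boolean tests instead of being carried through
-- the contractions. By `uip` it then depends on `F` alone, so recovering `F` also recovers the
-- rotation at `v`.
record Spread {n} (g s k : ℕ) (F : Adj n) (v : Fin n) (ws : Vec (Fin n) (suc k)) (ls : Vec (Fin 4) (suc k)) (cs : Vec (Fin s) k) : Set where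
  field
    simple : isSimple F ≡ true
    genus′ : genusAtMost g F ≡ true
    pos    : 0 < degree (adj F) v
    {Ps}   : List (Piece n)
    cuts   : Cut ws ls cs Ps
    order  : rest Ps ≡ Rotation.rotation (good-from g F simple genus′) v pos
    setup  : Setup v (adj F) Ps
    {result} : Adj n
    good   : Good g (adj result)
    known  : Facts v (adj F) Ps (adj result)
    sizes  : size (adj result) ≡ size (adj F) + 2 * vecSum ls

  around-v : ∀ {t} → adj F v t ≡ true → t ∈ rest Ps
  around-v e = subst (_ ∈_) (sym order) (Rotation.adj-rotation (good-from g F simple genus′) v pos e)

  degree-v : degree (adj result) v ≤ 3 * suc k
  degree-v = ≤-trans (count-cover (finFinite n) (adj result v) (Data.List.lookup (cover Ps)) λ t e →
      case Facts.covered known e of λ where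
        (inj₁ m) → Data.List.Relation.Unary.Any.index m , sym (lookup-index m)
        (inj₂ (q , _ , nr)) → ⊥-elim (nr (around-v q)))
    (≤-reflexive (cut-cover cuts))

  mask : Vec Bool (3 * suc k)
  mask = maskOf (3 * suc k) (adj result) v (member (hubsOf Ps))

spread : ∀ {n g s k} (F : Adj n) v (ws : Vec (Fin n) (suc k)) ls (cs : Vec (Fin s) k) → Good g (adj F) →
  (∀ i j → lookup ws i ≡ lookup ws j → i ≡ j) → (∀ j z → adj F (lookup ws j) z ≡ false) → (∀ j → lookup ws j ≢ v) →
  2 + k * suc s ≤ degree (adj F) v → Spread g s k F v ws ls cs
spread {n} {g} {s} {k} F v ws ls cs G₀ dist emp av deg = record
  { simple = simple ; genus′ = gen ; pos = pos ; cuts = C ; order = ord ; setup = S ; result = mk b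
  ; good = good-cong (λ i j → sym (adj-mk b i j)) B
  ; known = facts-cong (λ i j → sym (adj-mk b i j)) (facts S sp)
  ; sizes = trans (sumL-cong (allFin n) λ i → count-cong (finFinite n) λ j → adj-mk b i j)
      (trans sz (cong (λ x → size (adj F) + 2 * x) (cut-sum C))) }
  where
  ok = subst (λ A → isSimple A ≡ true × genusAtMost g A ≡ true) (mk-adj F) (good-mk G₀)
  simple = proj₁ ok
  gen = proj₂ ok
  G = good-from g F simple gen
  pos : 0 < degree (adj F) v
  pos = ≤-trans (s≤s z≤n) deg
  open Rotation G v pos
  up = cutUp ws ls cs rotation (≤-trans deg (≤-reflexive (sym (iterates-length (degree (adj F) v) start))))
  Ps = proj₁ up
  C = proj₁ (proj₂ up)
  ord : rest Ps ≡ rotation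
  ord = proj₂ (proj₂ up)
  S : Setup v (adj F) Ps
  S = record { symm = gsym G ; irr = girr G
    ; empty = λ m z → let (j , e) = cut-hub C m in subst (λ w → adj F w z ≡ false) e (emp j z)
    ; unique-hubs = cut-unique C dist
    ; v∉ = λ m → let (j , e) = cut-hub C m in av j e
    ; nbrs = λ m → rotation-adj (subst (_ ∈_) ord m)
    ; unique-rest = subst Unique (sym ord) rotation-unique }
  out = split-pieces G v Ps S (subst (Chained (nx (emb G v))) (sym ord) (iterates-chained (degree (adj F) v) start))
  b = proj₁ out
  B = proj₁ (proj₂ out)
  sp = proj₁ (proj₂ (proj₂ out))
  sz = proj₂ (proj₂ (proj₂ out))

-- Decoding

module Decode {n g s k E L} {F F' : Adj n} {v} {ws ws' : Vec (Fin n) (suc k)} {ls} {cs cs' : Vec (Fin s) k}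
  (X : Spread g s k F v ws ls cs) (X' : Spread g s k F' v ws' ls cs') (us : Vec (Undo n E L) (suc k))
  (labels : ∀ j → toℕ (lookup ls j) ≡ 0 → lookup us j ≡ lone (lookup ws j))
  (labels' : ∀ j → toℕ (lookup ls j) ≡ 0 → lookup us j ≡ lone (lookup ws' j))
  (results : Spread.result X ≡ Spread.result X') (masks : Spread.mask X ≡ Spread.mask X') where

  private
    module X = Spread X
    module X' = Spread X'

    index-hub' : ∀ j → lookup ws' j ∈ hubsOf X'.Ps
    index-hub' j = let (P , m , e , _) = cut-piece X'.cuts j in subst (_∈ hubsOf X'.Ps) e (piece-hub m)

  masked : ∀ {w} → w ∈ hubsOf X.Ps → adj X.result v w ≡ true → w ∈ hubsOf X'.Ps
  masked {w} m e = transport results (index (adj X.result v) (allFin n) (∈-allFin w) e)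
    where
    transport : ∀ {R'} → X.result ≡ R' → ∃[ i ] nthNbr (adj X.result) v i ≡ w → w ∈ hubsOf X'.Ps
    transport _ (i , refl) = member-true (trans (sym (lookup-mask (adj X.result) v (member (hubsOf X'.Ps)) X.degree-v i))
      (trans (cong (λ mk → lookup mk (inject≤ i X.degree-v)) (trans (cong (λ R → maskOf (3 * suc k) (adj R) v (member (hubsOf X'.Ps))) results) (sym masks)))
        (trans (lookup-mask (adj X.result) v (member (hubsOf X.Ps)) X.degree-v i) (member-intro m))))

  -- A freed vertex that lost an edge has been joined to `v` and is marked in the mask; one that
  -- lost none is named by its undo label.
  hubs-⊆ : ∀ {w} → w ∈ hubsOf X.Ps → w ∈ hubsOf X'.Ps
  hubs-⊆ {w} m with cut-hub X.cuts m
  ... | j , refl with cut-piece X.cuts j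
  ...   | P , mP , eh , el = by-loss (toℕ (lookup ls j)) refl
    where
    by-loss : ∀ l → toℕ (lookup ls j) ≡ l → w ∈ hubsOf X'.Ps
    by-loss zero z = subst (_∈ hubsOf X'.Ps) (sym (lone-inj (trans (sym (labels j z)) (labels' j z)))) (index-hub' j)
    by-loss (suc l) z = masked m (subst (λ u → adj X.result v u ≡ true) eh
      (Facts.linked X.known mP (<ᵇ-intro (subst (0 <_) (sym (trans (cong toℕ el) z)) z<s))))

module Decoded {n g s k E L} {F F' : Adj n} {v} {ws ws' : Vec (Fin n) (suc k)} {ls} {cs cs' : Vec (Fin s) k}
  (X : Spread g s k F v ws ls cs) (X' : Spread g s k F' v ws' ls cs') (us : Vec (Undo n E L) (suc k))
  (labels : ∀ j → toℕ (lookup ls j) ≡ 0 → lookup us j ≡ lone (lookup ws j))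
  (labels' : ∀ j → toℕ (lookup ls j) ≡ 0 → lookup us j ≡ lone (lookup ws' j))
  (results : Spread.result X ≡ Spread.result X') (masks : Spread.mask X ≡ Spread.mask X') where

  private
    module X = Spread X
    module X' = Spread X'
    module S = Setup X.setup
    module S' = Setup X'.setup
    module K = Facts X.known
    module K' = Facts X'.known

    there⊆ : ∀ {w} → w ∈ hubsOf X.Ps → w ∈ hubsOf X'.Ps
    there⊆ = Decode.hubs-⊆ X X' us labels labels' results masks

    back⊆ : ∀ {w} → w ∈ hubsOf X'.Ps → w ∈ hubsOf X.Ps
    back⊆ = Decode.hubs-⊆ X' X us labels' labels (sym results) (sym masks)

  assign-⊆ : ∀ {x} → x ∈ assign X.Ps → x ∈ assign X'.Ps
  assign-⊆ {z , w} m = let (mz , mw) = assign-hub X.Ps m ; zv = S.rest≢v mz in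
    proj₁ (K'.at-hub (there⊆ mw) zv) (subst (λ R → adj R w z ≡ true) results (proj₂ (K.at-hub mw zv) m))

  -- Away from `v` and the hubs nothing has changed, and hubs are isolated in `F`. The neighbours of
  -- `v` in `F` are the vertices assigned to hubs, because the intervals exhaust the rotation.
  edge-⊆ : ∀ u t → adj F u t ≡ true → adj F' u t ≡ true
  edge-⊆ u t e = cases (decide (u ≟ v)) (decide (t ≟ v))
    where
    from-v : ∀ t → adj F v t ≡ true → adj F' v t ≡ true
    from-v t e = let (w , m) = assigned X.Ps (X.around-v e) in S'.nbrs (proj₁ (assign-hub X'.Ps (assign-⊆ m)))
    no-hub : ∀ u t → adj F u t ≡ true → u ∉ hubsOf X.Ps
    no-hub u t e m = true≢false e (S.empty m t)
    cases : u ≡ v ⊎ u ≢ v → t ≡ v ⊎ t ≢ v → adj F' u t ≡ true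
    cases (inj₁ refl) _ = from-v t e
    cases (inj₂ _) (inj₁ refl) = S'.symm v u (from-v u (S.symm u v e))
    cases (inj₂ uv) (inj₂ tv) = proj₁ (K'.away (nu ∘ back⊆) (nt ∘ back⊆) uv tv)
      (subst (λ R → adj R u t ≡ true) results (proj₂ (K.away nu nt uv tv) e))
      where
      nu = no-hub u t e
      nt = no-hub t u (S.symm u t e)

-- Knowing `F` means knowing its rotation at `v`. The result gives the assignment as a set of pairs,
-- and the rotation puts it in order, which yields the freed vertices and the letters.
spread-inj : ∀ {n g s k E L} {F F' : Adj n} {v} {ws ws' : Vec (Fin n) (suc k)} {ls} {cs cs' : Vec (Fin s) k}
  (X : Spread g s k F v ws ls cs) (X' : Spread g s k F' v ws' ls cs') (us : Vec (Undo n E L) (suc k)) →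
  (∀ j → toℕ (lookup ls j) ≡ 0 → lookup us j ≡ lone (lookup ws j)) →
  (∀ j → toℕ (lookup ls j) ≡ 0 → lookup us j ≡ lone (lookup ws' j)) →
  Spread.result X ≡ Spread.result X' → Spread.mask X ≡ Spread.mask X' → F ≡ F' × ws ≡ ws' × cs ≡ cs'
spread-inj {n} {g} {F = F} {F'} {v} X X' us labels labels' results masks = F≡F' , same-order F≡F' (orders F≡F' X.simple X'.simple X.genus′ X'.genus′ X.pos X'.pos)
  where
  module X = Spread X
  module X' = Spread X'
  F≡F' : F ≡ F'
  F≡F' = trans (sym (mk-adj F)) (trans (mk-cong λ u t → bool-ext
      (Decoded.edge-⊆ X X' us labels labels' results masks u t)
      (Decoded.edge-⊆ X' X us labels' labels (sym results) (sym masks) u t)) (mk-adj F'))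
  orders : F ≡ F' → ∀ (p : isSimple F ≡ true) (p' : isSimple F' ≡ true) (q : genusAtMost g F ≡ true) (q' : genusAtMost g F' ≡ true)
    (r : 0 < degree (adj F) v) (r' : 0 < degree (adj F') v) →
    Rotation.rotation (good-from g F p q) v r ≡ Rotation.rotation (good-from g F' p' q') v r'
  orders refl p p' q q' r r' with uip p p' | uip q q'
  ... | refl | refl = refl
  same-order : F ≡ F' → Rotation.rotation (good-from g F X.simple X.genus′) v X.pos ≡ Rotation.rotation (good-from g F' X'.simple X'.genus′) v X'.pos → _
  same-order _ e = cut-inj X.cuts X'.cuts (Setup.unique-hubs X.setup) (Setup.unique-hubs X'.setup)
    (same-pairs (assign X.Ps) (assign X'.Ps)
      (trans (assign-rest X.Ps) (trans X.order (trans e (trans (sym X'.order) (sym (assign-rest X'.Ps))))))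
      (subst Unique (sym (assign-rest X'.Ps)) (Setup.unique-rest X'.setup))
      (Decoded.assign-⊆ X X' us labels labels' results masks))

-- Counting codes

infix 4 _↪_ _↩_

record _↪_ (X : Set) (N : ℕ) : Set where
  field
    to     : X → Fin N
    to-inj : ∀ {x y} → to x ≡ to y → x ≡ y

record _↩_ (X : Set) (N : ℕ) : Set where
  field
    from     : Fin N → X
    from-inj : ∀ {x y} → from x ≡ from y → x ≡ y

open _↪_
open _↩_

fin↪ : ∀ {N} → Fin N ↪ N
fin↪ = record { to = id ; to-inj = id }

bool↪ : Bool ↪ 2
bool↪ = record { to = λ { false → zero ; true → suc zero }
  ; to-inj = λ { {false} {false} _ → refl ; {true} {true} _ → refl } }

×↪ : ∀ {X Y M N} → X ↪ M → Y ↪ N → (X × Y) ↪ M * N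
×↪ f h = record { to = λ (x , y) → combine (to f x) (to h y)
  ; to-inj = λ {(x , y)} {(x' , y')} e → let (p , q) = combine-injective (to f x) (to h y) (to f x') (to h y') e
      in cong₂ _,_ (to-inj f p) (to-inj h q) }

⊎↪ : ∀ {X Y M N} → X ↪ M → Y ↪ N → (X ⊎ Y) ↪ M + N
⊎↪ {X} {Y} {M} {N} f h = record { to = join M N ∘ sides ; to-inj = λ e → sides-inj (trans (sym (splitAt-join M N _))
    (trans (cong (splitAt M) e) (splitAt-join M N _))) }
  where
  sides : X ⊎ Y → Fin M ⊎ Fin N
  sides (inj₁ x) = inj₁ (to f x)
  sides (inj₂ y) = inj₂ (to h y)
  sides-inj : ∀ {x y} → sides x ≡ sides y → x ≡ y
  sides-inj {inj₁ x} {inj₁ y} e = cong inj₁ (to-inj f (inj₁-inj e))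
    where
    inj₁-inj : ∀ {a b : Fin M} → inj₁ {B = Fin N} a ≡ inj₁ b → a ≡ b
    inj₁-inj refl = refl
  sides-inj {inj₂ x} {inj₂ y} e = cong inj₂ (to-inj h (inj₂-inj e))
    where
    inj₂-inj : ∀ {a b : Fin N} → inj₂ {A = Fin M} a ≡ inj₂ b → a ≡ b
    inj₂-inj refl = refl

vec↪ : ∀ {X N} → X ↪ N → ∀ k → Vec X k ↪ N ^ k
vec↪ f zero = record { to = λ _ → zero ; to-inj = λ { {[]} {[]} _ → refl } }
vec↪ f (suc k) = record { to = λ { (x ∷ xs) → to (×↪ f (vec↪ f k)) (x , xs) }
  ; to-inj = λ { {x ∷ xs} {y ∷ ys} e → case to-inj (×↪ f (vec↪ f k)) {x , xs} {y , ys} e of λ { refl → refl } } }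

undo↪ : ∀ {n E L} → Undo n E L ↪ n + (n + (E * 2 + n * (2 ^ L * 2 ^ L)))
undo↪ {n} {E} {L} = record { to = to code ∘ unpack ; to-inj = λ e → unpack-inj (to-inj code e) }
  where
  Shape = Fin n ⊎ (Fin n ⊎ ((Fin E × Bool) ⊎ (Fin n × (Vec Bool L × Vec Bool L))))
  code : Shape ↪ n + (n + (E * 2 + n * (2 ^ L * 2 ^ L)))
  code = ⊎↪ fin↪ (⊎↪ fin↪ (⊎↪ (×↪ fin↪ bool↪) (×↪ fin↪ (×↪ (vec↪ bool↪ L) (vec↪ bool↪ L)))))
  unpack : Undo n E L → Shape
  unpack (lone x) = inj₁ x
  unpack (leaf x) = inj₂ (inj₁ x)
  unpack (path e b) = inj₂ (inj₂ (inj₁ (e , b)))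
  unpack (fan x p q) = inj₂ (inj₂ (inj₂ (x , p , q)))
  unpack-inj : ∀ {x y} → unpack x ≡ unpack y → x ≡ y
  unpack-inj {lone _} {lone _} refl = refl
  unpack-inj {leaf _} {leaf _} refl = refl
  unpack-inj {path _ _} {path _ _} refl = refl
  unpack-inj {fan _ _ _} {fan _ _ _} refl = refl

fin↩ : ∀ {N} → Fin N ↩ N
fin↩ = record { from = id ; from-inj = id }

×↩ : ∀ {X Y M N} → X ↩ M → Y ↩ N → (X × Y) ↩ M * N
×↩ {M = M} {N} f h = record { from = λ i → let (p , q) = remQuot {M} N i in from f p , from h q
  ; from-inj = λ {i} {j} e → trans (sym (combine-remQuot {M} N i))
      (trans (cong₂ combine (from-inj f (,-injectiveˡ e)) (from-inj h (,-injectiveʳ e))) (combine-remQuot {M} N j)) }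

vec↩ : ∀ {X N} → X ↩ N → ∀ k → Vec X k ↩ N ^ k
vec↩ f zero = record { from = λ _ → [] ; from-inj = λ { {zero} {zero} _ → refl } }
vec↩ f (suc k) = record { from = λ i → let (x , xs) = from (×↩ f (vec↩ f k)) i in x ∷ xs
  ; from-inj = λ e → from-inj (×↩ f (vec↩ f k)) (∷-both e) }
  where
  ∷-both : ∀ {X : Set} {k} {p q : X × Vec X k} → _≡_ {A = Vec X (suc k)} (proj₁ p ∷ proj₂ p) (proj₁ q ∷ proj₂ q) → p ≡ q
  ∷-both refl = refl

cardinality : ∀ {X Y M N} → X ↩ M → Y ↪ N → (f : X → Y) → (∀ {x y} → f x ≡ f y → x ≡ y) → M ≤ N
cardinality d c f f-inj = injective⇒≤ {f = to c ∘ f ∘ from d} λ e → from-inj d (f-inj (to-inj c e))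

allAdj-complete : ∀ {n} (A : Adj n) → A ∈ allAdj n
allAdj-complete = ∈-allVecsOf (∈-allVecsOf λ { true → there (here refl) ; false → here refl })

allAdj-unique : ∀ n → Unique (allAdj n)
allAdj-unique n = unique-allVecsOf (unique-allVecsOf (((λ ()) ∷ []) ∷ [] ∷ []) n) n

maxF-attained : ∀ n (f : Fin n → ℕ) {t} → t < maxF n f → ∃[ i ] t < f i
maxF-attained n f {t} = go (allFin n)
  where
  go : ∀ xs → t < foldr (λ i s → f i ⊔ s) 0 xs → ∃[ i ] t < f i
  go (x ∷ xs) lt with ⊔-sel (f x) (foldr (λ i s → f i ⊔ s) 0 xs)
  ... | inj₁ e = x , subst (t <_) e lt
  ... | inj₂ e = go xs (subst (t <_) e lt)

trace-inj′ : ∀ {n D c E L W} {A A' F F' : Adj n} {k} {is is' : Vec (Fin c) k} {ws ws' us us'} →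
  Trace D c E L W A is F ws us → Trace D c E L W A' is' F' ws' us' → F ≡ F' → ws ≡ ws' → us ≡ us' → A ≡ A' × is ≡ is'
trace-inj′ t t' refl refl refl = trace-inj t t'

spread-inj′ : ∀ {n g s k E L} {F F' : Adj n} {v v'} {ws ws' : Vec (Fin n) (suc k)} {ls ls'} {cs cs' : Vec (Fin s) k}
  (X : Spread g s k F v ws ls cs) (X' : Spread g s k F' v' ws' ls' cs') {us us' : Vec (Undo n E L) (suc k)} →
  (∀ j → toℕ (lookup ls j) ≡ 0 → lookup us j ≡ lone (lookup ws j)) →
  (∀ j → toℕ (lookup ls' j) ≡ 0 → lookup us' j ≡ lone (lookup ws' j)) →
  Spread.result X ≡ Spread.result X' → v ≡ v' → Spread.mask X ≡ Spread.mask X' → ls ≡ ls' → us ≡ us' → F ≡ F' × ws ≡ ws' × cs ≡ cs'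
spread-inj′ X X' {us} l l' r refl m refl refl = spread-inj X X' us l l' r m

module Encoding {n} (g m c s k t : ℕ) (m≤ : m ≤ 3 * n + 6 * g)
  (room : 14 * (c + suc k) + deficit g ≤ n) (large : 7 + suc k + (2 + k * suc s) ≤ suc t) where

  L E : ℕ
  L = lowDegree + 6
  E = 6 * n + 12 * g

  bad : Adj n → Bool
  bad A = inS g n m A ∧ (t <ᵇ maxDeg A)

  record Encoded (A : Adj n) (is : Vec (Fin c) (suc k)) (cs : Vec (Fin s) k) : Set where
    field
      v      : Fin n
      {final} : Adj n
      {ws}   : Vec (Fin n) (suc k)
      {lost} : Vec (Fin 4) (suc k)
      {undos} : Vec (Undo n E L) (suc k)
      trace  : Trace lowDegree c E L [] A is final ws undos
      labels : ∀ j → toℕ (lookup lost j) ≡ 0 → lookup undos j ≡ lone (lookup ws j)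
      target : Spread g s k final v ws lost cs
      counted : inS g n m (Spread.result target) ≡ true

  abstract
    encoded : ∀ A → bad A ≡ true → ∀ is cs → Encoded A is cs
    encoded A isBad is cs = record { v = v ; trace = Outcome.trace O ; labels = Outcome.labels O ; target = X
      ; counted = ∧-intro (proj₁ ok) (∧-intro (≡ᵇ-intro {edges (Spread.result X)} edges≡) (proj₂ ok)) }
      where
      inA : inS g n m A ≡ true × (t <ᵇ maxDeg A) ≡ true
      inA = ∧-true {inS g n m A} isBad
      partsA : isSimple A ≡ true × (edges A ≡ᵇ m) ∧ genusAtMost g A ≡ true
      partsA = ∧-true {isSimple A} (proj₁ inA)
      moreA : (edges A ≡ᵇ m) ≡ true × genusAtMost g A ≡ true
      moreA = ∧-true {edges A ≡ᵇ m} (proj₂ partsA)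
      G : Good g (adj A)
      G = good-from g A (proj₁ partsA) (proj₂ moreA)
      sizeA : size (adj A) ≡ 2 * m
      sizeA = trans (size-edges (girr G) (gsym G)) (cong (2 *_) (≡ᵇ-true {edges A} (proj₁ moreA)))
      lem : ∀ n g → 2 * (3 * n + 6 * g) ≡ 6 * n + 12 * g
      lem = solve-∀
      size≤ : size (adj A) ≤ E
      size≤ = ≤-trans (≤-reflexive sizeA) (≤-trans (*-monoʳ-≤ 2 m≤) (≤-reflexive (lem n g)))
      peak : ∃[ u ] t < deg A u
      peak = maxF-attained n (deg A) (<ᵇ-true {t} (proj₂ inA))
      v : Fin n
      v = proj₁ peak
      -- The first part of the sum outlasts the contractions, the second provides for the intervals;
      -- it may reach `suc t` because the degree exceeds `t`.
      tall : 7 + suc k + (2 + k * suc s) ≤ degree (adj A) v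
      tall = ≤-trans large (proj₂ peak)
      O : Outcome g lowDegree c E (suc k) [] A v is
      O = run (suc k) [] A v G size≤ room (≤-trans (m≤m+n (7 + suc k) _) tall) is
      tall′ : 2 + k * suc s ≤ degree (adj (Outcome.final O)) v
      tall′ = +-cancelˡ-≤ (suc k) _ _ (≤-trans (≤-trans (+-monoˡ-≤ (2 + k * suc s) (m≤n+m (suc k) 7)) tall) (Outcome.degree-drop O))
      X : Spread g s k (Outcome.final O) v (Outcome.ws O) (Outcome.lost O) cs
      X = spread (Outcome.final O) v (Outcome.ws O) (Outcome.lost O) cs (Outcome.good O) (Outcome.distinct O)
        (Outcome.empty O) (Outcome.avoids O) tall′
      ok : isSimple (Spread.result X) ≡ true × genusAtMost g (Spread.result X) ≡ true
      ok = subst (λ B → isSimple B ≡ true × genusAtMost g B ≡ true) (mk-adj (Spread.result X)) (good-mk (Spread.good X))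
      -- The splits have added exactly what the contractions lost.
      edges≡ : edges (Spread.result X) ≡ m
      edges≡ = *-cancelˡ-≡ _ _ 2 (trans (sym (size-edges (girr (Spread.good X)) (gsym (Spread.good X))))
        (trans (Spread.sizes X) (trans (sym (Outcome.sizes O)) sizeA)))

  Choices Codes : Set
  Choices = Fin (countL bad (allAdj n)) × (Vec (Fin c) (suc k) × Vec (Fin s) k)
  Codes = Fin (countS g n m) × (Fin n × (Vec Bool (3 * suc k) × (Vec (Fin 4) (suc k) × Vec (Undo n E L) (suc k))))

  code-of : ∀ {A is cs} → Encoded A is cs → Codes
  code-of X = ix (inS g n m) (allAdj n) (allAdj-complete _) (Encoded.counted X) , Encoded.v X
    , Spread.mask (Encoded.target X) , Encoded.lost X , Encoded.undos X

  code-inj : ∀ {A A' is is' cs cs'} (X : Encoded A is cs) (X' : Encoded A' is' cs') → code-of X ≡ code-of X' →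
    A ≡ A' × is ≡ is' × cs ≡ cs'
  code-inj X X' e = conclude (spread-inj′ X.target X'.target X.labels X'.labels results v≡ mask≡ lost≡ undo≡)
    where
    module X = Encoded X
    module X' = Encoded X'
    results : Spread.result X.target ≡ Spread.result X'.target
    results = trans (sym (nth-ix (inS g n m) (allAdj n) (allAdj-complete _) X.counted))
      (trans (cong (nth (inS g n m) (allAdj n)) (,-injectiveˡ e)) (nth-ix (inS g n m) (allAdj n) (allAdj-complete _) X'.counted))
    v≡ : X.v ≡ X'.v
    v≡ = ,-injectiveˡ (,-injectiveʳ e)
    mask≡ : Spread.mask X.target ≡ Spread.mask X'.target
    mask≡ = ,-injectiveˡ (,-injectiveʳ (,-injectiveʳ e))
    lost≡ : X.lost ≡ X'.lost
    lost≡ = ,-injectiveˡ (,-injectiveʳ (,-injectiveʳ (,-injectiveʳ e)))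
    undo≡ : X.undos ≡ X'.undos
    undo≡ = ,-injectiveʳ (,-injectiveʳ (,-injectiveʳ (,-injectiveʳ e)))
    conclude : X.final ≡ X'.final × X.ws ≡ X'.ws × _ ≡ _ → _ ≡ _ × _ ≡ _ × _ ≡ _
    conclude (F≡ , ws≡ , cs≡) = let (A≡ , is≡) = trace-inj′ X.trace X'.trace F≡ ws≡ undo≡ in A≡ , is≡ , cs≡

  encode : Choices → Codes
  encode (i , is , cs) = code-of (encoded (nth bad (allAdj n) i) (nth-true bad (allAdj n) i) is cs)

  encode-inj : ∀ {x y} → encode x ≡ encode y → x ≡ y
  encode-inj {i , is , cs} {i' , is' , cs'} e =
    let (A≡ , is≡ , cs≡) = code-inj (encoded (nth bad (allAdj n) i) (nth-true bad (allAdj n) i) is cs)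
                                    (encoded (nth bad (allAdj n) i') (nth-true bad (allAdj n) i') is' cs') e
    in cong₂ _,_ (nth-inj bad (allAdj n) (allAdj-unique n) i i' A≡) (cong₂ _,_ is≡ cs≡)

  -- The factors on the right stand for the resulting graph, the vertex `v`, the mask, the losses
  -- and the undo data.
  encoding-bound : countL bad (allAdj n) * (c ^ suc k * s ^ k) ≤
    countS g n m * (n * (2 ^ (3 * suc k) * (4 ^ suc k * (n + (n + (E * 2 + n * (2 ^ L * 2 ^ L)))) ^ suc k)))
  encoding-bound = cardinality (×↩ fin↩ (×↩ (vec↩ fin↩ (suc k)) (vec↩ fin↩ k)))
    (×↪ fin↪ (×↪ fin↪ (×↪ (vec↪ bool↪ (3 * suc k)) (×↪ (vec↪ fin↪ (suc k)) (vec↪ undo↪ (suc k))))))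
    encode encode-inj

-- Numerical estimates

private
  *-^ : ∀ a b k → (a * b) ^ k ≡ a ^ k * b ^ k
  *-^ a b zero = refl
  *-^ a b (suc k) = trans (cong (a * b *_) (*-^ a b k)) (lem a b (a ^ k) (b ^ k))
    where
    lem : ∀ a b x y → a * b * (x * y) ≡ a * x * (b * y)
    lem = solve-∀

  pos-^ : ∀ {a} k → 1 ≤ a → 1 ≤ a ^ k
  pos-^ zero h = ≤-refl
  pos-^ (suc k) h = *-mono-≤ h (pos-^ k h)

  cancel : ∀ {x y} z → 1 ≤ z → x * z ≤ y * z → x ≤ y
  cancel (suc z) _ le = *-cancelʳ-≤ _ _ (suc z) le

  -- The second bound controls the increment of the first, so both are proved together.
  squares : ∀ l → l * l ≤ 2 * 2 ^ l × 1 + 2 * l ≤ 2 * 2 ^ l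
  squares zero = z≤n , s≤s z≤n
  squares (suc l) = let (p , q) = squares l in
      ≤-trans (≤-reflexive (sq l)) (≤-trans (+-mono-≤ p q) (≤-reflexive (double (2 ^ l))))
    , ≤-trans (≤-reflexive (lin l)) (≤-trans (+-mono-≤ q (*-monoʳ-≤ 2 (pos-^ {2} l (s≤s z≤n)))) (≤-reflexive (double (2 ^ l))))
    where
    sq : ∀ l → suc l * suc l ≡ l * l + (1 + 2 * l)
    sq = solve-∀
    lin : ∀ l → 1 + 2 * suc l ≡ (1 + 2 * l) + 2
    lin = solve-∀
    double : ∀ x → 2 * x + 2 * x ≡ 2 * (2 * x)
    double = solve-∀

  below-power : ∀ n → n ≤ 2 ^ n
  below-power zero = z≤n
  below-power (suc n) = ≤-trans (+-mono-≤ (pos-^ {2} n (s≤s z≤n)) (below-power n)) (≤-reflexive (cong (2 ^ n +_) (sym (+-identityʳ _))))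

log-upper : ∀ n → n ≤ 2 * 2 ^ ⌊log₂ n ⌋
log-upper n = <⇒≤ (≰⇒> λ le → 1+n≰n (subst (_≤ ⌊log₂ n ⌋) (⌊log₂[2^n]⌋≡n (suc ⌊log₂ n ⌋)) (⌊log₂⌋-mono-≤ le)))

log-lower : ∀ n → 1 ≤ n → 2 ^ ⌊log₂ n ⌋ ≤ 2 * n
log-lower n pos with minimal (λ j → n ≤? 2 ^ j) n (below-power n)
... | j , _ , le , least = ≤-trans (^-monoʳ-≤ 2 (subst (⌊log₂ n ⌋ ≤_) (⌊log₂[2^n]⌋≡n j) (⌊log₂⌋-mono-≤ le))) (bound j least)
  where
  bound : ∀ j → (∀ i → i < j → ¬ (n ≤ 2 ^ i)) → 2 ^ j ≤ 2 * n
  bound zero _ = ≤-trans pos (m≤m+n n (n + 0))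
  bound (suc j) least = *-monoʳ-≤ 2 (<⇒≤ (≰⇒> (least j ≤-refl)))

module _ (g : ℕ) where

  private
    P : ℕ
    P = 2 ^ (lowDegree + 6) * 2 ^ (lowDegree + 6)

  abstract
    -- `gain` is the cost per freed vertex: 8 for three mask bits, 4 for the loss, `undoFactor * n`
    -- for the undo data, and `n ≤ 56 * c` to compare the latter with the `c` choices.
    undoFactor gain : ℕ
    undoFactor = 2 + 2 * (6 + 12 * g) + P
    gain = 32 * (undoFactor * 56)

    gain-def : gain ≡ 32 * (undoFactor * 56)
    gain-def = refl

    gain-pos : 1 ≤ gain
    gain-pos = s≤s z≤n

    undo-codes : ∀ n → 1 ≤ n → n + (n + ((6 * n + 12 * g) * 2 + n * P)) ≤ undoFactor * n
    undo-codes n pos = ≤-trans (+-monoʳ-≤ n (+-monoʳ-≤ n (+-monoˡ-≤ (n * P) (*-monoˡ-≤ 2 (+-monoʳ-≤ (6 * n)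
        (≤-trans (≤-reflexive (sym (*-identityʳ (12 * g)))) (*-monoʳ-≤ (12 * g) pos))))))) (≤-reflexive (lem n g P))
      where
      lem : ∀ n g P → n + (n + ((6 * n + 12 * g * n) * 2 + n * P)) ≡ (2 + 2 * (6 + 12 * g) + P) * n
      lem = solve-∀

  -- With `2 * gain` letters each of `k` freed vertices repays its cost twice over; the vertex
  -- without a letter leaves a single factor `gain`.
  exponential-bound : ∀ {bad S n c U} k → 1 ≤ c → n ≤ 56 * c → U ≤ undoFactor * n →
    bad * (c ^ suc k * (2 * gain) ^ k) ≤ S * (n * (2 ^ (3 * suc k) * (4 ^ suc k * U ^ suc k))) →
    bad * 2 ^ k ≤ S * n * gain
  exponential-bound {bad} {S} {n} {c} {U} k c≥1 n≤ U≤ le = cancel (c ^ suc k * gain ^ k)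
    (*-mono-≤ (pos-^ (suc k) c≥1) (pos-^ k gain-pos)) (begin
      bad * 2 ^ k * (c ^ suc k * gain ^ k) ≡⟨ l1 bad (2 ^ k) (c ^ suc k) (gain ^ k) ⟩
      bad * (c ^ suc k * (2 ^ k * gain ^ k)) ≡⟨ cong (λ x → bad * (c ^ suc k * x)) (sym (*-^ 2 gain k)) ⟩
      bad * (c ^ suc k * (2 * gain) ^ k) ≤⟨ le ⟩
      S * (n * (2 ^ (3 * suc k) * (4 ^ suc k * U ^ suc k))) ≤⟨ *-monoʳ-≤ S (*-monoʳ-≤ n powers) ⟩
      S * (n * (gain ^ suc k * c ^ suc k)) ≡⟨ l2 S n gain (gain ^ k) (c ^ suc k) ⟩
      S * n * gain * (c ^ suc k * gain ^ k) ∎)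
    where
    open ≤-Reasoning
    l1 : ∀ b x y z → b * x * (y * z) ≡ b * (y * (x * z))
    l1 = solve-∀
    l2 : ∀ S n M x y → S * (n * (M * x * y)) ≡ S * n * M * (y * x)
    l2 = solve-∀
    l3 : ∀ K c → 8 * (4 * (K * (56 * c))) ≡ 32 * (K * 56) * c
    l3 = solve-∀
    powers : 2 ^ (3 * suc k) * (4 ^ suc k * U ^ suc k) ≤ gain ^ suc k * c ^ suc k
    powers = begin
      2 ^ (3 * suc k) * (4 ^ suc k * U ^ suc k) ≡⟨ cong₂ _*_ (sym (^-*-assoc 2 3 (suc k))) (sym (*-^ 4 U (suc k))) ⟩
      8 ^ suc k * (4 * U) ^ suc k ≡⟨ sym (*-^ 8 (4 * U) (suc k)) ⟩
      (8 * (4 * U)) ^ suc k ≤⟨ ^-monoˡ-≤ (suc k) (*-monoʳ-≤ 8 (*-monoʳ-≤ 4 (≤-trans U≤ (*-monoʳ-≤ undoFactor n≤)))) ⟩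
      (8 * (4 * (undoFactor * (56 * c)))) ^ suc k ≡⟨ cong (_^ suc k) (trans (l3 undoFactor c) (cong (_* c) (sym gain-def))) ⟩
      (gain * c) ^ suc k ≡⟨ *-^ gain c (suc k) ⟩
      gain ^ suc k * c ^ suc k ∎

  -- About `n / 14` vertices are removable. Offering `n / 28` choices takes half of them and leaves
  -- the rest for the excluded vertices and the deficit.
  quotient-bounds : ∀ n → 28 ≤ n → 28 * (n / 28) ≤ n × n ≤ 56 * (n / 28) × 1 ≤ n / 28
  quotient-bounds n n≥ = ≤-trans (m≤n+m (28 * c) (n % 28)) (≤-reflexive (sym split)) , upper , c≥1
    where
    c = n / 28
    split : n ≡ n % 28 + 28 * c
    split = trans (m≡m%n+[m/n]*n n 28) (cong (n % 28 +_) (*-comm c 28))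
    c≥1 : 1 ≤ c
    c≥1 with c in e
    ... | suc _ = s≤s z≤n
    ... | zero = ⊥-elim (<⇒≱ (m%n<n n 28) (≤-trans n≥ (≤-reflexive (trans split (trans (cong (λ x → n % 28 + 28 * x) e) (+-identityʳ _))))))
    upper : n ≤ 56 * c
    upper = ≤-trans (≤-reflexive split) (≤-trans (+-monoˡ-≤ (28 * c) (≤-trans (<⇒≤ (m%n<n n 28)) (*-monoʳ-≤ 28 c≥1)))
      (≤-reflexive (lem c)))
      where
      lem : ∀ c → 28 * c + 28 * c ≡ 56 * c
      lem = solve-∀

  -- For `k = l + l` and `2 * gain` letters the required degree is `10 + (4 + 4 * gain) * l`; the
  -- constant is absorbed by one more `l`.
  slope : ℕ
  slope = 5 + 2 * (2 * gain)

  abstract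
    -- Multiplied by eight, the room condition asks, besides the share of the choices, for
    -- `224 * l + 112 + 8 * deficit g ≤ 4 * n`. As `l * l ≤ 4 * n`, it is enough that `l` be at
    -- least `224 + 112 + 8 * deficit g`.
    threshold : ℕ
    threshold = 336 + 8 * deficit g

    threshold-def : threshold ≡ 336 + 8 * deficit g
    threshold-def = refl

  -- With `k = l + l`, the power `2 ^ k` is at least `n * n / 4`. One factor `n` cancels the name of
  -- `v`, the other exceeds `4 * gain * κ` by the size of `n`.
  rare : ∀ n m κ → m ≤ 3 * n + 6 * g → 28 + 2 ^ threshold + 4 * gain * κ ≤ n →
    κ * countBad g n m slope ≤ countS g n m
  rare n m κ m≤ n≥ = cancel (4 * gain) (≤-trans gain-pos (m≤m+n gain _)) (begin
      κ * B * (4 * gain) ≡⟨ l1 κ B gain ⟩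
      B * (4 * gain * κ) ≤⟨ *-monoʳ-≤ B (≤-trans (m≤n+m _ (28 + 2 ^ threshold)) n≥) ⟩
      B * n ≤⟨ cancel n n≥1 (begin
        B * n * n ≡⟨ *-assoc B n n ⟩
        B * (n * n) ≤⟨ *-monoʳ-≤ B (*-mono-≤ (log-upper n) (log-upper n)) ⟩
        B * (2 * 2 ^ l * (2 * 2 ^ l)) ≡⟨ trans (l2 B (2 ^ l)) (cong (λ x → 4 * (B * x)) (sym (^-distribˡ-+-* 2 l l))) ⟩
        4 * (B * 2 ^ (l + l)) ≤⟨ *-monoʳ-≤ 4 weak ⟩
        4 * (S * n * gain) ≡⟨ l3 S n gain ⟩
        S * (4 * gain) * n ∎) ⟩
      S * (4 * gain) ∎)
    where
    open ≤-Reasoning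
    l = ⌊log₂ n ⌋
    c = n / 28
    B = countBad g n m slope
    S = countS g n m
    l1 : ∀ k b x → k * b * (4 * x) ≡ b * (4 * x * k)
    l1 = solve-∀
    l2 : ∀ b x → b * (2 * x * (2 * x)) ≡ 4 * (b * (x * x))
    l2 = solve-∀
    l3 : ∀ s n x → 4 * (s * n * x) ≡ s * (4 * x) * n
    l3 = solve-∀
    n≥28 : 28 ≤ n
    n≥28 = ≤-trans (≤-trans (m≤m+n 28 (2 ^ threshold)) (m≤m+n _ (4 * gain * κ))) n≥
    n≥1 : 1 ≤ n
    n≥1 = ≤-trans (s≤s z≤n) n≥28
    l≥ : threshold ≤ l
    l≥ = subst (_≤ l) (⌊log₂[2^n]⌋≡n threshold) (⌊log₂⌋-mono-≤ (≤-trans (≤-trans (m≤n+m (2 ^ threshold) 28) (m≤m+n _ (4 * gain * κ))) n≥))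
    l≥336 : 336 + 8 * deficit g ≤ l
    l≥336 = ≤-trans (≤-reflexive (sym threshold-def)) l≥
    l≥1 : 1 ≤ l
    l≥1 = ≤-trans (s≤s z≤n) l≥336
    l²≤ : l * l ≤ 4 * n
    l²≤ = ≤-trans (proj₁ (squares l)) (≤-trans (*-monoʳ-≤ 2 (log-lower n n≥1)) (≤-reflexive (sym (*-assoc 2 2 n))))
    spare : 224 * l + 112 + 8 * deficit g ≤ 4 * n
    spare = begin
      224 * l + 112 + 8 * deficit g ≤⟨ +-mono-≤ (+-monoʳ-≤ (224 * l) (*-monoʳ-≤ 112 l≥1)) (≤-trans (≤-reflexive (sym (*-identityʳ _))) (*-monoʳ-≤ (8 * deficit g) l≥1)) ⟩
      224 * l + 112 * l + 8 * deficit g * l ≡⟨ r1 l (8 * deficit g) ⟩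
      (336 + 8 * deficit g) * l ≤⟨ *-monoˡ-≤ l l≥336 ⟩
      l * l ≤⟨ l²≤ ⟩
      4 * n ∎
      where
      r1 : ∀ l d → 224 * l + 112 * l + d * l ≡ (336 + d) * l
      r1 = solve-∀
    room : 14 * (c + suc (l + l)) + deficit g ≤ n
    room = *-cancelˡ-≤ 8 (begin
      8 * (14 * (c + suc (l + l)) + deficit g) ≡⟨ r1 c l (deficit g) ⟩
      4 * (28 * c) + (224 * l + 112 + 8 * deficit g) ≤⟨ +-mono-≤ (*-monoʳ-≤ 4 (proj₁ (quotient-bounds n n≥28))) spare ⟩
      4 * n + 4 * n ≡⟨ r2 n ⟩
      8 * n ∎)
      where
      r1 : ∀ c l d → 8 * (14 * (c + suc (l + l)) + d) ≡ 4 * (28 * c) + (224 * l + 112 + 8 * d)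
      r1 = solve-∀
      r2 : ∀ n → 4 * n + 4 * n ≡ 8 * n
      r2 = solve-∀
    large : 7 + suc (l + l) + (2 + (l + l) * suc (2 * gain)) ≤ suc (slope * l)
    large = begin
      7 + suc (l + l) + (2 + (l + l) * suc (2 * gain)) ≡⟨ r1 l (2 * gain) ⟩
      10 + (4 * l + 2 * (2 * gain) * l) ≤⟨ +-monoˡ-≤ _ (≤-trans (m≤m+n 10 326) (≤-trans (m≤m+n 336 (8 * deficit g)) l≥336)) ⟩
      l + (4 * l + 2 * (2 * gain) * l) ≡⟨ r2 l (2 * (2 * gain)) ⟩
      slope * l ≤⟨ n≤1+n _ ⟩
      suc (slope * l) ∎
      where
      r1 : ∀ l s → 7 + suc (l + l) + (2 + (l + l) * suc s) ≡ 10 + (4 * l + 2 * s * l)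
      r1 = solve-∀
      r2 : ∀ l s → l + (4 * l + s * l) ≡ (5 + s) * l
      r2 = solve-∀
    weak : B * 2 ^ (l + l) ≤ S * n * gain
    weak = exponential-bound {bad = B} {S} {n} {c} (l + l) (proj₂ (proj₂ (quotient-bounds n n≥28))) (proj₁ (proj₂ (quotient-bounds n n≥28)))
      (undo-codes n n≥1) (Encoding.encoding-bound g m c (2 * gain) (l + l) (slope * l) m≤ room large)

-- The eventual bound for every `k` expresses, without division, that the probability of a larger
-- maximum degree tends to zero. The base of the logarithm and its rounding affect only `C`.
theorem5p2 : (g : ℕ) (m : ℕ → ℕ) → ((n : ℕ) → m n ≤ 3 * n + 6 * g ∸ 6) →
    ∃[ C ] ((k : ℕ) → ∃[ N ] ((n : ℕ) → N ≤ n →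
    k * countBad g n (m n) C ≤ countS g n (m n)))
theorem5p2 g m m≤ = slope g , λ k → 28 + 2 ^ threshold g + 4 * gain g * k , λ n →
  rare g n (m n) k (≤-trans (m≤ n) (m∸n≤m (3 * n + 6 * g) 6))
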